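{- Consider the following ten types of matroid input: RANK, INDEPENDENT SETS, SPANNING SETS, BASES, FLATS, CIRCUITS, HYPERPLANES, NON-SPANNING CIRCUITS, DEPENDENT HYPERPLANES, CYCLIC FLATS. Form the directed graph $D$ on these ten types with exactly the following arcs: RANK $\to$ SPANNING SETS, RANK $\to$ INDEPENDENT SETS, SPANNING SETS $\to$ BASES, INDEPENDENT SETS $\to$ BASES, INDEPENDENT SETS $\to$ FLATS, BASES $\to$ CIRCUITS, BASES $\to$ CYCLIC FLATS, BASES $\to$ HYPERPLANES, FLATS $\to$ CYCLIC FLATS, FLATS $\to$ HYPERPLANES, CIRCUITS $\to$ NON-SPANNING CIRCUITS, HYPERPLANES $\to$ DEPENDENT HYPERPLANES. Then $D$ is the Hasse diagram of the relation $\leq$ restricted to these ten types: for any two of these types $I_1, I_2$, we have $I_1 \leq I_2$ if and only if $I_1 = I_2$ or there is a directed path from $I_1$ to $I_2$ in $D$.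
   Context: All matroids are finite. A matroid $M$ on a ground set $E$ with $|E| = n$ is described to a Turing machine by a word $(M,\, \textsc{Input})$ over a finite alphabet, where $\textsc{Input}$ is one of ten input types. RANK: a list of every subset of $E$ together with its rank. INDEPENDENT SETS, SPANNING SETS, BASES, FLATS, CIRCUITS, HYPERPLANES: a list of all independent sets, spanning sets, bases, flats, circuits, respectively hyperplanes of $M$. NON-SPANNING CIRCUITS: the rank $r(M)$ together with a list of all non-spanning circuits (only the rank if there are none). DEPENDENT HYPERPLANES: the rank $r(M)$ together with a list of all dependent hyperplanes (only the rank if there are none). CYCLIC FLATS: a list of all cyclic flats (flats that are a possibly empty union of circuits), each together with its rank. Subsets of $E$ are encoded by characteristic vectors and encodings are reasonable (no padding), so a description listing $i$ subsets has length $\Theta(ni)$. For input types $I_1, I_2$, we write $I_1 \leq I_2$ if there is a Turing machine running in time polynomial in the length of its input which, for every matroid $M$, given $(M, I_1)$ produces $(M, I_2)$. -}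

module Defs where

open import Data.Nat using (ℕ; zero; suc; _+_; _*_; _^_; _≤_; _<_)
open import Data.Nat.Properties using (_≟_)
open import Data.Bool using (Bool; true; false; if_then_else_)
open import Data.Fin using (Fin)
import Data.Fin.Properties as FinP
open import Data.Fin.Subset using (Subset; _∈_; _∉_; _⊆_; _⊂_; _∪_; _∩_; ⁅_⁆; ⊤; ∣_∣)
open import Data.Vec using (toList)
open import Data.List using (List; []; _∷_; _++_; [_]; map; concatMap; replicate; length)
open import Data.List.Membership.Propositional using () renaming (_∈_ to _∈ₗ_)
open import Data.List.Relation.Unary.Unique.Propositional using (Unique)
open import Data.Maybe using (Maybe; just; nothing)
open import Data.Sum using (_⊎_; inj₁; inj₂)
open import Data.Product using (Σ; ∃; ∃-syntax; _×_; _,_)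
open import Relation.Nullary using (¬_; does)
open import Relation.Binary.PropositionalEquality using (_≡_)
open import Relation.Binary.Construct.Closure.Transitive using (TransClosure)
open import Function.Bundles using (_⇔_)

record Matroid (n : ℕ) : Set where
  field
    rank : Subset n → ℕ
    R1   : ∀ X → rank X ≤ ∣ X ∣
    R2   : ∀ X Y → X ⊆ Y → rank X ≤ rank Y
    R3   : ∀ X Y → rank (X ∪ Y) + rank (X ∩ Y) ≤ rank X + rank Y

module _ {n : ℕ} (M : Matroid n) where
  open Matroid M

  r[M] : ℕ
  r[M] = rank ⊤

  Independent : Subset n → Set
  Independent X = rank X ≡ ∣ X ∣

  Dependent : Subset n → Set
  Dependent X = ¬ Independent X

  Spanning : Subset n → Set
  Spanning X = rank X ≡ r[M]

  Basis : Subset n → Set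
  Basis X = Independent X × Spanning X

  Flat : Subset n → Set
  Flat X = ∀ e → e ∉ X → rank X < rank (X ∪ ⁅ e ⁆)

  Circuit : Subset n → Set
  Circuit X = Dependent X × (∀ Y → Y ⊂ X → Independent Y)

  Hyperplane : Subset n → Set
  Hyperplane X = Flat X × suc (rank X) ≡ r[M]

  NonSpanningCircuit : Subset n → Set
  NonSpanningCircuit X = Circuit X × ¬ Spanning X

  DependentHyperplane : Subset n → Set
  DependentHyperplane X = Hyperplane X × Dependent X

  -- flats that are a (possibly empty) union of circuits
  CyclicFlat : Subset n → Set
  CyclicFlat X = Flat X × (∀ e → e ∈ X → ∃[ C ] (Circuit C × C ⊆ X × e ∈ C))

data InputType : Set where
  RANK INDEPENDENT-SETS SPANNING-SETS BASES FLATS CIRCUITS HYPERPLANES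
    NON-SPANNING-CIRCUITS DEPENDENT-HYPERPLANES CYCLIC-FLATS : InputType

data Sym : Set where
  𝟘 𝟙 sep bar : Sym

Word : Set
Word = List Sym

-- natural numbers (≤ n) in unary
encℕ : ℕ → Word
encℕ k = replicate k 𝟙

encSet : ∀ {n} → Subset n → Word
encSet X = map (λ b → if b then 𝟙 else 𝟘) (toList X) ++ [ sep ]

header : ℕ → Word
header n = encℕ n ++ [ bar ]

Enumerates : ∀ {n} → (Subset n → Set) → List (Subset n) → Set
Enumerates P L = Unique L × (∀ X → (X ∈ₗ L) ⇔ P X)

encSets : ∀ {n} → List (Subset n) → Word
encSets L = concatMap encSet L

encRankedSets : ∀ {n} → (Subset n → ℕ) → List (Subset n) → Word
encRankedSets r L = concatMap (λ X → encSet X ++ encℕ (r X) ++ [ sep ]) L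

Describes : InputType → ∀ {n} → Matroid n → Word → Set
Describes RANK {n} M w =
  ∃[ L ] (Enumerates (λ _ → Data.Unit.⊤) L × w ≡ header n ++ encRankedSets (Matroid.rank M) L)
  where import Data.Unit
Describes INDEPENDENT-SETS {n} M w =
  ∃[ L ] (Enumerates (Independent M) L × w ≡ header n ++ encSets L)
Describes SPANNING-SETS {n} M w =
  ∃[ L ] (Enumerates (Spanning M) L × w ≡ header n ++ encSets L)
Describes BASES {n} M w =
  ∃[ L ] (Enumerates (Basis M) L × w ≡ header n ++ encSets L)
Describes FLATS {n} M w =
  ∃[ L ] (Enumerates (Flat M) L × w ≡ header n ++ encSets L)
Describes CIRCUITS {n} M w =
  ∃[ L ] (Enumerates (Circuit M) L × w ≡ header n ++ encSets L)
Describes HYPERPLANES {n} M w =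
  ∃[ L ] (Enumerates (Hyperplane M) L × w ≡ header n ++ encSets L)
Describes NON-SPANNING-CIRCUITS {n} M w =
  ∃[ L ] (Enumerates (NonSpanningCircuit M) L
          × w ≡ header n ++ encℕ (r[M] M) ++ [ bar ] ++ encSets L)
Describes DEPENDENT-HYPERPLANES {n} M w =
  ∃[ L ] (Enumerates (DependentHyperplane M) L
          × w ≡ header n ++ encℕ (r[M] M) ++ [ bar ] ++ encSets L)
Describes CYCLIC-FLATS {n} M w =
  ∃[ L ] (Enumerates (CyclicFlat M) L × w ≡ header n ++ encRankedSets (Matroid.rank M) L)

data Move : Set where
  left right stay : Move

-- tape symbols: blank (nothing), input symbols, and G extra work symbols
Γ : ℕ → Set
Γ G = Maybe (Sym ⊎ Fin G)

record TM : Set where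
  field
    Q     : ℕ
    G     : ℕ
    start : Fin Q
    halt  : Fin Q
    δ     : Fin Q → Γ G → Fin Q × Γ G × Move

record Config (T : TM) : Set where
  constructor cfg
  field
    state : Fin (TM.Q T)
    head  : ℕ
    tape  : ℕ → Γ (TM.G T)

wordTape : ∀ {G} → Word → ℕ → Γ G
wordTape []       _       = nothing
wordTape (x ∷ xs) zero    = just (inj₁ x)
wordTape (x ∷ xs) (suc i) = wordTape xs i

move : Move → ℕ → ℕ
move left  zero    = zero
move left  (suc h) = h
move right h       = suc h
move stay  h       = h

step : (T : TM) → Config T → Config T
step T (cfg q h t) with does (FinP._≟_ q (TM.halt T))
... | true  = cfg q h t
... | false with TM.δ T q (t h)
...   | (q′ , a , m) = cfg q′ (move m h) (λ i → if does (i ≟ h) then a else t i)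

run : (T : TM) → Word → ℕ → Config T
run T w zero    = cfg (TM.start T) zero (wordTape w)
run T w (suc k) = step T (run T w k)

HaltedAt : (T : TM) → Word → ℕ → Set
HaltedAt T w k = Config.state (run T w k) ≡ TM.halt T

-- the tape of configuration c holds exactly the word u (followed by a blank)
OutputIs : ∀ {T} → Config T → Word → Set
OutputIs c u = ∀ i → i ≤ length u → Config.tape c i ≡ wordTape u i

_≼_ : InputType → InputType → Set
I₁ ≼ I₂ = ∃[ T ] ∃[ c ] ∃[ d ]
  ( (∀ w → ∃[ k ] (k ≤ c * length w ^ d + c × HaltedAt T w k))
  × (∀ n (M : Matroid n) w → Describes I₁ M w →
       ∃[ k ] ∃[ u ] (HaltedAt T w k × OutputIs (run T w k) u × Describes I₂ M u)) )

data Arc : InputType → InputType → Set where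
  rank→span   : Arc RANK SPANNING-SETS
  rank→ind    : Arc RANK INDEPENDENT-SETS
  span→bases  : Arc SPANNING-SETS BASES
  ind→bases   : Arc INDEPENDENT-SETS BASES
  ind→flats   : Arc INDEPENDENT-SETS FLATS
  bases→circ  : Arc BASES CIRCUITS
  bases→cyc   : Arc BASES CYCLIC-FLATS
  bases→hyp   : Arc BASES HYPERPLANES
  flats→cyc   : Arc FLATS CYCLIC-FLATS
  flats→hyp   : Arc FLATS HYPERPLANES
  circ→nsc    : Arc CIRCUITS NON-SPANNING-CIRCUITS
  hyp→dh      : Arc HYPERPLANES DEPENDENT-HYPERPLANES

Path : InputType → InputType → Set
Path = TransClosure Arc

{-# OPTIONS --safe #-}
module Submission where

-- Reductions. Every list of sets (with ranks) yields a polynomial-time test for independence, hence greedy bases and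
-- tests for all the other set families. Each arc of D generates polynomially many candidates from the input list,
-- keeps those of the required kind, and drops repetitions. The only non-obvious candidates are the cyclic flats given
-- the bases: for a fixed order of the ground set, internal and external activities attach to every basis one cyclic
-- flat, computable in one pass, and every cyclic flat arises in this way. Such procedures are written in a small loop
-- language over subsets of the ground set, in which every program runs in polynomial time, and compiled to
-- single-tape machines that keep the subsets on tracks of the tape.
--
-- Non-reductions. A machine cannot write more symbols than it makes steps, so I ≰ J follows from matroids with a
-- short description of type I but superpolynomially many sets of type J: free matroids, matroids of rank 0, uniform
-- matroids (with a loop and a coloop added), and truncated partition matroids with a coloop together with their
-- duals. With few flats the rank is at most logarithmic, so for FLATS the parallel classes have 2^j elements.

open import Defs
open import Data.Nat using (ℕ; zero; suc; _+_; _*_; _^_; _∸_; _⊓_; _≤_; _<_; z≤n; s≤s; NonZero)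
import Data.Nat.Properties as ℕ
open import Data.Nat.Tactic.RingSolver using (solve-∀)
open import Data.Bool using (Bool; true; false; if_then_else_; not; _∧_; _∨_)
import Data.Bool.Properties as 𝔹
open import Data.Fin using (Fin; zero; suc; toℕ; fromℕ<)
import Data.Fin as Fin
import Data.Fin.Properties as FinP
open import Data.Fin.Subset using (Subset; _∈_; _∉_; _⊆_; _∪_; _∩_; ∁; ⁅_⁆; ⊤; ⊥; ∣_∣)
import Data.Fin.Subset.Properties as S
open import Data.Vec using (Vec; []; _∷_; toList; lookup; here; there)
import Data.Vec as Vec
import Data.Vec.Properties as VecP
open import Data.List using (List; []; _∷_; _++_; [_]; map; concatMap; replicate; length; _ʳ++_; reverse; foldl; applyUpTo; drop; filter; deduplicate; cartesianProductWith; allFin)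
import Data.List.Properties as ListP
open import Data.List.Membership.Propositional using () renaming (_∈_ to _∈ₗ_)
import Data.List.Membership.Propositional.Properties as ∈ₗ
open import Data.List.Relation.Unary.Any using (here; there)
open import Data.List.Relation.Unary.All using (All; []; _∷_)
import Data.List.Relation.Unary.All as All
import Data.List.Relation.Unary.All.Properties as AllP
open import Data.List.Relation.Unary.AllPairs using ([]; _∷_)
open import Data.List.Relation.Unary.Unique.Propositional using (Unique)
open import Data.Maybe using (Maybe; just; nothing)
import Data.Maybe as Maybe
open import Data.Sum using (_⊎_; inj₁; inj₂)
import Data.Sum as Sum
open import Data.Product using (Σ; ∃; ∃-syntax; _×_; _,_; proj₁; proj₂; map₁; map₂)
import Data.Product as Prod
open import Data.Unit using (tt) renaming (⊤ to 𝟏)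
import Data.Empty as Empty
open import Function using (_∘_; id; _⇔_; mk⇔; Equivalence)
open import Relation.Nullary using (¬_; Dec; yes; no; does; Reflects; ofʸ; ofⁿ; contradiction; ¬?; _×-dec_)
import Relation.Nullary.Reflects as Refl
import Relation.Nullary.Decidable as Dec
open import Relation.Binary.PropositionalEquality using (_≡_; _≢_; refl; sym; trans; cong; cong₂; subst; subst₂; module ≡-Reasoning)
import Relation.Binary.Construct.Closure.Transitive as Plus
import Data.List.Relation.Unary.Unique.Propositional.Properties as Unq
import Data.List.Relation.Unary.Unique.DecPropositional.Properties as UnqDec

-- Structured programs and their compilation to Turing machines

-- The definition of `_≼_` asks for a machine that halts within one polynomial bound on every word,
-- not only on descriptions. Hence the parser accepts all words and the loop language has no
-- unbounded iteration. The output must also start at cell 0 and be followed by a blank, so the work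
-- cells have to be removed at the end; the resulting clean tape is also what lets reductions be
-- composed. Only a constant number of subsets fits on the tracks, so the sets already printed
-- cannot be stored: a repetition is recognised by recomputing all earlier candidates. The cyclic
-- flat attached to a basis is that of the decomposition of Etienne and Las Vergnas. Only one half
-- of it is proved: for each cyclic flat, a suitable basis is found by local improvement and the
-- pass over that basis returns the flat. Other candidates are harmless, as each is tested before it
-- is printed. In the lower bounds FLATS sets the scale: rank about `j` with classes of `2 ^ j`
-- elements gives descriptions polynomial in `2 ^ j` against more than `2 ^ (j * j)` bases. This is
-- only quasi-polynomial, but it beats every polynomial, and all other families are scaled to the
-- same threshold.

record Finite (A : Set) : Set where
  field
    size    : ℕ
    enc     : A → Fin size
    dec     : Fin size → A
    dec∘enc : ∀ a → dec (enc a) ≡ a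
open Finite

retract : ∀ {A A′ : Set} (f : A → A′) (g : A′ → A) → (∀ a → g (f a) ≡ a) → Finite A′ → Finite A
retract f g gf F = record
  { size = size F ; enc = enc F ∘ f ; dec = g ∘ dec F
  ; dec∘enc = λ a → trans (cong g (dec∘enc F (f a))) (gf a) }

finite-Fin : ∀ n → Finite (Fin n)
finite-Fin n = record { size = n ; enc = id ; dec = id ; dec∘enc = λ _ → refl }

finite-⊎ : ∀ {A A′ : Set} → Finite A → Finite A′ → Finite (A ⊎ A′)
finite-⊎ F G = record
  { size = size F + size G
  ; enc = λ x → Fin.join (size F) (size G) (Sum.map (enc F) (enc G) x)
  ; dec = λ i → Sum.map (dec F) (dec G) (Fin.splitAt (size F) i)
  ; dec∘enc = λ x → trans (cong (Sum.map (dec F) (dec G)) (FinP.splitAt-join (size F) (size G) (Sum.map (enc F) (enc G) x))) (inv x) }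
  where
  inv : ∀ x → Sum.map (dec F) (dec G) (Sum.map (enc F) (enc G) x) ≡ x
  inv (inj₁ x) = cong inj₁ (dec∘enc F x)
  inv (inj₂ y) = cong inj₂ (dec∘enc G y)

finite-× : ∀ {A A′ : Set} → Finite A → Finite A′ → Finite (A × A′)
finite-× F G = record
  { size = size F * size G
  ; enc = λ (x , y) → Fin.combine (enc F x) (enc G y)
  ; dec = λ i → Prod.map (dec F) (dec G) (Fin.remQuot (size G) i)
  ; dec∘enc = λ (x , y) → trans (cong (Prod.map (dec F) (dec G)) (FinP.remQuot-combine (enc F x) (enc G y)))
                                (cong₂ _,_ (dec∘enc F x) (dec∘enc G y)) }

finite-𝟏 : Finite 𝟏
finite-𝟏 = retract (λ _ → zero) (λ _ → tt) (λ _ → refl) (finite-Fin 1)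

finite-Bool : Finite Bool
finite-Bool = retract (λ b → if b then zero else suc zero) (λ { zero → true ; (suc _) → false })
  (λ { true → refl ; false → refl }) (finite-Fin 2)

finite-Maybe : ∀ {A : Set} → Finite A → Finite (Maybe A)
finite-Maybe F = retract (Maybe.maybe inj₂ (inj₁ tt)) Sum.[ (λ _ → nothing) , just ]
  (λ { (just _) → refl ; nothing → refl }) (finite-⊎ finite-𝟏 F)

finite-Sym : Finite Sym
finite-Sym = retract
  (λ { 𝟘 → zero ; 𝟙 → suc zero ; sep → suc (suc zero) ; bar → suc (suc (suc zero)) })
  (λ { zero → 𝟘 ; (suc zero) → 𝟙 ; (suc (suc zero)) → sep ; (suc (suc (suc _))) → bar })
  (λ { 𝟘 → refl ; 𝟙 → refl ; sep → refl ; bar → refl }) (finite-Fin 4)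

finite-Vec : ∀ {A : Set} n → Finite A → Finite (Vec A n)
finite-Vec zero    F = retract (λ _ → tt) (λ _ → []) (λ { [] → refl }) finite-𝟏
finite-Vec (suc n) F = retract (λ { (x ∷ xs) → x , xs }) (λ (x , xs) → x ∷ xs) (λ { (x ∷ xs) → refl })
  (finite-× F (finite-Vec n F))

Exit : Set
Exit = Maybe Bool

finite-ΣExit : ∀ {A : Exit → Set} → (∀ e → Finite (A e)) → Finite (Σ Exit A)
finite-ΣExit {A} F = retract to from
  (λ { (nothing , _) → refl ; (just true , _) → refl ; (just false , _) → refl })
  (finite-⊎ (F nothing) (finite-⊎ (F (just true)) (F (just false))))
  where
  to : Σ Exit A → A nothing ⊎ A (just true) ⊎ A (just false)
  to (nothing , a)    = inj₁ a
  to (just true , a)  = inj₂ (inj₁ a)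
  to (just false , a) = inj₂ (inj₂ a)
  from : A nothing ⊎ A (just true) ⊎ A (just false) → Σ Exit A
  from (inj₁ a)        = nothing , a
  from (inj₂ (inj₁ a)) = just true , a
  from (inj₂ (inj₂ a)) = just false , a

-- Tapes as zippers, and structured programs over them

Cell : Set → Set
Cell W = Maybe (Sym ⊎ W)

Zip : Set → Set
Zip W = List (Cell W) × List (Cell W)

module _ {W : Set} where

  cur : List (Cell W) → Cell W
  cur []      = nothing
  cur (b ∷ _) = b

  tl : List (Cell W) → List (Cell W)
  tl []       = []
  tl (_ ∷ bs) = bs

  -- Writing a blank at the right end creates no list cell, so that a tape has only one representation.
  infixr 5 _◂_
  _◂_ : Cell W → List (Cell W) → List (Cell W)
  just x  ◂ bs       = just x ∷ bs
  nothing ◂ []       = []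
  nothing ◂ (c ∷ cs) = nothing ∷ c ∷ cs

  -- With no cell to the left, a left move stays in place, in agreement with
  -- `move left zero = zero`.
  act : Cell W → Move → Zip W → Zip W
  act b stay  (ls , rs)     = ls , b ◂ tl rs
  act b right (ls , rs)     = b ∷ ls , tl rs
  act b left  ([] , rs)     = [] , b ◂ tl rs
  act b left  (l ∷ ls , rs) = ls , l ◂ b ◂ tl rs

  at : List (Cell W) → ℕ → Cell W
  at []       _       = nothing
  at (b ∷ bs) zero    = b
  at (b ∷ bs) (suc i) = at bs i

  at-◂-zero : ∀ b bs → at (b ◂ bs) 0 ≡ b
  at-◂-zero (just x) bs      = refl
  at-◂-zero nothing []       = refl
  at-◂-zero nothing (_ ∷ _)  = refl

  at-◂-suc : ∀ b bs i → at (b ◂ bs) (suc i) ≡ at bs i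
  at-◂-suc (just x) bs      i = refl
  at-◂-suc nothing []       i = refl
  at-◂-suc nothing (_ ∷ _)  i = refl

  at-tl : ∀ bs i → at (tl bs) i ≡ at bs (suc i)
  at-tl []       i = refl
  at-tl (_ ∷ bs) i = refl

  cur≡at : ∀ bs → cur bs ≡ at bs 0
  cur≡at []      = refl
  cur≡at (_ ∷ _) = refl

Action : Set → Set → Set
Action W A = A × Cell W × Move

-- An exit is either a verdict `just b` or the neutral `nothing`. A `branch` chooses its
-- continuation by the exit of its first part, and a `loop` repeats its body as long as the exit is
-- neutral.
data Prog (W : Set) : Set₁ where
  prim   : (A : Set) → Finite A → A → (A → Cell W → Action W (A ⊎ Exit)) → Prog W
  branch : Prog W → (Exit → Prog W) → Prog W
  loop   : Prog W → Prog W

module _ {W : Set} where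

  States : Prog W → Set
  States (prim A _ _ _) = A
  States (branch p f)   = States p ⊎ Σ Exit (λ e → States (f e))
  States (loop p)       = States p

  initial : (p : Prog W) → States p
  initial (prim _ _ a _) = a
  initial (branch p f)   = inj₁ (initial p)
  initial (loop p)       = initial p

  finite-States : (p : Prog W) → Finite (States p)
  finite-States (prim _ F _ _) = F
  finite-States (branch p f)   = finite-⊎ (finite-States p) (finite-ΣExit (λ e → finite-States (f e)))
  finite-States (loop p)       = finite-States p

  -- The transition on which `p` exits already leads into the initial state of `f e`. Sequencing
  -- therefore costs no extra step and running times add up exactly.
  enter : (p : Prog W) (f : Exit → Prog W) → States p ⊎ Exit → States (branch p f) ⊎ Exit
  enter p f (inj₁ s) = inj₁ (inj₁ s)
  enter p f (inj₂ e) = inj₁ (inj₂ (e , initial (f e)))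

  resume : (p : Prog W) (f : Exit → Prog W) (e : Exit) → States (f e) ⊎ Exit → States (branch p f) ⊎ Exit
  resume p f e = Sum.map₁ (λ s → inj₂ (e , s))

  again : (p : Prog W) → States p ⊎ Exit → States p ⊎ Exit
  again p (inj₁ s)        = inj₁ s
  again p (inj₂ nothing)  = inj₁ (initial p)
  again p (inj₂ (just b)) = inj₂ (just b)

  transition : (p : Prog W) → States p → Cell W → Action W (States p ⊎ Exit)
  transition (prim _ _ _ δ) s b              = δ s b
  transition (branch p f) (inj₁ s) b         = map₁ (enter p f) (transition p s b)
  transition (branch p f) (inj₂ (e , s)) b   = map₁ (resume p f e) (transition (f e) s b)
  transition (loop p) s b                    = map₁ (again p) (transition p s b)

  data Exec (p : Prog W) : States p → Zip W → ℕ → Exit → Zip W → Set where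
    stop : ∀ {s z e b m} → transition p s (cur (proj₂ z)) ≡ (inj₂ e , b , m) →
           Exec p s z 1 e (act b m z)
    next : ∀ {s z s′ b m t e z′} → transition p s (cur (proj₂ z)) ≡ (inj₁ s′ , b , m) →
           Exec p s′ (act b m z) t e z′ → Exec p s z (suc t) e z′

  exec-cast : ∀ {p s z₁ z₂ t₁ t₂ e y₁ y₂} → z₁ ≡ z₂ → t₁ ≡ t₂ → y₁ ≡ y₂ → Exec p s z₁ t₁ e y₁ → Exec p s z₂ t₂ e y₂
  exec-cast refl refl refl x = x

  exec-branch₂ : ∀ {p f e s z t e′ z′} → Exec (f e) s z t e′ z′ → Exec (branch p f) (inj₂ (e , s)) z t e′ z′
  exec-branch₂ {p} {f} {e} (stop eq)   = stop (cong (map₁ (resume p f e)) eq)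
  exec-branch₂ {p} {f} {e} (next eq x) = next (cong (map₁ (resume p f e)) eq) (exec-branch₂ x)

  exec-branch : ∀ {p f s z t e z′ t′ e′ z″} → Exec p s z t e z′ → Exec (f e) (initial (f e)) z′ t′ e′ z″ →
                Exec (branch p f) (inj₁ s) z (t + t′) e′ z″
  exec-branch {p} {f} (stop eq) y   = next (cong (map₁ (enter p f)) eq) (exec-branch₂ y)
  exec-branch {p} {f} (next eq x) y = next (cong (map₁ (enter p f)) eq) (exec-branch x y)

  exec-loop-stop : ∀ {p s z t b z′} → Exec p s z t (just b) z′ → Exec (loop p) s z t (just b) z′
  exec-loop-stop {p} (stop eq)   = stop (cong (map₁ (again p)) eq)
  exec-loop-stop {p} (next eq x) = next (cong (map₁ (again p)) eq) (exec-loop-stop x)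

  exec-loop-next : ∀ {p s z t z′ t′ e z″} → Exec p s z t nothing z′ → Exec (loop p) (initial p) z′ t′ e z″ →
                   Exec (loop p) s z (t + t′) e z″
  exec-loop-next {p} (stop eq) y   = next (cong (map₁ (again p)) eq) y
  exec-loop-next {p} (next eq x) y = next (cong (map₁ (again p)) eq) (exec-loop-next x y)

  record Runs (p : Prog W) (z : Zip W) (t : ℕ) (e : Exit) (z′ : Zip W) : Set where
    constructor runs
    field
      {steps} : ℕ
      bound   : steps ≤ t
      exec    : Exec p (initial p) z steps e z′

  runs-mono : ∀ {p z t t′ e z′} → t ≤ t′ → Runs p z t e z′ → Runs p z t′ e z′
  runs-mono t≤t′ (runs s≤t x) = runs (ℕ.≤-trans s≤t t≤t′) x

  runs-cast : ∀ {p z₁ z₂ t e₁ e₂ y₁ y₂} → z₁ ≡ z₂ → e₁ ≡ e₂ → y₁ ≡ y₂ → Runs p z₁ t e₁ y₁ → Runs p z₂ t e₂ y₂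
  runs-cast refl refl refl x = x

  runs-branch : ∀ {p f z t e z′ t′ e′ z″} → Runs p z t e z′ → Runs (f e) z′ t′ e′ z″ → Runs (branch p f) z (t + t′) e′ z″
  runs-branch (runs a x) (runs b y) = runs (ℕ.+-mono-≤ a b) (exec-branch x y)

  runs-loop-stop : ∀ {p z t b z′} → Runs p z t (just b) z′ → Runs (loop p) z t (just b) z′
  runs-loop-stop (runs a x) = runs a (exec-loop-stop x)

  runs-loop-next : ∀ {p z t z′ t′ e z″} → Runs p z t nothing z′ → Runs (loop p) z′ t′ e z″ → Runs (loop p) z (t + t′) e z″
  runs-loop-next (runs a x) (runs b y) = runs (ℕ.+-mono-≤ a b) (exec-loop-next x y)

  word : Word → List (Cell W)
  word = map (just ∘ inj₁)

-- Simulation of programs by Turing machines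

module Compile {W : Set} (F : Finite W) (p : Prog W) where

  private FS = finite-States p

  encCell : Cell W → Γ (size F)
  encCell = Maybe.map (Sum.map₂ (enc F))

  decCell : Γ (size F) → Cell W
  decCell = Maybe.map (Sum.map₂ (dec F))

  decCell∘encCell : ∀ b → decCell (encCell b) ≡ b
  decCell∘encCell (just (inj₁ x)) = refl
  decCell∘encCell (just (inj₂ y)) = cong (just ∘ inj₂) (dec∘enc F y)
  decCell∘encCell nothing         = refl

  encState : States p ⊎ Exit → Fin (suc (size FS))
  encState (inj₁ s) = suc (enc FS s)
  encState (inj₂ _) = zero

  encAction : Action W (States p ⊎ Exit) → Fin (suc (size FS)) × Γ (size F) × Move
  encAction (s , b , m) = encState s , encCell b , m

  δ : Fin (suc (size FS)) → Γ (size F) → Fin (suc (size FS)) × Γ (size F) × Move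
  δ zero    b = zero , b , stay
  δ (suc i) b = encAction (transition p (dec FS i) (decCell b))

  machine : TM
  machine = record { Q = suc (size FS) ; G = size F ; start = suc (enc FS (initial p)) ; halt = zero ; δ = δ }

  Left : (ℕ → Γ (size F)) → ℕ → List (Cell W) → Set
  Left t zero    []       = 𝟏
  Left t zero    (_ ∷ _)  = Empty.⊥
  Left t (suc h) []       = Empty.⊥
  Left t (suc h) (l ∷ ls) = t h ≡ encCell l × Left t h ls

  Right : (ℕ → Γ (size F)) → ℕ → List (Cell W) → Set
  Right t h rs = ∀ i → t (h + i) ≡ encCell (at rs i)

  -- The length of the left list fixes the head position. The right list fixes the whole infinite
  -- rest of the tape, blanks included; this is what yields the blank behind the output.
  record Represents (c : Config machine) (q : Fin (suc (size FS))) (z : Zip W) : Set where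
    constructor reps
    field
      state≡ : Config.state c ≡ q
      left≡  : Left (Config.tape c) (Config.head c) (proj₁ z)
      right≡ : Right (Config.tape c) (Config.head c) (proj₂ z)

  write : (ℕ → Γ (size F)) → ℕ → Γ (size F) → ℕ → Γ (size F)
  write t h a i = if does (i ℕ.≟ h) then a else t i

  write-hit : ∀ t h a → write t h a h ≡ a
  write-hit t h a = cong (λ b → if b then a else t h) (Dec.dec-true (h ℕ.≟ h) refl)

  write-miss : ∀ t h a i → i ≢ h → write t h a i ≡ t i
  write-miss t h a i i≢h = cong (λ b → if b then a else t i) (Dec.dec-false (i ℕ.≟ h) i≢h)

  Left-write : ∀ t h k a ls → k ≤ h → Left t k ls → Left (write t h a) k ls
  Left-write t h zero    a []       k≤h l       = tt
  Left-write t h (suc k) a (x ∷ ls) k≤h (eq , l) =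
    trans (write-miss t h a k (ℕ.<⇒≢ k≤h)) eq , Left-write t h k a ls (ℕ.<⇒≤ k≤h) l

  Right-write : ∀ t h b rs → Right t h rs → Right (write t h (encCell b)) h (b ◂ tl rs)
  Right-write t h b rs r zero    = trans (cong (write t h (encCell b)) (ℕ.+-identityʳ h))
    (trans (write-hit t h (encCell b)) (cong encCell (sym (at-◂-zero b (tl rs)))))
  Right-write t h b rs r (suc i) = trans (write-miss t h _ (h + suc i) (ℕ.m+1+n≢m h))
    (trans (r (suc i)) (cong encCell (trans (sym (at-tl rs i)) (sym (at-◂-suc b (tl rs) i)))))

  Right-suc : ∀ t h b rs → Right t h (b ◂ rs) → Right t (suc h) rs
  Right-suc t h b rs r i = trans (cong t (sym (ℕ.+-suc h i))) (trans (r (suc i)) (cong encCell (at-◂-suc b rs i)))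

  Right-pred : ∀ t h l rs → t h ≡ encCell l → Right t (suc h) rs → Right t h (l ◂ rs)
  Right-pred t h l rs eq r zero    = trans (cong t (ℕ.+-identityʳ h)) (trans eq (cong encCell (sym (at-◂-zero l rs))))
  Right-pred t h l rs eq r (suc i) = trans (cong t (ℕ.+-suc h i)) (trans (r i) (cong encCell (sym (at-◂-suc l rs i))))

  represents-act : ∀ t h q b m ls rs → Left t h ls → Right t h rs →
    Represents (cfg q (move m h) (write t h (encCell b))) q (act b m (ls , rs))
  represents-act t h q b stay ls rs l r =
    reps refl (Left-write t h h _ ls ℕ.≤-refl l) (Right-write t h b rs r)
  represents-act t h q b right ls rs l r =
    reps refl (write-hit t h _ , Left-write t h h _ ls ℕ.≤-refl l)
         (Right-suc (write t h (encCell b)) h b (tl rs) (Right-write t h b rs r))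
  represents-act t zero q b left [] rs l r =
    reps refl tt (Right-write t zero b rs r)
  represents-act t (suc h) q b left (x ∷ ls) rs (eq , l) r =
    reps refl (Left-write t (suc h) h _ ls (ℕ.n≤1+n h) l)
         (Right-pred (write t (suc h) (encCell b)) h x (b ◂ tl rs) (trans (write-miss t (suc h) (encCell b) h (ℕ.<⇒≢ (ℕ.n<1+n h))) eq) (Right-write t (suc h) b rs r))

  represents-step : ∀ c s z q b m → Represents c (suc (enc FS s)) z →
    transition p s (cur (proj₂ z)) ≡ (q , b , m) → Represents (step machine c) (encState q) (act b m z)
  represents-step (cfg _ h t) s (ls , rs) q b m (reps refl l r) eq =
    subst (λ a → Represents (cfg (proj₁ a) (move (proj₂ (proj₂ a)) h) (write t h (proj₁ (proj₂ a)))) (encState q) (act b m (ls , rs)))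
          (sym (trans action-eq (cong encAction eq))) (represents-act t h (encState q) b m ls rs l r)
    where
    action-eq : δ (suc (enc FS s)) (t h) ≡ encAction (transition p s (cur rs))
    action-eq = cong₂ (λ s′ c → encAction (transition p s′ c)) (dec∘enc FS s)
      (trans (cong decCell (trans (cong t (sym (ℕ.+-identityʳ h))) (r 0)))
             (trans (decCell∘encCell (at rs 0)) (sym (cur≡at rs))))

  -- `run` adds its steps at the end, whereas `Exec` unfolds a computation from its first step; this
  -- version follows `Exec`.
  iterate-step : ℕ → Config machine → Config machine
  iterate-step zero    c = c
  iterate-step (suc k) c = iterate-step k (step machine c)

  represents-exec : ∀ {s z k e z′} c → Represents c (suc (enc FS s)) z → Exec p s z k e z′ →
    Represents (iterate-step k c) zero z′
  represents-exec c rep (stop eq)   = represents-step c _ _ _ _ _ rep eq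
  represents-exec c rep (next eq x) = represents-exec (step machine c) (represents-step c _ _ _ _ _ rep eq) x

  iterate-suc : ∀ k c → iterate-step k (step machine c) ≡ step machine (iterate-step k c)
  iterate-suc zero    c = refl
  iterate-suc (suc k) c = iterate-suc k (step machine c)

  run≡iterate : ∀ w k → run machine w k ≡ iterate-step k (run machine w 0)
  run≡iterate w zero    = refl
  run≡iterate w (suc k) = trans (cong (step machine) (run≡iterate w k)) (sym (iterate-suc k _))

  at-word : ∀ w i → wordTape w i ≡ encCell (at (word w) i)
  at-word []      i       = refl
  at-word (x ∷ w) zero    = refl
  at-word (x ∷ w) (suc i) = at-word w i

  represents-run : ∀ {w k e u} → Exec p (initial p) ([] , word w) k e ([] , word u) →
    HaltedAt machine w k × OutputIs (run machine w k) u
  represents-run {w} {k} {e} {u} x rewrite run≡iterate w k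
    with iterate-step k (run machine w 0) | represents-exec (run machine w 0) (reps refl tt (at-word w)) x
  ... | cfg _ zero t | reps refl _ r = refl , λ i _ → trans (r i) (sym (at-word u i))

-- Round trips of a finite transducer over the tape

module Traversal {W : Set} (isFirst : Sym ⊎ W → Bool) where

  Transducer : Set → Set
  Transducer K = K → Cell W → (K × (Sym ⊎ W)) ⊎ (Exit × Cell W)

  forth : ∀ {K : Set} → (K × (Sym ⊎ W)) ⊎ (Exit × Cell W) → Action W ((K ⊎ Exit) ⊎ Exit)
  forth (inj₁ (k , x)) = inj₁ (inj₁ k) , just x , right
  forth (inj₂ (e , b)) = inj₁ (inj₂ e) , b , left

  -- A machine cannot feel the left end of its tape, since a left move from cell 0 goes nowhere. The
  -- way back is stopped by a flag that only cell 0 carries.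
  back : ∀ {K : Set} → Exit → Cell W → Action W ((K ⊎ Exit) ⊎ Exit)
  back e nothing  = inj₂ e , nothing , stay
  back e (just x) = if isFirst x then (inj₂ e , just x , stay) else (inj₁ (inj₂ e) , just x , left)

  traverse : (K : Set) → Finite K → K → Transducer K → Prog W
  traverse K F k f = prim (K ⊎ Exit) (finite-⊎ F (finite-Maybe finite-Bool)) (inj₁ k)
    λ { (inj₁ k) b → forth (f k b) ; (inj₂ e) b → back e b }

  -- The forward half of a round trip. The turning step may still write a symbol `b`, which is how a
  -- letter gets appended to the output.
  data Trace {K : Set} (f : Transducer K) : K → List (Cell W) → List (Sym ⊎ W) → Exit → List (Cell W) → Set where
    halt : ∀ {k rs e b} → f k (cur rs) ≡ inj₂ (e , b) → Trace f k rs [] e (b ◂ tl rs)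
    cont : ∀ {k rs k′ y ys e rest} → f k (cur rs) ≡ inj₁ (k′ , y) → Trace f k′ (tl rs) ys e rest →
           Trace f k rs (y ∷ ys) e rest

  FirstAt : List (Sym ⊎ W) → (Sym ⊎ W) → Set
  FirstAt []       x = isFirst x ≡ true
  FirstAt (l ∷ ls) x = isFirst x ≡ false × FirstAt ls l

  module _ {K : Set} (F : Finite K) (k₀ : K) (f : Transducer K) where
    private p = traverse K F k₀ f

    exec-back : ∀ {e} ls x rs → FirstAt ls x →
      Exec p (inj₂ e) (map just ls , just x ∷ rs) (suc (length ls)) e ([] , map just ls ʳ++ (just x ∷ rs))
    exec-back {e} [] x rs first = stop (cong (λ b → if b then _ else _) first)
    exec-back {e} (l ∷ ls) x rs (eq , first) = next (cong (λ b → if b then _ else _) eq) (exec-back ls l (just x ∷ rs) first)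

    exec-forth : ∀ {k rs ys e rest} l ls → Trace f k rs ys e rest → FirstAt ls l → All (λ y → isFirst y ≡ false) ys →
      Exec p (inj₁ k) (map just (l ∷ ls) , rs) (length ys + suc (suc (length ys + length ls))) e
             ([] , map just (l ∷ ls) ʳ++ (map just ys ++ rest))
    exec-forth {rs = rs} l ls (halt {b = b} eq) first [] = next (cong forth eq) (exec-back ls l (b ◂ tl rs) first)
    exec-forth {ys = y ∷ ys} l ls (cont eq tr) first (ny ∷ nys) = next (cong forth eq)
      (exec-cast refl (cong (λ m → length ys + suc (suc m)) (ℕ.+-suc (length ys) (length ls))) refl
        (exec-forth y (l ∷ ls) tr (ny , first) nys))

    runs-traverse : ∀ {rs y ys e rest} → Trace f k₀ rs (y ∷ ys) e rest → isFirst y ≡ true → All (λ y → isFirst y ≡ false) ys →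
      Runs p ([] , rs) (2 * length (y ∷ ys) + 1) e ([] , map just (y ∷ ys) ++ rest)
    runs-traverse {y = y} {ys} (cont eq tr) first nys = runs
      (ℕ.≤-reflexive (lemma (length ys))) (next (cong forth eq) (exec-forth y [] tr first nys))
      where
      lemma : ∀ m → suc (m + suc (suc (m + 0))) ≡ 2 * suc m + 1
      lemma = solve-∀

-- A tape with boolean tracks

listTok : Sym → Maybe Bool
listTok 𝟘   = just false
listTok 𝟙   = just true
listTok sep = nothing
listTok bar = nothing

data Tok : Set where
  hdr brk : Tok
  lst     : Maybe Bool → Tok

finite-Tok : Finite Tok
finite-Tok = retract
  (λ { hdr → inj₁ tt ; brk → inj₂ (inj₁ tt) ; (lst x) → inj₂ (inj₂ x) })
  (λ { (inj₁ _) → hdr ; (inj₂ (inj₁ _)) → brk ; (inj₂ (inj₂ x)) → lst x })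
  (λ { hdr → refl ; brk → refl ; (lst x) → refl })
  (finite-⊎ finite-𝟏 (finite-⊎ finite-𝟏 (finite-Maybe finite-Bool)))

Row : ℕ → Set
Row S = Vec Bool S

get : ∀ {S} → ℕ → Row S → Bool
get j       []      = false
get zero    (b ∷ r) = b
get (suc j) (b ∷ r) = get j r

put : ∀ {S} → ℕ → Bool → Row S → Row S
put j       c []      = []
put zero    c (b ∷ r) = c ∷ r
put (suc j) c (b ∷ r) = b ∷ put j c r

get-put : ∀ {S} j c (r : Row S) → j < S → get j (put j c r) ≡ c
get-put zero    c (b ∷ r) _         = refl
get-put (suc j) c (b ∷ r) (s≤s j<S) = get-put j c r j<S

get-put-≢ : ∀ {S} i j c (r : Row S) → i ≢ j → get i (put j c r) ≡ get i r
get-put-≢ i       j       c []      i≢j = refl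
get-put-≢ zero    zero    c (b ∷ r) i≢j = contradiction refl i≢j
get-put-≢ zero    (suc j) c (b ∷ r) i≢j = refl
get-put-≢ (suc i) zero    c (b ∷ r) i≢j = refl
get-put-≢ (suc i) (suc j) c (b ∷ r) i≢j = get-put-≢ i j c r (i≢j ∘ cong suc)

-- A cell carries a flag (set only on cell 0), a token and S boolean tracks.
module Tape (S : ℕ) where

  W : Set
  W = Bool × Tok × Row S

  finite-W : Finite W
  finite-W = finite-× finite-Bool (finite-× finite-Tok (finite-Vec S finite-Bool))

  isFirst : Sym ⊎ W → Bool
  isFirst (inj₁ _)       = false
  isFirst (inj₂ (b , _)) = b

  open Traversal isFirst

  Cells : Set
  Cells = List (Tok × Row S)

  flagged : Bool → Cells → List (Sym ⊎ W)
  flagged b []       = []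
  flagged b (c ∷ cs) = inj₂ (b , c) ∷ flagged false cs

  tapeOf : Cells → Word → Zip W
  tapeOf cs o = [] , map just (flagged true cs) ++ word o

  length-flagged : ∀ b cs → length (flagged b cs) ≡ length cs
  length-flagged b []       = refl
  length-flagged b (c ∷ cs) = cong suc (length-flagged false cs)

  flagged-false : ∀ cs → All (λ y → isFirst y ≡ false) (flagged false cs)
  flagged-false []       = []
  flagged-false (c ∷ cs) = refl ∷ flagged-false cs

  Mealy : Set → Set
  Mealy K = K → Tok → Row S → K × Bool

  mealy : ∀ {K} → Mealy K → ℕ → K → Cells → K × Cells
  mealy f d k []             = k , []
  mealy f d k ((t , r) ∷ cs) = map₂ ((t , put d (proj₂ (f k t r)) r) ∷_) (mealy f d (proj₁ (f k t r)) cs)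

  sweepStep : ∀ {K} → Mealy K → ℕ → (K → Exit) → Transducer K
  sweepStep f d out k (just (inj₂ (b , t , r))) = inj₁ (proj₁ (f k t r) , inj₂ (b , t , put d (proj₂ (f k t r)) r))
  sweepStep f d out k (just (inj₁ s))           = inj₂ (out k , just (inj₁ s))
  sweepStep f d out k nothing                   = inj₂ (out k , nothing)

  sweep : ∀ {K} → Finite K → K → Mealy K → ℕ → (K → Exit) → Prog W
  sweep {K} F k f d out = traverse K F k (sweepStep f d out)

  trace-sweep : ∀ {K} (f : Mealy K) d out k b cs o →
    Trace (sweepStep f d out) k (map just (flagged b cs) ++ word o) (flagged b (proj₂ (mealy f d k cs)))
          (out (proj₁ (mealy f d k cs))) (word o)
  trace-sweep f d out k b []             []      = halt refl
  trace-sweep f d out k b []             (s ∷ o) = halt refl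
  trace-sweep f d out k b ((t , r) ∷ cs) o       = cont refl (trace-sweep f d out _ false cs o)

  length-mealy : ∀ {K} (f : Mealy K) d k cs → length (proj₂ (mealy f d k cs)) ≡ length cs
  length-mealy f d k []             = refl
  length-mealy f d k ((t , r) ∷ cs) = cong suc (length-mealy f d _ cs)

  runs-sweep : ∀ {K} (F : Finite K) k f d out c cs o →
    Runs (sweep F k f d out) (tapeOf (c ∷ cs) o) (2 * length (c ∷ cs) + 1)
         (out (proj₁ (mealy f d k (c ∷ cs)))) (tapeOf (proj₂ (mealy f d k (c ∷ cs))) o)
  runs-sweep F k f d out c cs o = runs-mono
    (ℕ.≤-reflexive (cong (λ m → 2 * suc m + 1) (trans (length-flagged false (proj₂ (mealy f d _ cs))) (length-mealy f d _ cs))))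
    (runs-traverse F k (sweepStep f d out) (trace-sweep f d out k true (c ∷ cs) o) refl (flagged-false (proj₂ (mealy f d _ cs))))

  emitStep : Sym → Transducer 𝟏
  emitStep s _ (just x) = inj₁ (tt , x)
  emitStep s _ nothing  = inj₂ (nothing , just (inj₁ s))

  emitSym : Sym → Prog W
  emitSym s = traverse 𝟏 finite-𝟏 tt (emitStep s)

  trace-emit : ∀ s xs → Trace (emitStep s) tt (map just xs) xs nothing [ just (inj₁ s) ]
  trace-emit s []       = halt refl
  trace-emit s (x ∷ xs) = cont refl (trace-emit s xs)

  word-false : ∀ o → All (λ y → isFirst y ≡ false) (map inj₁ o)
  word-false []      = []
  word-false (s ∷ o) = refl ∷ word-false o

  map-just-++-word : ∀ xs o → map just (xs ++ map inj₁ o) ≡ map just xs ++ word {W} o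
  map-just-++-word xs o = trans (ListP.map-++ just xs (map inj₁ o)) (cong (map just xs ++_) (sym (ListP.map-∘ o)))

  runs-emit : ∀ s c cs o →
    Runs (emitSym s) (tapeOf (c ∷ cs) o) (2 * (length (c ∷ cs) + length o) + 1) nothing (tapeOf (c ∷ cs) (o ++ [ s ]))
  runs-emit s c cs o = runs-cast
    (cong ([] ,_) (map-just-++-word (flagged true (c ∷ cs)) o)) refl
    (cong ([] ,_) (trans (cong (_++ [ just (inj₁ s) ]) (map-just-++-word (flagged true (c ∷ cs)) o))
      (trans (ListP.++-assoc (map just (flagged true (c ∷ cs))) (word o) _)
        (cong (map just (flagged true (c ∷ cs)) ++_) (sym (ListP.map-++ _ o [ s ]))))))
    (runs-mono (ℕ.≤-reflexive (cong (λ m → 2 * suc m + 1) (trans (ListP.length-++ (flagged false cs))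
        (cong₂ _+_ (length-flagged false cs) (ListP.length-map inj₁ o)))))
      (runs-traverse finite-𝟏 tt (emitStep s) (trace-emit s (flagged true (c ∷ cs) ++ map inj₁ o)) refl
        (AllP.++⁺ (flagged-false cs) (word-false o))))

  isBar : Sym → Bool
  isBar bar = true
  isBar _   = false

  -- Any symbol before the first bar counts as a header cell, and any later `bar` as a separator. So
  -- every word with a bar becomes a regular store, even if it describes no matroid.
  tokOf : Bool → Sym → Tok
  tokOf true  s = lst (listTok s)
  tokOf false s = if isBar s then brk else hdr

  blankRow : Row S
  blankRow = Vec.replicate S false

  convert : Bool → Word → Cells
  convert seen []      = []
  convert seen (s ∷ w) = (tokOf seen s , blankRow) ∷ convert (seen ∨ isBar s) w

  hasBar : Bool → Word → Bool
  hasBar seen []      = seen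
  hasBar seen (s ∷ w) = hasBar (seen ∨ isBar s) w

  loadStep : Transducer (Bool × Bool)
  loadStep (first , seen) (just (inj₁ s)) = inj₁ ((false , seen ∨ isBar s) , inj₂ (first , tokOf seen s , blankRow))
  loadStep (first , seen) (just (inj₂ x)) = inj₂ (just seen , just (inj₂ x))
  loadStep (first , seen) nothing         = inj₂ (just seen , nothing)

  loadInput : Prog W
  loadInput = traverse (Bool × Bool) (finite-× finite-Bool finite-Bool) (true , false) loadStep

  trace-load : ∀ first seen w → Trace loadStep (first , seen) (word w) (flagged first (convert seen w)) (just (hasBar seen w)) []
  trace-load first seen []      = halt refl
  trace-load first seen (s ∷ w) = cont refl (trace-load false (seen ∨ isBar s) w)

  length-convert : ∀ seen w → length (convert seen w) ≡ length w
  length-convert seen []      = refl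
  length-convert seen (s ∷ w) = cong suc (length-convert _ w)

  runs-load : ∀ s w → Runs loadInput ([] , word (s ∷ w)) (2 * length (s ∷ w) + 1)
                           (just (hasBar false (s ∷ w))) (tapeOf (convert false (s ∷ w)) [])
  runs-load s w = runs-mono
    (ℕ.≤-reflexive (cong (λ m → 2 * suc m + 1) (trans (length-flagged false (convert (isBar s) w)) (length-convert _ w))))
    (runs-traverse _ _ loadStep (trace-load true false (s ∷ w)) refl (flagged-false (convert (isBar s) w)))

  -- One round: overwrite the last cell by the first output symbol, moving the output one place to the left.
  shiftOutput : Maybe (Maybe Sym) → Cell W → Action W (Maybe (Maybe Sym) ⊎ Exit)
  shiftOutput nothing  (just x)         = inj₁ nothing , just x , right
  shiftOutput nothing  nothing          = inj₁ (just nothing) , nothing , left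
  shiftOutput (just c) (just (inj₁ s))  = inj₁ (just (just s)) , Maybe.map inj₁ c , left
  shiftOutput (just c) (just (inj₂ (true , _)))  = inj₂ (just true) , Maybe.map inj₁ c , stay
  shiftOutput (just c) (just (inj₂ (false , _))) = inj₂ nothing , Maybe.map inj₁ c , left
  shiftOutput (just c) nothing          = inj₂ (just true) , nothing , stay

  shiftProg : Prog W
  shiftProg = prim (Maybe (Maybe Sym)) (finite-Maybe (finite-Maybe finite-Sym)) nothing shiftOutput

  unload : Prog W
  unload = loop shiftProg

  focus : List (Cell W) → List (Cell W) → Zip W
  focus []       rs = [] , rs
  focus (l ∷ ls) rs = ls , l ◂ rs

  act-left : ∀ b ls x rs → act b left (ls , x ∷ rs) ≡ focus ls (b ◂ rs)
  act-left b []       x rs = refl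
  act-left b (l ∷ ls) x rs = refl

  -- Here `os` is the output in reverse, in the order in which it is met on the way left. Each step
  -- puts down the symbol being carried and picks up the one under the head.
  carried : List Sym → Maybe Sym → List (Cell W) → List (Cell W)
  carried []       c rs = Maybe.map inj₁ c ◂ rs
  carried (s ∷ os) c rs = carried os (just s) (Maybe.map inj₁ c ◂ rs)

  carried-just : ∀ os s rs → carried os (just s) rs ≡ word os ʳ++ (just (inj₁ s) ∷ rs)
  carried-just []        s rs = refl
  carried-just (s′ ∷ os) s rs = carried-just os s′ (just (inj₁ s) ∷ rs)

  carried-nothing : ∀ os → carried os nothing [] ≡ word os ʳ++ []
  carried-nothing []       = refl
  carried-nothing (s ∷ os) = carried-just os s []

  exec-carry-first : ∀ os c x rs → Exec shiftProg (just c) (focus (word os ++ [ just (inj₂ (true , x)) ]) rs)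
    (suc (length os)) (just true) ([] , carried os c rs)
  exec-carry-first [] c x rs = stop refl
  exec-carry-first (s ∷ os) c x rs = next refl
    (exec-cast (sym (act-left _ (word os ++ _) _ rs)) refl refl (exec-carry-first os (just s) x (Maybe.map inj₁ c ◂ rs)))

  exec-carry : ∀ os c x y ls rs → Exec shiftProg (just c) (focus (word os ++ just (inj₂ (false , x)) ∷ just y ∷ ls) rs)
    (suc (length os)) nothing (ls , just y ∷ carried os c rs)
  exec-carry [] c x y ls rs = stop refl
  exec-carry (s ∷ os) c x y ls rs = next refl
    (exec-cast (sym (act-left _ (word os ++ _) _ rs)) refl refl (exec-carry os (just s) x y ls (Maybe.map inj₁ c ◂ rs)))

  exec-right : ∀ {t e z} ls xs → Exec shiftProg (just nothing) (focus (map just xs ʳ++ ls) []) t e z →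
    Exec shiftProg nothing (ls , map just xs) (length xs + suc t) e z
  exec-right [] []       x = next refl x
  exec-right (l ∷ ls) [] x = next refl x
  exec-right ls (y ∷ xs) x = next refl (exec-right (just y ∷ ls) xs x)

  word-ʳ++ : ∀ o (ls : List (Cell W)) → word o ʳ++ ls ≡ word (reverse o) ++ ls
  word-ʳ++ o ls = trans (ListP.ʳ++-defn (word o)) (cong (_++ ls) (sym (ListP.reverse-map (just ∘ inj₁) o)))

  word-reverse : ∀ o → word {W} (reverse o) ʳ++ [] ≡ word o
  word-reverse o = trans (word-ʳ++ (reverse o) []) (trans (ListP.++-identityʳ _) (cong word (ListP.reverse-involutive o)))

  cell : W → Cell W
  cell = just ∘ inj₂

  FirstLast : List W → Set
  FirstLast []            = Empty.⊥
  FirstLast (w ∷ [])      = proj₁ w ≡ true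
  FirstLast (w ∷ w′ ∷ ws) = proj₁ w ≡ false × FirstLast (w′ ∷ ws)

  round-cost : ∀ m (o : Word) (xs : List (Sym ⊎ W)) → length xs ≤ m → length xs + suc (suc (length (reverse o))) ≤ m + length o + 2
  round-cost m o xs le = ℕ.≤-trans (ℕ.≤-reflexive (trans (cong (λ a → length xs + suc (suc a)) (ListP.length-reverse o)) (eq (length xs) (length o))))
    (ℕ.+-monoˡ-≤ 2 (ℕ.+-monoˡ-≤ (length o) le))
    where
    eq : ∀ a b → a + suc (suc b) ≡ a + b + 2
    eq = solve-∀

  -- Induction on the remaining work cells `ws`, listed from the last one back to the flagged cell
  -- 0; each round deletes the last one. The tape is described by its reversal, because the head
  -- starts at cell 0 in the initial round and next to the output in all later ones. The number `m`
  -- bounds the distance to the right end.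
  runs-unload-from : ∀ m ws ls xs o → FirstLast ws → map just xs ʳ++ ls ≡ word (reverse o) ++ map cell ws →
    length xs ≤ m → suc (length o) ≤ m →
    Runs unload (ls , map just xs) (length ws * (m + length o + 2)) (just true) ([] , word o)
  runs-unload-from m ((_ , x) ∷ []) ls xs o refl eq le le′ = runs-loop-stop
    (runs (ℕ.≤-trans (round-cost m o xs le) (ℕ.≤-reflexive (sym (ℕ.+-identityʳ _))))
      (exec-right ls xs (exec-cast
        (cong (λ l → focus l []) (sym eq)) refl (cong ([] ,_) (trans (carried-nothing (reverse o)) (word-reverse o))) (exec-carry-first (reverse o) nothing x []))))
  runs-unload-from m ((_ , x) ∷ w ∷ ws) ls xs o (refl , first) eq le le′ = runs-loop-next
    (runs (round-cost m o xs le)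
      (exec-right ls xs (exec-cast
        (cong (λ l → focus l []) (sym eq)) refl
        (cong (λ r → map cell ws , cell w ∷ r) (trans (carried-nothing (reverse o)) (trans (word-reverse o) (ListP.map-∘ o))))
        (exec-carry (reverse o) nothing x (inj₂ w) (map cell ws) []))))
    (runs-unload-from m (w ∷ ws) (map cell ws) (inj₂ w ∷ map inj₁ o) o first
      (trans (cong (_ʳ++ (cell w ∷ map cell ws)) (sym (ListP.map-∘ o))) (word-ʳ++ o _))
      (subst (λ a → suc a ≤ m) (sym (ListP.length-map inj₁ o)) le′) le′)

  flaggedW : Bool → Cells → List W
  flaggedW b []       = []
  flaggedW b (c ∷ cs) = (b , c) ∷ flaggedW false cs

  map-flaggedW : ∀ b cs → map just (flagged b cs) ≡ map cell (flaggedW b cs)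
  map-flaggedW b []       = refl
  map-flaggedW b (c ∷ cs) = cong (cell (b , c) ∷_) (map-flaggedW false cs)

  firstLast-ʳ++ : ∀ cs w ws → FirstLast (w ∷ ws) → FirstLast (flaggedW false cs ʳ++ (w ∷ ws))
  firstLast-ʳ++ []       w ws f = f
  firstLast-ʳ++ (c ∷ cs) w ws f = firstLast-ʳ++ cs (false , c) (w ∷ ws) (refl , f)

  length-flaggedW-ʳ++ : ∀ b cs ws → length (flaggedW b cs ʳ++ ws) ≡ length cs + length ws
  length-flaggedW-ʳ++ b []       ws = refl
  length-flaggedW-ʳ++ b (c ∷ cs) ws = trans (length-flaggedW-ʳ++ false cs _) (ℕ.+-suc (length cs) _)

  unloadCost : ℕ → ℕ
  unloadCost m = m * (m + m + 2)

  runs-unload : ∀ c cs o → Runs unload (tapeOf (c ∷ cs) o) (unloadCost (length (c ∷ cs) + length o)) (just true) ([] , word o)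
  runs-unload c cs o = subst (λ r → Runs unload ([] , r) (unloadCost m) (just true) ([] , word o)) (map-just-++-word (flagged true (c ∷ cs)) o)
    (runs-mono (ℕ.*-mono-≤ (ℕ.≤-trans (ℕ.≤-reflexive (length-flaggedW-ʳ++ true (c ∷ cs) []))
                 (ℕ.+-monoʳ-≤ (length (c ∷ cs)) z≤n)) (ℕ.+-monoˡ-≤ 2 (ℕ.+-monoʳ-≤ m (ℕ.m≤n+m (length o) (length (c ∷ cs))))))
      (runs-unload-from m (flaggedW true (c ∷ cs) ʳ++ []) [] (flagged true (c ∷ cs) ++ map inj₁ o) o
        (firstLast-ʳ++ cs (true , c) [] refl) eq
        (ℕ.≤-reflexive (trans (ListP.length-++ (flagged true (c ∷ cs))) (cong₂ _+_ (length-flagged true (c ∷ cs)) (ListP.length-map inj₁ o))))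
        (s≤s (ℕ.m≤n+m (length o) (length cs)))))
    where
    m = length (c ∷ cs) + length o
    open ≡-Reasoning
    eq : map just (flagged true (c ∷ cs) ++ map inj₁ o) ʳ++ [] ≡ word (reverse o) ++ map cell (flaggedW true (c ∷ cs) ʳ++ [])
    eq = begin
      map just (flagged true (c ∷ cs) ++ map inj₁ o) ʳ++ []
        ≡⟨ cong (_ʳ++ []) (trans (map-just-++-word (flagged true (c ∷ cs)) o) (cong (_++ word o) (map-flaggedW true (c ∷ cs)))) ⟩
      (map cell (flaggedW true (c ∷ cs)) ++ word o) ʳ++ []
        ≡⟨ ListP.++-ʳ++ (map cell (flaggedW true (c ∷ cs))) ⟩
      word o ʳ++ (map cell (flaggedW true (c ∷ cs)) ʳ++ [])
        ≡⟨ word-ʳ++ o _ ⟩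
      word (reverse o) ++ (map cell (flaggedW true (c ∷ cs)) ʳ++ [])
        ≡⟨ cong (word (reverse o) ++_) (sym (ListP.map-ʳ++ cell (flaggedW true (c ∷ cs)))) ⟩
      word (reverse o) ++ map cell (flaggedW true (c ∷ cs) ʳ++ []) ∎

-- A language of set expressions, tests and output commands over a list of pairs (set, rank).
-- foldE binds the element (0) and the accumulator (1); anyL and forL bind the rank (0) and the set (1).
-- anyE s h and anyL s h look for an item satisfying h, giving up at the first one that satisfies s.

mutual
  data SE (d : ℕ) : Set where
    var   : Fin d → SE d
    con   : Bool → SE d
    op    : (Bool → Bool → Bool) → SE d → SE d → SE d
    ite   : BE d → SE d → SE d → SE d
    foldE : SE d → SE (2 + d) → SE d
    letS  : SE d → SE (1 + d) → SE d

  data BE (d : ℕ) : Set where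
    some : SE d → BE d
    notB : BE d → BE d
    andB : BE d → BE d → BE d
    anyE : BE (1 + d) → BE (1 + d) → BE d
    anyL : BE (2 + d) → BE (2 + d) → BE d
    letB : SE d → BE (1 + d) → BE d

data OP (d : ℕ) : Set where
  nop  : OP d
  emit : Sym → OP d
  _⨟_  : OP d → OP d → OP d
  ifO  : BE d → OP d → OP d → OP d
  forE : OP (1 + d) → OP d
  forL : OP (2 + d) → OP d
  letO : SE d → OP (1 + d) → OP d

infixr 4 _⨟_

-- hot k = {k} for k < n, and hot k = ∅ otherwise.
hot : ∀ {n} → ℕ → Subset n
hot {zero}  k       = []
hot {suc n} zero    = true ∷ ⊥
hot {suc n} (suc k) = false ∷ hot k

-- The loop over the elements looks at its marker only after the body has been executed. Hence there
-- is one more turn, in which the marker has left the header and the current set is empty. That turn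
-- also serves the candidates that depend on a listed set alone.
els : ∀ {n} → ℕ → ℕ → List (Subset n)
els k zero    = [ hot k ]
els k (suc r) = hot k ∷ els (suc k) r

-- the singletons of Fin n in increasing order, followed by ∅
elems : ∀ n → List (Subset n)
elems n = els 0 n

anyV : ∀ {n} → Vec Bool n → Bool
anyV []      = false
anyV (b ∷ v) = b ∨ anyV v

anyUntil : ∀ {A : Set} → (A → Bool) → (A → Bool) → List A → Bool
anyUntil stp hit []       = false
anyUntil stp hit (x ∷ xs) = if stp x then false else if hit x then true else anyUntil stp hit xs

module Semantics {n : ℕ} (Es : List (Subset n × Subset n)) where

  mutual
    ⟦_⟧S : ∀ {d} → SE d → Vec (Subset n) d → Subset n
    ⟦ var i ⟧S ρ     = lookup ρ i
    ⟦ con b ⟧S ρ     = Vec.replicate n b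
    ⟦ op f a b ⟧S ρ  = Vec.zipWith f (⟦ a ⟧S ρ) (⟦ b ⟧S ρ)
    ⟦ ite b a c ⟧S ρ = if ⟦ b ⟧B ρ then ⟦ a ⟧S ρ else ⟦ c ⟧S ρ
    ⟦ foldE a b ⟧S ρ = foldl (λ acc x → ⟦ b ⟧S (x ∷ acc ∷ ρ)) (⟦ a ⟧S ρ) (elems n)
    ⟦ letS a b ⟧S ρ  = ⟦ b ⟧S (⟦ a ⟧S ρ ∷ ρ)

    ⟦_⟧B : ∀ {d} → BE d → Vec (Subset n) d → Bool
    ⟦ some a ⟧B ρ          = anyV (⟦ a ⟧S ρ)
    ⟦ notB b ⟧B ρ          = not (⟦ b ⟧B ρ)
    ⟦ andB a b ⟧B ρ        = ⟦ a ⟧B ρ ∧ ⟦ b ⟧B ρ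
    ⟦ anyE stp hit ⟧B ρ    = anyUntil (λ x → ⟦ stp ⟧B (x ∷ ρ)) (λ x → ⟦ hit ⟧B (x ∷ ρ)) (elems n)
    ⟦ anyL stp hit ⟧B ρ    = anyUntil (λ (X , R) → ⟦ stp ⟧B (R ∷ X ∷ ρ)) (λ (X , R) → ⟦ hit ⟧B (R ∷ X ∷ ρ)) Es
    ⟦ letB a b ⟧B ρ        = ⟦ b ⟧B (⟦ a ⟧S ρ ∷ ρ)

  ⟦_⟧O : ∀ {d} → OP d → Vec (Subset n) d → Word
  ⟦ nop ⟧O ρ       = []
  ⟦ emit s ⟧O ρ    = [ s ]
  ⟦ p ⨟ q ⟧O ρ     = ⟦ p ⟧O ρ ++ ⟦ q ⟧O ρ
  ⟦ ifO b p q ⟧O ρ = if ⟦ b ⟧B ρ then ⟦ p ⟧O ρ else ⟦ q ⟧O ρ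
  ⟦ forE p ⟧O ρ    = concatMap (λ x → ⟦ p ⟧O (x ∷ ρ)) (elems n)
  ⟦ forL p ⟧O ρ    = concatMap (λ (X , R) → ⟦ p ⟧O (R ∷ X ∷ ρ)) Es
  ⟦ letO a p ⟧O ρ  = ⟦ p ⟧O (⟦ a ⟧S ρ ∷ ρ)

-- Markers, and the division of the list into entries

shiftIn : ∀ {n} → Bool → Vec Bool n → Vec Bool n
shiftIn c []      = []
shiftIn c (b ∷ v) = c ∷ shiftIn b v

shiftInL : Bool → List Bool → List Bool
shiftInL c []       = []
shiftInL c (b ∷ bs) = c ∷ shiftInL b bs

anyB : List Bool → Bool
anyB []       = false
anyB (b ∷ bs) = b ∨ anyB bs

shiftIn-⊥ : ∀ {n} → shiftIn false (⊥ {n}) ≡ ⊥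
shiftIn-⊥ {zero}  = refl
shiftIn-⊥ {suc n} = cong (false ∷_) shiftIn-⊥

shiftIn-hot : ∀ {n} k → shiftIn false (hot {n} k) ≡ hot (suc k)
shiftIn-hot {zero}        k       = refl
shiftIn-hot {suc zero}    zero    = refl
shiftIn-hot {suc (suc n)} zero    = cong (λ v → false ∷ true ∷ v) shiftIn-⊥
shiftIn-hot {suc n}       (suc k) = cong (false ∷_) (shiftIn-hot k)

shiftIn-true-⊥ : ∀ {n} → shiftIn true (⊥ {n}) ≡ hot 0
shiftIn-true-⊥ {zero}  = refl
shiftIn-true-⊥ {suc n} = cong (true ∷_) shiftIn-⊥

anyV-⊥ : ∀ n → anyV (⊥ {n}) ≡ false
anyV-⊥ zero    = refl
anyV-⊥ (suc n) = anyV-⊥ n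

anyV-hot-< : ∀ k r → anyV (hot {k + suc r} k) ≡ true
anyV-hot-< zero    r = refl
anyV-hot-< (suc k) r = anyV-hot-< k r

anyV-hot-≡ : ∀ k → anyV (hot {k + 0} k) ≡ false
anyV-hot-≡ zero    = refl
anyV-hot-≡ (suc k) = anyV-hot-≡ k

oneHot : ℕ → ℕ → List Bool
oneHot k       zero    = []
oneHot zero    (suc m) = true ∷ replicate m false
oneHot (suc k) (suc m) = false ∷ oneHot k m

shiftInL-false : ∀ m → shiftInL false (replicate m false) ≡ replicate m false
shiftInL-false zero    = refl
shiftInL-false (suc m) = cong (false ∷_) (shiftInL-false m)

shiftInL-oneHot : ∀ k m → shiftInL false (oneHot k m) ≡ oneHot (suc k) m
shiftInL-oneHot k       zero          = refl
shiftInL-oneHot zero    (suc zero)    = refl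
shiftInL-oneHot zero    (suc (suc m)) = cong (λ v → false ∷ true ∷ v) (shiftInL-false m)
shiftInL-oneHot (suc k) (suc m)       = cong (false ∷_) (shiftInL-oneHot k m)

shiftInL-true : ∀ m → shiftInL true (replicate m false) ≡ oneHot 0 m
shiftInL-true zero    = refl
shiftInL-true (suc m) = cong (true ∷_) (shiftInL-false m)

module _ {A : Set} where

  nonempty : List A → Bool
  nonempty []      = false
  nonempty (_ ∷ _) = true

  anyB-oneHot : ∀ k (ts : List A) → anyB (oneHot k (length ts)) ≡ nonempty (drop k ts)
  anyB-oneHot zero    []       = refl
  anyB-oneHot zero    (t ∷ ts) = refl
  anyB-oneHot (suc k) []       = refl
  anyB-oneHot (suc k) (t ∷ ts) = anyB-oneHot k ts

  drop-suc : ∀ k {t} (ts : List A) {us} → drop k ts ≡ t ∷ us → drop (suc k) ts ≡ us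
  drop-suc zero    (t ∷ ts) refl = refl
  drop-suc (suc k) []       ()
  drop-suc (suc k) (t ∷ ts) eq   = drop-suc k ts eq

  drop-suc-[] : ∀ k (ts : List A) → drop k ts ≡ [] → drop (suc k) ts ≡ []
  drop-suc-[] k       []       eq = refl
  drop-suc-[] zero    (t ∷ ts) ()
  drop-suc-[] (suc k) (t ∷ ts) eq = drop-suc-[] k ts eq

Toks : Set
Toks = List (Maybe Bool)

firstTok : Toks → Maybe Bool
firstTok []      = nothing
firstTok (t ∷ _) = t

readBlock : Toks → List Bool × Toks
readBlock []            = [] , []
readBlock (nothing ∷ ts) = [] , ts
readBlock (just b ∷ ts)  = map₁ (b ∷_) (readBlock ts)

-- Mirrors the copying loop of the machine: `p` is a one-element marker that walks along the header
-- cells. A block longer than the ground set loses its surplus, as the marker is then empty.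
loadBits : ∀ {n} → Subset n → Subset n → List Bool → Subset n
loadBits X p []       = X
loadBits X p (b ∷ bs) = loadBits (if b then X ∪ p else X) (shiftIn false p) bs

loadSet : ∀ {n} → List Bool → Subset n
loadSet = loadBits ⊥ (hot 0)

readEntry : ∀ {n} → Bool → Toks → (Subset n × Subset n) × Toks
readEntry true  ts = (loadSet (proj₁ (readBlock ts)) , loadSet (proj₁ (readBlock (proj₂ (readBlock ts)))))
                   , proj₂ (readBlock (proj₂ (readBlock ts)))
readEntry false ts = (loadSet (proj₁ (readBlock ts)) , ⊥) , proj₂ (readBlock ts)

-- The first argument bounds the number of entries read (the recursion is not structural).
entries : ∀ {n} → Bool → ℕ → Toks → List (Subset n × Subset n)
entries ranked zero    ts       = []
entries ranked (suc f) []       = []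
entries {n} ranked (suc f) (t ∷ ts) = proj₁ (readEntry ranked (t ∷ ts)) ∷ entries ranked f (proj₂ (readEntry {n} ranked (t ∷ ts)))

readBlock-≤ : ∀ ts → length (proj₂ (readBlock ts)) ≤ length ts
readBlock-≤ []             = z≤n
readBlock-≤ (nothing ∷ ts) = ℕ.n≤1+n _
readBlock-≤ (just b ∷ ts)  = ℕ.m≤n⇒m≤1+n (readBlock-≤ ts)

readBlock-< : ∀ t ts → length (proj₂ (readBlock (t ∷ ts))) ≤ length ts
readBlock-< nothing  ts = ℕ.≤-refl
readBlock-< (just b) ts = readBlock-≤ ts

readEntry-< : ∀ {n} ranked t ts → length (proj₂ (readEntry {n} ranked (t ∷ ts))) ≤ length ts
readEntry-< true  t ts = ℕ.≤-trans (readBlock-≤ (proj₂ (readBlock (t ∷ ts)))) (readBlock-< t ts)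
readEntry-< false t ts = readBlock-< t ts

-- Sweeps over a store of sets

unitCost : ℕ → ℕ
unitCost K = 2 * K + 1

module Primitives (S : ℕ) where

  open Tape S public

  -- The tape holds n header cells, on whose tracks the subsets of the ground set live, the bar cell, the cells
  -- of the input list, on whose tracks the loop markers live, and then the output.
  record Store (n : ℕ) : Set where
    constructor store
    field
      hs  : Vec (Row S) n
      mid : Row S
      ls  : List (Maybe Bool × Row S)
  open Store public

  hcells : ∀ {n} → Vec (Row S) n → Cells → Cells
  hcells []      cs = cs
  hcells (r ∷ H) cs = (hdr , r) ∷ hcells H cs

  lcells : List (Maybe Bool × Row S) → Cells
  lcells []            = []
  lcells ((l , r) ∷ L) = (lst l , r) ∷ lcells L

  cellsOf : ∀ {n} → Store n → Cells
  cellsOf (store H b L) = hcells H ((brk , b) ∷ lcells L)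

  tape : ∀ {n} → Store n → Word → Zip W
  tape st o = tapeOf (cellsOf st) o

  hcol : ∀ {n} → ℕ → Store n → Vec Bool n
  hcol j st = Vec.map (get j) (hs st)

  lcol : ∀ {n} → ℕ → Store n → List Bool
  lcol j st = map (λ c → get j (proj₂ c)) (ls st)

  ltoks : ∀ {n} → Store n → Toks
  ltoks st = map proj₁ (ls st)

  sz : ∀ {n} → Store n → ℕ
  sz {n} st = n + suc (length (ltoks st))

  length-lcells : ∀ L → length (lcells L) ≡ length (map proj₁ L)
  length-lcells []      = refl
  length-lcells (x ∷ L) = cong suc (length-lcells L)

  length-cellsOf : ∀ {n} (st : Store n) → length (cellsOf st) ≡ sz st
  length-cellsOf (store []      b L) = cong suc (length-lcells L)
  length-cellsOf (store (r ∷ H) b L) = cong suc (length-cellsOf (store H b L))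

  cellsOf-cons : ∀ {n} (st : Store n) → ∃[ c ] ∃[ cs ] cellsOf st ≡ c ∷ cs
  cellsOf-cons (store []      b L) = _ , _ , refl
  cellsOf-cons (store (r ∷ H) b L) = _ , _ , refl

  module _ {K : Set} (fH : K → Row S → K × Bool) (fL : K → Maybe Bool → Row S → K × Bool) (d : ℕ) where

    both : Mealy K
    both k hdr     r = fH k r
    both k brk     r = k , false
    both k (lst l) r = fL k l r

    hbits : ∀ {n} → K → Vec (Row S) n → Vec Bool n
    hbits k []      = []
    hbits k (r ∷ H) = proj₂ (fH k r) ∷ hbits (proj₁ (fH k r)) H

    hend : ∀ {n} → K → Vec (Row S) n → K
    hend k []      = k
    hend k (r ∷ H) = hend (proj₁ (fH k r)) H

    hnew : ∀ {n} → K → Vec (Row S) n → Vec (Row S) n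
    hnew k []      = []
    hnew k (r ∷ H) = put d (proj₂ (fH k r)) r ∷ hnew (proj₁ (fH k r)) H

    lbits : K → List (Maybe Bool × Row S) → List Bool
    lbits k []            = []
    lbits k ((l , r) ∷ L) = proj₂ (fL k l r) ∷ lbits (proj₁ (fL k l r)) L

    lend : K → List (Maybe Bool × Row S) → K
    lend k []            = k
    lend k ((l , r) ∷ L) = lend (proj₁ (fL k l r)) L

    lnew : K → List (Maybe Bool × Row S) → List (Maybe Bool × Row S)
    lnew k []            = []
    lnew k ((l , r) ∷ L) = (l , put d (proj₂ (fL k l r)) r) ∷ lnew (proj₁ (fL k l r)) L

    snew : ∀ {n} → K → Store n → Store n
    snew k (store H b L) = store (hnew k H) (put d false b) (lnew (hend k H) L)

    mealy-lcells : ∀ k L → mealy both d k (lcells L) ≡ (lend k L , lcells (lnew k L))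
    mealy-lcells k []            = refl
    mealy-lcells k ((l , r) ∷ L) = cong (map₂ (_ ∷_)) (mealy-lcells (proj₁ (fL k l r)) L)

    mealy-cellsOf : ∀ {n} k (st : Store n) → mealy both d k (cellsOf st) ≡ (lend (hend k (hs st)) (ls st) , cellsOf (snew k st))
    mealy-cellsOf k (store []      b L) = cong (map₂ (_ ∷_)) (mealy-lcells k L)
    mealy-cellsOf k (store (r ∷ H) b L) = cong (map₂ (_ ∷_)) (mealy-cellsOf (proj₁ (fH k r)) (store H b L))

    runs-both : ∀ {n} (F : Finite K) k out (st : Store n) o →
      Runs (sweep F k both d out) (tape st o) (unitCost (sz st)) (out (lend (hend k (hs st)) (ls st))) (tape (snew k st) o)
    runs-both F k out st o with cellsOf st | cellsOf-cons st | mealy-cellsOf k st | length-cellsOf st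
    ... | .(c ∷ cs) | c , cs , refl | eq | len = runs-mono (ℕ.≤-reflexive (cong unitCost len))
      (runs-cast refl (cong (out ∘ proj₁) eq) (cong (λ x → tapeOf (proj₂ x) o) eq) (runs-sweep F k both d out c cs o))

    hcol-hnew : ∀ {n} k (H : Vec (Row S) n) → d < S → Vec.map (get d) (hnew k H) ≡ hbits k H
    hcol-hnew k []      d<S = refl
    hcol-hnew k (r ∷ H) d<S = cong₂ _∷_ (get-put d _ r d<S) (hcol-hnew _ H d<S)

    hcol-hnew-≢ : ∀ {n} j k (H : Vec (Row S) n) → j ≢ d → Vec.map (get j) (hnew k H) ≡ Vec.map (get j) H
    hcol-hnew-≢ j k []      j≢d = refl
    hcol-hnew-≢ j k (r ∷ H) j≢d = cong₂ _∷_ (get-put-≢ j d _ r j≢d) (hcol-hnew-≢ j _ H j≢d)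

    lcol-lnew : ∀ k L → d < S → map (λ c → get d (proj₂ c)) (lnew k L) ≡ lbits k L
    lcol-lnew k []            d<S = refl
    lcol-lnew k ((l , r) ∷ L) d<S = cong₂ _∷_ (get-put d _ r d<S) (lcol-lnew _ L d<S)

    lcol-lnew-≢ : ∀ j k L → j ≢ d → map (λ c → get j (proj₂ c)) (lnew k L) ≡ map (λ c → get j (proj₂ c)) L
    lcol-lnew-≢ j k []            j≢d = refl
    lcol-lnew-≢ j k ((l , r) ∷ L) j≢d = cong₂ _∷_ (get-put-≢ j d _ r j≢d) (lcol-lnew-≢ j _ L j≢d)

    ltoks-lnew : ∀ k L → map proj₁ (lnew k L) ≡ map proj₁ L
    ltoks-lnew k []            = refl
    ltoks-lnew k ((l , r) ∷ L) = cong (l ∷_) (ltoks-lnew _ L)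

  Same : ∀ {n} → ℕ → Store n → Store n → Set
  Same j st st′ = hcol j st′ ≡ hcol j st × lcol j st′ ≡ lcol j st

  record Change {n} (d : ℕ) (st st′ : Store n) (h : Vec Bool n) (l : List Bool) : Set where
    constructor change
    field
      toks≡  : ltoks st′ ≡ ltoks st
      others : ∀ j → j ≢ d → Same j st st′
      hcol≡  : hcol d st′ ≡ h
      lcol≡  : lcol d st′ ≡ l
  open Change public

  change-snew : ∀ {K : Set} (fH : K → Row S → K × Bool) fL {n} d k (st : Store n) → d < S →
    Change d st (snew fH fL d k st) (hbits fH fL d k (hs st)) (lbits fH fL d (hend fH fL d k (hs st)) (ls st))
  change-snew fH fL d k st d<S = change (ltoks-lnew fH fL d _ (ls st))
    (λ j j≢d → hcol-hnew-≢ fH fL d j k (hs st) j≢d , lcol-lnew-≢ fH fL d j _ (ls st) j≢d)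
    (hcol-hnew fH fL d k (hs st) d<S) (lcol-lnew fH fL d _ (ls st) d<S)

  Step : ∀ {n} → Prog W → ℕ → Store n → Word → Exit → Vec Bool n → List Bool → Set
  Step {n} p d st o e h l = Σ (Store n) λ st′ → Runs p (tape st o) (unitCost (sz st)) e (tape st′ o) × Change d st st′ h l

  setH : ℕ → (Row S → Bool) → Prog W
  setH d g = sweep finite-𝟏 tt (both (λ k r → k , g r) (λ k l r → k , get d r) d) d (λ _ → nothing)

  step-setH : ∀ {n} d g (st : Store n) o → d < S → Step (setH d g) d st o nothing (Vec.map g (hs st)) (lcol d st)
  step-setH d g st o d<S = _ , runs-both fH fL d finite-𝟏 tt (λ _ → nothing) st o ,
    subst₂ (Change d st (snew fH fL d tt st)) (hb (hs st)) (lb (ls st)) (change-snew fH fL d tt st d<S)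
    where
    fH : 𝟏 → Row S → 𝟏 × Bool
    fH k r = k , g r
    fL : 𝟏 → Maybe Bool → Row S → 𝟏 × Bool
    fL k l r = k , get d r
    hb : ∀ {n} (H : Vec (Row S) n) → hbits fH fL d tt H ≡ Vec.map g H
    hb []      = refl
    hb (r ∷ H) = cong (g r ∷_) (hb H)
    lb : ∀ L → lbits fH fL d tt L ≡ map (λ c → get d (proj₂ c)) L
    lb []      = refl
    lb (c ∷ L) = cong (_ ∷_) (lb L)

  -- keep = false, c = true places the marker on the first cell; keep = true, c = false advances it.
  shiftH shiftL : Bool → Bool → ℕ → Prog W
  shiftH keep c d = sweep finite-Bool c (both (λ k r → keep ∧ get d r , k) (λ k l r → k , get d r) d) d (λ _ → nothing)
  shiftL keep c d = sweep finite-Bool c (both (λ k r → k , get d r) (λ k l r → keep ∧ get d r , k) d) d (λ _ → nothing)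

  module _ (keep : Bool) (d : ℕ) where

    private
      fS fK : Bool → Row S → Bool × Bool
      fS k r = keep ∧ get d r , k
      fK k r = k , get d r
      gS gK : Bool → Maybe Bool → Row S → Bool × Bool
      gS k l = fS k
      gK k l = fK k

    step-shiftH : ∀ {n} c (st : Store n) o → d < S →
      Step (shiftH keep c d) d st o nothing (shiftIn c (Vec.map (keep ∧_) (hcol d st))) (lcol d st)
    step-shiftH c st o d<S = _ , runs-both fS gK d finite-Bool c (λ _ → nothing) st o ,
      subst₂ (Change d st (snew fS gK d c st)) (hb c (hs st)) (lb _ (ls st)) (change-snew fS gK d c st d<S)
      where
      hb : ∀ {n} c (H : Vec (Row S) n) → hbits fS gK d c H ≡ shiftIn c (Vec.map (keep ∧_) (Vec.map (get d) H))
      hb c []      = refl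
      hb c (r ∷ H) = cong (c ∷_) (hb (keep ∧ get d r) H)
      lb : ∀ k L → lbits fS gK d k L ≡ map (λ c → get d (proj₂ c)) L
      lb k []      = refl
      lb k (c ∷ L) = cong (_ ∷_) (lb k L)

    step-shiftL : ∀ {n} c (st : Store n) o → d < S →
      Step (shiftL keep c d) d st o nothing (hcol d st) (shiftInL c (map (keep ∧_) (lcol d st)))
    step-shiftL c st o d<S = _ , runs-both fK gS d finite-Bool c (λ _ → nothing) st o ,
      subst₂ (Change d st (snew fK gS d c st)) (hb (hs st))
        (trans (cong (λ k → lbits fK gS d k (ls st)) (he (hs st))) (lb c (ls st))) (change-snew fK gS d c st d<S)
      where
      hb : ∀ {n k} (H : Vec (Row S) n) → hbits fK gS d k H ≡ Vec.map (get d) H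
      hb []      = refl
      hb (r ∷ H) = cong (_ ∷_) (hb H)
      he : ∀ {n k} (H : Vec (Row S) n) → hend fK gS d k H ≡ k
      he []      = refl
      he (r ∷ H) = he H
      lb : ∀ c L → lbits fK gS d c L ≡ shiftInL c (map (keep ∧_) (map (λ c → get d (proj₂ c)) L))
      lb c []            = refl
      lb c ((l , r) ∷ L) = cong (c ∷_) (lb (keep ∧ get d r) L)

  testH testL readL : ℕ → Prog W
  testH d = sweep finite-Bool false (both (λ k r → k ∨ get d r , get d r) (λ k l r → k , get d r) d) d just
  testL d = sweep finite-Bool false (both (λ k r → k , get d r) (λ k l r → k ∨ get d r , get d r) d) d just
  readL d = sweep (finite-Maybe finite-Bool) nothing
    (both (λ k r → k , get d r) (λ k l r → (if get d r then l else k) , get d r) d) d id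

  module _ {K : Set} (hK : K → Row S → K) (lK : K → Maybe Bool → Row S → K) (d : ℕ) where
    private
      fH : K → Row S → K × Bool
      fH k r = hK k r , get d r
      fL : K → Maybe Bool → Row S → K × Bool
      fL k l r = lK k l r , get d r

    step-test : ∀ {n} (F : Finite K) k out (st : Store n) o → d < S →
      Step (sweep F k (both fH fL d) d out) d st o (out (lend fH fL d (hend fH fL d k (hs st)) (ls st))) (hcol d st) (lcol d st)
    step-test F k out st o d<S = _ , runs-both fH fL d F k out st o ,
      subst₂ (Change d st (snew fH fL d k st)) (hb k (hs st)) (lb _ (ls st)) (change-snew fH fL d k st d<S)
      where
      hb : ∀ {n} k (H : Vec (Row S) n) → hbits fH fL d k H ≡ Vec.map (get d) H
      hb k []      = refl
      hb k (r ∷ H) = cong (_ ∷_) (hb (hK k r) H)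
      lb : ∀ k L → lbits fH fL d k L ≡ map (λ c → get d (proj₂ c)) L
      lb k []            = refl
      lb k ((l , r) ∷ L) = cong (_ ∷_) (lb (lK k l r) L)

  step-cast : ∀ {n p d} {st : Store n} {o e e′ h l} → e ≡ e′ → Step p d st o e h l → Step p d st o e′ h l
  step-cast refl s = s

  step-testH : ∀ {n} d (st : Store n) o → d < S → Step (testH d) d st o (just (anyV (hcol d st))) (hcol d st) (lcol d st)
  step-testH d st o d<S = step-cast (cong just (trans (le (ls st)) (he false (hs st))))
    (step-test (λ k r → k ∨ get d r) (λ k l r → k) d finite-Bool false just st o d<S)
    where
    fH : Bool → Row S → Bool × Bool
    fH k r = k ∨ get d r , get d r
    fL : Bool → Maybe Bool → Row S → Bool × Bool
    fL k l r = k , get d r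
    le : ∀ {k} L → lend fH fL d k L ≡ k
    le []      = refl
    le (_ ∷ L) = le L
    he : ∀ {n} k (H : Vec (Row S) n) → hend fH fL d k H ≡ k ∨ anyV (Vec.map (get d) H)
    he k []      = sym (𝔹.∨-identityʳ k)
    he k (r ∷ H) = trans (he (k ∨ get d r) H) (𝔹.∨-assoc k (get d r) _)

  step-testL : ∀ {n} d (st : Store n) o → d < S → Step (testL d) d st o (just (anyB (lcol d st))) (hcol d st) (lcol d st)
  step-testL d st o d<S = step-cast (cong just (trans (cong (λ k → lend fH fL d k (ls st)) (he (hs st))) (le false (ls st))))
    (step-test (λ k r → k) (λ k l r → k ∨ get d r) d finite-Bool false just st o d<S)
    where
    fH : Bool → Row S → Bool × Bool
    fH k r = k , get d r
    fL : Bool → Maybe Bool → Row S → Bool × Bool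
    fL k l r = k ∨ get d r , get d r
    he : ∀ {n k} (H : Vec (Row S) n) → hend fH fL d k H ≡ k
    he []      = refl
    he (_ ∷ H) = he H
    le : ∀ k L → lend fH fL d k L ≡ k ∨ anyB (map (λ c → get d (proj₂ c)) L)
    le k []            = sym (𝔹.∨-identityʳ k)
    le k ((l , r) ∷ L) = trans (le (k ∨ get d r) L) (𝔹.∨-assoc k (get d r) _)

  -- The memory is overwritten at the marked cell only, so it ends up with the marked token. A
  -- marker beyond the end leaves the initial `nothing`; the end of the list thus closes the last
  -- block like a separator.
  step-readL : ∀ {n} d (st : Store n) o k → d < S → lcol d st ≡ oneHot k (length (ltoks st)) →
    Step (readL d) d st o (firstTok (drop k (ltoks st))) (hcol d st) (lcol d st)
  step-readL d st o k d<S mark = step-cast (trans (cong (λ k → lend fH fL d k (ls st)) (he (hs st))) (le k (ls st) mark))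
    (step-test (λ k r → k) (λ k l r → if get d r then l else k) d (finite-Maybe finite-Bool) nothing id st o d<S)
    where
    fH : Maybe Bool → Row S → Maybe Bool × Bool
    fH k r = k , get d r
    fL : Maybe Bool → Maybe Bool → Row S → Maybe Bool × Bool
    fL k l r = (if get d r then l else k) , get d r
    he : ∀ {n k} (H : Vec (Row S) n) → hend fH fL d k H ≡ k
    he []      = refl
    he (_ ∷ H) = he H
    le′ : ∀ x L → map (λ c → get d (proj₂ c)) L ≡ replicate (length (map proj₁ L)) false → lend fH fL d x L ≡ x
    le′ x []            eq = refl
    le′ x ((l , r) ∷ L) eq = trans (cong (λ b → lend fH fL d (if b then l else x) L) (ListP.∷-injectiveˡ eq)) (le′ x L (ListP.∷-injectiveʳ eq))
    le : ∀ k L → map (λ c → get d (proj₂ c)) L ≡ oneHot k (length (map proj₁ L)) →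
         lend fH fL d nothing L ≡ firstTok (drop k (map proj₁ L))
    le zero    []            eq = refl
    le (suc k) []            eq = refl
    le zero    ((l , r) ∷ L) eq = trans (cong (λ b → lend fH fL d (if b then l else nothing) L) (ListP.∷-injectiveˡ eq)) (le′ l L (ListP.∷-injectiveʳ eq))
    le (suc k) ((l , r) ∷ L) eq = trans (cong (λ b → lend fH fL d (if b then l else nothing) L) (ListP.∷-injectiveˡ eq)) (le k L (ListP.∷-injectiveʳ eq))

  done : Exit → Prog W
  done e = prim 𝟏 finite-𝟏 tt (λ _ b → inj₂ e , b , stay)

  runs-done : ∀ {n} e (st : Store n) o → Runs (done e) (tape st o) 1 e (tape st o)
  runs-done e st o with cellsOf st | cellsOf-cons st
  ... | .(c ∷ cs) | c , cs , refl = runs ℕ.≤-refl (stop refl)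

  runs-emitS : ∀ {n} s (st : Store n) o → Runs (emitSym s) (tape st o) (unitCost (sz st + length o)) nothing (tape st (o ++ [ s ]))
  runs-emitS s st o with cellsOf st | cellsOf-cons st | length-cellsOf st
  ... | .(c ∷ cs) | c , cs , refl | eq = runs-mono (ℕ.≤-reflexive (cong (λ m → unitCost (m + length o)) eq)) (runs-emit s c cs o)

-- do-blocks only name intermediate results.
infixl 1 _>>=_
_>>=_ : ∀ {A X : Set} → A → (A → X) → X
x >>= f = f x

-- The common meaning of the element loop and the list loop. Folds and output loops never exit
-- early, and searches have a trivial accumulator.
foldBrk : ∀ {A X : Set} → (A → X → Exit × A) → A → List X → Bool × A
foldBrk f a []       = false , a
foldBrk f a (x ∷ xs) with f a x
... | just b  , a′ = b , a′
... | nothing , a′ = foldBrk f a′ xs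

-- Compilation of the loop language

_◃_ : ∀ {d} → ℕ → (Fin d → ℕ) → Fin (suc d) → ℕ
(k ◃ τ) zero    = k
(k ◃ τ) (suc i) = τ i

infixr 5 _◃_

mutual
  -- The number of tracks from `t` on. Sums are taken where maxima would do, because the demand of a
  -- part is then obtained by the plain projections `fitˡ` and `fitʳ`.
  needS : ∀ {d} → SE d → ℕ
  needS (var i)     = 1
  needS (con b)     = 1
  needS (op f a b)  = 1 + (needS a + suc (needS b))
  needS (ite b a c) = needB b + (needS a + needS c)
  needS (foldE a b) = 2 + (needS a + (2 + needS b))
  needS (letS a b)  = 1 + (needS a + suc (needS b))

  needB : ∀ {d} → BE d → ℕ
  needB (some a)   = 1 + needS a
  needB (notB b)   = needB b
  needB (andB a b) = needB a + needB b
  needB (anyE s h) = 1 + (suc (needB s) + suc (needB h))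
  needB (anyL s h) = 3 + ((2 + needB s) + (2 + needB h))
  needB (letB a b) = needS a + suc (needB b)

needO : ∀ {d} → OP d → ℕ
needO nop         = 0
needO (emit s)    = 0
needO (p ⨟ q)     = needO p + needO q
needO (ifO b p q) = needB b + (needO p + needO q)
needO (forE p)    = 1 + suc (needO p)
needO (forL p)    = 3 + (2 + needO p)
needO (letO a p)  = needS a + suc (needO p)

loadCost : ℕ → ℕ
loadCost K = unitCost K + (unitCost K + K * (unitCost K + (unitCost K + (unitCost K + unitCost K))))

elemCost listCost : ℕ → ℕ → ℕ
elemCost K C = unitCost K + K * (C + (unitCost K + (unitCost K + 1)))
listCost K C = unitCost K + K * (unitCost K + ((loadCost K + (loadCost K + C)) + 1))

mutual
  -- The parameter `K` bounds the number of work cells together with all output of the program, so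
  -- that every single sweep costs at most `unitCost K`.
  costS : ∀ {d} → SE d → ℕ → ℕ
  costS (var i)     K = unitCost K
  costS (con b)     K = unitCost K
  costS (op f a b)  K = costS a K + (costS b K + unitCost K)
  costS (ite b a c) K = costB b K + (costS a K + costS c K)
  costS (foldE a b) K = costS a K + elemCost K (costS b K + unitCost K)
  costS (letS a b)  K = costS a K + (costS b K + unitCost K)

  costB : ∀ {d} → BE d → ℕ → ℕ
  costB (some a)   K = costS a K + unitCost K
  costB (notB b)   K = costB b K + 2
  costB (andB a b) K = costB a K + (costB b K + 1)
  costB (anyE s h) K = elemCost K (costB s K + (1 + (costB h K + 2)))
  costB (anyL s h) K = listCost K (costB s K + (1 + (costB h K + 2)))
  costB (letB a b) K = costS a K + costB b K

costO : ∀ {d} → OP d → ℕ → ℕ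
costO nop         K = 1
costO (emit s)    K = unitCost K
costO (p ⨟ q)     K = costO p K + costO q K
costO (ifO b p q) K = costB b K + (costO p K + costO q K)
costO (forE p)    K = elemCost K (costO p K) + 1
costO (forL p)    K = listCost K (costO p K) + 1
costO (letO a p)  K = costS a K + costO p K

module Compiler (S : ℕ) (ranked : Bool) where

  open Primitives S

  infixr 4 _⊳_
  _⊳_ : Prog W → Prog W → Prog W
  p ⊳ q = branch p (λ _ → q)

  choose : Prog W → Prog W → Exit → Prog W
  choose q r (just true)  = q
  choose q r (just false) = r
  choose q r nothing      = r

  test : Prog W → Prog W → Prog W → Prog W
  test p q r = branch p (choose q r)

  initE nextE initL nextL : ℕ → Prog W
  initE = shiftH false true
  nextE = shiftH true false
  initL = shiftL false true
  nextL = shiftL true false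

  elemRound : ℕ → Exit → Prog W
  elemRound t (just b) = done (just b)
  elemRound t nothing  = test (testH t) (nextE t) (done (just false))

  elemLoop : ℕ → Prog W → Prog W
  elemLoop t body = initE t ⊳ loop (branch body (elemRound t))

  loadRound : ℕ → ℕ → ℕ → Exit → Prog W
  loadRound X m p nothing      = nextL m ⊳ done (just true)
  loadRound X m p (just true)  = setH X (λ r → get X r ∨ get p r) ⊳ nextL m ⊳ nextE p
  loadRound X m p (just false) = nextL m ⊳ nextE p

  load : ℕ → ℕ → ℕ → Prog W
  load X m p = setH X (λ _ → false) ⊳ initE p ⊳ loop (branch (readL m) (loadRound X m p))

  loadRank : ℕ → Prog W
  loadRank t = if ranked then load (1 + t) t (2 + t) else setH (1 + t) (λ _ → false)

  -- The test precedes the body, since the list may be empty. Track `t` does double duty: its list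
  -- part carries the marker, its header part the set just loaded. The marker is advanced by `load`,
  -- which leaves it behind the block that it has read.
  listLoop : ℕ → Prog W → Prog W
  listLoop t body = initL t ⊳ loop (test (testL t) (load t t (2 + t) ⊳ loadRank t ⊳ body) (done (just false)))

  search : Prog W → Prog W → Prog W
  search s h = test s (done (just false)) (test h (done (just true)) (done nothing))

  -- Variable i lives on track τ i; the value is left on track t, and all tracks from t on are scratch space.
  mutual
    compS : ∀ {d} → SE d → (Fin d → ℕ) → ℕ → Prog W
    compS (var i)     τ t = setH t (get (τ i))
    compS (con b)     τ t = setH t (λ _ → b)
    compS (op f a b)  τ t = compS a τ t ⊳ compS b τ (1 + t) ⊳ setH t (λ r → f (get t r) (get (1 + t) r))
    compS (ite b a c) τ t = test (compB b τ t) (compS a τ t) (compS c τ t)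
    compS (foldE a b) τ t = compS a τ t ⊳ elemLoop (1 + t) (compS b (1 + t ◃ t ◃ τ) (2 + t) ⊳ setH t (get (2 + t)))
    compS (letS a b)  τ t = compS a τ t ⊳ compS b (t ◃ τ) (1 + t) ⊳ setH t (get (1 + t))

    compB : ∀ {d} → BE d → (Fin d → ℕ) → ℕ → Prog W
    compB (some a)   τ t = compS a τ t ⊳ testH t
    compB (notB b)   τ t = test (compB b τ t) (done (just false)) (done (just true))
    compB (andB a b) τ t = test (compB a τ t) (compB b τ t) (done (just false))
    compB (anyE s h) τ t = elemLoop t (search (compB s (t ◃ τ) (1 + t)) (compB h (t ◃ τ) (1 + t)))
    compB (anyL s h) τ t = listLoop t (search (compB s (1 + t ◃ t ◃ τ) (2 + t)) (compB h (1 + t ◃ t ◃ τ) (2 + t)))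
    compB (letB a b) τ t = compS a τ t ⊳ compB b (t ◃ τ) (1 + t)

  compO : ∀ {d} → OP d → (Fin d → ℕ) → ℕ → Prog W
  compO nop         τ t = done nothing
  compO (emit s)    τ t = emitSym s
  compO (p ⨟ q)     τ t = compO p τ t ⊳ compO q τ t
  compO (ifO b p q) τ t = test (compB b τ t) (compO p τ t) (compO q τ t)
  compO (forE p)    τ t = elemLoop t (compO p (t ◃ τ) (1 + t)) ⊳ done nothing
  compO (forL p)    τ t = listLoop t (compO p (1 + t ◃ t ◃ τ) (2 + t)) ⊳ done nothing
  compO (letO a p)  τ t = compS a τ t ⊳ compO p (t ◃ τ) (1 + t)

  record Frame {n} (t : ℕ) (st st′ : Store n) : Set where
    constructor frame
    field
      toks  : ltoks st′ ≡ ltoks st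
      below : ∀ j → j < t → Same j st st′
  open Frame

  frame-refl : ∀ {n t} {st : Store n} → Frame t st st
  frame-refl = frame refl (λ _ _ → refl , refl)

  frame-trans : ∀ {n t} {st₁ st₂ st₃ : Store n} → Frame t st₁ st₂ → Frame t st₂ st₃ → Frame t st₁ st₃
  frame-trans F G = frame (trans (toks G) (toks F)) λ j j<t →
    trans (proj₁ (below G j j<t)) (proj₁ (below F j j<t)) , trans (proj₂ (below G j j<t)) (proj₂ (below F j j<t))

  frame-mono : ∀ {n t t′} {st st′ : Store n} → t ≤ t′ → Frame t′ st st′ → Frame t st st′
  frame-mono t≤t′ F = frame (toks F) (λ j j<t → below F j (ℕ.<-≤-trans j<t t≤t′))

  frame-suc : ∀ {n t} {st st′ : Store n} → Frame (suc t) st st′ → Frame t st st′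
  frame-suc = frame-mono (ℕ.n≤1+n _)

  change-frame : ∀ {n d t h l} {st st′ : Store n} → t ≤ d → Change d st st′ h l → Frame t st st′
  change-frame t≤d c = frame (toks≡ c) (λ j j<t → others c j (ℕ.<⇒≢ (ℕ.<-≤-trans j<t t≤d)))

  change-lcol : ∀ {n d h} {st st′ : Store n} → Change d st st′ h (lcol d st) → ∀ j → lcol j st′ ≡ lcol j st
  change-lcol {d = d} c j with j ℕ.≟ d
  ... | yes refl = lcol≡ c
  ... | no  j≢d  = proj₂ (others c j j≢d)

  change-hcol : ∀ {n d l} {st st′ : Store n} → Change d st st′ (hcol d st) l → ∀ j → hcol j st′ ≡ hcol j st
  change-hcol {d = d} c j with j ℕ.≟ d
  ... | yes refl = hcol≡ c
  ... | no  j≢d  = proj₁ (others c j j≢d)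

  frame-keep : ∀ {n d t} {st st′ : Store n} → Change d st st′ (hcol d st) (lcol d st) → Frame t st st′
  frame-keep c = frame (toks≡ c) (λ j _ → change-hcol c j , change-lcol c j)

  sz-frame : ∀ {n t K} {st st′ : Store n} → Frame t st st′ → sz st ≤ K → sz st′ ≤ K
  sz-frame {n} F le = ℕ.≤-trans (ℕ.≤-reflexive (cong (λ ts → n + suc (length ts)) (toks F))) le

  within : ∀ {K m} {p : Prog W} {z e z′} → m ≤ K → Runs p z (unitCost m) e z′ → Runs p z (unitCost K) e z′
  within m≤K = runs-mono (ℕ.+-monoˡ-≤ 1 (ℕ.*-monoʳ-≤ 2 m≤K))

  fitˡ : ∀ {x y} t → t + (x + y) ≤ S → t + x ≤ S
  fitˡ t = ℕ.≤-trans (ℕ.+-monoʳ-≤ t (ℕ.m≤m+n _ _))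

  fitʳ : ∀ {y} t x → t + (x + y) ≤ S → t + y ≤ S
  fitʳ t x = ℕ.≤-trans (ℕ.+-monoʳ-≤ t (ℕ.m≤n+m _ x))

  fit-suc : ∀ {x} t → t + suc x ≤ S → suc t + x ≤ S
  fit-suc t = subst (_≤ S) (ℕ.+-suc t _)

  fit-1 : ∀ t → t + 1 ≤ S → t < S
  fit-1 t = subst (_≤ S) (ℕ.+-comm t 1)

  runs-⊳ : ∀ {p q : Prog W} {z t e z′ t′ e′ z″} → Runs p z t e z′ → Runs q z′ t′ e′ z″ → Runs (p ⊳ q) z (t + t′) e′ z″
  runs-⊳ = runs-branch

  runs-test : ∀ {p q r : Prog W} {z t} b {z′ t₁ t₂ e′ z″} → Runs p z t (just b) z′ → Runs (if b then q else r) z′ (if b then t₁ else t₂) e′ z″ →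
              Runs (test p q r) z (t + (t₁ + t₂)) e′ z″
  runs-test true  {t₁ = t₁} x y = runs-branch x (runs-mono (ℕ.m≤m+n t₁ _) y)
  runs-test false {t₁ = t₁} x y = runs-branch x (runs-mono (ℕ.m≤n+m _ t₁) y)

  module _ {n : ℕ} (K t : ℕ) (t<S : t < S) {A : Set} (f : A → Subset n → Exit × A)
           (Inv : List (Subset n) → A → Store n → Word → Set) (body : Prog W) (C : ℕ)
           (inv-sz : ∀ {xs a st o} → Inv xs a st o → sz st ≤ K)
           (inv-frame : ∀ {xs a st st′ o} → Frame t st st′ → Inv xs a st o → Inv xs a st′ o)
           (spec : ∀ {x xs a st o} → Inv (x ∷ xs) a st o → hcol t st ≡ x →
             Σ (Store n) λ st′ → Σ Word λ o′ → Runs body (tape st o) C (proj₁ (f a x)) (tape st′ o′)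
               × Inv xs (proj₂ (f a x)) st′ o′ × hcol t st′ ≡ x)
           where

    private
      tail = unitCost K + (unitCost K + 1)

      rounds : ∀ k r → k + r ≡ n → ∀ {a st o} → Inv (els k r) a st o → hcol t st ≡ hot k →
        Σ (List (Subset n)) λ xs → Σ (Store n) λ st′ → Σ Word λ o′ →
          Runs (loop (branch body (elemRound t))) (tape st o) (suc r * (C + tail)) (just (proj₁ (foldBrk f a (els k r)))) (tape st′ o′)
          × Inv xs (proj₂ (foldBrk f a (els k r))) st′ o′
      rounds k zero eq {a} {st} {o} I hx with spec I hx
      ... | st₁ , o₁ , r₁ , I₁ , hx₁ with f a (hot k)
      ... | just b , a′ = _ , st₁ , o₁ , runs-loop-stop (runs-mono (ℕ.≤-trans (ℕ.+-monoʳ-≤ C (ℕ.m≤n+m 1 (unitCost K + unitCost K)))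
              (ℕ.≤-reflexive (trans (cong (C +_) (ℕ.+-assoc (unitCost K) (unitCost K) 1)) (sym (ℕ.+-identityʳ _)))))
              (runs-branch r₁ (runs-done (just b) st₁ o₁))) , I₁
      ... | nothing , a′ =
        do
            st₂ , r₂ , c₂ ← step-testH t st₁ o₁ t<S
            let no-x = trans (cong anyV hx₁) (trans (cong (λ m → anyV (hot {m} k)) (sym eq)) (anyV-hot-≡ k))
            _ , st₂ , o₁ , runs-loop-stop (runs-mono (ℕ.≤-reflexive (sym (ℕ.+-identityʳ _))) (runs-branch r₁
                  (runs-test false (runs-cast refl (cong just no-x) refl (within (inv-sz I₁) r₂)) (runs-done (just false) st₂ o₁))))
                , inv-frame (frame-keep c₂) I₁
      rounds k (suc r) eq {a} {st} {o} I hx with spec I hx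
      ... | st₁ , o₁ , r₁ , I₁ , hx₁ with f a (hot k)
      ... | just b , a′ = _ , st₁ , o₁ , runs-loop-stop (runs-mono (ℕ.≤-trans (ℕ.+-monoʳ-≤ C (ℕ.m≤n+m 1 (unitCost K + unitCost K)))
              (ℕ.≤-trans (ℕ.≤-reflexive (cong (C +_) (ℕ.+-assoc (unitCost K) (unitCost K) 1))) (ℕ.m≤m+n _ _)))
              (runs-branch r₁ (runs-done (just b) st₁ o₁))) , I₁
      ... | nothing , a′ =
        do
            st₂ , r₂ , c₂ ← step-testH t st₁ o₁ t<S
            let I₂ = inv-frame (frame-keep c₂) I₁
            let some-x = trans (cong anyV hx₁) (trans (cong (λ m → anyV (hot {m} k)) (sym eq)) (anyV-hot-< k r))
            st₃ , r₃ , c₃ ← step-shiftH true t false st₂ o₁ t<S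
            let I₃ = inv-frame (change-frame ℕ.≤-refl c₃) I₂
            let hx₃ = trans (hcol≡ c₃) (trans (cong (shiftIn false) (trans (VecP.map-id _) (trans (hcol≡ c₂) hx₁))) (shiftIn-hot k))
            xs , st₄ , o₄ , r₄ , I₄ ← rounds (suc k) r (trans (sym (ℕ.+-suc k r)) eq) I₃ hx₃
            xs , st₄ , o₄ , runs-loop-next (runs-branch r₁ (runs-test true {t₂ = 1}
                  (runs-cast refl (cong just some-x) refl (within (inv-sz I₁) r₂)) (within (inv-sz I₂) r₃))) r₄ , I₄

    -- `Inv` is indexed by the elements still to come because `okO` has to reserve tape for their
    -- output. After an early exit some of them are left, hence the existential list in the
    -- conclusion.
    runs-elemLoop : ∀ {a st o} → Inv (elems n) a st o →
      Σ (List (Subset n)) λ xs → Σ (Store n) λ st′ → Σ Word λ o′ →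
        Runs (elemLoop t body) (tape st o) (elemCost K C) (just (proj₁ (foldBrk f a (elems n)))) (tape st′ o′)
        × Inv xs (proj₂ (foldBrk f a (elems n))) st′ o′
    runs-elemLoop {a} {st} {o} I =
      do
          st₁ , r₁ , c₁ ← step-shiftH false t true st o t<S
          let hx₁ = trans (hcol≡ c₁) (trans (cong (shiftIn true) (VecP.map-const _ false)) shiftIn-true-⊥)
          xs , st₂ , o₂ , r₂ , I₂ ← rounds 0 n refl (inv-frame (change-frame ℕ.≤-refl c₁) I) hx₁
          xs , st₂ , o₂ , runs-⊳ (within (inv-sz I) r₁) (runs-mono (ℕ.*-monoˡ-≤ (C + tail)
               (ℕ.≤-trans (ℕ.≤-trans (ℕ.≤-reflexive (ℕ.+-comm 1 n)) (ℕ.+-monoʳ-≤ n (s≤s z≤n))) (inv-sz I))) r₂) , I₂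

  record Marked {n} (m : ℕ) (st : Store n) (ts : Toks) : Set where
    constructor marked
    field
      pos  : ℕ
      lmark : lcol m st ≡ oneHot pos (length (ltoks st))
      rest : drop pos (ltoks st) ≡ ts
  open Marked

  marked-same : ∀ {n m ts} {st st′ : Store n} → ltoks st′ ≡ ltoks st → lcol m st′ ≡ lcol m st → Marked m st ts → Marked m st′ ts
  marked-same eq eq′ (marked k l r) = marked k (trans eq′ (trans l (cong (oneHot k ∘ length) (sym eq)))) (trans (cong (drop k) eq) r)

  marked-next : ∀ {n m ts h} {st st′ : Store n} → Marked m st ts →
    Change m st st′ h (shiftInL false (map (true ∧_) (lcol m st))) → Marked m st′ (drop 1 ts)
  marked-next {m = m} {ts} {st = st} {st′} (marked k l r) c = marked (suc k)
    (trans (lcol≡ c) (trans (cong (shiftInL false) (trans (ListP.map-id _) l)) (trans (shiftInL-oneHot k _) (cong (oneHot (suc k) ∘ length) (sym (toks≡ c))))))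
    (trans (cong (drop (suc k)) (toks≡ c)) (go ts r))
    where
    go : ∀ us → drop k (ltoks st) ≡ us → drop (suc k) (ltoks st) ≡ drop 1 us
    go []       eq = drop-suc-[] k (ltoks st) eq
    go (u ∷ us) eq = drop-suc k (ltoks st) eq

  record Loaded {n} (X m p : ℕ) (st st′ : Store n) (v : Subset n) (ts : Toks) : Set where
    constructor loaded
    field
      ltoks≡   : ltoks st′ ≡ ltoks st
      hcol-X   : hcol X st′ ≡ v
      hcol-oth : ∀ j → j ≢ X → j ≢ p → hcol j st′ ≡ hcol j st
      lcol-oth : ∀ j → j ≢ m → lcol j st′ ≡ lcol j st
      mark     : Marked m st′ ts
  open Loaded

  module _ {n : ℕ} (K X m p : ℕ) (X<S : X < S) (m<S : m < S) (p<S : p < S) (X≢p : X ≢ p) where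

    private
      u4 = unitCost K + (unitCost K + (unitCost K + unitCost K))

      advance : ∀ (st : Store n) o t ts v → sz st ≤ K → Marked m st (t ∷ ts) → hcol X st ≡ v →
        Σ (Store n) λ st′ → Runs (nextL m ⊳ nextE p) (tape st o) (unitCost K + unitCost K) nothing (tape st′ o)
          × Loaded X m p st st′ v ts × hcol p st′ ≡ shiftIn false (hcol p st)
      advance st o t ts v le mk hX =
        do
            st₁ , r₁ , c₁ ← step-shiftL true m false st o m<S
            st₂ , r₂ , c₂ ← step-shiftH true p false st₁ o p<S
            st₂ , runs-⊳ (within le r₁) (within (sz-frame {t = 0} (change-frame z≤n c₁) le) r₂)
              , loaded (trans (toks≡ c₂) (toks≡ c₁))
                  (trans (proj₁ (others c₂ X X≢p)) (trans (change-hcol c₁ X) hX))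
                  (λ j j≢X j≢p → trans (proj₁ (others c₂ j j≢p)) (change-hcol c₁ j))
                  (λ j j≢m → trans (change-lcol c₂ j) (proj₂ (others c₁ j j≢m)))
                  (marked-same (toks≡ c₂) (change-lcol c₂ m) (marked-next mk c₁))
              , trans (hcol≡ c₂) (cong (shiftIn false) (trans (VecP.map-id _) (change-hcol c₁ p)))

      chain : ∀ {st st₁ st₂ : Store n} {v₁ v₂ ts₁ ts₂} → Loaded X m p st st₁ v₁ ts₁ → Loaded X m p st₁ st₂ v₂ ts₂ → Loaded X m p st st₂ v₂ ts₂
      chain a b = loaded (trans (ltoks≡ b) (ltoks≡ a)) (hcol-X b)
        (λ j x y → trans (hcol-oth b j x y) (hcol-oth a j x y)) (λ j x → trans (lcol-oth b j x) (lcol-oth a j x)) (mark b)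

      keep-loaded : ∀ {st st₁ : Store n} {v ts} → Change m st st₁ (hcol m st) (lcol m st) → hcol X st ≡ v → Marked m st ts → Loaded X m p st st₁ v ts
      keep-loaded c hX mk = loaded (toks≡ c) (trans (change-hcol c X) hX) (λ j _ _ → change-hcol c j) (λ j _ → change-lcol c j)
        (marked-same (toks≡ c) (change-lcol c m) mk)

      read : ∀ (st : Store n) o ts → Marked m st ts → Step (readL m) m st o (firstTok ts) (hcol m st) (lcol m st)
      read st o ts mk = step-cast (cong firstTok (rest mk)) (step-readL m st o (pos mk) m<S (lmark mk))

      sz-loaded : ∀ {st st′ : Store n} {v ts} → Loaded X m p st st′ v ts → sz st ≤ K → sz st′ ≤ K
      sz-loaded l = ℕ.≤-trans (ℕ.≤-reflexive (cong (λ ts → n + suc (length ts)) (ltoks≡ l)))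

      map-or : ∀ {n} (H : Vec (Row S) n) → Vec.map (λ r → get X r ∨ get p r) H ≡ Vec.map (get X) H ∪ Vec.map (get p) H
      map-or []      = refl
      map-or (r ∷ H) = cong (_ ∷_) (map-or H)

      finish : ∀ (st : Store n) o ts v → sz st ≤ K → Marked m st ts → hcol X st ≡ v → firstTok ts ≡ nothing →
        Σ (Store n) λ st′ → Runs (loop (branch (readL m) (loadRound X m p))) (tape st o) u4 (just true) (tape st′ o)
          × Loaded X m p st st′ v (drop 1 ts)
      finish st o ts v le mk hX ft =
        do
            st₁ , r₁ , c₁ ← step-cast ft (read st o ts mk)
            let l₁ = keep-loaded c₁ hX mk
            st₂ , r₂ , c₂ ← step-shiftL true m false st₁ o m<S
            let l₂ = loaded (toks≡ c₂) (trans (change-hcol c₂ X) (hcol-X l₁)) (λ j _ _ → change-hcol c₂ j)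
                       (λ j j≢m → proj₂ (others c₂ j j≢m)) (marked-next (mark l₁) c₂)
            st₂ , runs-loop-stop (runs-branch (within le r₁) (runs-mono (ℕ.+-monoʳ-≤ (unitCost K) (ℕ.m≤n⇒m≤o+n (unitCost K) (ℕ.m≤n+m 1 (2 * K))))
                  (runs-⊳ (within (sz-loaded l₁ le) r₂) (runs-done (just true) st₂ o))))
              , chain l₁ l₂

      rounds : ∀ ts (st : Store n) o v → sz st ≤ K → Marked m st ts → hcol X st ≡ v →
        Σ (Store n) λ st′ → Runs (loop (branch (readL m) (loadRound X m p))) (tape st o) (suc (length ts) * u4) (just true) (tape st′ o)
          × Loaded X m p st st′ (loadBits v (hcol p st) (proj₁ (readBlock ts))) (proj₂ (readBlock ts))
      rounds [] st o v le mk hX =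
        let st′ , r , l = finish st o [] v le mk hX refl in st′ , runs-mono (ℕ.≤-reflexive (sym (ℕ.+-identityʳ u4))) r , l
      rounds (nothing ∷ ts) st o v le mk hX =
        let st′ , r , l = finish st o (nothing ∷ ts) v le mk hX refl in st′ , runs-mono (ℕ.m≤m+n u4 _) r , l
      rounds (just false ∷ ts) st o v le mk hX =
        do
            st₁ , r₁ , c₁ ← read st o _ mk
            let l₁ = keep-loaded c₁ hX mk
            st₂ , r₂ , l₂ , hp ← advance st₁ o _ ts v (sz-loaded l₁ le) (mark l₁) (hcol-X l₁)
            st₃ , r₃ , l₃ ← rounds ts st₂ o v (sz-loaded l₂ (sz-loaded l₁ le)) (mark l₂) (hcol-X l₂)
            st₃ , runs-loop-next (runs-branch (within le r₁) (runs-mono (ℕ.m≤n+m _ (unitCost K)) r₂)) r₃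
              , subst (λ q → Loaded X m p st st₃ (loadBits v q (proj₁ (readBlock ts))) _) (trans hp (cong (shiftIn false) (change-hcol c₁ p)))
                  (chain l₁ (chain l₂ l₃))
      rounds (just true ∷ ts) st o v le mk hX =
        do
            st₁ , r₁ , c₁ ← read st o _ mk
            let l₁ = keep-loaded c₁ hX mk
            st₂ , r₂ , c₂ ← step-setH X (λ r → get X r ∨ get p r) st₁ o X<S
            let hX₂ = trans (hcol≡ c₂) (trans (map-or (hs st₁)) (cong₂ _∪_ (hcol-X l₁) (change-hcol c₁ p)))
            let l₂ = loaded (toks≡ c₂) hX₂ (λ j j≢X _ → proj₁ (others c₂ j j≢X)) (λ j _ → change-lcol c₂ j)
                       (marked-same (toks≡ c₂) (change-lcol c₂ m) (mark l₁))
            let le₁ = sz-loaded l₁ le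
            let le₂ = sz-loaded l₂ le₁
            st₃ , r₃ , l₃ , hp ← advance st₂ o _ ts _ le₂ (mark l₂) hX₂
            st₄ , r₄ , l₄ ← rounds ts st₃ o _ (sz-loaded l₃ le₂) (mark l₃) (hcol-X l₃)
            let hp₃ = trans hp (cong (shiftIn false) (trans (proj₁ (others c₂ p (X≢p ∘ sym))) (change-hcol c₁ p)))
            st₄ , runs-loop-next (runs-branch (within le r₁) (runs-⊳ (within le₁ r₂) r₃)) r₄
              , subst (λ q → Loaded X m p st st₄ (loadBits (v ∪ hcol p st) q (proj₁ (readBlock ts))) _) hp₃
                  (chain l₁ (chain l₂ (chain l₃ l₄)))

    runs-load-block : ∀ ts (st : Store n) o → sz st ≤ K → suc (length ts) ≤ K → Marked m st ts →
      Σ (Store n) λ st′ → Σ Exit λ e → Runs (load X m p) (tape st o) (loadCost K) e (tape st′ o)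
        × Loaded X m p st st′ (loadSet (proj₁ (readBlock ts))) (proj₂ (readBlock ts))
    runs-load-block ts st o le len mk =
      do
          st₁ , r₁ , c₁ ← step-setH X (λ _ → false) st o X<S
          let hX₁ = trans (hcol≡ c₁) (VecP.map-const (hs st) false)
          let l₁ : Loaded X m p st st₁ ⊥ ts
              l₁ = loaded (toks≡ c₁) hX₁ (λ j j≢X _ → proj₁ (others c₁ j j≢X)) (λ j _ → change-lcol c₁ j)
                     (marked-same (toks≡ c₁) (change-lcol c₁ m) mk)
          let le₁ = sz-loaded l₁ le
          st₂ , r₂ , c₂ ← step-shiftH false p true st₁ o p<S
          let l₂ = loaded (toks≡ c₂) (trans (proj₁ (others c₂ X X≢p)) hX₁) (λ j _ j≢p → proj₁ (others c₂ j j≢p))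
                     (λ j _ → change-lcol c₂ j) (marked-same (toks≡ c₂) (change-lcol c₂ m) (mark l₁))
          let hp₂ = trans (hcol≡ c₂) (trans (cong (shiftIn true) (VecP.map-const _ false)) shiftIn-true-⊥)
          st₃ , r₃ , l₃ ← rounds ts st₂ o ⊥ (sz-loaded l₂ le₁) (mark l₂) (hcol-X l₂)
          st₃ , just true , runs-⊳ (within le r₁) (runs-⊳ (within le₁ r₂) (runs-mono (ℕ.*-monoˡ-≤ u4 len) r₃))
            , subst (λ q → Loaded X m p st st₃ (loadBits ⊥ q (proj₁ (readBlock ts))) _) hp₂ (chain l₁ (chain l₂ l₃))

-- Correctness of compiled programs

foldBrk-fold : ∀ {A X : Set} (g : A → X → A) a xs → foldBrk (λ a x → nothing , g a x) a xs ≡ (false , foldl g a xs)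
foldBrk-fold g a []       = refl
foldBrk-fold g a (x ∷ xs) = foldBrk-fold g (g a x) xs

foldl-++ : ∀ {X : Set} (g : X → Word) o xs → foldl (λ o x → o ++ g x) o xs ≡ o ++ concatMap g xs
foldl-++ g o []       = sym (ListP.++-identityʳ o)
foldl-++ g o (x ∷ xs) = trans (foldl-++ g (o ++ g x) xs) (ListP.++-assoc o (g x) (concatMap g xs))

found : Bool → Bool → Exit
found true  _     = just false
found false true  = just true
found false false = nothing

foldBrk-found : ∀ {X : Set} (s h : X → Bool) xs → foldBrk (λ _ x → found (s x) (h x) , tt) tt xs ≡ (anyUntil s h xs , tt)
foldBrk-found s h []       = refl
foldBrk-found s h (x ∷ xs) with s x | h x
... | true  | _     = refl
... | false | true  = refl
... | false | false = foldBrk-found s h xs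

module Correctness (S : ℕ) (ranked : Bool) where

  open Primitives S
  open Compiler S ranked
  open Compiler.Frame
  open Compiler.Marked
  open Compiler.Loaded

  loaded-frame : ∀ {n X m p t v ts} {st st′ : Store n} → t ≤ X → t ≤ m → t ≤ p → Loaded X m p st st′ v ts → Frame t st st′
  loaded-frame t≤X t≤m t≤p l = frame (ltoks≡ l) λ j j<t →
    hcol-oth l j (ℕ.<⇒≢ (ℕ.<-≤-trans j<t t≤X)) (ℕ.<⇒≢ (ℕ.<-≤-trans j<t t≤p)) , lcol-oth l j (ℕ.<⇒≢ (ℕ.<-≤-trans j<t t≤m))

  marked-length : ∀ {n m ts K} {st : Store n} → Marked m st ts → sz st ≤ K → suc (length ts) ≤ K
  marked-length {n} {ts = ts} {st = st} mk le = ℕ.≤-trans (s≤s (ℕ.≤-trans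
    (ℕ.≤-reflexive (trans (cong length (sym (rest mk))) (ListP.length-drop (pos mk) (ltoks st)))) (ℕ.m∸n≤m (length (ltoks st)) (pos mk))))
    (ℕ.≤-trans (ℕ.m≤n+m _ n) le)

  module _ {n : ℕ} (K t : ℕ) (t+3≤S : 3 + t ≤ S) {A : Set} (f : A → Subset n × Subset n → Exit × A)
           (Inv : List (Subset n × Subset n) → A → Store n → Word → Set) (body : Prog W) (C : ℕ)
           (inv-sz : ∀ {xs a st o} → Inv xs a st o → sz st ≤ K)
           (inv-frame : ∀ {xs a st st′ o} → Frame t st st′ → Inv xs a st o → Inv xs a st′ o)
           (spec : ∀ {x xs a st o} → Inv (x ∷ xs) a st o → hcol t st ≡ proj₁ x → hcol (1 + t) st ≡ proj₂ x →
             Σ (Store n) λ st′ → Σ Word λ o′ → Runs body (tape st o) C (proj₁ (f a x)) (tape st′ o′)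
               × Inv xs (proj₂ (f a x)) st′ o′ × lcol t st′ ≡ lcol t st × ltoks st′ ≡ ltoks st)
           where

    private
      t<S : t < S
      t<S = ℕ.≤-trans (ℕ.m≤n+m (suc t) 2) t+3≤S

      1+t<S : 1 + t < S
      1+t<S = ℕ.≤-trans (ℕ.n≤1+n _) t+3≤S

      runs-loadEntry : ∀ u ts (st : Store n) o → sz st ≤ K → Marked t st (u ∷ ts) →
        Σ (Store n) λ st′ → (∀ C e z → Runs body (tape st′ o) C e z →
            Runs (load t t (2 + t) ⊳ loadRank t ⊳ body) (tape st o) (loadCost K + (loadCost K + C)) e z)
          × Frame t st st′ × hcol t st′ ≡ proj₁ (proj₁ (readEntry ranked (u ∷ ts))) × hcol (1 + t) st′ ≡ proj₂ (proj₁ (readEntry ranked (u ∷ ts)))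
          × Marked t st′ (proj₂ (readEntry {n} ranked (u ∷ ts)))
      runs-loadEntry u ts st o le mk =
        do
            st₁ , e₁ , r₁ , l₁ ← runs-load-block K t t (2 + t) t<S t<S t+3≤S (ℕ.<⇒≢ (ℕ.m≤n+m (suc t) 1)) (u ∷ ts) st o le (marked-length mk le) mk
            let F₁ = loaded-frame {t = t} ℕ.≤-refl ℕ.≤-refl (ℕ.m≤n+m t 2) l₁
            st₂ , e₂ , r₂ , F₂ , X₂ , R₂ , mk₂ ← second ranked st₁ o (sz-frame F₁ le) (mark l₁) (hcol-X l₁)
            st₂ , (λ _ _ _ r → runs-⊳ r₁ (runs-⊳ r₂ r)) , frame-trans F₁ F₂ , X₂ , R₂ , mk₂
        where
        second : ∀ rk (st : Store n) o → sz st ≤ K → Marked t st (proj₂ (readBlock (u ∷ ts))) → hcol t st ≡ loadSet (proj₁ (readBlock (u ∷ ts))) →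
          Σ (Store n) λ st′ → Σ Exit λ e → Runs (if rk then load (1 + t) t (2 + t) else setH (1 + t) (λ _ → false)) (tape st o) (loadCost K) e (tape st′ o)
            × Frame t st st′ × hcol t st′ ≡ proj₁ (proj₁ (readEntry rk (u ∷ ts))) × hcol (1 + t) st′ ≡ proj₂ (proj₁ (readEntry rk (u ∷ ts)))
            × Marked t st′ (proj₂ (readEntry {n} rk (u ∷ ts)))
        second true st o le mk hX =
          do
              st₁ , e₁ , r₁ , l₁ ← runs-load-block K (1 + t) t (2 + t) 1+t<S t<S t+3≤S (ℕ.<⇒≢ (ℕ.n<1+n (suc t))) _ st o le (marked-length mk le) mk
              st₁ , e₁ , r₁ , loaded-frame (ℕ.n≤1+n t) ℕ.≤-refl (ℕ.m≤n+m t 2) l₁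
                , trans (hcol-oth l₁ t (ℕ.<⇒≢ (ℕ.n<1+n t)) (ℕ.<⇒≢ (ℕ.m≤n+m (suc t) 1))) hX , hcol-X l₁ , mark l₁
        second false st o le mk hX =
          do
              st₁ , r₁ , c₁ ← step-setH (1 + t) (λ _ → false) st o 1+t<S
              st₁ , nothing , runs-mono (ℕ.m≤m+n _ _) (within le r₁) , change-frame (ℕ.n≤1+n t) c₁
                , trans (proj₁ (others c₁ t (ℕ.<⇒≢ (ℕ.n<1+n t)))) hX , trans (hcol≡ c₁) (VecP.map-const (hs st) false)
                , marked-same (toks≡ c₁) (change-lcol c₁ t) mk

      round = unitCost K + ((loadCost K + (loadCost K + C)) + 1)

      prog = loop (test (testL t) (load t t (2 + t) ⊳ loadRank t ⊳ body) (done (just false)))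

      probe : ∀ ts (st : Store n) o → Marked t st ts → Step (testL t) t st o (just (nonempty ts)) (hcol t st) (lcol t st)
      probe ts st o mk = step-cast (cong just (trans (cong anyB (lmark mk)) (trans (anyB-oneHot (pos mk) (ltoks st)) (cong nonempty (rest mk)))))
        (step-testL t st o t<S)

      Result : List (Subset n × Subset n) → A → Store n → Word → ℕ → Set
      Result es a st o c = Σ (List (Subset n × Subset n)) λ xs → Σ (Store n) λ st′ → Σ Word λ o′ →
          Runs prog (tape st o) c (just (proj₁ (foldBrk f a es))) (tape st′ o′)
          × Inv xs (proj₂ (foldBrk f a es)) st′ o′

      finished : ∀ {a st o c} → Marked t st [] → Inv [] a st o → round ≤ c → Result [] a st o c
      finished {a} {st} {o} mk I le =
        do
            st₁ , r₁ , c₁ ← probe [] st o mk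
            [] , st₁ , o , runs-loop-stop (runs-mono le (runs-test false {t₂ = 1} (within (inv-sz I) r₁) (runs-done (just false) st₁ o)))
              , inv-frame (frame-keep c₁) I

      rounds : ∀ fuel ts {a st o} → length ts ≤ fuel → Marked t st ts → Inv (entries ranked fuel ts) a st o →
        Result (entries ranked fuel ts) a st o (suc fuel * round)
      rounds zero    []       le mk I = finished mk I (ℕ.≤-reflexive (sym (ℕ.+-identityʳ round)))
      rounds (suc g) []       le mk I = finished mk I (ℕ.m≤m+n round _)
      rounds (suc g) (u ∷ ts) {a} {st} {o} (s≤s le) mk I =
        do
            st₁ , r₁ , c₁ ← probe (u ∷ ts) st o mk
            let I₁ = inv-frame (frame-keep c₁) I
            st₂ , r₂ , F₂ , X₂ , R₂ , mk₂ ← runs-loadEntry u ts st₁ o (inv-sz I₁) (marked-same (toks≡ c₁) (lcol≡ c₁) mk)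
            st₃ , o₃ , r₃ , I₃ , l₃ , t₃ ← spec (inv-frame F₂ I₁) X₂ R₂
            continue r₁ (r₂ _ _ _ r₃) I₃ (marked-same t₃ l₃ mk₂)
        where
        continue : ∀ {st₁ st₃ o₃} → Runs (testL t) (tape st o) (unitCost (sz st)) (just true) (tape st₁ o) →
          Runs (load t t (2 + t) ⊳ loadRank t ⊳ body) (tape st₁ o) (loadCost K + (loadCost K + C)) (proj₁ (f a (proj₁ (readEntry ranked (u ∷ ts))))) (tape st₃ o₃) →
          Inv (entries ranked g (proj₂ (readEntry {n} ranked (u ∷ ts)))) (proj₂ (f a (proj₁ (readEntry ranked (u ∷ ts))))) st₃ o₃ →
          Marked t st₃ (proj₂ (readEntry {n} ranked (u ∷ ts))) →
          Result (entries ranked (suc g) (u ∷ ts)) a st o (suc (suc g) * round)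
        continue {st₁} {st₃} {o₃} r₁ r₂ I₃ mk₃ with f a (proj₁ (readEntry ranked (u ∷ ts)))
        ... | just b , a′ = _ , st₃ , o₃ , runs-loop-stop (runs-mono (ℕ.m≤m+n round _) (runs-test true {t₂ = 1} (within (inv-sz I) r₁) r₂)) , I₃
        ... | nothing , a′ =
          do
              xs , st₄ , o₄ , r₄ , I₄ ← rounds g (proj₂ (readEntry {n} ranked (u ∷ ts))) (ℕ.≤-trans (readEntry-< {n} ranked u ts) le) mk₃ I₃
              xs , st₄ , o₄ , runs-loop-next (runs-test true {t₂ = 1} (within (inv-sz I) r₁) r₂) r₄ , I₄

    runs-listLoop : ∀ {a st o} → let es = entries ranked (length (ltoks st)) (ltoks st) in Inv es a st o →
      Σ (List (Subset n × Subset n)) λ xs → Σ (Store n) λ st′ → Σ Word λ o′ →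
        Runs (listLoop t body) (tape st o) (listCost K C) (just (proj₁ (foldBrk f a es))) (tape st′ o′)
        × Inv xs (proj₂ (foldBrk f a es)) st′ o′
    runs-listLoop {a} {st} {o} I =
      do
          st₁ , r₁ , c₁ ← step-shiftL false t true st o t<S
          let mk = marked {st = st₁} 0 (trans (lcol≡ c₁) (trans (cong (shiftInL true) (falses (ls st)))
                     (trans (shiftInL-true _) (cong (oneHot 0 ∘ length) (sym (toks≡ c₁)))))) (toks≡ c₁)
          xs , st₂ , o₂ , r₂ , I₂ ← rounds (length (ltoks st)) (ltoks st) ℕ.≤-refl mk (inv-frame (change-frame ℕ.≤-refl c₁) I)
          xs , st₂ , o₂ , runs-⊳ (within (inv-sz I) r₁) (runs-mono (ℕ.*-monoˡ-≤ round (ℕ.≤-trans (ℕ.m≤n+m _ n) (inv-sz I))) r₂) , I₂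
      where
      falses : ∀ L → map (false ∧_) (map (λ c → get t (proj₂ c)) L) ≡ replicate (length (map proj₁ L)) false
      falses []      = refl
      falses (c ∷ L) = cong (false ∷_) (falses L)

  module Main {n : ℕ} (ts : Toks) (K : ℕ) (size≤K : n + suc (length ts) ≤ K) where

    Es : List (Subset n × Subset n)
    Es = entries ranked (length ts) ts

    open Semantics Es

    record Good {d} (τ : Fin d → ℕ) (t : ℕ) (ρ : Vec (Subset n) d) (st : Store n) : Set where
      constructor good
      field
        gtoks : ltoks st ≡ ts
        low   : ∀ i → τ i < t
        vals  : ∀ i → hcol (τ i) st ≡ lookup ρ i
    open Good

    good-frame : ∀ {d τ t ρ} {st st′ : Store n} → Frame t st st′ → Good {d} τ t ρ st → Good τ t ρ st′
    good-frame F g = good (trans (toks F) (gtoks g)) (low g) (λ i → trans (proj₁ (below F _ (low g i))) (vals g i))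

    good-ext : ∀ {d τ t ρ v} {st : Store n} → Good {d} τ t ρ st → hcol t st ≡ v → Good (t ◃ τ) (1 + t) (v ∷ ρ) st
    good-ext g eq = good (gtoks g) (λ { zero → ℕ.≤-refl ; (suc i) → ℕ.m≤n⇒m≤1+n (low g i) }) (λ { zero → eq ; (suc i) → vals g i })

    good-weak : ∀ {d τ t ρ} {st : Store n} → Good {d} τ t ρ st → Good τ (1 + t) ρ st
    good-weak g = good (gtoks g) (λ i → ℕ.m≤n⇒m≤1+n (low g i)) (vals g)

    good-sz : ∀ {d τ t ρ} {st : Store n} → Good {d} τ t ρ st → sz st ≤ K
    good-sz g = ℕ.≤-trans (ℕ.≤-reflexive (cong (λ us → n + suc (length us)) (gtoks g))) size≤K

    record ResS (p : Prog W) (t c : ℕ) (st : Store n) (o : Word) (v : Subset n) : Set where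
      constructor resS
      field
        {st′}  : Store n
        {ex}   : Exit
        runS   : Runs p (tape st o) c ex (tape st′ o)
        frameS : Frame t st st′
        valS   : hcol t st′ ≡ v

    record ResO (p : Prog W) (t c : ℕ) (st : Store n) (o : Word) (e : Exit) (o′ : Word) : Set where
      constructor resO
      field
        {st′}  : Store n
        runO   : Runs p (tape st o) c e (tape st′ o′)
        frameO : Frame t st st′

    map-zip : ∀ {m} (f : Bool → Bool → Bool) i j (H : Vec (Row S) m) →
      Vec.map (λ r → f (get i r) (get j r)) H ≡ Vec.zipWith f (Vec.map (get i) H) (Vec.map (get j) H)
    map-zip f i j []      = refl
    map-zip f i j (r ∷ H) = cong (_ ∷_) (map-zip f i j H)

    search-ok : ∀ {ps ph t cs ch} {st : Store n} {o} bs bh → ResO ps t cs st o (just bs) o →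
      (∀ {st′} → Frame t st st′ → ResO ph t ch st′ o (just bh) o) → ResO (search ps ph) t (cs + (1 + (ch + 2))) st o (found bs bh) o
    search-ok {o = o} true bh (resO {st₁} r F) k = resO (runs-test true r (runs-done (just false) st₁ o)) F
    search-ok {ch = ch} {o = o} false bh (resO r F) k with k F
    search-ok {ch = ch} {o = o} false true (resO r F) k | resO {st₁} r′ F′ = resO
      (runs-test false {t₁ = 1} {t₂ = ch + 2} r (runs-test true {t₁ = 1} {t₂ = 1} r′ (runs-done (just true) st₁ o))) (frame-trans F F′)
    search-ok {ch = ch} {o = o} false false (resO r F) k | resO {st₁} r′ F′ = resO
      (runs-test false {t₁ = 1} {t₂ = ch + 2} r (runs-test false {t₁ = 1} {t₂ = 1} r′ (runs-done nothing st₁ o))) (frame-trans F F′)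

    mutual
      okS : ∀ {d} (e : SE d) τ t ρ (st : Store n) o → Good τ t ρ st → t + needS e ≤ S →
        ResS (compS e τ t) t (costS e K) st o (⟦ e ⟧S ρ)
      okS (var i) τ t ρ st o g fit =
        do
            st₁ , r₁ , c₁ ← step-setH t (get (τ i)) st o (fit-1 t fit)
            resS (within (good-sz g) r₁) (change-frame ℕ.≤-refl c₁) (trans (hcol≡ c₁) (vals g i))
      okS (con b) τ t ρ st o g fit =
        do
            st₁ , r₁ , c₁ ← step-setH t (λ _ → b) st o (fit-1 t fit)
            resS (within (good-sz g) r₁) (change-frame ℕ.≤-refl c₁) (trans (hcol≡ c₁) (VecP.map-const (hs st) b))
      okS (op f a b) τ t ρ st o g fit =
        do
            resS {st₁} r₁ F₁ v₁ ← okS a τ t ρ st o g (fitˡ t (fitʳ t 1 fit))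
            let g₁ = good-frame F₁ g
            resS {st₂} r₂ F₂ v₂ ← okS b τ (1 + t) ρ st₁ o (good-weak g₁) (fit-suc t (fitʳ t (needS a) (fitʳ t 1 fit)))
            let g₂ = good-frame (frame-suc F₂) g₁
            st₃ , r₃ , c₃ ← step-setH t (λ r → f (get t r) (get (1 + t) r)) st₂ o (fit-1 t (fitˡ t fit))
            resS (runs-⊳ r₁ (runs-⊳ r₂ (within (good-sz g₂) r₃)))
                 (frame-trans F₁ (frame-trans (frame-suc F₂) (change-frame ℕ.≤-refl c₃)))
                 (trans (hcol≡ c₃) (trans (map-zip f t (1 + t) (hs st₂))
                   (cong₂ (Vec.zipWith f) (trans (proj₁ (below F₂ t ℕ.≤-refl)) v₁) v₂)))
      okS (ite b x y) τ t ρ st o g fit =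
        do
            resO {st₁} r₁ F₁ ← okB b τ t ρ st o g (fitˡ t fit)
            let g₁ = good-frame F₁ g
            pick (⟦ b ⟧B ρ) r₁ F₁ (okS x τ t ρ st₁ o g₁ (fitˡ t (fitʳ t (needB b) fit)))
                 (okS y τ t ρ st₁ o g₁ (fitʳ t (needS x) (fitʳ t (needB b) fit)))
        where
        pick : ∀ c {st₁} → Runs (compB b τ t) (tape st o) (costB b K) (just c) (tape st₁ o) → Frame t st st₁ →
          ResS (compS x τ t) t (costS x K) st₁ o (⟦ x ⟧S ρ) → ResS (compS y τ t) t (costS y K) st₁ o (⟦ y ⟧S ρ) →
          ResS (test (compB b τ t) (compS x τ t) (compS y τ t)) t (costB b K + (costS x K + costS y K)) st o (if c then ⟦ x ⟧S ρ else ⟦ y ⟧S ρ)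
        pick true  r F (resS rx Fx vx) _ = resS (runs-test true r rx) (frame-trans F Fx) vx
        pick false r F _ (resS ry Fy vy) = resS (runs-test false r ry) (frame-trans F Fy) vy
      okS (foldE a b) τ t ρ st o g fit =
        do
            resS {st₁} r₁ F₁ v₁ ← okS a τ t ρ st o g (fitˡ t (fitʳ t 2 fit))
            xs , st₂ , o₂ , r₂ , (F₂ , v₂ , eq₂) ← runs-elemLoop K (1 + t) (fit-1 (1 + t) (fit-suc t (fitˡ t fit)))
              (λ acc x → nothing , ⟦ b ⟧S (x ∷ acc ∷ ρ))
              (λ _ acc st′ o′ → Frame t st st′ × hcol t st′ ≡ acc × o′ ≡ o)
              _ (costS b K + unitCost K)
              (λ (F , _) → sz-frame F (good-sz g))
              (λ F (F′ , v , eq) → frame-trans F′ (frame-suc F) , trans (proj₁ (below F t ℕ.≤-refl)) v , eq)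
              (λ { {x} {xs} {acc} {st′} (F , v , refl) hx →
                let resS {st₃} r₃ F₃ v₃ = okS b (1 + t ◃ t ◃ τ) (2 + t) (x ∷ acc ∷ ρ) st′ o (good-ext (good-ext (good-frame F g) v) hx)
                                           (fit-suc (1 + t) (fit-suc t (fitʳ t (needS a) (fitʳ t 2 fit))))
                    st₄ , r₄ , c₄ = step-setH t (get (2 + t)) st₃ o (fit-1 t (fitˡ {1} t fit))
                in st₄ , o , runs-⊳ r₃ (within (sz-frame F₃ (sz-frame F (good-sz g))) r₄)
                  , (frame-trans F (frame-trans (frame-suc (frame-suc F₃)) (change-frame ℕ.≤-refl c₄)) , trans (hcol≡ c₄) v₃ , refl)
                  , trans (proj₁ (others c₄ (1 + t) (ℕ.1+n≢n))) (trans (proj₁ (below F₃ (1 + t) ℕ.≤-refl)) hx) })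
              {st = st₁} {o = o} (F₁ , v₁ , refl)
            resS (runs-⊳ r₁ (runs-cast refl refl (cong (tape st₂) eq₂) r₂)) F₂ (trans v₂ (cong proj₂ (foldBrk-fold (λ acc x → ⟦ b ⟧S (x ∷ acc ∷ ρ)) (⟦ a ⟧S ρ) (elems n))))
      okS (letS a b) τ t ρ st o g fit =
        do
            resS {st₁} r₁ F₁ v₁ ← okS a τ t ρ st o g (fitˡ t (fitʳ t 1 fit))
            let g₁ = good-frame F₁ g
            resS {st₂} r₂ F₂ v₂ ← okS b (t ◃ τ) (1 + t) _ st₁ o (good-ext g₁ v₁) (fit-suc t (fitʳ t (needS a) (fitʳ t 1 fit)))
            let g₂ = good-frame (frame-suc F₂) g₁
            st₃ , r₃ , c₃ ← step-setH t (get (1 + t)) st₂ o (fit-1 t (fitˡ t fit))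
            resS (runs-⊳ r₁ (runs-⊳ r₂ (within (good-sz g₂) r₃)))
                 (frame-trans F₁ (frame-trans (frame-suc F₂) (change-frame ℕ.≤-refl c₃))) (trans (hcol≡ c₃) v₂)

      okB : ∀ {d} (b : BE d) τ t ρ (st : Store n) o → Good τ t ρ st → t + needB b ≤ S →
        ResO (compB b τ t) t (costB b K) st o (just (⟦ b ⟧B ρ)) o
      okB (some a) τ t ρ st o g fit =
        do
            resS {st₁} r₁ F₁ v₁ ← okS a τ t ρ st o g (fitʳ t 1 fit)
            st₂ , r₂ , c₂ ← step-testH t st₁ o (fit-1 t (fitˡ t fit))
            resO (runs-cast refl (cong (just ∘ anyV) v₁) refl (runs-⊳ r₁ (within (good-sz (good-frame F₁ g)) r₂)))
                 (frame-trans F₁ (change-frame ℕ.≤-refl c₂))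
      okB (notB b) τ t ρ st o g fit with okB b τ t ρ st o g fit
      ... | resO {st₁} r F with ⟦ b ⟧B ρ
      ... | true  = resO (runs-test true {t₂ = 1} r (runs-done (just false) st₁ o)) F
      ... | false = resO (runs-test false {t₁ = 1} r (runs-done (just true) st₁ o)) F
      okB (andB a b) τ t ρ st o g fit with okB a τ t ρ st o g (fitˡ t fit)
      ... | resO {st₁} r F with okB b τ t ρ st₁ o (good-frame F g) (fitʳ t (needB a) fit) | ⟦ a ⟧B ρ
      ... | resO r′ F′ | true  = resO (runs-test true r r′) (frame-trans F F′)
      ... | resO r′ F′ | false = resO (runs-test false r (runs-done (just false) st₁ o)) F
      okB (anyE s h) τ t ρ st o g fit =
        do
            xs , st₂ , o₂ , r₂ , (F₂ , eq₂) ← runs-elemLoop K t (fit-1 t (fitˡ t fit))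
              (λ _ x → found (⟦ s ⟧B (x ∷ ρ)) (⟦ h ⟧B (x ∷ ρ)) , tt)
              (λ _ _ st′ o′ → Frame t st st′ × o′ ≡ o)
              _ (costB s K + (1 + (costB h K + 2)))
              (λ (F , _) → sz-frame F (good-sz g))
              (λ F (F′ , eq) → frame-trans F′ F , eq)
              (λ { {x} {xs} {_} {st′} (F , refl) hx →
                let resO {st₃} r₃ F₃ = search-ok (⟦ s ⟧B (x ∷ ρ)) (⟦ h ⟧B (x ∷ ρ))
                      (okB s (t ◃ τ) (1 + t) (x ∷ ρ) st′ o (good-ext (good-frame F g) hx) (fit-suc t (fitˡ t (fitʳ t 1 fit))))
                      (λ F′ → okB h (t ◃ τ) (1 + t) (x ∷ ρ) _ o (good-frame F′ (good-ext (good-frame F g) hx)) (fit-suc t (fitʳ t (suc (needB s)) (fitʳ t 1 fit))))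
                in st₃ , o , r₃ , (frame-trans F (frame-suc F₃) , refl) , trans (proj₁ (below F₃ t ℕ.≤-refl)) hx })
              {st = st} {o = o} (frame-refl , refl)
            resO (runs-cast refl (cong (just ∘ proj₁) (foldBrk-found _ _ (elems n))) (cong (tape st₂) eq₂) r₂) F₂
      okB (anyL s h) τ t ρ st o g@(good refl _ _) fit =
        do
            xs , st₂ , o₂ , r₂ , (F₂ , eq₂) ← runs-listLoop K t (subst (_≤ S) (ℕ.+-comm t 3) (fitˡ t fit))
              (λ _ (X , R) → found (⟦ s ⟧B (R ∷ X ∷ ρ)) (⟦ h ⟧B (R ∷ X ∷ ρ)) , tt)
              (λ _ _ st′ o′ → Frame t st st′ × o′ ≡ o)
              _ (costB s K + (1 + (costB h K + 2)))
              (λ (F , _) → sz-frame F (good-sz g))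
              (λ F (F′ , eq) → frame-trans F′ F , eq)
              (λ { {X , R} {xs} {_} {st′} (F , refl) hX hR →
                let g′ = good-ext (good-ext (good-frame F g) hX) hR
                    resO {st₃} r₃ F₃ = search-ok (⟦ s ⟧B (R ∷ X ∷ ρ)) (⟦ h ⟧B (R ∷ X ∷ ρ))
                      (okB s (1 + t ◃ t ◃ τ) (2 + t) (R ∷ X ∷ ρ) st′ o g′ (fit-suc (1 + t) (fit-suc t (fitˡ t (fitʳ t 3 fit)))))
                      (λ F′ → okB h (1 + t ◃ t ◃ τ) (2 + t) (R ∷ X ∷ ρ) _ o (good-frame F′ g′) (fit-suc (1 + t) (fit-suc t (fitʳ t (2 + needB s) (fitʳ t 3 fit)))))
                in st₃ , o , r₃ , (frame-trans F (frame-suc (frame-suc F₃)) , refl) , proj₂ (below F₃ t (ℕ.n≤1+n _)) , toks F₃ })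
              {st = st} {o = o} (frame-refl , refl)
            resO (runs-cast refl (cong (just ∘ proj₁) (foldBrk-found _ _ Es)) (cong (tape st₂) eq₂) r₂) F₂
      okB (letB a b) τ t ρ st o g fit =
        do
            resS {st₁} r₁ F₁ v₁ ← okS a τ t ρ st o g (fitˡ t fit)
            resO r₂ F₂ ← okB b (t ◃ τ) (1 + t) _ st₁ o (good-ext (good-frame F₁ g) v₁) (fit-suc t (fitʳ t (needS a) fit))
            resO (runs-⊳ r₁ r₂) (frame-trans F₁ (frame-suc F₂))

    room : ∀ a b c k → a + (b + c) ≤ k → a + b ≤ k
    room a b c k = ℕ.≤-trans (ℕ.+-monoʳ-≤ a (ℕ.m≤m+n b c))

    split : ∀ {X : Set} (p : ℕ) (o w v : List X) {k} → p + (length o + length (w ++ v)) ≤ k →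
      p + (length o + length w) ≤ k × p + (length (o ++ w) + length v) ≤ k
    split p o w v le =
      let le′ = ℕ.≤-trans (ℕ.≤-reflexive (cong (λ m → p + m) (trans (cong (_+ length v) (ListP.length-++ o))
                 (trans (ℕ.+-assoc (length o) _ _) (cong (length o +_) (sym (ListP.length-++ w))))))) le
      in room p _ (length v) _ (ℕ.≤-trans (ℕ.≤-reflexive (cong (λ m → p + (m + length v)) (sym (ListP.length-++ o)))) le′) , le′

    N : ℕ
    N = n + suc (length ts)

    -- The last hypothesis reserves room for the entire output of `p` in advance. It splits along
    -- concatenation, so one and the same `K` serves all subprograms although the tape grows.
    okO : ∀ {d} (p : OP d) τ t ρ (st : Store n) o → Good τ t ρ st → t + needO p ≤ S →
      N + (length o + length (⟦ p ⟧O ρ)) ≤ K → ResO (compO p τ t) t (costO p K) st o nothing (o ++ ⟦ p ⟧O ρ)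
    okO nop τ t ρ st o g fit le = resO (runs-cast refl refl (cong (tape st) (sym (ListP.++-identityʳ o))) (runs-done nothing st o)) frame-refl
    okO (emit s) τ t ρ st o g fit le = resO (within (ℕ.≤-trans (ℕ.≤-reflexive (cong (λ us → n + suc (length us) + length o) (gtoks g))) (room N (length o) 1 K le))
      (runs-emitS s st o)) frame-refl
    okO (p ⨟ q) τ t ρ st o g fit le =
      do
          le₁ , le₂ ← split N o (⟦ p ⟧O ρ) (⟦ q ⟧O ρ) le
          resO {st₁} r₁ F₁ ← okO p τ t ρ st o g (fitˡ t fit) le₁
          resO {st₂} r₂ F₂ ← okO q τ t ρ st₁ _ (good-frame F₁ g) (fitʳ t (needO p) fit) le₂
          resO (runs-cast refl refl (cong (tape st₂) (ListP.++-assoc o _ _)) (runs-⊳ r₁ r₂)) (frame-trans F₁ F₂)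
    okO (ifO b p q) τ t ρ st o g fit le with okB b τ t ρ st o g (fitˡ t fit)
    ... | resO {st₁} r F with ⟦ b ⟧B ρ
    ... | true  = let resO r′ F′ = okO p τ t ρ st₁ o (good-frame F g) (fitˡ t (fitʳ t (needB b) fit)) le
                  in resO (runs-test true r r′) (frame-trans F F′)
    ... | false = let resO r′ F′ = okO q τ t ρ st₁ o (good-frame F g) (fitʳ t (needO p) (fitʳ t (needB b) fit)) le
                  in resO (runs-test false r r′) (frame-trans F F′)
    okO (forE p) τ t ρ st o g fit le =
      do
          let out = λ x → ⟦ p ⟧O (x ∷ ρ)
          xs , st₂ , o₂ , r₂ , (F₂ , eq₂ , _) ← runs-elemLoop K t (fit-1 t (fitˡ t fit))
            (λ acc x → nothing , acc ++ out x)
            (λ xs acc st′ o′ → Frame t st st′ × o′ ≡ acc × N + (length acc + length (concatMap out xs)) ≤ K)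
            _ (costO p K)
            (λ (F , _) → sz-frame F (good-sz g))
            (λ F (F′ , eq) → frame-trans F′ F , eq)
            (λ { {x} {xs} {acc} {st′} (F , refl , le) hx →
              let le₁ , le₂ = split N acc (out x) (concatMap out xs) le
                  resO {st₃} r₃ F₃ = okO p (t ◃ τ) (1 + t) (x ∷ ρ) st′ acc (good-ext (good-frame F g) hx) (fit-suc t (fitʳ t 1 fit)) le₁
              in st₃ , acc ++ out x , r₃ , (frame-trans F (frame-suc F₃) , refl , le₂) , trans (proj₁ (below F₃ t ℕ.≤-refl)) hx })
            {a = o} {st = st} {o = o} (frame-refl , refl , le)
          let eq = trans eq₂ (trans (cong proj₂ (foldBrk-fold (λ acc x → acc ++ out x) o (elems n))) (foldl-++ out o (elems n)))
          resO (runs-⊳ (runs-cast refl refl (cong (tape st₂) eq) r₂) (runs-done nothing st₂ (o ++ concatMap out (elems n)))) F₂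
    okO (forL p) τ t ρ st o g@(good refl _ _) fit le =
      do
          let out = λ (X , R) → ⟦ p ⟧O (R ∷ X ∷ ρ)
          xs , st₂ , o₂ , r₂ , (F₂ , eq₂ , _) ← runs-listLoop K t (subst (_≤ S) (ℕ.+-comm t 3) (fitˡ t fit))
            (λ acc x → nothing , acc ++ out x)
            (λ xs acc st′ o′ → Frame t st st′ × o′ ≡ acc × N + (length acc + length (concatMap out xs)) ≤ K)
            _ (costO p K)
            (λ (F , _) → sz-frame F (good-sz g))
            (λ F (F′ , eq) → frame-trans F′ F , eq)
            (λ { {X , R} {xs} {acc} {st′} (F , refl , le) hX hR →
              let le₁ , le₂ = split N acc (out (X , R)) (concatMap out xs) le
                  resO {st₃} r₃ F₃ = okO p (1 + t ◃ t ◃ τ) (2 + t) (R ∷ X ∷ ρ) st′ acc (good-ext (good-ext (good-frame F g) hX) hR)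
                                       (fit-suc (1 + t) (fit-suc t (fitʳ t 3 fit))) le₁
              in st₃ , acc ++ out (X , R) , r₃ , (frame-trans F (frame-suc (frame-suc F₃)) , refl , le₂) , proj₂ (below F₃ t (ℕ.n≤1+n _)) , toks F₃ })
            {a = o} {st = st} {o = o} (frame-refl , refl , le)
          let eq = trans eq₂ (trans (cong proj₂ (foldBrk-fold (λ acc x → acc ++ out x) o Es)) (foldl-++ out o Es))
          resO (runs-⊳ (runs-cast refl refl (cong (tape st₂) eq) r₂) (runs-done nothing st₂ (o ++ concatMap out Es))) F₂
    okO (letO a p) τ t ρ st o g fit le =
      do
          resS {st₁} r₁ F₁ v₁ ← okS a τ t ρ st o g (fitˡ t fit)
          resO r₂ F₂ ← okO p (t ◃ τ) (1 + t) _ st₁ o (good-ext (good-frame F₁ g) v₁) (fit-suc t (fitʳ t (needS a) fit)) le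
          resO (runs-⊳ r₁ r₂) (frame-trans F₁ (frame-suc F₂))

-- Polynomial running time

-- The base `suc n` is positive also at `n = 0`, so powers increase with the exponent and bounds of
-- different degrees can be compared without case distinctions.
record IsPoly (f : ℕ → ℕ) : Set where
  constructor poly
  field
    coeff  : ℕ
    degree : ℕ
    below  : ∀ n → f n ≤ coeff * suc n ^ degree

^-mono-exp : ∀ n {d d′} → d ≤ d′ → suc n ^ d ≤ suc n ^ d′
^-mono-exp n = ℕ.^-monoʳ-≤ (suc n)

poly-const : ∀ k → IsPoly (λ _ → k)
poly-const k = poly k 0 (λ n → ℕ.≤-reflexive (sym (ℕ.*-identityʳ k)))

poly-id : IsPoly id
poly-id = poly 1 1 (λ n → ℕ.≤-trans (ℕ.n≤1+n n) (ℕ.≤-reflexive (trans (sym (ℕ.*-identityʳ (suc n))) (sym (ℕ.+-identityʳ (suc n * 1))))))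

poly-+ : ∀ {f g} → IsPoly f → IsPoly g → IsPoly (λ n → f n + g n)
poly-+ (poly c d b) (poly c′ d′ b′) = poly (c + c′) (d + d′) λ n → ℕ.≤-trans
  (ℕ.+-mono-≤ (ℕ.≤-trans (b n) (ℕ.*-monoʳ-≤ c (^-mono-exp n (ℕ.m≤m+n d d′))))
              (ℕ.≤-trans (b′ n) (ℕ.*-monoʳ-≤ c′ (^-mono-exp n (ℕ.m≤n+m d′ d)))))
  (ℕ.≤-reflexive (sym (ℕ.*-distribʳ-+ (suc n ^ (d + d′)) c c′)))

poly-* : ∀ {f g} → IsPoly f → IsPoly g → IsPoly (λ n → f n * g n)
poly-* (poly c d b) (poly c′ d′ b′) = poly (c * c′) (d + d′) λ n → ℕ.≤-trans (ℕ.*-mono-≤ (b n) (b′ n))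
  (ℕ.≤-reflexive (trans (swap c (suc n ^ d) c′ (suc n ^ d′)) (cong (c * c′ *_) (sym (ℕ.^-distribˡ-+-* (suc n) d d′)))))
  where
  swap : ∀ x y z w → x * y * (z * w) ≡ x * z * (y * w)
  swap = solve-∀

^-distribʳ-* : ∀ d a b → (a * b) ^ d ≡ a ^ d * b ^ d
^-distribʳ-* zero    a b = refl
^-distribʳ-* (suc d) a b = trans (cong (a * b *_) (^-distribʳ-* d a b)) (swap a b (a ^ d) (b ^ d))
  where
  swap : ∀ x y z w → x * y * (z * w) ≡ x * z * (y * w)
  swap = solve-∀

poly-∘ : ∀ {f g} → IsPoly f → IsPoly g → IsPoly (λ n → f (g n))
poly-∘ {f} {g} (poly c d b) (poly c′ d′ b′) = poly (c * suc c′ ^ d) (d′ * d) λ n → begin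
  f (g n)                                    ≤⟨ b (g n) ⟩
  c * suc (g n) ^ d                          ≤⟨ ℕ.*-monoʳ-≤ c (ℕ.^-monoˡ-≤ d (s≤s (b′ n))) ⟩
  c * suc (c′ * suc n ^ d′) ^ d              ≤⟨ ℕ.*-monoʳ-≤ c (ℕ.^-monoˡ-≤ d (ℕ.+-monoˡ-≤ (c′ * suc n ^ d′) (ℕ.m^n>0 (suc n) d′))) ⟩
  c * (suc c′ * suc n ^ d′) ^ d              ≡⟨ cong (c *_) (^-distribʳ-* d (suc c′) (suc n ^ d′)) ⟩
  c * (suc c′ ^ d * (suc n ^ d′) ^ d)        ≡⟨ sym (ℕ.*-assoc c (suc c′ ^ d) _) ⟩
  c * suc c′ ^ d * (suc n ^ d′) ^ d          ≡⟨ cong (c * suc c′ ^ d *_) (ℕ.^-*-assoc (suc n) d′ d) ⟩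
  c * suc c′ ^ d * suc n ^ (d′ * d)          ∎
  where open ℕ.≤-Reasoning

poly-unit : IsPoly unitCost
poly-unit = poly-+ (poly-* (poly-const 2) poly-id) (poly-const 1)

poly-load : IsPoly loadCost
poly-load = poly-+ poly-unit (poly-+ poly-unit (poly-* poly-id (poly-+ poly-unit (poly-+ poly-unit (poly-+ poly-unit poly-unit)))))

poly-elem : ∀ {f} → IsPoly f → IsPoly (λ K → elemCost K (f K))
poly-elem pf = poly-+ poly-unit (poly-* poly-id (poly-+ pf (poly-+ poly-unit (poly-+ poly-unit (poly-const 1)))))

poly-list : ∀ {f} → IsPoly f → IsPoly (λ K → listCost K (f K))
poly-list pf = poly-+ poly-unit (poly-* poly-id (poly-+ poly-unit (poly-+ (poly-+ poly-load (poly-+ poly-load pf)) (poly-const 1))))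

mutual
  poly-costS : ∀ {d} (e : SE d) → IsPoly (costS e)
  poly-costS (var i)     = poly-unit
  poly-costS (con b)     = poly-unit
  poly-costS (op f a b)  = poly-+ (poly-costS a) (poly-+ (poly-costS b) poly-unit)
  poly-costS (ite b a c) = poly-+ (poly-costB b) (poly-+ (poly-costS a) (poly-costS c))
  poly-costS (foldE a b) = poly-+ (poly-costS a) (poly-elem (poly-+ (poly-costS b) poly-unit))
  poly-costS (letS a b)  = poly-+ (poly-costS a) (poly-+ (poly-costS b) poly-unit)

  poly-costB : ∀ {d} (b : BE d) → IsPoly (costB b)
  poly-costB (some a)   = poly-+ (poly-costS a) poly-unit
  poly-costB (notB b)   = poly-+ (poly-costB b) (poly-const 2)
  poly-costB (andB a b) = poly-+ (poly-costB a) (poly-+ (poly-costB b) (poly-const 1))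
  poly-costB (anyE s h) = poly-elem (poly-+ (poly-costB s) (poly-+ (poly-const 1) (poly-+ (poly-costB h) (poly-const 2))))
  poly-costB (anyL s h) = poly-list (poly-+ (poly-costB s) (poly-+ (poly-const 1) (poly-+ (poly-costB h) (poly-const 2))))
  poly-costB (letB a b) = poly-+ (poly-costS a) (poly-costB b)

poly-costO : ∀ {d} (p : OP d) → IsPoly (costO p)
poly-costO nop         = poly-const 1
poly-costO (emit s)    = poly-unit
poly-costO (p ⨟ q)     = poly-+ (poly-costO p) (poly-costO q)
poly-costO (ifO b p q) = poly-+ (poly-costB b) (poly-+ (poly-costO p) (poly-costO q))
poly-costO (forE p)    = poly-+ (poly-elem (poly-costO p)) (poly-const 1)
poly-costO (forL p)    = poly-+ (poly-list (poly-costO p)) (poly-const 1)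
poly-costO (letO a p)  = poly-+ (poly-costS a) (poly-costO p)

outBound : ∀ {d} → OP d → ℕ → ℕ
outBound nop         N = 0
outBound (emit s)    N = 1
outBound (p ⨟ q)     N = outBound p N + outBound q N
outBound (ifO b p q) N = outBound p N + outBound q N
outBound (forE p)    N = N * outBound p N
outBound (forL p)    N = N * outBound p N
outBound (letO a p)  N = outBound p N

poly-outBound : ∀ {d} (p : OP d) → IsPoly (outBound p)
poly-outBound nop         = poly-const 0
poly-outBound (emit s)    = poly-const 1
poly-outBound (p ⨟ q)     = poly-+ (poly-outBound p) (poly-outBound q)
poly-outBound (ifO b p q) = poly-+ (poly-outBound p) (poly-outBound q)
poly-outBound (forE p)    = poly-* poly-id (poly-outBound p)
poly-outBound (forL p)    = poly-* poly-id (poly-outBound p)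
poly-outBound (letO a p)  = poly-outBound p

length-concatMap : ∀ {X : Set} (g : X → Word) c xs → (∀ x → length (g x) ≤ c) → length (concatMap g xs) ≤ length xs * c
length-concatMap g c []       b = z≤n
length-concatMap g c (x ∷ xs) b = ℕ.≤-trans (ℕ.≤-reflexive (ListP.length-++ (g x))) (ℕ.+-mono-≤ (b x) (length-concatMap g c xs b))

length-els : ∀ {n} k r → length (els {n} k r) ≡ suc r
length-els k zero    = refl
length-els k (suc r) = cong suc (length-els (suc k) r)

length-entries : ∀ {n} ranked f ts → length (entries {n} ranked f ts) ≤ f
length-entries ranked zero    ts       = z≤n
length-entries ranked (suc f) []       = z≤n
length-entries {n} ranked (suc f) (t ∷ ts) = s≤s (length-entries ranked f (proj₂ (readEntry {n} ranked (t ∷ ts))))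

module _ {n : ℕ} (Es : List (Subset n × Subset n)) (N : ℕ) (n<N : suc n ≤ N) (Es≤N : length Es ≤ N) where
  open Semantics Es

  length-out : ∀ {d} (p : OP d) ρ → length (⟦ p ⟧O ρ) ≤ outBound p N
  length-out nop         ρ = z≤n
  length-out (emit s)    ρ = s≤s z≤n
  length-out (p ⨟ q)     ρ = ℕ.≤-trans (ℕ.≤-reflexive (ListP.length-++ (⟦ p ⟧O ρ))) (ℕ.+-mono-≤ (length-out p ρ) (length-out q ρ))
  length-out (ifO b p q) ρ with ⟦ b ⟧B ρ
  ... | true  = ℕ.≤-trans (length-out p ρ) (ℕ.m≤m+n _ _)
  ... | false = ℕ.≤-trans (length-out q ρ) (ℕ.m≤n+m _ _)
  length-out (forE p)    ρ = ℕ.≤-trans (length-concatMap _ (outBound p N) (elems n) (λ x → length-out p (x ∷ ρ)))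
    (ℕ.*-monoˡ-≤ (outBound p N) (ℕ.≤-trans (ℕ.≤-reflexive (length-els 0 n)) n<N))
  length-out (forL p)    ρ = ℕ.≤-trans (length-concatMap _ (outBound p N) Es (λ (X , R) → length-out p (R ∷ X ∷ ρ)))
    (ℕ.*-monoˡ-≤ (outBound p N) Es≤N)
  length-out (letO a p)  ρ = length-out p _

-- Whole machines on arbitrary words, and composition of reductions

parse : Word → Maybe (ℕ × Word)
parse []        = nothing
parse (bar ∷ w) = just (0 , w)
parse (_ ∷ w)   = Maybe.map (map₁ suc) (parse w)

parse-header : ∀ n post → parse (header n ++ post) ≡ just (n , post)
parse-header zero    post = refl
parse-header (suc n) post = cong (Maybe.map (map₁ suc)) (parse-header n post)

entriesOf : ∀ {n} → Bool → Word → List (Subset n × Subset n)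
entriesOf ranked post = entries ranked (length (map listTok post)) (map listTok post)

result : Bool → OP 0 → Maybe (ℕ × Word) → Word
result ranked p nothing           = []
result ranked p (just (n , post)) = Semantics.⟦_⟧O {n} (entriesOf ranked post) p []

-- The summands are the blank test, the immediate stop on the empty word, loading, the program with
-- the final unloading, and the unloading of a word without a bar. Alternative branches are simply
-- added.
totalCost : OP 0 → ℕ → ℕ
totalCost p L = let K = L + outBound p L in
  1 + (1 + (unitCost L + ((costO p K + K * (K + K + 2)) + L * (L + L + 2))))

poly-total : ∀ p → IsPoly (totalCost p)
poly-total p = poly-+ one (poly-+ one (poly-+ poly-unit (poly-+ (poly-+ (poly-∘ (poly-costO p) pK)
    (poly-* pK (poly-+ (poly-+ pK pK) (poly-const 2)))) (poly-* poly-id (poly-+ (poly-+ poly-id poly-id) (poly-const 2))))))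
  where
  one = poly-const 1
  pK = poly-+ poly-id (poly-outBound p)

module Whole (S : ℕ) (ranked : Bool) (p : OP 0) where
  open Primitives S
  open Compiler S ranked
  open Correctness S ranked

  -- The empty word is treated apart, because it leaves no cell that could carry the flag on which
  -- every round trip relies.
  blankTest : Prog W
  blankTest = prim 𝟏 finite-𝟏 tt λ { _ nothing → inj₂ (just true) , nothing , stay ; _ (just x) → inj₂ (just false) , just x , stay }

  whole : Prog W
  whole = test blankTest (done nothing) (test loadInput (compO p (λ ()) 0 ⊳ unload) unload)

  initStore : ∀ n → Word → Store n
  initStore n post = store (Vec.replicate n blankRow) blankRow (map (λ s → listTok s , blankRow) post)

  convert-list : ∀ post → convert true post ≡ lcells (map (λ s → listTok s , blankRow) post)
  convert-list []           = refl
  convert-list (𝟘 ∷ post)   = cong (_ ∷_) (convert-list post)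
  convert-list (𝟙 ∷ post)   = cong (_ ∷_) (convert-list post)
  convert-list (sep ∷ post) = cong (_ ∷_) (convert-list post)
  convert-list (bar ∷ post) = cong (_ ∷_) (convert-list post)

  hasBar-true : ∀ w → hasBar true w ≡ true
  hasBar-true []      = refl
  hasBar-true (s ∷ w) = hasBar-true w

  Parsed : Word → Maybe (ℕ × Word) → Set
  Parsed w nothing           = hasBar false w ≡ false
  Parsed w (just (n , post)) = hasBar false w ≡ true × convert false w ≡ cellsOf (initStore n post)

  parsed-suc : ∀ s w r → hasBar false (s ∷ w) ≡ hasBar false w → convert false (s ∷ w) ≡ (hdr , blankRow) ∷ convert false w →
    Parsed w r → Parsed (s ∷ w) (Maybe.map (map₁ suc) r)
  parsed-suc s w nothing e e′ q                  = trans e q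
  parsed-suc s w (just (n , post)) e e′ (q , q′) = trans e q , trans e′ (cong (_ ∷_) q′)

  parsed : ∀ w → Parsed w (parse w)
  parsed []        = refl
  parsed (bar ∷ w) = hasBar-true w , cong (_ ∷_) (convert-list w)
  parsed (𝟘 ∷ w)   = parsed-suc 𝟘 w (parse w) refl refl (parsed w)
  parsed (𝟙 ∷ w)   = parsed-suc 𝟙 w (parse w) refl refl (parsed w)
  parsed (sep ∷ w) = parsed-suc sep w (parse w) refl refl (parsed w)

  runs-unloadS : ∀ {n} (st : Store n) o → Runs unload (tape st o) (unloadCost (sz st + length o)) (just true) ([] , word o)
  runs-unloadS st o with cellsOf st | cellsOf-cons st | length-cellsOf st
  ... | .(c ∷ cs) | c , cs , refl | eq = runs-mono (ℕ.≤-reflexive (cong (λ m → unloadCost (m + length o)) eq)) (runs-unload c cs o)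

  unloadCost-mono : ∀ {m K} → m ≤ K → unloadCost m ≤ unloadCost K
  unloadCost-mono le = ℕ.*-mono-≤ le (ℕ.+-monoˡ-≤ 2 (ℕ.+-mono-≤ le le))

  Outcome : Word → Word → Set
  Outcome w u = (∃[ e ] Runs whole ([] , word w) (totalCost p (length w)) e ([] , word u)) × length u ≤ outBound p (length w)

  runs-whole : needO p ≤ S → ∀ w → Outcome w (result ranked p (parse w))
  runs-whole fit [] = (_ , runs-mono (ℕ.+-monoʳ-≤ 1 (ℕ.m≤m+n 1 _)) (runs-branch {t = 1} {t′ = 1} (runs ℕ.≤-refl (stop refl)) (runs ℕ.≤-refl (stop refl)))) , z≤n
  runs-whole fit (s ∷ w) = go (parse (s ∷ w)) (parsed (s ∷ w))
    where
    L = length (s ∷ w)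
    entry : ∀ {C e z} b → hasBar false (s ∷ w) ≡ b →
      Runs (if b then compO p (λ ()) 0 ⊳ unload else unload) (tapeOf (convert false (s ∷ w)) []) C e z →
      Runs whole ([] , word (s ∷ w)) (1 + (1 + (unitCost L + C))) e z
    entry true  eq r = runs-branch {t = 1} (runs ℕ.≤-refl (stop refl)) (runs-mono (ℕ.n≤1+n _) (runs-branch (runs-cast refl (cong just eq) refl (runs-load s w)) r))
    entry false eq r = runs-branch {t = 1} (runs ℕ.≤-refl (stop refl)) (runs-mono (ℕ.n≤1+n _) (runs-branch (runs-cast refl (cong just eq) refl (runs-load s w)) r))

    go : ∀ r → Parsed (s ∷ w) r → Outcome (s ∷ w) (result ranked p r)
    go nothing eq = (_ , entry false eq (runs-mono (ℕ.≤-trans (ℕ.≤-reflexive (cong unloadCost (trans (ℕ.+-identityʳ _) (length-convert false (s ∷ w)))))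
        (ℕ.m≤n+m _ (costO p (L + outBound p L) + _))) (runs-unload _ _ []))) , z≤n
    go (just (n , post)) (eq , eq′) = (_ , entry true eq (runs-mono (ℕ.m≤m+n _ _) (runs-⊳ (runs-cast (cong (λ cs → tapeOf cs []) (sym eq′)) refl refl runO)
          (runs-mono (unloadCost-mono (ℕ.≤-trans (ℕ.+-monoˡ-≤ _ (ℕ.≤-reflexive (trans (cong (λ us → n + suc (length us)) (trans (Frame.toks frameO) toks-init)) sz≡))) le))
            (runs-unloadS _ (Semantics.⟦_⟧O {n} Es p [])))))) , short
      where
      ts = map listTok post
      Es : List (Subset n × Subset n)
      Es = entriesOf ranked post
      toks-init : ltoks (initStore n post) ≡ ts
      toks-init = sym (ListP.map-∘ post)
      sz≡ : n + suc (length ts) ≡ L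
      sz≡ = trans (cong (λ us → n + suc (length us)) (sym toks-init)) (trans (sym (length-cellsOf (initStore n post)))
              (trans (cong length (sym eq′)) (length-convert false (s ∷ w))))
      short : length (Semantics.⟦_⟧O {n} Es p []) ≤ outBound p L
      short = length-out Es L
        (ℕ.≤-trans (ℕ.≤-trans (ℕ.≤-reflexive (ℕ.+-comm 1 n)) (ℕ.+-monoʳ-≤ n (s≤s z≤n))) (ℕ.≤-reflexive sz≡))
        (ℕ.≤-trans (length-entries {n} ranked (length ts) ts) (ℕ.≤-trans (ℕ.n≤1+n _) (ℕ.≤-trans (ℕ.m≤n+m (suc (length ts)) n) (ℕ.≤-reflexive sz≡)))) p []
      le : L + length (Semantics.⟦_⟧O {n} Es p []) ≤ L + outBound p L
      le = ℕ.+-monoʳ-≤ L short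
      open Main ts (L + outBound p L) (ℕ.≤-trans (ℕ.≤-reflexive sz≡) (ℕ.m≤m+n _ _)) hiding (Es)
      open ResO (okO p (λ ()) 0 [] (initStore n post) [] (good toks-init (λ ()) (λ ())) fit
                  (ℕ.≤-trans (ℕ.+-monoˡ-≤ _ (ℕ.≤-reflexive sz≡)) le))

-- A polynomial-time reduction that starts and ends with a clean tape; such reductions compose.
record Reduces (I J : InputType) : Set₁ where
  field
    tracks : ℕ
    prog   : ∀ S → Prog (Tape.W S)
    c d    : ℕ
    spec   : ∀ S → tracks ≤ S → ∀ w → ∃[ u ] (∃[ e ] Runs (prog S) ([] , word w) (c * suc (length w) ^ d) e ([] , word u))
               × length u ≤ c * suc (length w) ^ d × (∀ n (M : Matroid n) → Describes I M w → Describes J M u)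

reduces-trans : ∀ {I J K} → Reduces I J → Reduces J K → Reduces I K
reduces-trans {I} {J} {K} p q = record
  -- Both programs have to run over the same tape alphabet. This is why a reduction offers a program
  -- for every sufficiently large number of tracks.
  { tracks = P.tracks + Q.tracks
  ; prog   = λ S → branch (P.prog S) (λ _ → Q.prog S)
  ; c = IsPoly.coeff cost ; d = IsPoly.degree cost
  ; spec   = spec }
  where
  module P = Reduces p
  module Q = Reduces q
  time₁ time₂ : ℕ → ℕ
  time₁ n = P.c * suc n ^ P.d
  time₂ n = Q.c * suc n ^ Q.d
  cost : IsPoly (λ n → time₁ n + time₂ (time₁ n))
  cost = poly-+ (poly P.c P.d (λ _ → ℕ.≤-refl)) (poly-∘ (poly Q.c Q.d (λ _ → ℕ.≤-refl)) (poly P.c P.d (λ _ → ℕ.≤-refl)))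
  spec : ∀ S → P.tracks + Q.tracks ≤ S → ∀ w → _
  spec S le w with P.spec S (ℕ.≤-trans (ℕ.m≤m+n P.tracks Q.tracks) le) w
  ... | u , (e , r) , short , ok with Q.spec S (ℕ.≤-trans (ℕ.m≤n+m Q.tracks P.tracks) le) u
  ... | v , (e′ , r′) , short′ , ok′ = v
      , (e′ , runs-mono (ℕ.≤-trans (ℕ.+-monoʳ-≤ (time₁ (length w)) mono) (IsPoly.below cost (length w))) (runs-branch r r′))
      , ℕ.≤-trans short′ (ℕ.≤-trans mono (ℕ.≤-trans (ℕ.m≤n+m _ (time₁ (length w))) (IsPoly.below cost (length w))))
      , λ n M D → ok′ n M (ok n M D)
    where
    mono : time₂ (length u) ≤ time₂ (time₁ (length w))
    mono = ℕ.*-monoʳ-≤ Q.c (ℕ.^-monoˡ-≤ Q.d (s≤s short))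

reduces-by : ∀ {I J} ranked (p : OP 0) →
  (∀ n (M : Matroid n) w → Describes I M w →
     ∃[ post ] (w ≡ header n ++ post × Describes J M (Semantics.⟦_⟧O {n} (entriesOf ranked post) p []))) →
  Reduces I J
reduces-by {I} {J} ranked p ok = record
  { tracks = needO p
  ; prog   = λ S → Whole.whole S ranked p
  ; c = IsPoly.coeff cost ; d = IsPoly.degree cost
  ; spec   = λ S fit w → let (e , r) , short = Whole.runs-whole S ranked p fit w in
      result ranked p (parse w)
      , (e , runs-mono (ℕ.≤-trans (ℕ.m≤m+n _ _) (IsPoly.below cost (length w))) r)
      , ℕ.≤-trans short (ℕ.≤-trans (ℕ.m≤n+m _ _) (IsPoly.below cost (length w)))
      , correct w }
  where
  cost : IsPoly (λ n → totalCost p n + outBound p n)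
  cost = poly-+ (poly-total p) (poly-outBound p)
  correct : ∀ w n (M : Matroid n) → Describes I M w → Describes J M (result ranked p (parse w))
  correct w n M D with ok n M w D
  ... | post , refl , D′ = subst (λ r → Describes J M (result ranked p r)) (sym (parse-header n post)) D′

reduces⇒≼ : ∀ {I J} → Reduces I J → I ≼ J
reduces⇒≼ {I} {J} R = machine , c * 2 ^ d , d , halts , correct
  where
  open Reduces R
  open Compile (Tape.finite-W tracks) (prog tracks)
  -- A positive `n` satisfies `suc n ≤ 2 * n`, which accounts for the factor `2 ^ d`; the additive
  -- constant takes care of the empty word.
  time : ∀ n → c * suc n ^ d ≤ c * 2 ^ d * n ^ d + c * 2 ^ d
  time zero    = ℕ.≤-trans (ℕ.*-monoʳ-≤ c (ℕ.^-monoˡ-≤ d {1} {2} (s≤s z≤n))) (ℕ.m≤n+m _ _)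
  time (suc n) = ℕ.≤-trans (ℕ.*-monoʳ-≤ c (ℕ.≤-trans (ℕ.^-monoˡ-≤ d le) (ℕ.≤-reflexive (^-distribʳ-* d 2 (suc n)))))
    (ℕ.≤-trans (ℕ.≤-reflexive (sym (ℕ.*-assoc c (2 ^ d) _))) (ℕ.m≤m+n _ _))
    where
    le : suc (suc n) ≤ 2 * suc n
    le = s≤s (ℕ.≤-trans (ℕ.m≤n+m (suc n) n) (ℕ.≤-reflexive (cong (n +_) (sym (ℕ.+-identityʳ (suc n))))))
  halts : ∀ w → ∃[ k ] (k ≤ c * 2 ^ d * length w ^ d + c * 2 ^ d × HaltedAt machine w k)
  halts w with spec tracks ℕ.≤-refl w
  ... | u , (e , runs {k} le x) , _ , _ = k , ℕ.≤-trans le (time (length w)) , proj₁ (represents-run {w} x)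
  correct : ∀ n (M : Matroid n) w → Describes I M w → ∃[ k ] ∃[ u ] (HaltedAt machine w k × OutputIs (run machine w k) u × Describes J M u)
  correct n M w D with spec tracks ℕ.≤-refl w
  ... | u , (e , runs {k} le x) , _ , ok = k , u , proj₁ (represents-run {w} x) , proj₂ (represents-run {w} x) , ok n M D

-- Matroids given by their rank function

infixl 7 _∖_
_∖_ : ∀ {n} → Subset n → Subset n → Subset n
X ∖ Y = Vec.zipWith (λ x y → x ∧ not y) X Y

∈-∖⁺ : ∀ {n} {X Y : Subset n} {i} → i ∈ X → i ∉ Y → i ∈ X ∖ Y
∈-∖⁺ {X = _ ∷ _} {true ∷ _}  here      i∉Y = contradiction here i∉Y
∈-∖⁺ {X = _ ∷ _} {false ∷ _} here      i∉Y = here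
∈-∖⁺ {X = _ ∷ _} {_ ∷ _}     (there p) i∉Y = there (∈-∖⁺ p (i∉Y ∘ there))

∈-∖⁻ : ∀ {n} (X Y : Subset n) {i} → i ∈ X ∖ Y → i ∈ X × i ∉ Y
∈-∖⁻ (true ∷ X)  (false ∷ Y) here      = here , λ ()
∈-∖⁻ (x ∷ X)     (y ∷ Y)     (there p) = there (proj₁ (∈-∖⁻ X Y p)) , λ { (there q) → proj₂ (∈-∖⁻ X Y p) q }

card-split : ∀ {n} (X Y : Subset n) → ∣ Y ∣ ≡ ∣ Y ∩ X ∣ + ∣ Y ∖ X ∣
card-split []          []          = refl
card-split (true ∷ X)  (true ∷ Y)  = cong suc (card-split X Y)
card-split (true ∷ X)  (false ∷ Y) = card-split X Y
card-split (false ∷ X) (true ∷ Y)  = trans (cong suc (card-split X Y)) (sym (ℕ.+-suc _ _))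
card-split (false ∷ X) (false ∷ Y) = card-split X Y

infixl 6 _⊕_ _⊖_
_⊕_ _⊖_ : ∀ {n} → Subset n → Fin n → Subset n
X ⊕ e = X ∪ ⁅ e ⁆
X ⊖ e = X ∖ ⁅ e ⁆

∈-⊕ : ∀ {n} (X : Subset n) e → e ∈ X ⊕ e
∈-⊕ X e = S.q⊆p∪q X ⁅ e ⁆ (S.x∈⁅x⁆ e)

⊆-⊕ : ∀ {n} (X : Subset n) e → X ⊆ X ⊕ e
⊆-⊕ X e = S.p⊆p∪q ⁅ e ⁆

∈-⊕⁻ : ∀ {n} (X : Subset n) e {i} → i ∈ X ⊕ e → i ∈ X ⊎ i ≡ e
∈-⊕⁻ X e p = Sum.map₂ (S.x∈⁅y⁆⇒x≡y e) (S.x∈p∪q⁻ X ⁅ e ⁆ p)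

⊕-⊆ : ∀ {n} {X Y : Subset n} {e} → X ⊆ Y → e ∈ Y → X ⊕ e ⊆ Y
⊕-⊆ {X = X} {e = e} X⊆Y e∈Y p with ∈-⊕⁻ X e p
... | inj₁ q    = X⊆Y q
... | inj₂ refl = e∈Y

⊕-mono : ∀ {n} {X Y : Subset n} {e} → X ⊆ Y → X ⊕ e ⊆ Y ⊕ e
⊕-mono {Y = Y} {e} X⊆Y = ⊕-⊆ (⊆-⊕ Y e ∘ X⊆Y) (∈-⊕ Y e)

∈-⊖⁺ : ∀ {n} {X : Subset n} {e i} → i ∈ X → i ≢ e → i ∈ X ⊖ e
∈-⊖⁺ {e = e} p i≢e = ∈-∖⁺ p (i≢e ∘ S.x∈⁅y⁆⇒x≡y e)

∈-⊖⁻ : ∀ {n} (X : Subset n) e {i} → i ∈ X ⊖ e → i ∈ X × i ≢ e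
∈-⊖⁻ X e p = proj₁ (∈-∖⁻ X ⁅ e ⁆ p) , λ { refl → proj₂ (∈-∖⁻ X ⁅ e ⁆ p) (S.x∈⁅x⁆ e) }

⊖-⊆ : ∀ {n} (X : Subset n) e → X ⊖ e ⊆ X
⊖-⊆ X e p = proj₁ (∈-⊖⁻ X e p)

⊖-mono : ∀ {n} {X Y : Subset n} {e} → X ⊆ Y → X ⊖ e ⊆ Y ⊖ e
⊖-mono {X = X} {e = e} X⊆Y p = ∈-⊖⁺ (X⊆Y (⊖-⊆ X e p)) (proj₂ (∈-⊖⁻ X e p))

⊆-⊖ : ∀ {n} {X Y : Subset n} {e} → X ⊆ Y → e ∉ X → X ⊆ Y ⊖ e
⊆-⊖ X⊆Y e∉X p = ∈-⊖⁺ (X⊆Y p) λ { refl → e∉X p }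

⊖-⊕ : ∀ {n} {X : Subset n} {e} → e ∈ X → X ⊖ e ⊕ e ≡ X
⊖-⊕ {X = X} {e} e∈X = S.⊆-antisym (⊕-⊆ (⊖-⊆ X e) e∈X) back
  where
  back : X ⊆ X ⊖ e ⊕ e
  back {i} p with i Fin.≟ e
  ... | yes refl = ∈-⊕ (X ⊖ e) e
  ... | no  i≢e  = ⊆-⊕ (X ⊖ e) e (∈-⊖⁺ p i≢e)

⊕-∈ : ∀ {n} {X : Subset n} {e} → e ∈ X → X ⊕ e ≡ X
⊕-∈ {X = X} {e} e∈X = S.⊆-antisym (⊕-⊆ id e∈X) (⊆-⊕ X e)

∖-⊥ : ∀ {n} (X : Subset n) → X ∖ ⊥ ≡ X
∖-⊥ []          = refl
∖-⊥ (true ∷ X)  = cong (true ∷_) (∖-⊥ X)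
∖-⊥ (false ∷ X) = cong (false ∷_) (∖-⊥ X)

card-⊕ : ∀ {n} {X : Subset n} {e} → e ∉ X → ∣ X ⊕ e ∣ ≡ suc ∣ X ∣
card-⊕ {X = true ∷ X}  {zero}  e∉X = contradiction here e∉X
card-⊕ {X = false ∷ X} {zero}  e∉X = cong (suc ∘ ∣_∣) (S.∪-identityʳ X)
card-⊕ {X = true ∷ X}  {suc e} e∉X = cong suc (card-⊕ (e∉X ∘ there))
card-⊕ {X = false ∷ X} {suc e} e∉X = card-⊕ (e∉X ∘ there)

∉-⊖ : ∀ {n} (X : Subset n) e → e ∉ X ⊖ e
∉-⊖ X e p = proj₂ (∈-⊖⁻ X e p) refl

card-⊖ : ∀ {n} {X : Subset n} {e} → e ∈ X → suc ∣ X ⊖ e ∣ ≡ ∣ X ∣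
card-⊖ {X = X} {e} e∈X = trans (sym (card-⊕ (∉-⊖ X e))) (cong ∣_∣ (⊖-⊕ e∈X))

¬⊆⇒∃ : ∀ {n} (X Y : Subset n) → ¬ (∀ i → i ∈ X → i ∈ Y) → ∃[ i ] (i ∈ X × i ∉ Y)
¬⊆⇒∃ X Y ¬X⊆Y with FinP.any? (λ i → (i S.∈? X) ×-dec (¬? (i S.∈? Y)))
... | yes p = p
... | no ¬p = contradiction (λ i i∈X → Dec.decidable-stable (i S.∈? Y) (λ i∉Y → ¬p (i , i∈X , i∉Y))) ¬X⊆Y

module Theory {n : ℕ} (M : Matroid n) where
  open Matroid M

  private
    Ind : Subset n → Set
    Ind = Independent M

  ind? : ∀ X → Dec (Independent M X)
  ind? X = rank X ℕ.≟ ∣ X ∣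

  rank-⊕ : ∀ X e → rank (X ⊕ e) ≤ suc (rank X)
  rank-⊕ X e = ℕ.≤-trans (ℕ.≤-trans (ℕ.m≤m+n _ _) (R3 X ⁅ e ⁆))
    (ℕ.≤-trans (ℕ.+-monoʳ-≤ (rank X) (ℕ.≤-trans (R1 ⁅ e ⁆) (ℕ.≤-reflexive (S.∣⁅x⁆∣≡1 e)))) (ℕ.≤-reflexive (ℕ.+-comm (rank X) 1)))

  ind-⊥ : Independent M ⊥
  ind-⊥ = ℕ.≤-antisym (R1 ⊥) (ℕ.≤-trans (ℕ.≤-reflexive (S.∣⊥∣≡0 n)) z≤n)

  -- Submodularity for `X` and `Y ∖ X` bounds the rank of `Y` by `rank X + ∣ Y ∖ X ∣`, and the
  -- cardinality of `Y ∖ X` cancels.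
  ind-⊆ : ∀ {X Y} → X ⊆ Y → Independent M Y → Independent M X
  ind-⊆ {X} {Y} X⊆Y iY = ℕ.≤-antisym (R1 X) (ℕ.+-cancelʳ-≤ ∣ Y ∖ X ∣ ∣ X ∣ (rank X) (begin
    ∣ X ∣ + ∣ Y ∖ X ∣                           ≡⟨ cong (λ Z → ∣ Z ∣ + ∣ Y ∖ X ∣) (sym Y∩X) ⟩
    ∣ Y ∩ X ∣ + ∣ Y ∖ X ∣                       ≡⟨ sym (card-split X Y) ⟩
    ∣ Y ∣                                       ≡⟨ sym iY ⟩
    rank Y                                      ≤⟨ R2 Y (X ∪ (Y ∖ X)) cover ⟩
    rank (X ∪ (Y ∖ X))                          ≤⟨ ℕ.m≤m+n _ _ ⟩
    rank (X ∪ (Y ∖ X)) + rank (X ∩ (Y ∖ X))     ≤⟨ R3 X (Y ∖ X) ⟩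
    rank X + rank (Y ∖ X)                       ≤⟨ ℕ.+-monoʳ-≤ (rank X) (R1 (Y ∖ X)) ⟩
    rank X + ∣ Y ∖ X ∣                          ∎))
    where
    open ℕ.≤-Reasoning
    Y∩X : Y ∩ X ≡ X
    Y∩X = S.⊆-antisym (S.p∩q⊆q Y X) (λ p → S.x∈p∩q⁺ (X⊆Y p , p))
    cover : Y ⊆ X ∪ (Y ∖ X)
    cover {i} p with i S.∈? X
    ... | yes q = S.x∈p∪q⁺ (inj₁ q)
    ... | no ¬q = S.x∈p∪q⁺ (inj₂ (∈-∖⁺ p ¬q))

  -- Monotonicity of the closure operator, obtained from submodularity for `X ⊕ e` and `Y`.
  rank-⊕-mono : ∀ {X Y e} → X ⊆ Y → rank (X ⊕ e) ≤ rank X → rank (Y ⊕ e) ≤ rank Y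
  rank-⊕-mono {X} {Y} {e} X⊆Y le = ℕ.+-cancelʳ-≤ (rank X) (rank (Y ⊕ e)) (rank Y) (begin
    rank (Y ⊕ e) + rank X                          ≤⟨ ℕ.+-mono-≤ (R2 _ _ up) (R2 _ _ low) ⟩
    rank ((X ⊕ e) ∪ Y) + rank ((X ⊕ e) ∩ Y)        ≤⟨ R3 (X ⊕ e) Y ⟩
    rank (X ⊕ e) + rank Y                          ≤⟨ ℕ.+-monoˡ-≤ (rank Y) le ⟩
    rank X + rank Y                                ≡⟨ ℕ.+-comm (rank X) (rank Y) ⟩
    rank Y + rank X                                ∎)
    where
    open ℕ.≤-Reasoning
    up : Y ⊕ e ⊆ (X ⊕ e) ∪ Y
    up = ⊕-⊆ (S.q⊆p∪q (X ⊕ e) Y) (S.p⊆p∪q Y (∈-⊕ X e))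
    low : X ⊆ (X ⊕ e) ∩ Y
    low p = S.x∈p∩q⁺ (⊆-⊕ X e p , X⊆Y p)

  rank-∪ : ∀ X Y → (∀ e → e ∈ Y → rank (X ⊕ e) ≤ rank X) → rank (X ∪ Y) ≤ rank X
  rank-∪ X Y = go ∣ Y ∣ Y ℕ.≤-refl
    where
    go : ∀ k Y → ∣ Y ∣ ≤ k → (∀ e → e ∈ Y → rank (X ⊕ e) ≤ rank X) → rank (X ∪ Y) ≤ rank X
    go k Y le cl with S.nonempty? Y
    ... | no ¬p = R2 _ _ (λ p → Sum.[ id , (λ q → contradiction (_ , q) ¬p) ] (S.x∈p∪q⁻ X Y p))
    go zero Y le cl | yes (e , p) = contradiction (ℕ.≤-trans (ℕ.≤-reflexive (card-⊖ p)) le) λ ()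
    go (suc k) Y le cl | yes (e , p) = ℕ.≤-trans (R2 _ _ up)
      (ℕ.≤-trans (rank-⊕-mono {X} (S.p⊆p∪q (Y ⊖ e)) (cl e p))
        (go k (Y ⊖ e) (ℕ.≤-pred (ℕ.≤-trans (ℕ.≤-reflexive (card-⊖ p)) le)) (λ f q → cl f (⊖-⊆ Y e q))))
      where
      up : X ∪ Y ⊆ (X ∪ (Y ⊖ e)) ⊕ e
      up {i} q with S.x∈p∪q⁻ X Y q
      ... | inj₁ r = ⊆-⊕ _ e (S.x∈p∪q⁺ (inj₁ r))
      ... | inj₂ r with i Fin.≟ e
      ...   | yes refl = ∈-⊕ _ e
      ...   | no i≢e   = ⊆-⊕ _ e (S.x∈p∪q⁺ (inj₂ (∈-⊖⁺ r i≢e)))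

  rank-closure : ∀ {X Y} → X ⊆ Y → (∀ e → e ∈ Y → rank (X ⊕ e) ≤ rank X) → rank X ≡ rank Y
  rank-closure {X} {Y} X⊆Y cl = ℕ.≤-antisym (R2 _ _ X⊆Y) (ℕ.≤-trans (R2 _ _ (S.q⊆p∪q X Y)) (rank-∪ X Y cl))

  ind-rank-⊕ : ∀ {I e} → e ∉ I → Independent M I → Independent M (I ⊕ e) → rank (I ⊕ e) ≡ suc (rank I)
  ind-rank-⊕ e∉I iI iIe = trans iIe (trans (card-⊕ e∉I) (cong suc (sym iI)))

  dep-rank-⊕ : ∀ {I e} → Independent M I → ¬ Independent M (I ⊕ e) → rank (I ⊕ e) ≤ rank I
  dep-rank-⊕ {I} {e} iI d with e S.∈? I
  ... | yes p = ℕ.≤-reflexive (cong rank (⊕-∈ p))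
  ... | no ¬p = ℕ.≤-pred (ℕ.≤-trans (ℕ.≤∧≢⇒< (R1 (I ⊕ e)) d) (ℕ.≤-reflexive (trans (card-⊕ ¬p) (cong suc (sym iI)))))

  record BasisOf (I X : Subset n) : Set where
    constructor basisOf
    field
      sub   : ∀ {i} → i ∈ I → i ∈ X
      indep : Independent M I
      rank≡ : rank I ≡ rank X
  open BasisOf public

  maximal⇒basisOf : ∀ {I X} → I ⊆ X → Independent M I → (∀ e → e ∈ X → e ∉ I → ¬ Independent M (I ⊕ e)) → BasisOf I X
  maximal⇒basisOf {I} {X} I⊆X iI mx = basisOf I⊆X iI (rank-closure I⊆X cl)
    where
    cl : ∀ e → e ∈ X → rank (I ⊕ e) ≤ rank I
    cl e p with e S.∈? I
    ... | yes q = ℕ.≤-reflexive (cong rank (⊕-∈ q))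
    ... | no ¬q = dep-rank-⊕ iI (mx e p ¬q)

  extend : ∀ I X → I ⊆ X → Independent M I → ∃[ J ] (BasisOf J X × (∀ {i} → i ∈ I → i ∈ J))
  extend I X = go n I (ℕ.m≤m+n n ∣ I ∣)
    where
    go : ∀ k I → n ≤ k + ∣ I ∣ → I ⊆ X → Independent M I → ∃[ J ] (BasisOf J X × (∀ {i} → i ∈ I → i ∈ J))
    go k I le I⊆X iI with FinP.any? (λ e → (e S.∈? X) ×-dec ((¬? (e S.∈? I)) ×-dec ind? (I ⊕ e)))
    ... | no ¬p = I , maximal⇒basisOf I⊆X iI (λ e p q r → ¬p (e , p , q , r)) , id
    go zero I le I⊆X iI | yes (e , p , q , r) = contradiction (ℕ.≤-trans (ℕ.≤-reflexive (sym (card-⊕ q))) (ℕ.≤-trans (S.∣p∣≤n (I ⊕ e)) le)) (ℕ.<-irrefl refl)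
    go (suc k) I le I⊆X iI | yes (e , p , q , r) with go k (I ⊕ e) (ℕ.≤-trans le (ℕ.≤-reflexive (trans (sym (ℕ.+-suc k ∣ I ∣)) (cong (k +_) (sym (card-⊕ q)))))) (⊕-⊆ I⊆X p) r
    ... | J , bJ , sJ = J , bJ , sJ ∘ ⊆-⊕ I e

  basis-exists : ∀ X → ∃[ I ] BasisOf I X
  basis-exists X with extend ⊥ X S.⊥⊆ ind-⊥
  ... | I , bI , _ = I , bI

  basisOf-⊤⇒Basis : ∀ {B} → BasisOf B ⊤ → Basis M B
  basisOf-⊤⇒Basis b = indep b , rank≡ b

  extend-basis : ∀ {I} → Independent M I → ∃[ B ] (Basis M B × (∀ {i} → i ∈ I → i ∈ B))
  extend-basis {I} iI with extend I ⊤ S.⊆⊤ iI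
  ... | B , bB , s = B , basisOf-⊤⇒Basis bB , s

  ind⇒rank-⊖ : ∀ {X e} → Independent M X → e ∈ X → rank (X ⊖ e) < rank X
  ind⇒rank-⊖ {X} {e} iX p = ℕ.≤-trans (s≤s (R1 (X ⊖ e))) (ℕ.≤-reflexive (trans (card-⊖ p) (sym iX)))

  -- A basis of `X` that omitted `e` would lie in `X ⊖ e` and give it full rank. So a basis of `X`
  -- omits nothing.
  rank-⊖⇒ind : ∀ X → (∀ e → e ∈ X → rank (X ⊖ e) < rank X) → Independent M X
  rank-⊖⇒ind X lt with basis-exists X
  ... | I , bI = ind-⊆ X⊆I (indep bI)
    where
    X⊆I : X ⊆ I
    X⊆I {e} p with e S.∈? I
    ... | yes q = q
    ... | no ¬q = contradiction (ℕ.≤-trans (ℕ.≤-reflexive (sym (rank≡ bI))) (R2 I (X ⊖ e) (⊆-⊖ (sub bI) ¬q))) (ℕ.<⇒≱ (lt e p))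

  rank-⊖ : ∀ {X e} → e ∈ X → rank X ≤ suc (rank (X ⊖ e))
  rank-⊖ {X} {e} p = ℕ.≤-trans (ℕ.≤-reflexive (cong rank (sym (⊖-⊕ p)))) (rank-⊕ (X ⊖ e) e)

  circuit-⊖ : ∀ {C e} → Circuit M C → e ∈ C → Independent M (C ⊖ e)
  circuit-⊖ {C} {e} (_ , min) p = min (C ⊖ e) (⊖-⊆ C e , e , p , ∉-⊖ C e)

  circuit-intro : ∀ {C} → ¬ Independent M C → (∀ e → e ∈ C → Independent M (C ⊖ e)) → Circuit M C
  circuit-intro d min = d , λ Y (Y⊆C , e , p , q) → ind-⊆ (⊆-⊖ Y⊆C q) (min e p)

  circuit-rank : ∀ {C e} → Circuit M C → e ∈ C → rank (C ⊖ e ⊕ e) ≤ rank (C ⊖ e)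
  circuit-rank {C} {e} cC p = dep-rank-⊕ (circuit-⊖ cC p) (λ i → proj₁ cC (subst Ind (⊖-⊕ p) i))

  dependent⇒circuit : ∀ X → ¬ Independent M X → ∃[ C ] (Circuit M C × (∀ {i} → i ∈ C → i ∈ X))
  dependent⇒circuit X = go ∣ X ∣ X ℕ.≤-refl
    where
    go : ∀ k X → ∣ X ∣ ≤ k → ¬ Independent M X → ∃[ C ] (Circuit M C × (∀ {i} → i ∈ C → i ∈ X))
    go k X le d with FinP.any? (λ e → (e S.∈? X) ×-dec (¬? (ind? (X ⊖ e))))
    ... | no ¬p = X , circuit-intro d (λ e p → Dec.decidable-stable (ind? (X ⊖ e)) (λ q → ¬p (e , p , q))) , id
    go zero X le d | yes (e , p , q) = contradiction (ℕ.≤-trans (ℕ.≤-reflexive (card-⊖ p)) le) λ ()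
    go (suc k) X le d | yes (e , p , q) with go k (X ⊖ e) (ℕ.≤-pred (ℕ.≤-trans (ℕ.≤-reflexive (card-⊖ p)) le)) q
    ... | C , cC , s = C , cC , ⊖-⊆ X e ∘ s

  in-circuit⇒rank : ∀ {X e C} → Circuit M C → C ⊆ X → e ∈ C → rank (X ⊖ e) ≡ rank X
  in-circuit⇒rank {X} {e} {C} cC C⊆X p = ℕ.≤-antisym (R2 _ _ (⊖-⊆ X e))
    (ℕ.≤-trans (ℕ.≤-reflexive (cong rank (sym (⊖-⊕ (C⊆X p))))) (rank-⊕-mono {C ⊖ e} (⊖-mono C⊆X) (circuit-rank cC p)))

  -- A basis of `X ⊖ e` becomes dependent when `e` is added, and the circuit that appears must
  -- contain `e`, as the basis itself contains none.
  rank⇒in-circuit : ∀ {X e} → e ∈ X → rank (X ⊖ e) ≡ rank X → ∃[ C ] (Circuit M C × C ⊆ X × e ∈ C)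
  rank⇒in-circuit {X} {e} p eq with basis-exists (X ⊖ e)
  ... | I , bI with dependent⇒circuit (I ⊕ e) dep
    where
    e∉I : e ∉ I
    e∉I q = ∉-⊖ X e (sub bI q)
    dep : ¬ Independent M (I ⊕ e)
    dep i = ℕ.<⇒≱ (ℕ.≤-reflexive (sym (ind-rank-⊕ e∉I (indep bI) i)))
      (ℕ.≤-trans (R2 (I ⊕ e) X (⊕-⊆ (⊖-⊆ X e ∘ sub bI) p)) (ℕ.≤-reflexive (trans (sym eq) (sym (rank≡ bI)))))
  ... | C , cC , s = C , cC , (λ q → ⊕-⊆ {X = I} (⊖-⊆ X e ∘ sub bI) p (s q)) , e∈C
    where
    e∈C : e ∈ C
    e∈C with e S.∈? C
    ... | yes q = q
    ... | no ¬q = contradiction (ind-⊆ (λ {i} r → Sum.[ id , (λ { refl → contradiction r ¬q }) ] (∈-⊕⁻ I e (s r))) (indep bI)) (proj₁ cC)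

  -- A set is a union of circuits exactly if the restriction to it has no coloop. This replaces the
  -- quantifier over circuits by rank equations, which can be tested with an independence oracle and
  -- carry over to the dual.
  cyclic⇔ : ∀ X → CyclicFlat M X ⇔ (Flat M X × (∀ e → e ∈ X → rank (X ⊖ e) ≡ rank X))
  cyclic⇔ X = mk⇔ (λ (f , c) → f , λ e p → let C , cC , s , q = c e p in in-circuit⇒rank cC s q)
                  (λ (f , c) → f , λ e p → rank⇒in-circuit p (c e p))

  basis-card : ∀ {B} → Basis M B → ∣ B ∣ ≡ rank ⊤
  basis-card (i , s) = trans (sym i) s

  card⇒basis : ∀ {B} → Independent M B → ∣ B ∣ ≡ rank ⊤ → Basis M B
  card⇒basis i eq = i , trans i eq

  basis-rank-⊕ : ∀ {I X e} → BasisOf I X → rank (I ⊕ e) ≤ rank I → rank (X ⊕ e) ≤ rank X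
  basis-rank-⊕ b = rank-⊕-mono (sub b)

  flat-closed : ∀ {X} → Flat M X → ∀ e → rank (X ⊕ e) ≤ rank X → e ∈ X
  flat-closed {X} f e le with e S.∈? X
  ... | yes p = p
  ... | no ¬p = contradiction le (ℕ.<⇒≱ (f e ¬p))

  spanning? : ∀ X → Dec (Spanning M X)
  spanning? X = rank X ℕ.≟ rank ⊤

  flat? : ∀ X → Dec (Flat M X)
  flat? X = FinP.all? (λ e → Dec._→-dec_ (¬? (e S.∈? X)) (rank X ℕ.<? rank (X ⊕ e)))

  circuit? : ∀ X → Dec (Circuit M X)
  circuit? X = Dec.map′ (λ (d , m) → circuit-intro d m) (λ c → proj₁ c , λ e p → circuit-⊖ c p)
    ((¬? (ind? X)) ×-dec FinP.all? (λ e → Dec._→-dec_ (e S.∈? X) (ind? (X ⊖ e))))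

  cyclic? : ∀ X → Dec (CyclicFlat M X)
  cyclic? X = Dec.map′ (Equivalence.from (cyclic⇔ X)) (Equivalence.to (cyclic⇔ X))
    (flat? X ×-dec FinP.all? (λ e → Dec._→-dec_ (e S.∈? X) (rank (X ⊖ e) ℕ.≟ rank X)))

  hyperplane? : ∀ X → Dec (Hyperplane M X)
  hyperplane? X = flat? X ×-dec (suc (rank X) ℕ.≟ rank ⊤)

-- Matroid predicates as tests

reflects-map : ∀ {P Q : Set} {b} → (P → Q) → (Q → P) → Reflects P b → Reflects Q b
reflects-map f g (ofʸ p)  = ofʸ (f p)
reflects-map f g (ofⁿ ¬p) = ofⁿ (¬p ∘ g)

dec-reflects : ∀ {P : Set} {b} → Reflects P b → Dec P
dec-reflects (ofʸ p)  = yes p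
dec-reflects (ofⁿ ¬p) = no ¬p

anyV-reflects : ∀ {n} (X : Subset n) → Reflects (∃[ i ] i ∈ X) (anyV X)
anyV-reflects []          = ofⁿ λ ()
anyV-reflects (true ∷ X)  = ofʸ (zero , here)
anyV-reflects (false ∷ X) = reflects-map (λ (i , p) → suc i , there p) (λ { (suc i , there p) → i , p }) (anyV-reflects X)

anyUntil-reflects : ∀ {A : Set} {P : A → Set} {stp hit : A → Bool} → (∀ x → stp x ≡ false) → (∀ x → Reflects (P x) (hit x)) →
  ∀ xs → Reflects (∃[ x ] (x ∈ₗ xs × P x)) (anyUntil stp hit xs)
anyUntil-reflects ns rh [] = ofⁿ λ ()
anyUntil-reflects {stp = stp} {hit} ns rh (x ∷ xs) rewrite ns x with hit x | rh x
... | true  | ofʸ p  = ofʸ (x , here refl , p)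
... | false | ofⁿ ¬p = reflects-map (λ (y , q , r) → y , there q , r)
  (λ { (y , here refl , r) → contradiction r ¬p ; (y , there q , r) → y , q , r }) (anyUntil-reflects ns rh xs)

-- Stopping at the current item confines a search to the items before it. This is the only way in
-- which the programs can say "earlier".
anyUntil-prefix : ∀ {A : Set} {P Q : A → Set} {stp hit : A → Bool} → (∀ x → Reflects (Q x) (stp x)) → (∀ x → Reflects (P x) (hit x)) →
  ∀ pre y post → (∀ x → x ∈ₗ pre → ¬ Q x) → Q y → Reflects (∃[ x ] (x ∈ₗ pre × P x)) (anyUntil stp hit (pre ++ y ∷ post))
anyUntil-prefix {stp = stp} rs rh [] y post nq qy with stp y | rs y
... | true  | _      = ofⁿ λ ()
... | false | ofⁿ ¬q = contradiction qy ¬q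
anyUntil-prefix {stp = stp} {hit} rs rh (x ∷ pre) y post nq qy with stp x | rs x | hit x | rh x
... | true  | ofʸ q  | _     | _      = contradiction q (nq x (here refl))
... | false | ofⁿ _  | true  | ofʸ p  = ofʸ (x , here refl , p)
... | false | ofⁿ _  | false | ofⁿ ¬p = reflects-map (λ (y , q , r) → y , there q , r)
  (λ { (y , here refl , r) → contradiction r ¬p ; (y , there q , r) → y , q , r }) (anyUntil-prefix rs rh pre y post (λ z z∈ → nq z (there z∈)) qy)

anyUntil-before : ∀ {A : Set} {P Q : A → Set} {stp hit : A → Bool} {xs} → (∀ x → Reflects (Q x) (stp x)) → (∀ x → Reflects (P x) (hit x)) →
  ∀ pre y post → xs ≡ pre ++ y ∷ post → (∀ x → x ∈ₗ pre → ¬ Q x) → Q y → Reflects (∃[ x ] (x ∈ₗ pre × P x)) (anyUntil stp hit xs)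
anyUntil-before rs rh pre y post refl = anyUntil-prefix rs rh pre y post

hot-toℕ : ∀ {n} (i : Fin n) → hot (toℕ i) ≡ ⁅ i ⁆
hot-toℕ zero    = refl
hot-toℕ (suc i) = cong (false ∷_) (hot-toℕ i)

hot-n : ∀ n → hot {n} n ≡ ⊥
hot-n zero    = refl
hot-n (suc n) = cong (false ∷_) (hot-n n)

els-suc : ∀ {n} k r → els {suc n} (suc k) r ≡ map (false ∷_) (els {n} k r)
els-suc k zero    = refl
els-suc k (suc r) = cong (_ ∷_) (els-suc (suc k) r)

elems-suc : ∀ n → elems (suc n) ≡ (true ∷ ⊥) ∷ map (false ∷_) (elems n)
elems-suc n = cong ((true ∷ ⊥) ∷_) (els-suc 0 n)

⁅⁆∈elems : ∀ {n} (i : Fin n) → ⁅ i ⁆ ∈ₗ elems n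
⁅⁆∈elems {suc n} zero    = here refl
⁅⁆∈elems {suc n} (suc i) = subst (⁅ suc i ⁆ ∈ₗ_) (sym (elems-suc n)) (there (∈ₗ.∈-map⁺ (false ∷_) (⁅⁆∈elems i)))

∈elems⁻ : ∀ {n} {x : Subset n} → x ∈ₗ elems n → (∃[ i ] x ≡ ⁅ i ⁆) ⊎ x ≡ ⊥
∈elems⁻ {zero} {[]} p = inj₂ refl
∈elems⁻ {suc n} {x} p with subst (x ∈ₗ_) (elems-suc n) p
... | here refl = inj₁ (zero , refl)
... | there q with ∈ₗ.∈-map⁻ (false ∷_) q
... | y , r , refl = Sum.map (λ (i , eq) → suc i , cong (false ∷_) eq) (cong (false ∷_)) (∈elems⁻ r)

elems-unique : ∀ n → Unique (elems n)
elems-unique zero    = [] ∷ []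
elems-unique (suc n) = subst Unique (sym (elems-suc n))
  (AllP.map⁺ (All.tabulate (λ _ ())) ∷ Unique.map⁺ VecP.∷-injectiveʳ (elems-unique n))
  where import Data.List.Relation.Unary.Unique.Propositional.Properties as Unique

pattern x0 = var zero
pattern x1 = var (suc zero)
pattern x2 = var (suc (suc zero))
pattern x3 = var (suc (suc (suc zero)))
pattern x4 = var (suc (suc (suc (suc zero))))

infixr 7 _∩′_ _∖′_
infixr 6 _∪′_
_∩′_ _∪′_ _∖′_ : ∀ {d} → SE d → SE d → SE d
_∩′_ = op _∧_
_∪′_ = op _∨_
_∖′_ = op (λ x y → x ∧ not y)

infix 4 _⊆′_ _≐_
_⊆′_ _≐_ : ∀ {d} → SE d → SE d → BE d
a ⊆′ b = notB (some (a ∖′ b))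
a ≐ b  = andB (a ⊆′ b) (b ⊆′ a)

falseB : ∀ {d} → BE d
falseB = some (con false)

orB : ∀ {d} → BE d → BE d → BE d
orB a b = notB (andB (notB a) (notB b))

existsE : ∀ {d} → BE (1 + d) → BE d
existsE = anyE falseB

existsL : ∀ {d} → BE (2 + d) → BE d
existsL = anyL falseB

-- Independence of the set in variable 0.
Oracle : Set
Oracle = ∀ {d} → BE (1 + d)

module Predicates (ind : Oracle) where

  -- The greedy algorithm. Inside the fold `x0` is the current element, `x1` the set built so far
  -- and `x2` the value of `a`.
  basisE : ∀ {d} → SE d → SE d
  basisE a = letS a (foldE (con false) (ite (andB (some (x0 ∩′ x2)) (letB (x1 ∪′ x0) ind)) (x1 ∪′ x0) x1))

  spanB flatB circB cycB hypB indB : ∀ {d} → SE d → BE d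
  indB a  = letB a ind
  spanB a = letB (basisE a) (notB (existsE (andB (some (x0 ∖′ x1)) (letB (x1 ∪′ x0) ind))))
  flatB a = letB a (letB (basisE x0) (notB (existsE (andB (some (x0 ∖′ x2)) (notB (letB (x1 ∪′ x0) ind))))))
  circB a = letB a (andB (notB ind) (notB (existsE (andB (some (x0 ∩′ x1)) (notB (letB (x1 ∖′ x0) ind))))))
  -- By `cyclic⇔` no element may be a coloop of the flat, and an element is a coloop exactly if it
  -- extends a basis of the rest.
  cycB a  = letB a (andB (flatB x0) (notB (existsE (andB (some (x0 ∩′ x1)) (letB (basisE (x1 ∖′ x0)) (letB (x0 ∪′ x1) ind))))))
  -- Adding an element to a flat from outside raises the rank by exactly one. So a flat is a
  -- hyperplane if and only if some such extension is spanning.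
  hypB a  = letB a (andB (flatB x0) (existsE (andB (some (x0 ∖′ x1)) (spanB (x1 ∪′ x0)))))

  targetB : InputType → ∀ {d} → SE d → BE d
  targetB RANK                  a = notB falseB
  targetB INDEPENDENT-SETS      a = indB a
  targetB SPANNING-SETS         a = spanB a
  targetB BASES                 a = andB (indB a) (spanB a)
  targetB FLATS                 a = flatB a
  targetB CIRCUITS              a = circB a
  targetB HYPERPLANES           a = hypB a
  targetB NON-SPANNING-CIRCUITS a = andB (circB a) (notB (spanB a))
  targetB DEPENDENT-HYPERPLANES a = andB (hypB a) (notB (indB a))
  targetB CYCLIC-FLATS          a = cycB a

Target : InputType → ∀ {n} → Matroid n → Subset n → Set
Target RANK                  M X = 𝟏
Target INDEPENDENT-SETS      M X = Independent M X
Target SPANNING-SETS         M X = Spanning M X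
Target BASES                 M X = Basis M X
Target FLATS                 M X = Flat M X
Target CIRCUITS              M X = Circuit M X
Target HYPERPLANES           M X = Hyperplane M X
Target NON-SPANNING-CIRCUITS M X = NonSpanningCircuit M X
Target DEPENDENT-HYPERPLANES M X = DependentHyperplane M X
Target CYCLIC-FLATS          M X = CyclicFlat M X

module Reflection {n : ℕ} (Es : List (Subset n × Subset n)) where
  open Semantics Es

  ∩-reflects : ∀ i (X : Subset n) → Reflects (i ∈ X) (anyV (⁅ i ⁆ ∩ X))
  ∩-reflects i X = reflects-map
    (λ (j , p) → let q , r = S.x∈p∩q⁻ ⁅ i ⁆ X p in subst (_∈ X) (S.x∈⁅y⁆⇒x≡y i q) r)
    (λ p → i , S.x∈p∩q⁺ (S.x∈⁅x⁆ i , p)) (anyV-reflects (⁅ i ⁆ ∩ X))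

  ∖-reflects : ∀ i (X : Subset n) → Reflects (i ∉ X) (anyV (⁅ i ⁆ ∖ X))
  ∖-reflects i X = reflects-map
    (λ (j , p) → let q , r = ∈-∖⁻ ⁅ i ⁆ X p in subst (_∉ X) (S.x∈⁅y⁆⇒x≡y i q) r)
    (λ p → i , ∈-∖⁺ (S.x∈⁅x⁆ i) p) (anyV-reflects (⁅ i ⁆ ∖ X))

  ∅∩-false : (X : Subset n) → anyV (⊥ ∩ X) ≡ false
  ∅∩-false X = trans (cong anyV (S.∩-zeroˡ X)) (anyV-⊥ n)

  ∅∖-false : (X : Subset n) → anyV (⊥ ∖ X) ≡ false
  ∅∖-false X = trans (cong anyV (VecP.zipWith-zeroˡ {e = false} (λ _ → refl) X)) (anyV-⊥ n)

  ⊆-reflects : ∀ {d} (a b : SE d) ρ → Reflects (∀ i → i ∈ ⟦ a ⟧S ρ → i ∈ ⟦ b ⟧S ρ) (⟦ a ⊆′ b ⟧B ρ)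
  ⊆-reflects a b ρ = reflects-map
    (λ ¬p i i∈a → Dec.decidable-stable (i S.∈? ⟦ b ⟧S ρ) (λ i∉b → ¬p (i , ∈-∖⁺ i∈a i∉b)))
    (λ f (i , p) → let q , r = ∈-∖⁻ (⟦ a ⟧S ρ) (⟦ b ⟧S ρ) p in r (f i q))
    (Refl.¬-reflects (anyV-reflects (⟦ a ⟧S ρ ∖ ⟦ b ⟧S ρ)))

  ≐-reflects : ∀ {d} (a b : SE d) ρ → Reflects (⟦ a ⟧S ρ ≡ ⟦ b ⟧S ρ) (⟦ a ≐ b ⟧B ρ)
  ≐-reflects a b ρ = reflects-map (λ (f , g) → S.⊆-antisym (f _) (g _)) (λ eq → (λ i → subst (i ∈_) eq) , (λ i → subst (i ∈_) (sym eq)))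
    (⊆-reflects a b ρ Refl.×-reflects ⊆-reflects b a ρ)

  existsL-reflects : ∀ {d} (φ : BE (2 + d)) ρ {P : Subset n × Subset n → Set} →
    (∀ X R → Reflects (P (X , R)) (⟦ φ ⟧B (R ∷ X ∷ ρ))) → Reflects (∃[ E ] (E ∈ₗ Es × P E)) (⟦ existsL φ ⟧B ρ)
  existsL-reflects φ ρ r = anyUntil-reflects (λ _ → anyV-⊥ n) (λ (X , R) → r X R) Es

  exists-elem : ∀ {d} (φ : BE (1 + d)) ρ {P : Subset n → Set} → (∀ x → Reflects (P x) (⟦ φ ⟧B (x ∷ ρ))) →
    Reflects (∃[ x ] (x ∈ₗ elems n × P x)) (⟦ existsE φ ⟧B ρ)
  exists-elem φ ρ r = anyUntil-reflects (λ _ → anyV-⊥ n) r (elems n)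

  -- The loop also offers the empty set, which stands for no element; the second hypothesis makes
  -- sure that it is rejected. The intersection and difference guards in `exists∈` and `exists∉` see
  -- to that.
  existsE-reflects : ∀ {d} (φ : BE (1 + d)) ρ {P : Fin n → Set} → (∀ i → Reflects (P i) (⟦ φ ⟧B (⁅ i ⁆ ∷ ρ))) →
    ⟦ φ ⟧B (⊥ ∷ ρ) ≡ false → Reflects (∃ P) (⟦ existsE φ ⟧B ρ)
  existsE-reflects φ ρ {P} r r∅ = reflects-map to from (exists-elem φ ρ {λ x → ⟦ φ ⟧B (x ∷ ρ) ≡ true} (λ x → bool _))
    where
    bool : ∀ b → Reflects (b ≡ true) b
    bool true  = ofʸ refl
    bool false = ofⁿ λ ()
    to : ∃[ x ] (x ∈ₗ elems n × ⟦ φ ⟧B (x ∷ ρ) ≡ true) → ∃ P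
    to (x , p , q) with ∈elems⁻ p
    ... | inj₁ (i , refl) = i , Refl.invert (subst (Reflects (P i)) q (r i))
    ... | inj₂ refl       = contradiction (trans (sym r∅) q) λ ()
    from : ∃ P → ∃[ x ] (x ∈ₗ elems n × ⟦ φ ⟧B (x ∷ ρ) ≡ true)
    from (i , p) = ⁅ i ⁆ , ⁅⁆∈elems i , Refl.det (r i) (ofʸ p)

  exists∈ : ∀ {d} (k : Fin d) (ψ : BE (1 + d)) ρ {P : Fin n → Set} → (∀ i → Reflects (P i) (⟦ ψ ⟧B (⁅ i ⁆ ∷ ρ))) →
    Reflects (∃[ i ] (i ∈ lookup ρ k × P i)) (⟦ existsE (andB (some (x0 ∩′ var (suc k))) ψ) ⟧B ρ)
  exists∈ k ψ ρ r = existsE-reflects (andB (some (x0 ∩′ var (suc k))) ψ) ρ (λ i → ∩-reflects i (lookup ρ k) Refl.×-reflects r i)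
    (cong (_∧ ⟦ ψ ⟧B (⊥ ∷ ρ)) (∅∩-false (lookup ρ k)))

  exists∉ : ∀ {d} (k : Fin d) (ψ : BE (1 + d)) ρ {P : Fin n → Set} → (∀ i → Reflects (P i) (⟦ ψ ⟧B (⁅ i ⁆ ∷ ρ))) →
    Reflects (∃[ i ] (i ∉ lookup ρ k × P i)) (⟦ existsE (andB (some (x0 ∖′ var (suc k))) ψ) ⟧B ρ)
  exists∉ k ψ ρ r = existsE-reflects (andB (some (x0 ∖′ var (suc k))) ψ) ρ (λ i → ∖-reflects i (lookup ρ k) Refl.×-reflects r i)
    (cong (_∧ ⟦ ψ ⟧B (⊥ ∷ ρ)) (∅∖-false (lookup ρ k)))

  module Correct (M : Matroid n) (ind : Oracle) (ind-ok : ∀ {d} X (ρ : Vec (Subset n) d) → Reflects (Independent M X) (⟦ ind ⟧B (X ∷ ρ))) where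
    open Matroid M
    open Theory M
    open Predicates ind

    -- A rejected element of `X` is dependent on the set built at that time, hence on the larger
    -- final set, which is therefore maximal. The step function is known only through its two
    -- possible effects, which keeps the evaluated test out of the induction.
    greedy : (g : Subset n → Subset n → Subset n) (X : Subset n) →
      (∀ A i → (i ∈ X × Independent M (A ⊕ i) × g A ⁅ i ⁆ ≡ A ⊕ i) ⊎ (¬ (i ∈ X × Independent M (A ⊕ i)) × g A ⁅ i ⁆ ≡ A)) →
      (∀ A → g A ⊥ ≡ A) → BasisOf (foldl g ⊥ (elems n)) X
    greedy g X step step∅ = maximal⇒basisOf (proj₁ inv) (proj₁ (proj₂ inv)) (λ e p q → proj₂ (proj₂ (proj₂ inv)) e p q (⁅⁆∈elems e))
      where
      Inv : Subset n → List (Subset n) → Subset n → Set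
      Inv A xs J = (∀ {i} → i ∈ J → i ∈ X) × Independent M J × (∀ {i} → i ∈ A → i ∈ J)
        × (∀ e → e ∈ X → e ∉ J → ⁅ e ⁆ ∈ₗ xs → ¬ Independent M (J ⊕ e))
      go : ∀ xs A → (∀ x → x ∈ₗ xs → x ∈ₗ elems n) → (∀ {i} → i ∈ A → i ∈ X) → Independent M A → Inv A xs (foldl g A xs)
      go [] A xs⊆ A⊆X iA = A⊆X , iA , id , λ _ _ _ ()
      go (x ∷ xs) A xs⊆ A⊆X iA with ∈elems⁻ (xs⊆ x (here refl))
      ... | inj₂ refl rewrite step∅ A with go xs A (λ y y∈ → xs⊆ y (there y∈)) A⊆X iA
      ...   | J⊆X , iJ , A⊆J , mx = J⊆X , iJ , A⊆J ,
              λ { e p q (here eq) → contradiction (subst (e ∈_) eq (S.x∈⁅x⁆ e)) S.∉⊥ ; e p q (there r) → mx e p q r }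
      go (x ∷ xs) A xs⊆ A⊆X iA | inj₁ (i , refl) with step A i
      ... | inj₁ (i∈X , iAi , eq) rewrite eq with go xs (A ⊕ i) (λ y y∈ → xs⊆ y (there y∈)) (⊕-⊆ A⊆X i∈X) iAi
      ...   | J⊆X , iJ , A⊆J , mx = J⊆X , iJ , A⊆J ∘ ⊆-⊕ A i , λ
              { e p q (here eq′) → contradiction (A⊆J (subst (e ∈_) (cong (A ∪_) eq′) (∈-⊕ A e))) q ; e p q (there r) → mx e p q r }
      go (x ∷ xs) A xs⊆ A⊆X iA | inj₁ (i , refl) | inj₂ (no-i , eq) rewrite eq with go xs A (λ y y∈ → xs⊆ y (there y∈)) A⊆X iA
      ...   | J⊆X , iJ , A⊆J , mx = J⊆X , iJ , A⊆J , λ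
              { e p q (here eq′) iJe → no-i (subst (_∈ X) (S.x∈⁅y⁆⇒x≡y i (subst (e ∈_) eq′ (S.x∈⁅x⁆ e))) p
                                            , ind-⊆ (λ {j} r → subst (λ s → j ∈ foldl g A xs ∪ s) (sym eq′) (⊆-∪ A⊆J r)) iJe)
              ; e p q (there r) → mx e p q r }
        where
        ⊆-∪ : ∀ {J} → (∀ {i} → i ∈ A → i ∈ J) → A ⊕ i ⊆ J ∪ ⁅ i ⁆
        ⊆-∪ = ⊕-mono
      inv = go (elems n) ⊥ (λ _ p → p) (λ p → contradiction p S.∉⊥) ind-⊥

    basisE-ok : ∀ {d} (a : SE d) ρ → BasisOf (⟦ basisE a ⟧S ρ) (⟦ a ⟧S ρ)
    basisE-ok a ρ = greedy _ X inc (λ A → cong (λ b → if b ∧ ⟦ ind ⟧B ((A ∪ ⊥) ∷ ⊥ ∷ A ∷ X ∷ ρ) then A ∪ ⊥ else A) (∅∩-false X))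
      where
      X = ⟦ a ⟧S ρ
      inc : ∀ A i → _
      inc A i = pick (∩-reflects i X Refl.×-reflects ind-ok (A ⊕ i) (⁅ i ⁆ ∷ A ∷ X ∷ ρ))
        where
        pick : ∀ {b} → Reflects (i ∈ X × Independent M (A ⊕ i)) b →
          (i ∈ X × Independent M (A ⊕ i) × (if b then A ⊕ i else A) ≡ A ⊕ i) ⊎ (¬ (i ∈ X × Independent M (A ⊕ i)) × (if b then A ⊕ i else A) ≡ A)
        pick (ofʸ (p , q)) = inj₁ (p , q , refl)
        pick (ofⁿ ¬p)      = inj₂ (¬p , refl)

    spanB-ok : ∀ {d} (a : SE d) ρ → Reflects (Spanning M (⟦ a ⟧S ρ)) (⟦ spanB a ⟧B ρ)
    spanB-ok a ρ = reflects-map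
      (λ ¬ext → trans (sym (rank≡ b)) (rank-closure S.⊆⊤ (λ e _ → Dec.decidable-stable (_ ℕ.≤? _) (λ ¬le → ¬ext (e , out e ¬le)))))
      (λ sp (e , e∉I , iIe) → ℕ.<⇒≱ (ℕ.≤-reflexive (sym (ind-rank-⊕ e∉I (indep b) iIe)))
         (ℕ.≤-trans (R2 (I ⊕ e) ⊤ S.⊆⊤) (ℕ.≤-reflexive (trans (sym sp) (sym (rank≡ b))))))
      (Refl.¬-reflects (exists∉ zero (letB (x1 ∪′ x0) ind) (I ∷ ρ) (λ i → ind-ok (I ⊕ i) (⁅ i ⁆ ∷ I ∷ ρ))))
      where
      I = ⟦ basisE a ⟧S ρ
      b = basisE-ok a ρ
      out : ∀ e → ¬ (rank (I ⊕ e) ≤ rank I) → e ∉ I × Independent M (I ⊕ e)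
      out e ¬le = (λ p → ¬le (ℕ.≤-reflexive (cong rank (⊕-∈ p)))) , Dec.decidable-stable (ind? (I ⊕ e)) (λ d → ¬le (dep-rank-⊕ (indep b) d))

    flatB-ok : ∀ {d} (a : SE d) ρ → Reflects (Flat M (⟦ a ⟧S ρ)) (⟦ flatB a ⟧B ρ)
    flatB-ok a ρ = reflects-map
      (λ ¬ext e e∉X → grow e e∉X (Dec.decidable-stable (ind? (I ⊕ e)) (λ d → ¬ext (e , e∉X , d))))
      (λ f (e , e∉X , d) → ℕ.<⇒≱ (f e e∉X) (basis-rank-⊕ b (dep-rank-⊕ (indep b) d)))
      (Refl.¬-reflects (exists∉ (suc zero) (notB (letB (x1 ∪′ x0) ind)) (I ∷ X ∷ ρ) (λ i → Refl.¬-reflects (ind-ok (I ⊕ i) (⁅ i ⁆ ∷ I ∷ X ∷ ρ)))))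
      where
      X = ⟦ a ⟧S ρ
      I = ⟦ basisE x0 ⟧S (X ∷ ρ)
      b = basisE-ok x0 (X ∷ ρ)
      grow : ∀ e → e ∉ X → Independent M (I ⊕ e) → rank X < rank (X ⊕ e)
      grow e e∉X i = ℕ.≤-trans (ℕ.≤-reflexive (trans (cong suc (sym (rank≡ b))) (sym (ind-rank-⊕ (e∉X ∘ sub b) (indep b) i)))) (R2 _ _ (⊕-mono (sub b)))

    circB-ok : ∀ {d} (a : SE d) ρ → Reflects (Circuit M (⟦ a ⟧S ρ)) (⟦ circB a ⟧B ρ)
    circB-ok a ρ = reflects-map
      (λ (d , ¬ex) → circuit-intro d (λ e p → Dec.decidable-stable (ind? (X ⊖ e)) (λ q → ¬ex (e , p , q))))
      (λ c → proj₁ c , λ (e , p , q) → q (circuit-⊖ c p))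
      (Refl.¬-reflects (ind-ok X ρ) Refl.×-reflects
        Refl.¬-reflects (exists∈ zero (notB (letB (x1 ∖′ x0) ind)) (X ∷ ρ) (λ i → Refl.¬-reflects (ind-ok (X ⊖ i) (⁅ i ⁆ ∷ X ∷ ρ)))))
      where X = ⟦ a ⟧S ρ

    cycB-ok : ∀ {d} (a : SE d) ρ → Reflects (CyclicFlat M (⟦ a ⟧S ρ)) (⟦ cycB a ⟧B ρ)
    cycB-ok a ρ = reflects-map
      (λ (f , ¬ex) → Equivalence.from (cyclic⇔ X) (f , λ e p → Dec.decidable-stable (_ ℕ.≟ _) (λ neq → ¬ex (e , p , coloop e p neq))))
      (λ c → let f , r = Equivalence.to (cyclic⇔ X) c in f , λ (e , p , i) → ℕ.<-irrefl (r e p) (small e p i))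
      (flatB-ok x0 (X ∷ ρ) Refl.×-reflects
        Refl.¬-reflects (exists∈ zero (letB (basisE (x1 ∖′ x0)) (letB (x0 ∪′ x1) ind)) (X ∷ ρ) (λ i → ind-ok (I i ⊕ i) (I i ∷ ⁅ i ⁆ ∷ X ∷ ρ))))
      where
      X = ⟦ a ⟧S ρ
      I : Fin n → Subset n
      I i = ⟦ basisE (x1 ∖′ x0) ⟧S (⁅ i ⁆ ∷ X ∷ ρ)
      b : ∀ i → BasisOf (I i) (X ⊖ i)
      b i = basisE-ok (x1 ∖′ x0) (⁅ i ⁆ ∷ X ∷ ρ)
      small : ∀ e → e ∈ X → Independent M (I e ⊕ e) → rank (X ⊖ e) < rank X
      small e p i = ℕ.≤-trans (ℕ.≤-reflexive (trans (cong suc (sym (rank≡ (b e)))) (sym (ind-rank-⊕ (λ q → ∉-⊖ X e (sub (b e) q)) (indep (b e)) i))))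
        (R2 _ _ (⊕-⊆ (⊖-⊆ X e ∘ sub (b e)) p))
      coloop : ∀ e → e ∈ X → rank (X ⊖ e) ≢ rank X → Independent M (I e ⊕ e)
      coloop e p neq = Dec.decidable-stable (ind? (I e ⊕ e)) λ d → neq (ℕ.≤-antisym (R2 _ _ (⊖-⊆ X e))
        (ℕ.≤-trans (ℕ.≤-reflexive (cong rank (sym (⊖-⊕ p)))) (basis-rank-⊕ (b e) (dep-rank-⊕ (indep (b e)) d))))

    hypB-ok : ∀ {d} (a : SE d) ρ → Reflects (Hyperplane M (⟦ a ⟧S ρ)) (⟦ hypB a ⟧B ρ)
    hypB-ok a ρ = reflects-map
      (λ (f , e , e∉X , sp) → f , trans (sym (inc f e e∉X)) sp)
      (λ (f , eq) → f , proper f eq)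
      (flatB-ok x0 (X ∷ ρ) Refl.×-reflects
        exists∉ zero (spanB (x1 ∪′ x0)) (X ∷ ρ) (λ i → spanB-ok (x1 ∪′ x0) (⁅ i ⁆ ∷ X ∷ ρ)))
      where
      X = ⟦ a ⟧S ρ
      inc : Flat M X → ∀ e → e ∉ X → rank (X ⊕ e) ≡ suc (rank X)
      inc f e e∉X = ℕ.≤-antisym (rank-⊕ X e) (f e e∉X)
      proper : Flat M X → suc (rank X) ≡ rank ⊤ → ∃[ e ] (e ∉ X × Spanning M (X ⊕ e))
      proper f eq with ¬⊆⇒∃ ⊤ X (λ s → ℕ.<-irrefl refl (ℕ.≤-trans (ℕ.≤-reflexive eq) (R2 ⊤ X (λ {i} → s i))))
      ... | e , _ , e∉X = e , e∉X , trans (inc f e e∉X) eq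

    indB-ok : ∀ {d} (a : SE d) ρ → Reflects (Independent M (⟦ a ⟧S ρ)) (⟦ indB a ⟧B ρ)
    indB-ok a ρ = ind-ok (⟦ a ⟧S ρ) ρ

    targetB-ok : ∀ J {d} (a : SE d) ρ → Reflects (Target J M (⟦ a ⟧S ρ)) (⟦ targetB J a ⟧B ρ)
    targetB-ok RANK                  a ρ = subst (λ b → Reflects 𝟏 (not b)) (sym (anyV-⊥ n)) (ofʸ tt)
    targetB-ok INDEPENDENT-SETS      a ρ = indB-ok a ρ
    targetB-ok SPANNING-SETS         a ρ = spanB-ok a ρ
    targetB-ok BASES                 a ρ = indB-ok a ρ Refl.×-reflects spanB-ok a ρ
    targetB-ok FLATS                 a ρ = flatB-ok a ρ
    targetB-ok CIRCUITS              a ρ = circB-ok a ρ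
    targetB-ok HYPERPLANES           a ρ = hypB-ok a ρ
    targetB-ok NON-SPANNING-CIRCUITS a ρ = circB-ok a ρ Refl.×-reflects Refl.¬-reflects (spanB-ok a ρ)
    targetB-ok DEPENDENT-HYPERPLANES a ρ = hypB-ok a ρ Refl.×-reflects Refl.¬-reflects (indB-ok a ρ)
    targetB-ok CYCLIC-FLATS          a ρ = cycB-ok a ρ

-- Output of the sets found, without repetitions

_≟S_ : ∀ {n} (X Y : Subset n) → Dec (X ≡ Y)
_≟S_ = VecP.≡-dec 𝔹._≟_

-- What the rest of a run prints from some point on: `Seen` holds the candidates that have already
-- come up, `Cand` those that are still to come. Completeness concerns only the latter, so a listing
-- can be built from its end.
record Listing {n} (enc : Subset n → Word) (T Seen Cand : Subset n → Set) (w : Word) : Set where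
  constructor listing
  field
    list     : List (Subset n)
    word≡    : w ≡ concatMap enc list
    unique   : Unique list
    sound    : ∀ {X} → X ∈ₗ list → T X × ¬ Seen X
    complete : ∀ {X} → Cand X → T X → ¬ Seen X → X ∈ₗ list
open Listing

module _ {n : ℕ} {enc : Subset n → Word} {T : Subset n → Set} where

  listing-[] : ∀ {Seen Cand} → (∀ X → ¬ Cand X) → Listing enc T Seen Cand []
  listing-[] none = listing [] refl [] (λ ()) (λ c → contradiction c (none _))

  listing-map : ∀ {Seen Seen′ Cand Cand′ w} → (∀ {X} → Seen X → Seen′ X) → (∀ {X} → Seen′ X → Seen X) → (∀ {X} → Cand′ X → Cand X) →
    Listing enc T Seen Cand w → Listing enc T Seen′ Cand′ w
  listing-map f g h (listing L eq u s c) = listing L eq u (λ p → proj₁ (s p) , proj₂ (s p) ∘ g) (λ cX tX nX → c (h cX) tX (nX ∘ f))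

  listing-∷ : ∀ {Seen Cand w c b} → Reflects (T c × ¬ Seen c) b → Listing enc T (λ X → Seen X ⊎ X ≡ c) Cand w →
    Listing enc T Seen (λ X → X ≡ c ⊎ Cand X) ((if b then enc c else []) ++ w)
  listing-∷ {c = c} (ofʸ (t , ns)) (listing L eq u s k) = listing (c ∷ L) (cong (enc c ++_) eq)
    (All.tabulate (λ p q → proj₂ (s p) (inj₂ (sym q))) ∷ u)
    (λ { (here refl) → t , ns ; (there p) → proj₁ (s p) , proj₂ (s p) ∘ inj₁ }) done′
    where
    done′ : ∀ {X} → X ≡ c ⊎ _ → _ → _ → X ∈ₗ c ∷ L
    done′ (inj₁ refl) tX nX = here refl
    done′ {X} (inj₂ cX) tX nX with X ≟S c
    ... | yes refl = here refl
    ... | no X≢c   = there (k cX tX Sum.[ nX , X≢c ])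
  listing-∷ {c = c} (ofⁿ ¬p) (listing L eq u s k) = listing L eq u (λ p → proj₁ (s p) , proj₂ (s p) ∘ inj₁) done′
    where
    done′ : ∀ {X} → X ≡ c ⊎ _ → _ → _ → X ∈ₗ L
    done′ (inj₁ refl) tX nX = contradiction (tX , nX) ¬p
    done′ {X} (inj₂ cX) tX nX with X ≟S c
    ... | yes refl = contradiction (tX , nX) ¬p
    ... | no X≢c   = k cX tX Sum.[ nX , X≢c ]

emitSetO emitCardO : ∀ {d} → SE d → OP d
emitSetO a  = letO a (forE (ifO (some (x0 ∩′ x1)) (emit 𝟙) (ifO (some x0) (emit 𝟘) nop)) ⨟ emit sep)
emitCardO a = letO a (forE (ifO (some (x0 ∩′ x1)) (emit 𝟙) nop))

headerO : ∀ {d} → OP d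
headerO = emitCardO (con true) ⨟ emit bar

isCyclic : InputType → Bool
isCyclic CYCLIC-FLATS = true
isCyclic _            = false

hasRank : InputType → Bool
hasRank NON-SPANNING-CIRCUITS = true
hasRank DEPENDENT-HYPERPLANES = true
hasRank _                     = false

-- A candidate is computed from an element (variable 0, possibly ∅) and a listed set (variable 1).
Candidate : Set
Candidate = ∀ {d} → SE (2 + d)

-- A candidate is printed if it is of the kind `J` and differs from every candidate computed before
-- it, that is, from those of earlier listed sets with any element and those of the same set with an
-- earlier element. All of them are recomputed each time.
module Program (J : InputType) (ind : Oracle) (cand : Candidate) where
  open Predicates ind

  itemO : ∀ {d} → SE d → OP d
  itemO a = emitSetO a ⨟ (if isCyclic J then emitCardO (basisE a) ⨟ emit sep else nop)

  rankO : ∀ {d} → OP d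
  rankO = if hasRank J then emitCardO (basisE (con true)) ⨟ emit bar else nop

  -- in the context C ∷ e ∷ X ∷ …, where C is the candidate of (X, e)
  earlier-set earlier-elem : ∀ {d} → BE (3 + d)
  earlier-set  = anyL (x1 ≐ x4) (letB x1 (existsE (cand ≐ x4)))
  earlier-elem = letB x2 (anyE (x0 ≐ x3) (cand ≐ x2))

  blockO : ∀ {d} → OP (2 + d)
  blockO = letO cand (ifO (andB (targetB J x0) (notB (orB earlier-set earlier-elem))) (itemO x0) nop)

  program : OP 0
  -- The list loop binds the rank nearest. `letO x1` copies the set in front of it, so that inside
  -- the element loop the set is variable 1, where `cand` expects it.
  program = headerO ⨟ rankO ⨟ forL (letO x1 (forE blockO))

itemWord : InputType → ∀ {n} → Matroid n → Subset n → Word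
itemWord J M X = encSet X ++ (if isCyclic J then encℕ (Matroid.rank M X) ++ [ sep ] else [])

rankWord : InputType → ∀ {n} → Matroid n → Word
rankWord J M = if hasRank J then encℕ (r[M] M) ++ [ bar ] else []

concatMap-cong′ : ∀ {A : Set} {f g : A → Word} → (∀ x → f x ≡ g x) → ∀ xs → concatMap f xs ≡ concatMap g xs
concatMap-cong′ eq []       = refl
concatMap-cong′ eq (x ∷ xs) = cong₂ _++_ (eq x) (concatMap-cong′ eq xs)

concatMap-map′ : ∀ {A B : Set} (f : B → Word) (g : A → B) xs → concatMap f (map g xs) ≡ concatMap (f ∘ g) xs
concatMap-map′ f g []       = refl
concatMap-map′ f g (x ∷ xs) = cong (f (g x) ++_) (concatMap-map′ f g xs)

-- `RANK` is excluded because `itemWord` attaches ranks to cyclic flats only; no arc ends in `RANK`.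
describe : ∀ J {n} (M : Matroid n) L → J ≢ RANK → Enumerates (Target J M) L →
  Describes J M (header n ++ rankWord J M ++ concatMap (itemWord J M) L)
describe J {n} M L J≢RANK en = go J J≢RANK en
  where
  plain : concatMap (λ X → encSet X ++ []) L ≡ encSets L
  plain = concatMap-cong′ (λ X → ListP.++-identityʳ (encSet X)) L
  go : ∀ J → J ≢ RANK → Enumerates (Target J M) L → Describes J M (header n ++ rankWord J M ++ concatMap (itemWord J M) L)
  go RANK                  ne en = contradiction refl ne
  go INDEPENDENT-SETS      ne en = L , en , cong (header n ++_) plain
  go SPANNING-SETS         ne en = L , en , cong (header n ++_) plain
  go BASES                 ne en = L , en , cong (header n ++_) plain
  go FLATS                 ne en = L , en , cong (header n ++_) plain
  go CIRCUITS              ne en = L , en , cong (header n ++_) plain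
  go HYPERPLANES           ne en = L , en , cong (header n ++_) plain
  go NON-SPANNING-CIRCUITS ne en = L , en , cong (header n ++_) (trans (ListP.++-assoc (encℕ (r[M] M)) [ bar ] _) (cong (λ w → encℕ (r[M] M) ++ bar ∷ w) plain))
  go DEPENDENT-HYPERPLANES ne en = L , en , cong (header n ++_) (trans (ListP.++-assoc (encℕ (r[M] M)) [ bar ] _) (cong (λ w → encℕ (r[M] M) ++ bar ∷ w) plain))
  go CYCLIC-FLATS          ne en = L , en , refl

module Emission {n : ℕ} (Es : List (Subset n × Subset n)) where
  open Semantics Es
  open Reflection Es

  private
    bits : ∀ {m} → Word → Word → Subset m → Subset m → Word
    bits w v X x = if anyV (x ∩ X) then w else if anyV x then v else []

    head-bit : ∀ {m} c (X : Subset m) w v → bits w v (c ∷ X) (true ∷ ⊥) ≡ (if c then w else v)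
    head-bit true  X w v = refl
    head-bit {m} false X w v rewrite S.∩-zeroˡ X | anyV-⊥ m = refl

    emit-bits : ∀ {m} w v (X : Subset m) → concatMap (bits w v X) (elems m) ≡ concatMap (λ b → if b then w else v) (toList X)
    emit-bits w v [] = refl
    emit-bits {suc m} w v (c ∷ X) = trans (cong (concatMap (bits w v (c ∷ X))) (elems-suc m))
      (cong₂ _++_ (head-bit c X w v) (trans (concatMap-map′ (bits w v (c ∷ X)) (false ∷_) (elems m)) (emit-bits w v X)))

    emit-set : ∀ {m} (X : Subset m) → concatMap (λ b → if b then [ 𝟙 ] else [ 𝟘 ]) (toList X) ≡ map (λ b → if b then 𝟙 else 𝟘) (toList X)
    emit-set []          = refl
    emit-set (true ∷ X)  = cong (𝟙 ∷_) (emit-set X)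
    emit-set (false ∷ X) = cong (𝟘 ∷_) (emit-set X)

    emit-card : ∀ {m} (X : Subset m) → concatMap (λ b → if b then [ 𝟙 ] else []) (toList X) ≡ encℕ ∣ X ∣
    emit-card []          = refl
    emit-card (true ∷ X)  = cong (𝟙 ∷_) (emit-card X)
    emit-card (false ∷ X) = emit-card X

  emitSetO-ok : ∀ {d} (a : SE d) ρ → ⟦ emitSetO a ⟧O ρ ≡ encSet (⟦ a ⟧S ρ)
  emitSetO-ok a ρ = cong (_++ [ sep ]) (trans (emit-bits [ 𝟙 ] [ 𝟘 ] X) (emit-set X))
    where X = ⟦ a ⟧S ρ

  emitCardO-ok : ∀ {d} (a : SE d) ρ → ⟦ emitCardO a ⟧O ρ ≡ encℕ ∣ ⟦ a ⟧S ρ ∣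
  emitCardO-ok a ρ = trans (concatMap-cong′ same (elems n)) (trans (emit-bits [ 𝟙 ] [] X) (emit-card X))
    where
    X = ⟦ a ⟧S ρ
    same : ∀ x → (if anyV (x ∩ X) then [ 𝟙 ] else []) ≡ bits [ 𝟙 ] [] X x
    same x with anyV (x ∩ X) | anyV x
    ... | true  | _     = refl
    ... | false | true  = refl
    ... | false | false = refl

  headerO-ok : ∀ {d} (ρ : Vec (Subset n) d) → ⟦ headerO ⟧O ρ ≡ header n
  headerO-ok ρ = cong (_++ [ bar ]) (trans (emitCardO-ok (con true) ρ) (cong encℕ (S.∣⊤∣≡n n)))

  module Generate (J : InputType) (J≢RANK : J ≢ RANK) (M : Matroid n) (ind : Oracle) (cand : Candidate)
             (ind-ok : ∀ {d} X (ρ : Vec (Subset n) d) → Reflects (Independent M X) (⟦ ind ⟧B (X ∷ ρ)))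
             (F : Subset n → Subset n → Subset n)
             (cand-ok : ∀ {d} X e (ρ : Vec (Subset n) d) → ⟦ cand ⟧S (e ∷ X ∷ ρ) ≡ F X e)
             (unique-Es : Unique (map proj₁ Es))
             (covers : ∀ Y → Target J M Y → ∃[ E ] (E ∈ₗ Es × ∃[ e ] (e ∈ₗ elems n × F (proj₁ E) e ≡ Y)))
             where
    open Matroid M
    open Theory M
    open Predicates ind
    open Correct M ind ind-ok
    open Program J ind cand

    itemO-ok : ∀ {d} (a : SE d) ρ → ⟦ itemO a ⟧O ρ ≡ itemWord J M (⟦ a ⟧S ρ)
    itemO-ok a ρ = cong₂ _++_ (emitSetO-ok a ρ) (go (isCyclic J))
      where
      b = basisE-ok a ρ
      go : ∀ c → ⟦ (if c then emitCardO (basisE a) ⨟ emit sep else nop) ⟧O ρ ≡ (if c then encℕ (rank (⟦ a ⟧S ρ)) ++ [ sep ] else [])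
      go true  = cong (_++ [ sep ]) (trans (emitCardO-ok (basisE a) ρ) (cong encℕ (trans (sym (indep b)) (rank≡ b))))
      go false = refl

    rankO-ok : ∀ {d} (ρ : Vec (Subset n) d) → ⟦ rankO ⟧O ρ ≡ rankWord J M
    rankO-ok ρ = go (hasRank J)
      where
      b = basisE-ok (con true) ρ
      go : ∀ c → ⟦ (if c then emitCardO (basisE (con true)) ⨟ emit bar else nop) ⟧O ρ ≡ (if c then encℕ (r[M] M) ++ [ bar ] else [])
      go true  = cong (_++ [ bar ]) (trans (emitCardO-ok (basisE (con true)) ρ) (cong encℕ (trans (sym (indep b)) (rank≡ b))))
      go false = refl

    SeenBy : List (Subset n × Subset n) → Subset n → List (Subset n) → Subset n → Set
    SeenBy pre X preE C = (∃[ E ] (E ∈ₗ pre × ∃[ e ] (e ∈ₗ elems n × F (proj₁ E) e ≡ C))) ⊎ (∃[ e ] (e ∈ₗ preE × F X e ≡ C))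

    private
      test-ok : ∀ {d} pre X R post preE e postE (ρ : Vec (Subset n) d) → Es ≡ pre ++ (X , R) ∷ post → elems n ≡ preE ++ e ∷ postE →
        Reflects (Target J M (F X e) × ¬ SeenBy pre X preE (F X e))
                 (⟦ andB (targetB J x0) (notB (orB earlier-set earlier-elem)) ⟧B (F X e ∷ e ∷ X ∷ ρ))
      test-ok pre X R post preE e postE ρ eqE eqe = targetB-ok J x0 σ Refl.×-reflects
        Refl.¬-reflects (reflects-map
          (λ ¬¬p → Dec.decidable-stable (dec-reflects set-ok Dec.⊎-dec dec-reflects elem-ok) (λ ¬p → ¬¬p (¬p ∘ inj₁ , ¬p ∘ inj₂)))
          (λ p (¬a , ¬b) → Sum.[ ¬a , ¬b ] p)
          (Refl.¬-reflects (Refl.¬-reflects set-ok Refl.×-reflects Refl.¬-reflects elem-ok)))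
        where
        C = F X e
        σ : Vec (Subset n) _
        σ = C ∷ e ∷ X ∷ ρ
        fresh : ∀ {A : Set} (pre : List A) y post → Unique (pre ++ y ∷ post) → ∀ x → x ∈ₗ pre → x ≢ y
        fresh (z ∷ pre) y post (z∉ ∷ u) x (here refl) eq = All.lookup z∉ (∈ₗ.∈-++⁺ʳ pre (here refl)) eq
        fresh (z ∷ pre) y post (z∉ ∷ u) x (there p)   eq = fresh pre y post u x p eq
        hit-ok : ∀ {d} (ρ : Vec (Subset n) d) k X′ e′ → lookup ρ k ≡ C → Reflects (F X′ e′ ≡ C) (⟦ cand ≐ var (suc (suc k)) ⟧B (e′ ∷ X′ ∷ ρ))
        hit-ok ρ k X′ e′ eq = reflects-map (λ p → trans (sym (cand-ok X′ e′ ρ)) (trans p eq)) (λ p → trans (cand-ok X′ e′ ρ) (trans p (sym eq)))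
          (≐-reflects cand (var (suc (suc k))) (e′ ∷ X′ ∷ ρ))
        -- The search stops at the first listed set equal to `X`. Since the listed sets are
        -- distinct, that is the current one.
        set-ok : Reflects (∃[ E ] (E ∈ₗ pre × ∃[ e ] (e ∈ₗ elems n × F (proj₁ E) e ≡ C))) (⟦ earlier-set ⟧B σ)
        set-ok =
          anyUntil-before {Q = λ E → proj₁ E ≡ X} (λ (X′ , R′) → ≐-reflects x1 x4 (R′ ∷ X′ ∷ σ))
            (λ (X′ , R′) → exists-elem (cand ≐ x4) (X′ ∷ R′ ∷ X′ ∷ σ) (λ e′ → hit-ok (R′ ∷ X′ ∷ σ) (suc (suc zero)) X′ e′ refl))
            pre (X , R) post eqE
            (λ E p → fresh (map proj₁ pre) X (map proj₁ post) (subst Unique (trans (cong (map proj₁) eqE) (ListP.map-++ proj₁ pre _)) unique-Es) (proj₁ E) (∈ₗ.∈-map⁺ proj₁ p))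
            refl
        elem-ok : Reflects (∃[ e′ ] (e′ ∈ₗ preE × F X e′ ≡ C)) (⟦ earlier-elem ⟧B σ)
        elem-ok =
          anyUntil-before {Q = λ e′ → e′ ≡ e} (λ e′ → ≐-reflects x0 x3 (e′ ∷ X ∷ σ)) (λ e′ → hit-ok σ zero X e′ refl)
            preE e postE eqe (fresh preE e postE (subst Unique eqe (elems-unique n))) refl

      Seen : List (Subset n × Subset n) → Subset n → Set
      Seen pre C = ∃[ E ] (E ∈ₗ pre × ∃[ e ] (e ∈ₗ elems n × F (proj₁ E) e ≡ C))

      block : Subset n → Subset n → Subset n → Word
      block R X e = ⟦ blockO ⟧O (e ∷ X ∷ R ∷ X ∷ [])

      block-ok : ∀ pre X R post preE e postE → Es ≡ pre ++ (X , R) ∷ post → elems n ≡ preE ++ e ∷ postE →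
        ∃[ b ] (Reflects (Target J M (F X e) × ¬ SeenBy pre X preE (F X e)) b × block R X e ≡ (if b then itemWord J M (F X e) else []))
      block-ok pre X R post preE e postE eqE eqe = b , ok , trans (cong inside′ (cand-ok X e (R ∷ X ∷ [])))
          (cong (λ w → if b then w else []) (itemO-ok x0 (F X e ∷ e ∷ X ∷ R ∷ X ∷ [])))
        where
        inside′ : Subset n → Word
        inside′ C = ⟦ ifO (andB (targetB J x0) (notB (orB earlier-set earlier-elem))) (itemO x0) nop ⟧O (C ∷ e ∷ X ∷ R ∷ X ∷ [])
        b = ⟦ andB (targetB J x0) (notB (orB earlier-set earlier-elem)) ⟧B (F X e ∷ e ∷ X ∷ R ∷ X ∷ [])
        ok = test-ok pre X R post preE e postE (R ∷ X ∷ []) eqE eqe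

      inner : ∀ pre X R post preE postE {Cand w} → Es ≡ pre ++ (X , R) ∷ post → elems n ≡ preE ++ postE →
        Listing (itemWord J M) (Target J M) (SeenBy pre X (elems n)) Cand w →
        Listing (itemWord J M) (Target J M) (SeenBy pre X preE) (λ C → (∃[ e ] (e ∈ₗ postE × F X e ≡ C)) ⊎ Cand C) (concatMap (block R X) postE ++ w)
      inner pre X R post preE [] eqE eqe rest = listing-map (subst (λ l → SeenBy pre X l _) eq) (subst (λ l → SeenBy pre X l _) (sym eq))
        (λ { (inj₁ (_ , () , _)) ; (inj₂ c) → c }) rest
        where eq = trans eqe (ListP.++-identityʳ preE)
      inner pre X R post preE (e ∷ postE) {w = w} eqE eqe rest with block-ok pre X R post preE e postE eqE eqe
      ... | b , ok , eq = subst (Listing _ _ _ _) (trans (cong (_++ (concatMap (block R X) postE ++ w)) (sym eq)) (sym (ListP.++-assoc (block R X e) _ w)))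
        (listing-map id id (λ { (inj₁ (_ , here refl , q)) → inj₁ (sym q) ; (inj₁ (_ , there p , q)) → inj₂ (inj₁ (_ , p , q)) ; (inj₂ c) → inj₂ (inj₂ c) })
          (listing-∷ ok (listing-map to from id
            (inner pre X R post (preE ++ [ e ]) postE eqE (trans eqe (sym (ListP.++-assoc preE [ e ] postE))) rest))))
        where
        to : ∀ {C} → SeenBy pre X (preE ++ [ e ]) C → SeenBy pre X preE C ⊎ C ≡ F X e
        to (inj₁ s) = inj₁ (inj₁ s)
        to (inj₂ (e′ , p , q)) with ∈ₗ.∈-++⁻ preE p
        ... | inj₁ r           = inj₁ (inj₂ (e′ , r , q))
        ... | inj₂ (here refl) = inj₂ (sym q)
        from : ∀ {C} → SeenBy pre X preE C ⊎ C ≡ F X e → SeenBy pre X (preE ++ [ e ]) C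
        from (inj₁ (inj₁ s))            = inj₁ s
        from (inj₁ (inj₂ (e′ , p , q))) = inj₂ (e′ , ∈ₗ.∈-++⁺ˡ p , q)
        from (inj₂ refl)                = inj₂ (e , ∈ₗ.∈-++⁺ʳ preE (here refl) , refl)

      outer : ∀ pre post → Es ≡ pre ++ post →
        Listing (itemWord J M) (Target J M) (Seen pre) (Seen post) (concatMap (λ (X , R) → concatMap (block R X) (elems n)) post)
      outer pre [] eq = listing-[] λ { X (_ , () , _) }
      outer pre ((X , R) ∷ post) eq = listing-map (λ { (inj₁ s) → s ; (inj₂ (_ , () , _)) }) inj₁
        (λ { (_ , here refl , e , p , q) → inj₁ (e , p , q) ; (E , there r , s) → inj₂ (E , r , s) })
        (inner pre X R post [] (elems n) eq refl
          (listing-map to from id (outer (pre ++ [ X , R ]) post (trans eq (sym (ListP.++-assoc pre [ X , R ] post))))))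
        where
        to : ∀ {C} → Seen (pre ++ [ X , R ]) C → SeenBy pre X (elems n) C
        to (E , p , s) with ∈ₗ.∈-++⁻ pre p
        ... | inj₁ r           = inj₁ (E , r , s)
        ... | inj₂ (here refl) = inj₂ s
        from : ∀ {C} → SeenBy pre X (elems n) C → Seen (pre ++ [ X , R ]) C
        from (inj₁ (E , p , s)) = E , ∈ₗ.∈-++⁺ˡ p , s
        from (inj₂ s)           = (X , R) , ∈ₗ.∈-++⁺ʳ pre (here refl) , s

    program-ok : Describes J M (⟦ program ⟧O [])
    program-ok with outer [] Es refl
    ... | listing L eq u s k = subst (Describes J M) (sym (cong₂ _++_ (headerO-ok []) (cong₂ _++_ (rankO-ok []) eq)))
      (describe J M L J≢RANK (u , λ X → mk⇔ (proj₁ ∘ s) (λ t → k (covers X t) t λ { (_ , () , _) })))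

-- Weights, closures, fundamental circuits and activities

wsum : ∀ {n} → (Fin n → ℕ) → Subset n → ℕ
wsum w []          = 0
wsum w (true ∷ X)  = w zero + wsum (w ∘ suc) X
wsum w (false ∷ X) = wsum (w ∘ suc) X

wsum-≤ : ∀ {n} (w : Fin n → ℕ) X → wsum w X ≤ wsum w ⊤
wsum-≤ w []          = z≤n
wsum-≤ w (true ∷ X)  = ℕ.+-monoʳ-≤ (w zero) (wsum-≤ (w ∘ suc) X)
wsum-≤ w (false ∷ X) = ℕ.m≤n⇒m≤o+n (w zero) (wsum-≤ (w ∘ suc) X)

wsum-⊕ : ∀ {n} (w : Fin n → ℕ) {X : Subset n} {e} → e ∉ X → wsum w (X ⊕ e) ≡ w e + wsum w X
wsum-⊕ w {true ∷ X}  {zero}  e∉X = contradiction here e∉X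
wsum-⊕ w {false ∷ X} {zero}  e∉X = cong (λ Y → w zero + wsum (w ∘ suc) Y) (S.∪-identityʳ X)
wsum-⊕ w {true ∷ X}  {suc e} e∉X = trans (cong (w zero +_) (wsum-⊕ (w ∘ suc) (e∉X ∘ there))) (swap (w zero) (w (suc e)) _)
  where
  swap : ∀ a b c → a + (b + c) ≡ b + (a + c)
  swap = solve-∀
wsum-⊕ w {false ∷ X} {suc e} e∉X = wsum-⊕ (w ∘ suc) (e∉X ∘ there)

wsum-⊖ : ∀ {n} (w : Fin n → ℕ) {X : Subset n} {e} → e ∈ X → w e + wsum w (X ⊖ e) ≡ wsum w X
wsum-⊖ w {X} {e} p = trans (sym (wsum-⊕ w (∉-⊖ X e))) (cong (wsum w) (⊖-⊕ p))

bit⇒∈ : ∀ {n} {X : Subset n} {i} → lookup X i ≡ true → i ∈ X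
bit⇒∈ {X = X} {i} eq = subst (λ b → X Vec.[ i ]= b) eq (VecP.lookup⇒[]= i X refl)

module Closure {n : ℕ} (M : Matroid n) where
  open Matroid M
  open Theory M

  cl : Subset n → Subset n
  cl Y = Vec.tabulate (λ i → does (rank (Y ⊕ i) ℕ.≤? rank Y))

  ∈-cl⁺ : ∀ {Y i} → rank (Y ⊕ i) ≤ rank Y → i ∈ cl Y
  ∈-cl⁺ {Y} {i} le = bit⇒∈ (trans (VecP.lookup∘tabulate _ i) (Dec.dec-true (_ ℕ.≤? _) le))

  ∈-cl⁻ : ∀ {Y i} → i ∈ cl Y → rank (Y ⊕ i) ≤ rank Y
  ∈-cl⁻ {Y} {i} p = Dec.decidable-stable (_ ℕ.≤? _) λ ¬le →
    contradiction (trans (sym (VecP.[]=⇒lookup p)) (trans (VecP.lookup∘tabulate _ i) (Dec.dec-false (rank (Y ⊕ i) ℕ.≤? rank Y) ¬le))) λ ()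

  ⊆-cl : ∀ Y → Y ⊆ cl Y
  ⊆-cl Y p = ∈-cl⁺ (ℕ.≤-reflexive (cong rank (⊕-∈ p)))

  rank-cl : ∀ Y → rank Y ≡ rank (cl Y)
  rank-cl Y = rank-closure (⊆-cl Y) (λ e p → ∈-cl⁻ p)

  cl-flat : ∀ Y → Flat M (cl Y)
  cl-flat Y e e∉ = ℕ.<-≤-trans (ℕ.≤-<-trans (ℕ.≤-reflexive (sym (rank-cl Y))) (ℕ.≰⇒> (e∉ ∘ ∈-cl⁺))) (R2 _ _ (⊕-mono (⊆-cl Y)))

  flat-cl : ∀ {I Y} → Flat M Y → BasisOf I Y → cl I ≡ Y
  flat-cl {I} {Y} f b = S.⊆-antisym (λ p → flat-closed f _ (basis-rank-⊕ b (∈-cl⁻ p)))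
    (λ p → ∈-cl⁺ (ℕ.≤-trans (R2 _ _ (⊕-⊆ (sub b) p)) (ℕ.≤-reflexive (sym (rank≡ b)))))

  cl-hyperplane : ∀ {B e} → Basis M B → e ∈ B → Hyperplane M (cl (B ⊖ e)) × e ∉ cl (B ⊖ e)
  cl-hyperplane {B} {e} (iB , sB) p =
    (cl-flat (B ⊖ e) , trans (cong suc (sym (rank-cl (B ⊖ e)))) (trans up sB)) ,
    λ q → ℕ.<⇒≱ (ind⇒rank-⊖ iB p) (ℕ.≤-trans (ℕ.≤-reflexive (cong rank (sym (⊖-⊕ p)))) (∈-cl⁻ q))
    where
    up : suc (rank (B ⊖ e)) ≡ rank B
    up = ℕ.≤-antisym (ind⇒rank-⊖ iB p) (rank-⊖ p)

  hyperplane-basis : ∀ {H} → Hyperplane M H → ∃[ B ] ∃[ e ] (Basis M B × cl (B ⊖ e) ≡ H × Independent M (B ⊖ e))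
  hyperplane-basis {H} (f , eq) with ¬⊆⇒∃ ⊤ H (λ s → ℕ.<-irrefl refl (ℕ.≤-trans (ℕ.≤-reflexive eq) (R2 ⊤ H (λ {i} → s i)))) | basis-exists H
  ... | e , _ , e∉H | I , b = I ⊕ e , e , (iIe , trans (ind-rank-⊕ e∉I (indep b) iIe) (trans (cong suc (rank≡ b)) eq)) ,
        trans (cong cl I⊕e⊖e) (flat-cl f b) , subst (Independent M) (sym I⊕e⊖e) (indep b)
    where
    e∉I : e ∉ I
    e∉I = e∉H ∘ sub b
    iIe : Independent M (I ⊕ e)
    iIe = Dec.decidable-stable (ind? (I ⊕ e)) (λ d → ℕ.<⇒≱ (f e e∉H) (basis-rank-⊕ b (dep-rank-⊕ (indep b) d)))
    I⊕e⊖e : I ⊕ e ⊖ e ≡ I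
    I⊕e⊖e = S.⊆-antisym (λ p → Sum.[ id , (λ q → contradiction q (proj₂ (∈-⊖⁻ (I ⊕ e) e p))) ] (∈-⊕⁻ I e (⊖-⊆ (I ⊕ e) e p)))
      (⊆-⊖ (⊆-⊕ I e) e∉I)

  -- Extending `C ⊖ e` to a basis `B` makes `C` the fundamental circuit of `e` with respect to `B`.
  -- Its other members are the elements of `B` that can be exchanged for `e`, and this is what
  -- `cand-circ` collects.
  circuit-basis : ∀ {C} → Circuit M C → ∃[ B ] ∃[ e ] (Basis M B × e ∈ C
    × (∀ i → i ∈ C → i ≢ e → i ∈ B × Independent M ((B ⊕ e) ⊖ i)) × (∀ i → i ∈ B → Independent M ((B ⊕ e) ⊖ i) → i ∈ C))
  circuit-basis {C} cC with ¬⊆⇒∃ C ⊥ (λ s → proj₁ cC (ind-⊆ (λ {i} → s i) ind-⊥))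
  ... | e , e∈C , _ with extend-basis (circuit-⊖ cC e∈C)
  ... | B , bB , s = B , e , bB , e∈C , fwd , bwd
    where
    C⊆Be : C ⊆ B ⊕ e
    C⊆Be p = ⊕-mono s (subst (_ ∈_) (sym (⊖-⊕ e∈C)) p)
    e∉B : e ∉ B
    e∉B p = proj₁ cC (ind-⊆ (λ q → ⊕-⊆ id p (C⊆Be q)) (proj₁ bB))
    fwd : ∀ i → i ∈ C → i ≢ e → i ∈ B × Independent M ((B ⊕ e) ⊖ i)
    fwd i p i≢e = s (∈-⊖⁺ p i≢e) , ℕ.≤-antisym (R1 _) (begin
      ∣ (B ⊕ e) ⊖ i ∣     ≡⟨ ℕ.suc-injective (trans (card-⊖ (C⊆Be p)) (card-⊕ e∉B)) ⟩
      ∣ B ∣                ≡⟨ sym (proj₁ bB) ⟩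
      rank B               ≤⟨ R2 _ _ (⊆-⊕ B e) ⟩
      rank (B ⊕ e)         ≡⟨ sym (in-circuit⇒rank cC C⊆Be p) ⟩
      rank ((B ⊕ e) ⊖ i)   ∎)
      where open ℕ.≤-Reasoning
    bwd : ∀ i → i ∈ B → Independent M ((B ⊕ e) ⊖ i) → i ∈ C
    bwd i p ind with i S.∈? C
    ... | yes q = q
    ... | no ¬q = contradiction (ind-⊆ (⊆-⊖ C⊆Be ¬q) ind) (proj₁ cC)

-- Given a cyclic flat F, some basis B is active only "towards" F: inside F every element of B can be
-- exchanged for a smaller element of F, outside F every non-element of B for a smaller element of B ─ F.
-- Then F can be recovered from B by one pass over the elements in increasing order.
module Activity {n : ℕ} (M : Matroid n) (F : Subset n) (cyc : CyclicFlat M F) where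
  open Matroid M
  open Theory M

  private
    flatF = proj₁ cyc

    no-coloop : ∀ e → e ∈ F → rank (F ⊖ e) ≡ rank F
    no-coloop = proj₂ (Equivalence.to (cyclic⇔ F) cyc)

  swap : Subset n → Fin n → Fin n → Subset n
  swap B b e = B ⊖ b ⊕ e

  -- Increasing inside `F` and decreasing outside. Both kinds of forbidden exchange, `Inside` and
  -- `Outside`, therefore raise the weight of the basis, and one bounded potential makes the
  -- improvement end.
  weight : Fin n → ℕ
  weight i = if does (i S.∈? F) then toℕ i else n ∸ toℕ i

  weight-∈ : ∀ {i} → i ∈ F → weight i ≡ toℕ i
  weight-∈ {i} p = cong (λ c → if c then toℕ i else n ∸ toℕ i) (Dec.dec-true (i S.∈? F) p)

  weight-∉ : ∀ {i} → i ∉ F → weight i ≡ n ∸ toℕ i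
  weight-∉ {i} p = cong (λ c → if c then toℕ i else n ∸ toℕ i) (Dec.dec-false (i S.∈? F) p)

  -- Such a basis splits into a basis of the restriction to `F` and a basis of the contraction of
  -- `F`; the two kinds of exchange act on these parts separately.
  Admissible : Subset n → Set
  Admissible B = Basis M B × ∣ B ∩ F ∣ ≡ rank F

  card-swap : ∀ {B b e} → b ∈ B → e ∉ B → ∣ swap B b e ∣ ≡ ∣ B ∣
  card-swap {B} {b} {e} p q = trans (card-⊕ (q ∘ ⊖-⊆ B b)) (card-⊖ p)

  basis-swap : ∀ {B b e} → Basis M B → b ∈ B → e ∉ B → Independent M (swap B b e) → Basis M (swap B b e)
  basis-swap bB p q i = card⇒basis i (trans (card-swap p q) (basis-card bB))

  wsum-swap : ∀ {B b e} → b ∈ B → e ∉ B → weight b < weight e → wsum weight B < wsum weight (swap B b e)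
  wsum-swap {B} {b} {e} p q lt = ℕ.≤-trans (ℕ.≤-reflexive (cong suc (sym (wsum-⊖ weight p))))
    (ℕ.≤-trans (ℕ.+-monoˡ-≤ (wsum weight (B ⊖ b)) lt) (ℕ.≤-reflexive (sym (wsum-⊕ weight (q ∘ ⊖-⊆ B b)))))

  Inside Outside : Subset n → Fin n → Fin n → Set
  Inside  B b e = b ∈ B × b ∈ F × e ∉ B × e ∈ F × Independent M (swap B b e) × toℕ b < toℕ e
  Outside B b e = b ∈ B × b ∉ F × e ∉ B × e ∉ F × Independent M (swap B b e) × toℕ e < toℕ b

  admissible-inside : ∀ {B b e} → Admissible B → Inside B b e → Admissible (swap B b e)
  admissible-inside {B} {b} {e} (bB , c) (p , p′ , q , q′ , i , _) = basis-swap bB p q i , trans (cong ∣_∣ eq) (trans (card-swap (S.x∈p∩q⁺ (p , p′)) (q ∘ S.p∩q⊆p B F)) c)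
    where
    eq : swap B b e ∩ F ≡ swap (B ∩ F) b e
    eq = S.⊆-antisym to from
      where
      to : swap B b e ∩ F ⊆ swap (B ∩ F) b e
      to r with S.x∈p∩q⁻ (swap B b e) F r
      ... | r₁ , r₂ with ∈-⊕⁻ (B ⊖ b) e r₁
      ...   | inj₁ s    = ⊆-⊕ _ e (∈-⊖⁺ (S.x∈p∩q⁺ (⊖-⊆ B b s , r₂)) (proj₂ (∈-⊖⁻ B b s)))
      ...   | inj₂ refl = ∈-⊕ _ e
      from : swap (B ∩ F) b e ⊆ swap B b e ∩ F
      from r with ∈-⊕⁻ ((B ∩ F) ⊖ b) e r
      ... | inj₁ s    = let s₁ , s₂ = S.x∈p∩q⁻ B F (⊖-⊆ (B ∩ F) b s) in S.x∈p∩q⁺ (⊆-⊕ _ e (∈-⊖⁺ s₁ (proj₂ (∈-⊖⁻ (B ∩ F) b s))) , s₂)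
      ... | inj₂ refl = S.x∈p∩q⁺ (∈-⊕ _ e , q′)

  admissible-outside : ∀ {B b e} → Admissible B → Outside B b e → Admissible (swap B b e)
  admissible-outside {B} {b} {e} (bB , c) (p , p′ , q , q′ , i , _) = basis-swap bB p q i , trans (cong ∣_∣ eq) c
    where
    eq : swap B b e ∩ F ≡ B ∩ F
    eq = S.⊆-antisym to from
      where
      to : swap B b e ∩ F ⊆ B ∩ F
      to r with S.x∈p∩q⁻ (swap B b e) F r
      ... | r₁ , r₂ with ∈-⊕⁻ (B ⊖ b) e r₁
      ...   | inj₁ s    = S.x∈p∩q⁺ (⊖-⊆ B b s , r₂)
      ...   | inj₂ refl = contradiction r₂ q′
      from : B ∩ F ⊆ swap B b e ∩ F
      from r with S.x∈p∩q⁻ B F r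
      ... | r₁ , r₂ = S.x∈p∩q⁺ (⊆-⊕ _ e (∈-⊖⁺ r₁ λ { refl → p′ r₂ }) , r₂)

  basis-∩ : ∀ {B} → Admissible B → BasisOf (B ∩ F) F
  basis-∩ {B} ((iB , _) , c) = basisOf (S.p∩q⊆q B F) i (trans i c)
    where i = ind-⊆ (S.p∩q⊆p B F) iB

  initial-admissible : ∃[ B ] Admissible B
  initial-admissible with basis-exists F
  ... | I , bI with extend-basis (indep bI)
  ... | B , bB , s = B , bB , ℕ.≤-antisym
          (ℕ.≤-trans (ℕ.≤-reflexive (sym (ind-⊆ (S.p∩q⊆p B F) (proj₁ bB)))) (R2 _ _ (S.p∩q⊆q B F)))
          (ℕ.≤-trans (ℕ.≤-reflexive (trans (sym (rank≡ bI)) (indep bI))) (S.p⊆q⇒∣p∣≤∣q∣ (λ p → S.x∈p∩q⁺ (s p , sub bI p))))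

  Optimal : Subset n → Set
  Optimal B = Admissible B × (∀ b e → ¬ Inside B b e) × (∀ b e → ¬ Outside B b e)

  optimal : ∃[ B ] Optimal B
  optimal = let B , a = initial-admissible in go (wsum weight ⊤) B (ℕ.m≤m+n _ _) a
    where
    inside? : ∀ B → Dec (∃[ b ] ∃[ e ] Inside B b e)
    inside? B = FinP.any? λ b → FinP.any? λ e → (b S.∈? B) ×-dec ((b S.∈? F) ×-dec ((¬? (e S.∈? B)) ×-dec ((e S.∈? F) ×-dec (ind? _ ×-dec (toℕ b ℕ.<? toℕ e)))))
    outside? : ∀ B → Dec (∃[ b ] ∃[ e ] Outside B b e)
    outside? B = FinP.any? λ b → FinP.any? λ e → (b S.∈? B) ×-dec ((¬? (b S.∈? F)) ×-dec ((¬? (e S.∈? B)) ×-dec ((¬? (e S.∈? F)) ×-dec (ind? _ ×-dec (toℕ e ℕ.<? toℕ b)))))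
    go : ∀ k B → wsum weight ⊤ ≤ k + wsum weight B → Admissible B → ∃[ B ] Optimal B
    better : ∀ k B b e → wsum weight ⊤ ≤ k + wsum weight B → b ∈ B → e ∉ B → weight b < weight e → Admissible (swap B b e) → ∃[ B ] Optimal B
    better zero B b e le p q lt a = contradiction (ℕ.≤-trans (wsum-swap p q lt) (ℕ.≤-trans (wsum-≤ weight (swap B b e)) le)) (ℕ.<-irrefl refl)
    better (suc k) B b e le p q lt a = go k (swap B b e) (ℕ.≤-trans le (ℕ.≤-trans (ℕ.≤-reflexive (sym (ℕ.+-suc k _))) (ℕ.+-monoʳ-≤ k (wsum-swap p q lt)))) a
    go k B le a with inside? B | outside? B
    ... | yes (b , e , x@(p , p′ , q , q′ , _ , lt)) | _ = better k B b e le p q (subst₂ _<_ (sym (weight-∈ p′)) (sym (weight-∈ q′)) lt) (admissible-inside a x)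
    ... | no _ | yes (b , e , x@(p , p′ , q , q′ , _ , lt)) = better k B b e le p q
            (subst₂ _<_ (sym (weight-∉ p′)) (sym (weight-∉ q′)) (ℕ.∸-monoʳ-< lt (ℕ.<⇒≤ (FinP.toℕ<n b)))) (admissible-outside a x)
    ... | no ¬i | no ¬o = B , a , (λ b e x → ¬i (b , e , x)) , (λ b e x → ¬o (b , e , x))

  -- Since `b` is no coloop of `F`, the set `F ⊖ b` still has full rank, so `(B ∩ F) ⊖ b` can be
  -- extended inside it by some `e`. Optimality rules out that `e` is larger than `b`.
  smaller-inside : ∀ {B} → Optimal B → ∀ b → b ∈ B → b ∈ F → ∃[ e ] (e ∉ B × e ∈ F × Independent M (swap B b e) × toℕ e < toℕ b)
  smaller-inside {B} (adm@((iB , sB) , c) , noI , _) b p p′ with extend ((B ∩ F) ⊖ b) (F ⊖ b) (⊖-mono (S.p∩q⊆q B F)) (ind-⊆ (S.p∩q⊆p B F ∘ ⊖-⊆ (B ∩ F) b) iB)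
  ... | J , bJ , s with ¬⊆⇒∃ J ((B ∩ F) ⊖ b) (λ J⊆ → ℕ.<-irrefl refl (begin-strict
      rank F                    ≡⟨ sym (no-coloop b p′) ⟩
      rank (F ⊖ b)              ≡⟨ sym (rank≡ bJ) ⟩
      rank J                    ≤⟨ R2 _ _ (λ {i} → J⊆ i) ⟩
      rank ((B ∩ F) ⊖ b)        ≤⟨ R1 _ ⟩
      ∣ (B ∩ F) ⊖ b ∣           <⟨ ℕ.≤-reflexive (card-⊖ (S.x∈p∩q⁺ (p , p′))) ⟩
      ∣ B ∩ F ∣                 ≡⟨ c ⟩
      rank F                    ∎))
    where open ℕ.≤-Reasoning
  ... | e , e∈J , e∉ = e , e∉B , e∈F , iswap , ℕ.≤∧≢⇒< (ℕ.≮⇒≥ (λ lt → noI b e (p , p′ , e∉B , e∈F , iswap , lt))) (e≢b ∘ FinP.toℕ-injective)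
    where
    e∈F : e ∈ F
    e∈F = ⊖-⊆ F b (sub bJ e∈J)
    e≢b : e ≢ b
    e≢b = proj₂ (∈-⊖⁻ F b (sub bJ e∈J))
    e∉B : e ∉ B
    e∉B q = e∉ (∈-⊖⁺ (S.x∈p∩q⁺ (q , e∈F)) e≢b)
    K = swap (B ∩ F) b e
    iK : Independent M K
    iK = ind-⊆ (⊕-⊆ s e∈J) (indep bJ)
    K⊆ : K ⊆ swap B b e
    K⊆ = ⊕-mono (⊖-mono (S.p∩q⊆p B F))
    -- `K` is independent and as large as a basis of `F`, so it spans `F` and in particular `b`. If
    -- the exchanged set were dependent, then `B ⊖ b` would span `e`, hence `K` and with it `b`.
    K-spans : rank (K ⊕ b) ≤ rank K
    K-spans = ℕ.≤-trans (R2 (K ⊕ b) F (⊕-⊆ (⊕-⊆ (S.p∩q⊆q B F ∘ ⊖-⊆ (B ∩ F) b) e∈F) p′))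
      (ℕ.≤-reflexive (trans (sym c) (trans (sym (card-swap (S.x∈p∩q⁺ (p , p′)) (e∉B ∘ S.p∩q⊆p B F))) (sym iK))))
    iswap : Independent M (swap B b e)
    iswap = Dec.decidable-stable (ind? (swap B b e)) λ d → ℕ.<⇒≱ (ind⇒rank-⊖ iB p)
      (ℕ.≤-trans (R2 B (swap B b e ⊕ b) (λ q → ⊕-mono (⊆-⊕ (B ⊖ b) e) (subst (_ ∈_) (sym (⊖-⊕ p)) q)))
        (ℕ.≤-trans (rank-⊕-mono K⊆ K-spans) (dep-rank-⊕ (ind-⊆ (⊖-⊆ B b) iB) d)))

  -- As `F` is a flat, `(B ∩ F) ⊕ e` is independent and extends to a basis of `B ⊕ e`. An element
  -- missing from that basis lies in `B` but not in `F`, and can be exchanged for `e`; by optimality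
  -- it is smaller than `e`.
  smaller-outside : ∀ {B} → Optimal B → ∀ e → e ∉ B → e ∉ F → ∃[ b ] (b ∈ B × b ∉ F × Independent M (swap B b e) × toℕ b < toℕ e)
  smaller-outside {B} (adm@((iB , sB) , c) , _ , noO) e q q′ with extend ((B ∩ F) ⊕ e) (B ⊕ e) (⊕-mono (S.p∩q⊆p B F)) i∩e
    where
    i∩e : Independent M ((B ∩ F) ⊕ e)
    i∩e = Dec.decidable-stable (ind? _) λ d → ℕ.<⇒≱ (flatF e q′) (basis-rank-⊕ (basis-∩ adm) (dep-rank-⊕ (indep (basis-∩ adm)) d))
  ... | J , bJ , s with ¬⊆⇒∃ (B ⊕ e) J (λ ⊆J → ℕ.<-irrefl refl (begin-strict
      ∣ B ∣             <⟨ ℕ.≤-reflexive (sym (card-⊕ q)) ⟩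
      ∣ B ⊕ e ∣         ≤⟨ S.p⊆q⇒∣p∣≤∣q∣ (λ {i} → ⊆J i) ⟩
      ∣ J ∣             ≡⟨ sym (indep bJ) ⟩
      rank J            ≤⟨ R2 J ⊤ S.⊆⊤ ⟩
      rank ⊤            ≡⟨ sym sB ⟩
      rank B            ≡⟨ iB ⟩
      ∣ B ∣             ∎))
    where open ℕ.≤-Reasoning
  ... | b , b∈ , b∉J = b , b∈B , b∉F , iswap , ℕ.≤∧≢⇒< (ℕ.≮⇒≥ (λ lt → noO b e (b∈B , b∉F , q , q′ , iswap , lt))) (b≢e ∘ FinP.toℕ-injective)
    where
    b≢e : b ≢ e
    b≢e refl = b∉J (s (∈-⊕ _ e))
    b∈B : b ∈ B
    b∈B = Sum.[ id , (λ eq → contradiction eq b≢e) ] (∈-⊕⁻ B e b∈)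
    b∉F : b ∉ F
    b∉F r = b∉J (s (⊆-⊕ _ e (S.x∈p∩q⁺ (b∈B , r))))
    iswap : Independent M (swap B b e)
    iswap = ind-⊆ (⊕-⊆ (⊖-mono (⊆-⊕ B e)) (∈-⊖⁺ (∈-⊕ B e) (b≢e ∘ sym))) (ℕ.≤-antisym (R1 _) (begin
      ∣ (B ⊕ e) ⊖ b ∣     ≡⟨ ℕ.suc-injective (trans (card-⊖ b∈) (card-⊕ q)) ⟩
      ∣ B ∣                ≡⟨ sym iB ⟩
      rank B               ≤⟨ R2 _ _ (⊆-⊕ B e) ⟩
      rank (B ⊕ e)         ≡⟨ sym (rank≡ bJ) ⟩
      rank J               ≤⟨ R2 _ _ (⊆-⊖ (sub bJ) b∉J) ⟩
      rank ((B ⊕ e) ⊖ b)   ∎))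
      where open ℕ.≤-Reasoning

  -- The exchange would leave all of `B ∩ F` in place and add `e` to it, an independent subset of
  -- `F` of more than full size.
  no-crossing : ∀ {B} → Optimal B → ∀ b e → b ∈ B → b ∉ F → e ∉ B → e ∈ F → ¬ Independent M (swap B b e)
  no-crossing {B} (adm@(_ , c) , _) b e p p′ q q′ i = ℕ.<-irrefl refl (begin-strict
    rank F                 ≡⟨ sym c ⟩
    ∣ B ∩ F ∣              <⟨ ℕ.≤-reflexive (sym (card-⊕ (q ∘ S.p∩q⊆p B F))) ⟩
    ∣ (B ∩ F) ⊕ e ∣        ≡⟨ sym (ind-⊆ (⊕-mono (⊆-⊖ (S.p∩q⊆p B F) (p′ ∘ S.p∩q⊆q B F))) i) ⟩
    rank ((B ∩ F) ⊕ e)     ≤⟨ R2 _ F (⊕-⊆ (S.p∩q⊆q B F) q′) ⟩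
    rank F                 ∎)
    where open ℕ.≤-Reasoning

-- Independence oracles for the different lists

pattern x5 = var (suc (suc (suc (suc (suc zero)))))

-- Each type of list decides independence of X: X is listed; X lies in a listed basis; X contains no listed
-- circuit; every e ∈ X is separated from X ∖ e by a listed flat (hyperplane); removing any e ∈ X lowers the
-- listed rank; X lies in a minimal listed spanning set.
ind-IND ind-BASES ind-CIRC ind-SEP ind-RANK ind-SPAN : Oracle
ind-IND   = existsL (x1 ≐ x2)
ind-BASES = existsL (x2 ⊆′ x1)
ind-CIRC  = notB (existsL (x1 ⊆′ x2))
ind-SEP   = notB (existsE (andB (some (x0 ∩′ x1)) (notB (existsL (andB ((x3 ∖′ x2) ⊆′ x1) (notB (x2 ⊆′ x1)))))))
ind-RANK  = notB (existsE (andB (some (x0 ∩′ x1)) (existsL (existsL (andB (x3 ≐ x5) (andB (x1 ≐ x5 ∖′ x4) (x0 ≐ x2)))))))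
ind-SPAN  = existsL (andB (x2 ⊆′ x1) (notB (existsE (andB (some (x0 ∩′ x2)) (existsL (x1 ≐ x4 ∖′ x2))))))

module Oracles {n : ℕ} (M : Matroid n) (T : Subset n → Set) (r : Subset n → Subset n) (L : List (Subset n)) (enum : Enumerates T L) where
  open Matroid M
  open Theory M
  open Closure M

  Es : List (Subset n × Subset n)
  Es = map (λ X → X , r X) L

  open Semantics Es
  open Reflection Es

  ∈L⁺ : ∀ {X} → T X → X ∈ₗ L
  ∈L⁺ = Equivalence.from (proj₂ enum _)

  ∈L⁻ : ∀ {X} → X ∈ₗ L → T X
  ∈L⁻ = Equivalence.to (proj₂ enum _)

  ∈Es⁺ : ∀ {X} → T X → (X , r X) ∈ₗ Es
  ∈Es⁺ t = ∈ₗ.∈-map⁺ (λ X → X , r X) (∈L⁺ t)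

  unique-Es : Unique (map proj₁ Es)
  unique-Es = subst Unique (trans (sym (ListP.map-id L)) (ListP.map-∘ L)) (proj₁ enum)

  listed : ∀ {d} (φ : BE (2 + d)) ρ {P : Subset n → Set} →
    (∀ X → Reflects (P X) (⟦ φ ⟧B (r X ∷ X ∷ ρ))) → Reflects (∃[ X ] (T X × P X)) (⟦ existsL φ ⟧B ρ)
  listed φ ρ {P} ok = reflects-map to from (existsL-reflects φ ρ {λ (X , R) → ⟦ φ ⟧B (R ∷ X ∷ ρ) ≡ true} (λ X R → bool _))
    where
    bool : ∀ b → Reflects (b ≡ true) b
    bool true  = ofʸ refl
    bool false = ofⁿ λ ()
    to : _ → ∃[ X ] (T X × P X)
    to (E , p , q) with ∈ₗ.∈-map⁻ (λ X → X , r X) p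
    ... | X , X∈L , refl = X , ∈L⁻ X∈L , Refl.invert (subst (Reflects (P X)) q (ok X))
    from : ∃[ X ] (T X × P X) → _
    from (X , t , p) = (X , r X) , ∈Es⁺ t , Refl.det (ok X) (ofʸ p)

  Correct : Oracle → Set
  Correct ind = ∀ {d} X (ρ : Vec (Subset n) d) → Reflects (Independent M X) (⟦ ind ⟧B (X ∷ ρ))

  correct-IND : (∀ X → T X ⇔ Independent M X) → Correct ind-IND
  correct-IND T⇔ X ρ = reflects-map (λ { (Y , t , refl) → Equivalence.to (T⇔ Y) t }) (λ i → X , Equivalence.from (T⇔ X) i , refl)
    (listed (x1 ≐ x2) (X ∷ ρ) (λ Y → ≐-reflects x1 x2 (r Y ∷ Y ∷ X ∷ ρ)))

  correct-BASES : (∀ X → T X ⇔ Basis M X) → Correct ind-BASES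
  correct-BASES T⇔ X ρ = reflects-map (λ (B , t , s) → ind-⊆ (s _) (proj₁ (Equivalence.to (T⇔ B) t)))
    (λ i → let B , b , s = extend-basis i in B , Equivalence.from (T⇔ B) b , λ _ → s)
    (listed (x2 ⊆′ x1) (X ∷ ρ) (λ Y → ⊆-reflects x2 x1 (r Y ∷ Y ∷ X ∷ ρ)))

  correct-CIRC : (∀ X → T X ⇔ Circuit M X) → Correct ind-CIRC
  correct-CIRC T⇔ X ρ = reflects-map {¬ (∃[ C ] (T C × (∀ i → i ∈ C → i ∈ X)))}
    (λ ¬c → Dec.decidable-stable (ind? X) (λ d → let C , c , s = dependent⇒circuit X d in ¬c (C , Equivalence.from (T⇔ C) c , λ _ → s)))
    (λ i (C , t , s) → proj₁ (Equivalence.to (T⇔ C) t) (ind-⊆ (s _) i))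
    (Refl.¬-reflects (listed (x1 ⊆′ x2) (X ∷ ρ) (λ Y → ⊆-reflects x1 x2 (r Y ∷ Y ∷ X ∷ ρ))))

  -- If `X ⊖ e` has the same rank as `X`, every flat that contains `X ⊖ e` contains `e` as well. So
  -- separating flats certify that each removal lowers the rank; conversely, `separate` supplies
  -- them for independent sets.
  correct-SEP : (∀ X → T X → Flat M X) → (∀ X e → Independent M X → e ∈ X → ∃[ F ] (T F × (∀ i → i ∈ X ⊖ e → i ∈ F) × e ∉ F)) → Correct ind-SEP
  correct-SEP T-flat separate X ρ = reflects-map to from
    (Refl.¬-reflects (exists∈ zero (notB (existsL (andB ((x3 ∖′ x2) ⊆′ x1) (notB (x2 ⊆′ x1))))) (X ∷ ρ) (λ e → Refl.¬-reflects (sep-ok e))))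
    where
    sep-ok : ∀ e → Reflects (∃[ F ] (T F × (∀ i → i ∈ X ⊖ e → i ∈ F) × ¬ (∀ i → i ∈ ⁅ e ⁆ → i ∈ F))) _
    sep-ok e = listed (andB ((x3 ∖′ x2) ⊆′ x1) (notB (x2 ⊆′ x1))) (⁅ e ⁆ ∷ X ∷ ρ)
      (λ F → ⊆-reflects (x3 ∖′ x2) x1 (r F ∷ F ∷ ⁅ e ⁆ ∷ X ∷ ρ) Refl.×-reflects Refl.¬-reflects (⊆-reflects x2 x1 (r F ∷ F ∷ ⁅ e ⁆ ∷ X ∷ ρ)))
    to : ¬ (∃[ e ] (e ∈ X × ¬ (∃[ F ] (T F × (∀ i → i ∈ X ⊖ e → i ∈ F) × ¬ (∀ i → i ∈ ⁅ e ⁆ → i ∈ F))))) → Independent M X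
    to ¬ex = rank-⊖⇒ind X λ e p → ℕ.≰⇒> λ le → ¬ex (e , p , λ (F , t , s , e∉) →
      e∉ λ i q → subst (_∈ F) (sym (S.x∈⁅y⁆⇒x≡y e q)) (flat-closed (T-flat F t) e
        (rank-⊕-mono {X ⊖ e} (s _) (ℕ.≤-trans (ℕ.≤-reflexive (cong rank (⊖-⊕ p))) le))))
    from : Independent M X → ¬ (∃[ e ] (e ∈ X × ¬ (∃[ F ] (T F × (∀ i → i ∈ X ⊖ e → i ∈ F) × ¬ (∀ i → i ∈ ⁅ e ⁆ → i ∈ F)))))
    from i (e , p , ¬sep) = let F , t , s , e∉ = separate X e i p in ¬sep (F , t , s , λ f → e∉ (f e (S.x∈⁅x⁆ e)))

  separate-FLATS : (∀ X → T X ⇔ Flat M X) → ∀ X e → Independent M X → e ∈ X → ∃[ F ] (T F × (∀ i → i ∈ X ⊖ e → i ∈ F) × e ∉ F)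
  separate-FLATS T⇔ X e i p = cl (X ⊖ e) , Equivalence.from (T⇔ _) (cl-flat (X ⊖ e)) , (λ _ → ⊆-cl (X ⊖ e)) ,
    λ q → ℕ.<⇒≱ (ind⇒rank-⊖ i p) (ℕ.≤-trans (ℕ.≤-reflexive (cong rank (sym (⊖-⊕ p)))) (∈-cl⁻ q))

  separate-HYP : (∀ X → T X ⇔ Hyperplane M X) → ∀ X e → Independent M X → e ∈ X → ∃[ F ] (T F × (∀ i → i ∈ X ⊖ e → i ∈ F) × e ∉ F)
  separate-HYP T⇔ X e i p with extend-basis i
  ... | B , b , s = cl (B ⊖ e) , Equivalence.from (T⇔ _) (proj₁ (cl-hyperplane b (s p))) , (λ _ q → ⊆-cl (B ⊖ e) (⊖-mono s q)) , proj₂ (cl-hyperplane b (s p))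

  -- Stored ranks are never read as numbers. It suffices to compare the codes of `X` and `X ⊖ e` for
  -- equality, because removing an element either keeps the rank or lowers it.
  correct-RANK : (∀ X → T X) → (∀ X Y → r X ≡ r Y ⇔ rank X ≡ rank Y) → Correct ind-RANK
  correct-RANK all r⇔ X ρ = reflects-map to from (Refl.¬-reflects (exists∈ zero (existsL (existsL same)) (X ∷ ρ) same-ok))
    where
    same : ∀ {d} → BE (6 + d)
    same = andB (x3 ≐ x5) (andB (x1 ≐ x5 ∖′ x4) (x0 ≐ x2))
    same-ok : ∀ e → Reflects (∃[ Y ] (T Y × ∃[ Z ] (T Z × Y ≡ X × Z ≡ X ⊖ e × r Z ≡ r Y))) _
    same-ok e = listed (existsL same) (⁅ e ⁆ ∷ X ∷ ρ) λ Y → listed same (r Y ∷ Y ∷ ⁅ e ⁆ ∷ X ∷ ρ) λ Z → let σ = r Z ∷ Z ∷ r Y ∷ Y ∷ ⁅ e ⁆ ∷ X ∷ ρ in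
      ≐-reflects x3 x5 σ Refl.×-reflects (≐-reflects x1 (x5 ∖′ x4) σ Refl.×-reflects ≐-reflects x0 x2 σ)
    Same : Fin n → Set
    Same e = ∃[ Y ] (T Y × ∃[ Z ] (T Z × Y ≡ X × Z ≡ X ⊖ e × r Z ≡ r Y))
    to : ¬ (∃[ e ] (e ∈ X × Same e)) → Independent M X
    to ¬ex = rank-⊖⇒ind X λ e p → ℕ.≤∧≢⇒< (R2 _ _ (⊖-⊆ X e)) λ eq →
      ¬ex (e , p , X , all X , X ⊖ e , all (X ⊖ e) , refl , refl , Equivalence.from (r⇔ (X ⊖ e) X) eq)
    from : Independent M X → ¬ (∃[ e ] (e ∈ X × Same e))
    from i (e , p , _ , _ , _ , _ , refl , refl , eq) = ℕ.<⇒≢ (ind⇒rank-⊖ i p) (Equivalence.to (r⇔ (X ⊖ e) X) eq)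

  correct-SPAN : (∀ X → T X ⇔ Spanning M X) → Correct ind-SPAN
  correct-SPAN T⇔ X ρ = reflects-map to from
    (listed (andB (x2 ⊆′ x1) (notB (existsE (andB (some (x0 ∩′ x2)) (existsL (x1 ≐ x4 ∖′ x2)))))) (X ∷ ρ)
      (λ Y → ⊆-reflects x2 x1 (r Y ∷ Y ∷ X ∷ ρ) Refl.×-reflects Refl.¬-reflects (exists∈ (suc zero) (existsL (x1 ≐ x4 ∖′ x2)) (r Y ∷ Y ∷ X ∷ ρ)
      (λ e → listed (x1 ≐ x4 ∖′ x2) (⁅ e ⁆ ∷ r Y ∷ Y ∷ X ∷ ρ) (λ Z → ≐-reflects x1 (x4 ∖′ x2) (r Z ∷ Z ∷ ⁅ e ⁆ ∷ r Y ∷ Y ∷ X ∷ ρ))))))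
    where
    to : ∃[ Y ] (T Y × (∀ i → i ∈ X → i ∈ Y) × ¬ (∃[ e ] (e ∈ Y × ∃[ Z ] (T Z × Z ≡ Y ⊖ e)))) → Independent M X
    to (Y , t , s , mn) = ind-⊆ (s _) (rank-⊖⇒ind Y λ e p → ℕ.≤∧≢⇒< (R2 _ _ (⊖-⊆ Y e)) λ eq →
      mn (e , p , Y ⊖ e , Equivalence.from (T⇔ _) (trans eq (Equivalence.to (T⇔ Y) t)) , refl))
    from : Independent M X → ∃[ Y ] (T Y × (∀ i → i ∈ X → i ∈ Y) × ¬ (∃[ e ] (e ∈ Y × ∃[ Z ] (T Z × Z ≡ Y ⊖ e))))
    from i = let B , (iB , sB) , s = extend-basis i in B , Equivalence.from (T⇔ B) sB , (λ _ → s) ,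
      λ { (e , p , _ , t , refl) → ℕ.<⇒≢ (ind⇒rank-⊖ iB p) (trans (Equivalence.to (T⇔ _) t) (sym sB)) }

-- Candidates computed from a listed set and an element

foldl-cong′ : ∀ {A X : Set} {g h : A → X → A} → (∀ a x → g a x ≡ h a x) → ∀ a xs → foldl g a xs ≡ foldl h a xs
foldl-cong′ eq a []       = refl
foldl-cong′ {g = g} {h} eq a (x ∷ xs) = trans (cong (λ b → foldl g b xs) (eq a x)) (foldl-cong′ eq (h a x) xs)

anyUntil-cong : ∀ {X : Set} {s s′ h h′ : X → Bool} → (∀ x → s x ≡ s′ x) → (∀ x → h x ≡ h′ x) → ∀ xs → anyUntil s h xs ≡ anyUntil s′ h′ xs
anyUntil-cong es eh [] = refl
anyUntil-cong es eh (x ∷ xs) rewrite es x | eh x | anyUntil-cong es eh xs = refl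

collect : ∀ {n} → (Subset n → Bool) → Subset n → Subset n
collect {n} b A = foldl (λ acc x → if b x then acc ∪ x else acc) A (elems n)

module _ {n : ℕ} (b : Subset n → Bool) where

  private
    to : ∀ xs A {i} → i ∈ foldl (λ acc x → if b x then acc ∪ x else acc) A xs → i ∈ A ⊎ ∃[ x ] (x ∈ₗ xs × b x ≡ true × i ∈ x)
    to [] A p = inj₁ p
    to (x ∷ xs) A p with b x in eq
    ... | false = Sum.map₂ (λ (y , q , s) → y , there q , s) (to xs A p)
    ... | true with to xs (A ∪ x) p
    ...   | inj₂ (y , q , s) = inj₂ (y , there q , s)
    ...   | inj₁ q with S.x∈p∪q⁻ A x q
    ...     | inj₁ s = inj₁ s
    ...     | inj₂ s = inj₂ (x , here refl , eq , s)

    from : ∀ xs A {i} → i ∈ A ⊎ ∃[ x ] (x ∈ₗ xs × b x ≡ true × i ∈ x) → i ∈ foldl (λ acc x → if b x then acc ∪ x else acc) A xs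
    from [] A (inj₁ p) = p
    from (x ∷ xs) A (inj₁ p) with b x
    ... | false = from xs A (inj₁ p)
    ... | true  = from xs (A ∪ x) (inj₁ (S.x∈p∪q⁺ (inj₁ p)))
    from (x ∷ xs) A (inj₂ (_ , here refl , q , s)) rewrite q = from xs (A ∪ x) (inj₁ (S.x∈p∪q⁺ (inj₂ s)))
    from (x ∷ xs) A (inj₂ (y , there p , qs)) with b x
    ... | false = from xs A (inj₂ (y , p , qs))
    ... | true  = from xs (A ∪ x) (inj₂ (y , p , qs))

  ∈-collect⁻ : ∀ A {i} → i ∈ collect b A → i ∈ A ⊎ b ⁅ i ⁆ ≡ true
  ∈-collect⁻ A p with to (elems n) A p
  ... | inj₁ q = inj₁ q
  ... | inj₂ (x , q , s , t) with ∈elems⁻ q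
  ...   | inj₂ refl = contradiction t S.∉⊥
  ...   | inj₁ (j , refl) with S.x∈⁅y⁆⇒x≡y j t
  ...     | refl = inj₂ s

  ∈-collect⁺ : ∀ A {i} → i ∈ A ⊎ b ⁅ i ⁆ ≡ true → i ∈ collect b A
  ∈-collect⁺ A (inj₁ p) = from (elems n) A (inj₁ p)
  ∈-collect⁺ A {i} (inj₂ q) = from (elems n) A (inj₂ (⁅ i ⁆ , ⁅⁆∈elems i , q , S.x∈⁅x⁆ i))

els-split : ∀ {n} k r → elems n ≡ els 0 (k + r) → elems n ≡ applyUpTo hot k ++ els k r
els-split {n} k r eq = trans eq (go 0 k)
  where
  go : ∀ j k → els {n} j (k + r) ≡ applyUpTo (λ i → hot (j + i)) k ++ els (j + k) r
  go j zero    = cong (λ m → els m r) (sym (ℕ.+-identityʳ j))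
  go j (suc k) = cong₂ _∷_ (cong hot (sym (ℕ.+-identityʳ j))) (trans (go (suc j) k) (cong₂ _++_ (cong-up k (λ i → cong hot (sym (ℕ.+-suc j i)))) (cong (λ m → els m r) (sym (ℕ.+-suc j k)))))
    where
    cong-up : ∀ {f g : ℕ → Subset n} k → (∀ i → f i ≡ g i) → applyUpTo f k ≡ applyUpTo g k
    cong-up zero    eq = refl
    cong-up (suc k) eq = cong₂ _∷_ (eq 0) (cong-up k (eq ∘ suc))

module Candidates (ind : Oracle) where

  cand-flat cand-hyp cand-circ cand-cyc : Candidate
  clE : ∀ {d} → SE d → SE d
  clE a     = letS a (foldE x0 (ite (notB (letB (x2 ∪′ x0) ind)) (x1 ∪′ x0) x1))
  cand-flat = clE x1
  cand-hyp  = clE (x1 ∖′ x0)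
  cand-circ = foldE x0 (ite (andB (some (x0 ∩′ x3)) (letB ((x3 ∪′ x2) ∖′ x0) ind)) (x1 ∪′ x0) x1)
  -- Variables: `x0` is the current element, `x1` the part of the flat found so far, `x3` the basis.
  -- A basis element enters if it can be exchanged for a non-basis element already found. Any other
  -- element enters unless some smaller basis element that was left out can be exchanged for it;
  -- stopping at `x0 ≐ x1` expresses "smaller".
  passB : ∀ {d} → BE (4 + d)
  passB = orB (andB (some (x0 ∩′ x3)) (existsE (andB (some (x0 ∩′ x2)) (andB (some (x0 ∖′ x4)) (letB ((x4 ∖′ x1) ∪′ x0) ind)))))
              (andB (some (x0 ∖′ x3)) (notB (anyE (x0 ≐ x1) (andB (some (x0 ∩′ x4)) (andB (some (x0 ∖′ x2)) (letB ((x4 ∖′ x0) ∪′ x1) ind))))))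
  cand-cyc  = foldE (con false) (ite passB (x1 ∪′ x0) x1)

module CandidateSemantics {n : ℕ} (Es : List (Subset n × Subset n)) (M : Matroid n) (ind : Oracle)
  (ind-ok : ∀ {d} X (ρ : Vec (Subset n) d) → Reflects (Independent M X) (Semantics.⟦_⟧B Es ind (X ∷ ρ))) where
  open Semantics Es
  open Reflection Es
  open Matroid M
  open Theory M
  open Closure M
  open Candidates ind

  -- The evaluated oracle has the whole environment as an argument. Replacing it by the decision
  -- procedure turns candidates into functions of the set and the element alone, as the field `F` of
  -- `Valid` demands.
  indᵇ : Subset n → Bool
  indᵇ X = does (ind? X)

  ind≡ : ∀ {d} X (ρ : Vec (Subset n) d) → ⟦ ind ⟧B (X ∷ ρ) ≡ indᵇ X
  ind≡ X ρ = Refl.det (ind-ok X ρ) (Dec.proof (ind? X))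

  indᵇ-true : ∀ {X} → Independent M X → indᵇ X ≡ true
  indᵇ-true {X} = Dec.dec-true (ind? X)

  clF : Subset n → Subset n
  clF Y = collect (λ x → not (indᵇ (Y ∪ x))) Y

  clE-ok : ∀ {d} (a : SE d) ρ → ⟦ clE a ⟧S ρ ≡ clF (⟦ a ⟧S ρ)
  clE-ok a ρ = foldl-cong′ (λ acc x → cong (λ b → if not b then acc ∪ x else acc) (ind≡ (⟦ a ⟧S ρ ∪ x) _)) _ (elems n)

  -- On a dependent `Y` the test would accept every element. The candidates for flats and
  -- hyperplanes start from an independent set and from a basis minus an element.
  clF≡cl : ∀ {Y} → Independent M Y → clF Y ≡ cl Y
  clF≡cl {Y} i = S.⊆-antisym to from
    where
    to : clF Y ⊆ cl Y
    to {j} p with ∈-collect⁻ (λ x → not (indᵇ (Y ∪ x))) Y p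
    ... | inj₁ q = ⊆-cl Y q
    ... | inj₂ q = ∈-cl⁺ (dep-rank-⊕ i λ i′ → contradiction (trans (sym q) (cong not (indᵇ-true i′))) λ ())
    from : cl Y ⊆ clF Y
    from {j} p = ∈-collect⁺ (λ x → not (indᵇ (Y ∪ x))) Y (go (j S.∈? Y))
      where
      go : Dec (j ∈ Y) → j ∈ Y ⊎ not (indᵇ (Y ⊕ j)) ≡ true
      go (yes q) = inj₁ q
      go (no ¬q) = inj₂ (cong not (Dec.dec-false (ind? (Y ⊕ j)) λ i′ → ℕ.<⇒≱ (ℕ.≤-reflexive (sym (ind-rank-⊕ ¬q i i′))) (∈-cl⁻ p)))

  circF : Subset n → Subset n → Subset n
  circF B e = collect (λ x → anyV (x ∩ B) ∧ indᵇ ((B ∪ e) ∖ x)) e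

  circ-ok : ∀ {d} B e (ρ : Vec (Subset n) d) → ⟦ cand-circ ⟧S (e ∷ B ∷ ρ) ≡ circF B e
  circ-ok B e ρ = foldl-cong′ (λ acc x → cong (λ b → if anyV (x ∩ B) ∧ b then acc ∪ x else acc) (ind≡ ((B ∪ e) ∖ x) _)) e (elems n)

  circF≡ : ∀ {B e C} → e ∈ C → (∀ i → i ∈ C → i ≢ e → i ∈ B × Independent M ((B ⊕ e) ⊖ i)) →
    (∀ i → i ∈ B → Independent M ((B ⊕ e) ⊖ i) → i ∈ C) → circF B ⁅ e ⁆ ≡ C
  circF≡ {B} {e} {C} e∈C fwd bwd = S.⊆-antisym to from
    where
    test-ok : ∀ i → Reflects (i ∈ B × Independent M ((B ⊕ e) ⊖ i)) (anyV (⁅ i ⁆ ∩ B) ∧ indᵇ ((B ⊕ e) ⊖ i))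
    test-ok i = ∩-reflects i B Refl.×-reflects Dec.proof (ind? ((B ⊕ e) ⊖ i))
    to : circF B ⁅ e ⁆ ⊆ C
    to {i} p with ∈-collect⁻ (λ x → anyV (x ∩ B) ∧ indᵇ ((B ⊕ e) ∖ x)) ⁅ e ⁆ p
    ... | inj₁ q = subst (_∈ C) (sym (S.x∈⁅y⁆⇒x≡y e q)) e∈C
    ... | inj₂ q = let i∈B , j = Refl.invert (subst (Reflects _) q (test-ok i)) in bwd i i∈B j
    from : C ⊆ circF B ⁅ e ⁆
    from {i} p = ∈-collect⁺ (λ x → anyV (x ∩ B) ∧ indᵇ ((B ⊕ e) ∖ x)) ⁅ e ⁆ (go (i Fin.≟ e))
      where
      go : Dec (i ≡ e) → i ∈ ⁅ e ⁆ ⊎ (anyV (⁅ i ⁆ ∩ B) ∧ indᵇ ((B ⊕ e) ⊖ i)) ≡ true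
      go (yes refl) = inj₁ (S.x∈⁅x⁆ e)
      go (no i≢e)   = inj₂ (Refl.det (test-ok i) (ofʸ (fwd i p i≢e)))

  passᵇ : Subset n → Subset n → Subset n → Bool
  passᵇ B acc x = not (not (anyV (x ∩ B) ∧ anyUntil (λ _ → anyV {n} ⊥) (λ e → anyV (e ∩ acc) ∧ (anyV (e ∖ B) ∧ indᵇ ((B ∖ x) ∪ e))) (elems n))
    ∧ not (anyV (x ∖ B) ∧ not (anyUntil (λ b → ⟦ x0 ≐ x1 ⟧B (b ∷ x ∷ [])) (λ b → anyV (b ∩ B) ∧ (anyV (b ∖ acc) ∧ indᵇ ((B ∖ b) ∪ x))) (elems n))))

  passF : Subset n → Subset n → Subset n
  passF B acc = foldl (λ acc x → if passᵇ B acc x then acc ∪ x else acc) acc (elems n)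

  cyc-ok : ∀ {d} B e (ρ : Vec (Subset n) d) → ⟦ cand-cyc ⟧S (e ∷ B ∷ ρ) ≡ passF B ⊥
  cyc-ok B e ρ = foldl-cong′ (λ acc x → cong (λ b → if b then acc ∪ x else acc)
    (cong₂ (λ u v → not (not (anyV (x ∩ B) ∧ u) ∧ not (anyV (x ∖ B) ∧ not v)))
      (anyUntil-cong (λ _ → refl) (λ f → cong (λ b → anyV (f ∩ acc) ∧ (anyV (f ∖ B) ∧ b)) (ind≡ ((B ∖ x) ∪ f) _)) (elems n))
      (anyUntil-cong (λ _ → refl) (λ f → cong (λ b → anyV (f ∩ B) ∧ (anyV (f ∖ acc) ∧ b)) (ind≡ ((B ∖ f) ∪ x) _)) (elems n)))) ⊥ (elems n)

  module _ (F : Subset n) (cyc : CyclicFlat M F) (B : Subset n) where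
    open Activity M F cyc

    passᵇ-reflects : ∀ acc i post → elems n ≡ applyUpTo hot (toℕ i) ++ ⁅ i ⁆ ∷ post →
      Reflects ((i ∈ B × ∃[ e ] (e ∈ acc × e ∉ B × Independent M (swap B i e)))
                ⊎ (i ∉ B × ¬ (∃[ b ] (toℕ b < toℕ i × b ∈ B × b ∉ acc × Independent M (swap B b i)))))
               (passᵇ B acc ⁅ i ⁆)
    passᵇ-reflects acc i post eq = reflects-map
      (λ ¬¬p → Dec.decidable-stable (dec-reflects left-ok Dec.⊎-dec dec-reflects right-ok) (λ ¬p → ¬¬p (¬p ∘ inj₁ , ¬p ∘ inj₂)))
      (λ p (¬a , ¬b) → Sum.[ ¬a , ¬b ] p)
      (Refl.¬-reflects (Refl.¬-reflects left-ok Refl.×-reflects Refl.¬-reflects right-ok))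
      where
      any∅ : ∀ (h : Subset n → Bool) {P : Fin n → Set} {c} → (∀ e → Reflects (P e) (h ⁅ e ⁆)) → h ⊥ ≡ false →
        ∀ {xs} → (∀ {x} → x ∈ₗ xs → x ∈ₗ elems n) → Reflects (∃[ x ] (x ∈ₗ xs × h x ≡ true)) c → Reflects (∃[ e ] (⁅ e ⁆ ∈ₗ xs × P e)) c
      any∅ h {P} ok h∅ {xs} xs⊆ = reflects-map to from
        where
        to : ∃[ x ] (x ∈ₗ xs × h x ≡ true) → ∃[ e ] (⁅ e ⁆ ∈ₗ xs × P e)
        to (x , p , q) with ∈elems⁻ (xs⊆ p)
        ... | inj₁ (e , refl) = e , p , Refl.invert (subst (Reflects (P e)) q (ok e))
        ... | inj₂ refl       = contradiction (trans (sym h∅) q) λ ()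
        from : ∃[ e ] (⁅ e ⁆ ∈ₗ xs × P e) → ∃[ x ] (x ∈ₗ xs × h x ≡ true)
        from (e , p , q) = ⁅ e ⁆ , p , Refl.det (ok e) (ofʸ q)
      bool : ∀ b → Reflects (b ≡ true) b
      bool true  = ofʸ refl
      bool false = ofⁿ λ ()
      left-ok : Reflects (i ∈ B × ∃[ e ] (e ∈ acc × e ∉ B × Independent M (swap B i e))) _
      left-ok = ∩-reflects i B Refl.×-reflects reflects-map (λ (e , _ , p) → e , p) (λ (e , p) → e , ⁅⁆∈elems e , p)
        (any∅ (λ e → anyV (e ∩ acc) ∧ (anyV (e ∖ B) ∧ indᵇ ((B ∖ ⁅ i ⁆) ∪ e))) {P = λ e → e ∈ acc × e ∉ B × Independent M (swap B i e)}
          (λ e → ∩-reflects e acc Refl.×-reflects (∖-reflects e B Refl.×-reflects Dec.proof (ind? (swap B i e))))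
          (cong (λ b → b ∧ (anyV (⊥ ∖ B) ∧ indᵇ ((B ∖ ⁅ i ⁆) ∪ ⊥))) (∅∩-false acc)) id
          (anyUntil-reflects (λ _ → anyV-⊥ n) (λ _ → bool _) (elems n)))
      pre = applyUpTo hot (toℕ i)
      pre⊆ : ∀ {x} → x ∈ₗ pre → x ∈ₗ elems n
      pre⊆ p = subst (_ ∈ₗ_) (sym eq) (∈ₗ.∈-++⁺ˡ p)
      hot-<⁺ : ∀ {b} → toℕ b < toℕ i → ⁅ b ⁆ ∈ₗ pre
      hot-<⁺ {b} lt = subst (_∈ₗ pre) (hot-toℕ b) (∈ₗ.∈-applyUpTo⁺ hot lt)
      hot-<⁻ : ∀ {b} → ⁅ b ⁆ ∈ₗ pre → toℕ b < toℕ i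
      hot-<⁻ {b} p with ∈ₗ.∈-applyUpTo⁻ hot p
      ... | j , j<i , e with fromℕ< (ℕ.<-trans j<i (FinP.toℕ<n i)) in eqj
      ... | k = subst (_< toℕ i) (trans (sym toℕk) (cong toℕ (sym b≡k))) j<i
        where
        toℕk : toℕ k ≡ j
        toℕk = trans (cong toℕ (sym eqj)) (FinP.toℕ-fromℕ< _)
        b≡k : b ≡ k
        b≡k = S.x∈⁅y⁆⇒x≡y k (subst (b ∈_) (trans e (trans (cong hot (sym toℕk)) (hot-toℕ k))) (S.x∈⁅x⁆ b))
      right-ok : Reflects (i ∉ B × ¬ (∃[ b ] (toℕ b < toℕ i × b ∈ B × b ∉ acc × Independent M (swap B b i)))) _
      right-ok = ∖-reflects i B Refl.×-reflects Refl.¬-reflects (reflects-map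
        (λ (b , p , q) → b , hot-<⁻ p , q) (λ (b , p , q) → b , hot-<⁺ p , q)
        (any∅ (λ b → anyV (b ∩ B) ∧ (anyV (b ∖ acc) ∧ indᵇ ((B ∖ b) ∪ ⁅ i ⁆))) {P = λ b → b ∈ B × b ∉ acc × Independent M (swap B b i)}
          (λ b → ∩-reflects b B Refl.×-reflects (∖-reflects b acc Refl.×-reflects Dec.proof (ind? (swap B b i))))
          (cong (λ c → c ∧ (anyV (⊥ ∖ acc) ∧ indᵇ ((B ∖ ⊥) ∪ ⁅ i ⁆))) (∅∩-false B)) pre⊆
          (anyUntil-before {Q = _≡ ⁅ i ⁆} (λ b → ≐-reflects x0 x1 (b ∷ ⁅ i ⁆ ∷ [])) (λ _ → bool _) pre ⁅ i ⁆ post eq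
            (λ { x p refl → ℕ.<-irrefl refl (hot-<⁻ p) }) refl)))

    -- Before turn `k` the accumulator consists of the elements of `F` below `k`. Completeness of
    -- each decision comes from `smaller-inside` and `smaller-outside`, whose witnesses are smaller
    -- and hence already classified; soundness comes from `no-crossing`.
    pass≡F : Optimal B → passF B ⊥ ≡ F
    pass≡F opt = let f = go 0 n refl ⊥ (λ i p → contradiction p S.∉⊥) (λ i p ()) in S.⊆-antisym (proj₁ (f _)) (proj₂ (f _))
      where
      g : Subset n → Subset n → Subset n
      g acc x = if passᵇ B acc x then acc ∪ x else acc
      go : ∀ k r → k + r ≡ n → ∀ acc → (∀ i → i ∈ acc → i ∈ F × toℕ i < k) → (∀ i → i ∈ F → toℕ i < k → i ∈ acc) →
        ∀ i → (i ∈ foldl g acc (els k r) → i ∈ F) × (i ∈ F → i ∈ foldl g acc (els k r))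
      go k zero eq acc to from i = (λ p → proj₁ (to i (subst (i ∈_) same p))) ,
        (λ p → subst (i ∈_) (sym same) (from i p (ℕ.<-≤-trans (FinP.toℕ<n i) (ℕ.≤-reflexive (trans (sym eq) (ℕ.+-identityʳ k))))))
        where
        -- The extra turn with the empty set: whatever the test says, nothing is added.
        same : g acc (hot k) ≡ acc
        same = trans (cong (g acc) (trans (cong hot (trans (sym (ℕ.+-identityʳ k)) eq)) (hot-n n))) (both (passᵇ B acc ⊥))
          where
          both : ∀ c → (if c then acc ∪ ⊥ else acc) ≡ acc
          both true  = S.∪-identityʳ acc
          both false = refl
      go k (suc r) eq acc to from = go (suc k) r (trans (sym (ℕ.+-suc k r)) eq) (g acc (hot k))
        (λ j p → to′ j (subst (λ x → j ∈ g acc x) hot-k p)) (λ j p q → subst (λ x → j ∈ g acc x) (sym hot-k) (from′ j p q))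
        where
        k<n : k < n
        k<n = ℕ.≤-trans (ℕ.m≤m+n (suc k) r) (ℕ.≤-reflexive (trans (sym (ℕ.+-suc k r)) eq))
        i : Fin n
        i = fromℕ< k<n
        toℕi : toℕ i ≡ k
        toℕi = FinP.toℕ-fromℕ< k<n
        hot-k : hot k ≡ ⁅ i ⁆
        hot-k = trans (cong hot (sym toℕi)) (hot-toℕ i)
        split : elems n ≡ applyUpTo hot (toℕ i) ++ ⁅ i ⁆ ∷ els (suc k) r
        split = subst₂ (λ a b → elems n ≡ applyUpTo hot a ++ b ∷ els (suc k) r) (sym toℕi) hot-k
          (els-split k (suc r) (cong (els 0) (sym eq)))
        member : (i ∈ B × ∃[ e ] (e ∈ acc × e ∉ B × Independent M (swap B i e)))
                ⊎ (i ∉ B × ¬ (∃[ b ] (toℕ b < toℕ i × b ∈ B × b ∉ acc × Independent M (swap B b i)))) → i ∈ F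
        member (inj₁ (p , e , q , e∉B , s)) = Dec.decidable-stable (i S.∈? F) λ i∉F → no-crossing opt i e p i∉F e∉B (proj₁ (to e q)) s
        member (inj₂ (p , none)) = Dec.decidable-stable (i S.∈? F) λ i∉F →
          let b , b∈B , b∉F , s , lt = smaller-outside opt i p i∉F in none (b , lt , b∈B , (λ q → b∉F (proj₁ (to b q))) , s)
        enters : i ∈ F → (i ∈ B × ∃[ e ] (e ∈ acc × e ∉ B × Independent M (swap B i e)))
                ⊎ (i ∉ B × ¬ (∃[ b ] (toℕ b < toℕ i × b ∈ B × b ∉ acc × Independent M (swap B b i))))
        enters p with i S.∈? B
        ... | yes q = let e , e∉B , e∈F , s , lt = smaller-inside opt i q p in inj₁ (q , e , from e e∈F (subst (toℕ e <_) toℕi lt) , e∉B , s)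
        ... | no ¬q = inj₂ (¬q , λ (b , lt , b∈B , b∉acc , s) → no-crossing opt b i b∈B (λ b∈F → b∉acc (from b b∈F (subst (toℕ b <_) toℕi lt))) ¬q p s)
        decide : Reflects (i ∈ F) (passᵇ B acc ⁅ i ⁆)
        decide = reflects-map member enters (passᵇ-reflects acc i (els (suc k) r) split)
        to′ : ∀ j → j ∈ g acc ⁅ i ⁆ → j ∈ F × toℕ j < suc k
        to′ j with passᵇ B acc ⁅ i ⁆ | decide
        ... | true  | ofʸ i∈F = λ p → Sum.[ (λ q → proj₁ (to j q) , ℕ.m≤n⇒m≤1+n (proj₂ (to j q)))
                                          , (λ { refl → i∈F , s≤s (ℕ.≤-reflexive toℕi) }) ] (∈-⊕⁻ acc i p)
        ... | false | ofⁿ _   = λ p → proj₁ (to j p) , ℕ.m≤n⇒m≤1+n (proj₂ (to j p))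
        from′ : ∀ j → j ∈ F → toℕ j < suc k → j ∈ g acc ⁅ i ⁆
        from′ j p (s≤s le) with passᵇ B acc ⁅ i ⁆ | decide | ℕ.m≤n⇒m<n∨m≡n le
        ... | true  | _       | inj₁ lt = ⊆-⊕ acc i (from j p lt)
        ... | true  | _       | inj₂ eq = subst (_∈ acc ⊕ i) (FinP.toℕ-injective (trans toℕi (sym eq))) (∈-⊕ acc i)
        ... | false | _       | inj₁ lt = from j p lt
        ... | false | ofⁿ i∉F | inj₂ eq = contradiction (subst (_∈ F) (FinP.toℕ-injective (trans eq (sym toℕi))) p) i∉F

-- Decoding the listed sets and ranks

loadBits-∷ : ∀ {n} a (A p : Subset n) bs → loadBits (a ∷ A) (false ∷ p) bs ≡ a ∷ loadBits A p bs
loadBits-∷ a A p []           = refl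
loadBits-∷ a A p (true ∷ bs)  = trans (loadBits-∷ (a ∨ false) (A ∪ p) (shiftIn false p) bs) (cong (_∷ loadBits (A ∪ p) (shiftIn false p) bs) (𝔹.∨-identityʳ a))
loadBits-∷ a A p (false ∷ bs) = loadBits-∷ a A (shiftIn false p) bs

loadSet-∷ : ∀ {n} b bs → loadSet {suc n} (b ∷ bs) ≡ b ∷ loadSet bs
loadSet-∷ {n} b bs = trans (cong₂ (λ A p → loadBits A (false ∷ p) bs) (first b) shiftIn-true-⊥) (loadBits-∷ b ⊥ (hot 0) bs)
  where
  first : ∀ b → (if b then (false ∷ ⊥) ∪ (true ∷ ⊥) else (false ∷ ⊥)) ≡ b ∷ ⊥ {n}
  first true  = cong (true ∷_) (S.∪-identityʳ ⊥)
  first false = refl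

loadSet-toList : ∀ {n} (X : Subset n) → loadSet (toList X) ≡ X
loadSet-toList []      = refl
loadSet-toList (b ∷ X) = trans (loadSet-∷ b (toList X)) (cong (b ∷_) (loadSet-toList X))

-- A unary rank is read like a characteristic vector, so the number `k` turns into the set of the
-- first `k` elements. This is faithful because no rank exceeds `n`.
unary : ∀ {n} → ℕ → Subset n
unary k = loadSet (replicate k true)

card-unary : ∀ {n} k → k ≤ n → ∣ unary {n} k ∣ ≡ k
card-unary {n}     zero    k≤n       = S.∣⊥∣≡0 n
card-unary {suc n} (suc k) (s≤s k≤n) = trans (cong ∣_∣ (loadSet-∷ {n} true (replicate k true))) (cong suc (card-unary k k≤n))

toks-encSet : ∀ {n} (X : Subset n) v → map listTok (encSet X ++ v) ≡ map just (toList X) ++ nothing ∷ map listTok v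
toks-encSet []          v = refl
toks-encSet (true ∷ X)  v = cong (just true ∷_) (toks-encSet X v)
toks-encSet (false ∷ X) v = cong (just false ∷_) (toks-encSet X v)

toks-encℕ : ∀ k v → map listTok (encℕ k ++ sep ∷ v) ≡ map just (replicate k true) ++ nothing ∷ map listTok v
toks-encℕ zero    v = refl
toks-encℕ (suc k) v = cong (just true ∷_) (toks-encℕ k v)

readBlock-just : ∀ bs ts → readBlock (map just bs ++ nothing ∷ ts) ≡ (bs , ts)
readBlock-just []       ts = refl
readBlock-just (b ∷ bs) ts = cong (map₁ (b ∷_)) (readBlock-just bs ts)

entries-step : ∀ {n} ranked f ts → nonempty ts ≡ true →
  entries {n} ranked (suc f) ts ≡ proj₁ (readEntry ranked ts) ∷ entries ranked f (proj₂ (readEntry {n} ranked ts))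
entries-step ranked f (t ∷ ts) _ = refl

nonempty-block : ∀ bs (ts : Toks) → nonempty (map just bs ++ nothing ∷ ts) ≡ true
nonempty-block []      ts = refl
nonempty-block (_ ∷ _) ts = refl

length-blocks : ∀ {A : Set} (g : A → Word) → (∀ x → 1 ≤ length (g x)) → ∀ L → length L ≤ length (map listTok (concatMap g L))
length-blocks g pos L = ℕ.≤-trans (go L) (ℕ.≤-reflexive (sym (ListP.length-map listTok (concatMap g L))))
  where
  go : ∀ L → length L ≤ length (concatMap g L)
  go []      = z≤n
  go (x ∷ L) = ℕ.≤-trans (ℕ.+-mono-≤ (pos x) (go L)) (ℕ.≤-reflexive (sym (ListP.length-++ (g x))))

entries-plain : ∀ {n} f (L : List (Subset n)) → length L ≤ f → entries false f (map listTok (encSets L)) ≡ map (λ X → X , ⊥) L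
entries-plain zero    []      le = refl
entries-plain (suc f) []      le = refl
entries-plain {n} (suc f) (X ∷ L) (s≤s le) = begin
  entries false (suc f) (map listTok (encSet X ++ encSets L))  ≡⟨ cong (entries false (suc f)) (toks-encSet X (encSets L)) ⟩
  entries false (suc f) block                                  ≡⟨ entries-step false f block (nonempty-block (toList X) _) ⟩
  (loadSet (proj₁ (readBlock block)) , ⊥) ∷ entries false f (proj₂ (readBlock block))
    ≡⟨ cong (λ rb → (loadSet (proj₁ rb) , ⊥) ∷ entries false f (proj₂ rb)) (readBlock-just (toList X) _) ⟩
  (loadSet (toList X) , ⊥) ∷ entries false f (map listTok (encSets L))
    ≡⟨ cong₂ (λ Y es → (Y , ⊥) ∷ es) (loadSet-toList X) (entries-plain f L le) ⟩
  (X , ⊥) ∷ map (λ X → X , ⊥) L ∎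
  where
  open ≡-Reasoning
  block = map just (toList X) ++ nothing ∷ map listTok (encSets L)

entries-ranked : ∀ {n} (rk : Subset n → ℕ) f L → length L ≤ f → entries true f (map listTok (encRankedSets rk L)) ≡ map (λ X → X , unary (rk X)) L
entries-ranked rk zero    []      le = refl
entries-ranked rk (suc f) []      le = refl
entries-ranked {n} rk (suc f) (X ∷ L) (s≤s le) = begin
  entries true (suc f) (map listTok ((encSet X ++ encℕ (rk X) ++ [ sep ]) ++ encRankedSets rk L))
    ≡⟨ cong (entries true (suc f)) (trans (cong (map listTok) (trans (ListP.++-assoc (encSet X) _ _) (cong (encSet X ++_) (ListP.++-assoc (encℕ (rk X)) [ sep ] _))))
        (trans (toks-encSet X _) (cong (λ ts → map just (toList X) ++ nothing ∷ ts) (toks-encℕ (rk X) (encRankedSets rk L))))) ⟩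
  entries true (suc f) block
    ≡⟨ entries-step true f block (nonempty-block (toList X) _) ⟩
  entry (readBlock block)
    ≡⟨ cong entry (readBlock-just (toList X) _) ⟩
  entry (toList X , block′)
    ≡⟨ cong (λ rb → (loadSet (toList X) , loadSet (proj₁ rb)) ∷ entries true f (proj₂ rb)) (readBlock-just (replicate (rk X) true) _) ⟩
  (loadSet (toList X) , unary (rk X)) ∷ entries true f (map listTok (encRankedSets rk L))
    ≡⟨ cong₂ (λ Y es → (Y , unary (rk X)) ∷ es) (loadSet-toList X) (entries-ranked rk f L le) ⟩
  (X , unary (rk X)) ∷ map (λ X → X , unary (rk X)) L ∎
  where
  open ≡-Reasoning
  block′ = map just (replicate (rk X) true) ++ nothing ∷ map listTok (encRankedSets rk L)
  block = map just (toList X) ++ nothing ∷ block′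
  entry : List Bool × Toks → List (Subset n × Subset n)
  entry rb = (loadSet (proj₁ rb) , loadSet (proj₁ (readBlock (proj₂ rb)))) ∷ entries true f (proj₂ (readBlock (proj₂ rb)))

length-encSet : ∀ {n} (X : Subset n) → length (encSet X) ≡ suc n
length-encSet []          = refl
length-encSet (true ∷ X)  = cong suc (length-encSet X)
length-encSet (false ∷ X) = cong suc (length-encSet X)

entriesOf-plain : ∀ {n} (L : List (Subset n)) → entriesOf false (encSets L) ≡ map (λ X → X , ⊥) L
entriesOf-plain L = entries-plain _ L (length-blocks encSet (λ X → ℕ.≤-trans (s≤s z≤n) (ℕ.≤-reflexive (sym (length-encSet X)))) L)

entriesOf-ranked : ∀ {n} (rk : Subset n → ℕ) L → entriesOf true (encRankedSets rk L) ≡ map (λ X → X , unary (rk X)) L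
entriesOf-ranked rk L = entries-ranked rk _ L (length-blocks _ (λ X → ℕ.≤-trans (s≤s z≤n)
  (ℕ.≤-trans (ℕ.≤-reflexive (sym (length-encSet X))) (ℕ.≤-trans (ℕ.m≤m+n _ _) (ℕ.≤-reflexive (sym (ListP.length-++ (encSet X))))))) L)

-- The arcs of the diagram as reductions

record Valid (J : InputType) {n} (M : Matroid n) (Es : List (Subset n × Subset n)) (ind : Oracle) (cand : Candidate) : Set where
  open Semantics Es
  field
    ind-ok  : ∀ {d} X (ρ : Vec (Subset n) d) → Reflects (Independent M X) (⟦ ind ⟧B (X ∷ ρ))
    F       : Subset n → Subset n → Subset n
    cand-ok : ∀ {d} X e (ρ : Vec (Subset n) d) → ⟦ cand ⟧S (e ∷ X ∷ ρ) ≡ F X e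
    covers  : ∀ Y → Target J M Y → ∃[ E ] (E ∈ₗ Es × ∃[ e ] (e ∈ₗ elems n × F (proj₁ E) e ≡ Y))

arc : ∀ {I J} ranked (enc : ∀ {n} → Matroid n → List (Subset n) → Word) (r : ∀ {n} → Matroid n → Subset n → Subset n) →
  (∀ {n} (M : Matroid n) L → entriesOf ranked (enc M L) ≡ map (λ X → X , r M X) L) →
  (∀ {n} {M : Matroid n} {w} → Describes I M w → ∃[ L ] (Enumerates (Target I M) L × w ≡ header n ++ enc M L)) →
  J ≢ RANK → (ind : Oracle) (cand : Candidate) →
  (∀ {n} (M : Matroid n) L → Enumerates (Target I M) L → Valid J M (map (λ X → X , r M X) L) ind cand) → Reduces I J
arc {I} {J} ranked enc r parsed describes J≢RANK ind cand valid = reduces-by ranked (Program.program J ind cand) ok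
  where
  ok : ∀ n (M : Matroid n) w → Describes I M w →
     ∃[ post ] (w ≡ header n ++ post × Describes J M (Semantics.⟦_⟧O {n} (entriesOf ranked post) (Program.program J ind cand) []))
  ok n M w D with describes D
  ... | L , en , eq = enc M L , eq ,
    subst (λ es → Describes J M (Semantics.⟦_⟧O es (Program.program J ind cand) [])) (sym (parsed M L))
      (Emission.Generate.program-ok _ J J≢RANK M ind cand ind-ok F cand-ok (Oracles.unique-Es M (Target I M) (r M) L en) covers)
    where open Valid (valid M L en)

plain-arc : ∀ {I J} → (∀ {n} {M : Matroid n} {w} → Describes I M w → ∃[ L ] (Enumerates (Target I M) L × w ≡ header n ++ encSets L)) →
  J ≢ RANK → (ind : Oracle) (cand : Candidate) →
  (∀ {n} (M : Matroid n) L → Enumerates (Target I M) L → Valid J M (map (λ X → X , ⊥) L) ind cand) → Reduces I J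
plain-arc = arc false (λ _ → encSets) (λ _ _ → ⊥) (λ _ → entriesOf-plain)

∅∈elems : ∀ n → ⊥ ∈ₗ elems n
∅∈elems zero    = here refl
∅∈elems (suc n) = subst (⊥ ∈ₗ_) (sym (elems-suc n)) (there (∈ₗ.∈-map⁺ (false ∷_) (∅∈elems n)))

module _ {n : ℕ} {M : Matroid n} {T : Subset n → Set} {r : Subset n → Subset n} {L : List (Subset n)} (en : Enumerates T L) where
  open Oracles M T r L en
  open Theory M
  open Closure M

  -- Covers all arcs along which each target set is itself listed: the listed sets are their own
  -- candidates, obtained in the turn with the empty element.
  valid-filter : ∀ {J} (ind : Oracle) → Correct ind → (∀ Y → Target J M Y → T Y) → Valid J M Es ind x1
  valid-filter ind ok incl = record
    { ind-ok = ok ; F = λ X e → X ; cand-ok = λ _ _ _ → refl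
    ; covers = λ Y t → _ , ∈Es⁺ (incl Y t) , _ , ∅∈elems n , refl }

  valid-flats : (T⇔ : ∀ X → T X ⇔ Independent M X) → Valid FLATS M Es ind-IND (Candidates.cand-flat ind-IND)
  valid-flats T⇔ = record
    { ind-ok = correct-IND T⇔ ; F = λ X e → clF X ; cand-ok = λ X e ρ → clE-ok x1 (e ∷ X ∷ ρ)
    ; covers = λ Y f → let I , b = basis-exists Y in
        _ , ∈Es⁺ (Equivalence.from (T⇔ I) (indep b)) , _ , ∅∈elems n , trans (clF≡cl (indep b)) (flat-cl f b) }
    where open CandidateSemantics Es M ind-IND (correct-IND T⇔)

  module _ (T⇔ : ∀ X → T X ⇔ Basis M X) where
    open CandidateSemantics Es M ind-BASES (correct-BASES T⇔)

    valid-hyperplanes : Valid HYPERPLANES M Es ind-BASES (Candidates.cand-hyp ind-BASES)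
    valid-hyperplanes = record
      { ind-ok = correct-BASES T⇔ ; F = λ X e → clF (X ∖ e) ; cand-ok = λ X e ρ → clE-ok (x1 ∖′ x0) (e ∷ X ∷ ρ)
      ; covers = λ Y h → let B , e , b , eq , i = hyperplane-basis h in
          _ , ∈Es⁺ (Equivalence.from (T⇔ B) b) , _ , ⁅⁆∈elems e , trans (clF≡cl i) eq }

    valid-circuits : Valid CIRCUITS M Es ind-BASES (Candidates.cand-circ ind-BASES)
    valid-circuits = record
      { ind-ok = correct-BASES T⇔ ; F = circF ; cand-ok = circ-ok
      ; covers = λ Y c → let B , e , b , e∈C , fwd , bwd = circuit-basis c in
          _ , ∈Es⁺ (Equivalence.from (T⇔ B) b) , _ , ⁅⁆∈elems e , circF≡ e∈C fwd bwd }

    valid-cyclic : Valid CYCLIC-FLATS M Es ind-BASES (Candidates.cand-cyc ind-BASES)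
    valid-cyclic = record
      { ind-ok = correct-BASES T⇔ ; F = λ B e → passF B ⊥ ; cand-ok = cyc-ok
      ; covers = λ Y c → let B , o = Activity.optimal M Y c in
          _ , ∈Es⁺ (Equivalence.from (T⇔ B) (proj₁ (proj₁ o))) , _ , ∅∈elems n , pass≡F Y c B o }

unary-injective : ∀ {n} (M : Matroid n) X Y → unary {n} (Matroid.rank M X) ≡ unary (Matroid.rank M Y) ⇔ Matroid.rank M X ≡ Matroid.rank M Y
unary-injective {n} M X Y = mk⇔ (λ eq → trans (sym (card-unary _ (small X))) (trans (cong ∣_∣ eq) (card-unary _ (small Y)))) (cong unary)
  where
  small : ∀ Z → Matroid.rank M Z ≤ n
  small Z = ℕ.≤-trans (Matroid.R1 M Z) (S.∣p∣≤n Z)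

rank-arc : ∀ {J} → J ≢ RANK → Reduces RANK J
rank-arc {J} J≢RANK = arc {RANK} true (λ M → encRankedSets (Matroid.rank M)) (λ M X → unary (Matroid.rank M X))
  (λ M → entriesOf-ranked (Matroid.rank M)) id J≢RANK ind-RANK x1
  (λ M L en → valid-filter en ind-RANK (Oracles.correct-RANK M _ _ L en (λ _ → tt) (unary-injective M)) (λ _ _ → tt))

⇔-id : ∀ {A : Set} → A ⇔ A
⇔-id = mk⇔ id id

reduces-arc : ∀ {I J} → Arc I J → Reduces I J
reduces-arc rank→span  = rank-arc λ ()
reduces-arc rank→ind   = rank-arc λ ()
reduces-arc span→bases = plain-arc id (λ ()) ind-SPAN x1 (λ M L en → valid-filter en ind-SPAN (Oracles.correct-SPAN M _ _ L en (λ _ → ⇔-id)) (λ _ → proj₂))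
reduces-arc ind→bases  = plain-arc id (λ ()) ind-IND x1 (λ M L en → valid-filter en ind-IND (Oracles.correct-IND M _ _ L en (λ _ → ⇔-id)) (λ _ → proj₁))
reduces-arc ind→flats  = plain-arc id (λ ()) ind-IND (Candidates.cand-flat ind-IND) (λ M L en → valid-flats en (λ _ → ⇔-id))
reduces-arc bases→circ = plain-arc id (λ ()) ind-BASES (Candidates.cand-circ ind-BASES) (λ M L en → valid-circuits en (λ _ → ⇔-id))
reduces-arc bases→cyc  = plain-arc id (λ ()) ind-BASES (Candidates.cand-cyc ind-BASES) (λ M L en → valid-cyclic en (λ _ → ⇔-id))
reduces-arc bases→hyp  = plain-arc id (λ ()) ind-BASES (Candidates.cand-hyp ind-BASES) (λ M L en → valid-hyperplanes en (λ _ → ⇔-id))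
reduces-arc flats→cyc  = plain-arc id (λ ()) ind-SEP x1 (λ M L en → valid-filter en ind-SEP
  (Oracles.correct-SEP M _ _ L en (λ _ → id) (Oracles.separate-FLATS M _ (λ _ → ⊥) L en (λ _ → ⇔-id))) (λ _ → proj₁))
reduces-arc flats→hyp  = plain-arc id (λ ()) ind-SEP x1 (λ M L en → valid-filter en ind-SEP
  (Oracles.correct-SEP M _ _ L en (λ _ → id) (Oracles.separate-FLATS M _ (λ _ → ⊥) L en (λ _ → ⇔-id))) (λ _ → proj₁))
reduces-arc circ→nsc   = plain-arc id (λ ()) ind-CIRC x1 (λ M L en → valid-filter en ind-CIRC (Oracles.correct-CIRC M _ _ L en (λ _ → ⇔-id)) (λ _ → proj₁))
reduces-arc hyp→dh     = plain-arc id (λ ()) ind-SEP x1 (λ M L en → valid-filter en ind-SEP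
  (Oracles.correct-SEP M _ _ L en (λ _ → proj₁) (Oracles.separate-HYP M _ (λ _ → ⊥) L en (λ _ → ⇔-id))) (λ _ → proj₁))

reduces-path : ∀ {I J} → Path I J → Reduces I J
reduces-path Plus.[ a ]       = reduces-arc a
reduces-path (a Plus.∷ p)     = reduces-trans (reduces-arc a) (reduces-path p)

-- The start state is the halting state, so the input is left in place as output after no step at
-- all.
≼-refl : ∀ I → I ≼ I
≼-refl I = record { Q = 1 ; G = 0 ; start = zero ; halt = zero ; δ = λ q a → q , a , stay } , 0 , 0
  , (λ w → 0 , z≤n , refl) , (λ n M w D → 0 , w , refl , (λ _ _ → refl) , D)

path⇒≼ : ∀ {I J} → I ≡ J ⊎ Path I J → I ≼ J
path⇒≼ (inj₁ refl) = ≼-refl _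
path⇒≼ (inj₂ p)    = reduces⇒≼ (reduces-path p)

-- Lower bounds by output length

module _ (T : TM) where

  step-halted : ∀ c → Config.state c ≡ TM.halt T → step T c ≡ c
  step-halted (cfg q h t) eq with does (FinP._≟_ q (TM.halt T)) | Dec.dec-true (FinP._≟_ q (TM.halt T)) eq
  ... | true | _ = refl

  run-halted : ∀ w k → HaltedAt T w k → ∀ j → run T w (j + k) ≡ run T w k
  run-halted w k h zero    = refl
  run-halted w k h (suc j) = trans (cong (step T) (run-halted w k h j)) (step-halted (run T w k) h)

  -- In `_≼_` the time bound and the output are stated at separately quantified halting times. A
  -- halted configuration stays as it is, so both times show the same tape.
  run-unique : ∀ w k k′ → HaltedAt T w k → HaltedAt T w k′ → run T w k ≡ run T w k′
  run-unique w k k′ h h′ = trans (sym (run-halted w k h k′)) (trans (cong (run T w) (ℕ.+-comm k′ k)) (run-halted w k′ h′ k))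

  -- After k steps only the cells 0, …, k have been visited.
  record Local (m k : ℕ) (c : Config T) : Set where
    constructor local
    field
      near  : Config.head c ≤ k
      blank : ∀ i → m + k ≤ i → Config.tape c i ≡ nothing

  move-≤ : ∀ m h k → h ≤ k → move m h ≤ suc k
  move-≤ left  zero    k le = z≤n
  move-≤ left  (suc h) k le = ℕ.≤-trans (ℕ.n≤1+n h) (ℕ.m≤n⇒m≤1+n le)
  move-≤ right h       k le = s≤s le
  move-≤ stay  h       k le = ℕ.m≤n⇒m≤1+n le

  local-step : ∀ m k c → Local m k c → Local m (suc k) (step T c)
  local-step m k (cfg q h t) (local n b) with does (FinP._≟_ q (TM.halt T))
  ... | true  = local (ℕ.m≤n⇒m≤1+n n) (λ i le → b i (ℕ.≤-trans (ℕ.+-monoʳ-≤ m (ℕ.n≤1+n k)) le))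
  ... | false = local (move-≤ (proj₂ (proj₂ (TM.δ T q (t h)))) h k n) λ i le →
    trans (cong (λ e → if e then proj₁ (proj₂ (TM.δ T q (t h))) else t i)
            (Dec.dec-false (i ℕ.≟ h) λ { refl → ℕ.<⇒≱ (ℕ.≤-trans (ℕ.m≤n+m (suc k) m) le) n }))
          (b i (ℕ.≤-trans (ℕ.+-monoʳ-≤ m (ℕ.n≤1+n k)) le))

  wordTape-blank : ∀ w i → length w ≤ i → wordTape {TM.G T} w i ≡ nothing
  wordTape-blank []      i       le       = refl
  wordTape-blank (x ∷ w) (suc i) (s≤s le) = wordTape-blank w i le

  wordTape-just : ∀ w i → i < length w → wordTape {TM.G T} w i ≢ nothing
  wordTape-just (x ∷ w) zero    le       ()
  wordTape-just (x ∷ w) (suc i) (s≤s le) = wordTape-just w i le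

  local-run : ∀ w k → Local (length w) k (run T w k)
  local-run w zero    = local z≤n (λ i le → wordTape-blank w i (ℕ.≤-trans (ℕ.m≤m+n _ _) le))
  local-run w (suc k) = local-step (length w) k (run T w k) (local-run w k)

  output-length : ∀ w k u → OutputIs (run T w k) u → length u ≤ length w + k
  output-length w k u out = ℕ.≮⇒≥ λ lt → wordTape-just u (length w + k) lt
    (trans (sym (out (length w + k) (ℕ.<⇒≤ lt))) (Local.blank (local-run w k) (length w + k) ℕ.≤-refl))

Few Many : InputType → ∀ {n} → Matroid n → ℕ → Set
Few  I M ℓ = ∃[ w ] (Describes I M w × length w ≤ ℓ)
Many J M N = ∀ u → Describes J M u → N ≤ length u

n<2^n : ∀ n → n < 2 ^ n
n<2^n zero    = s≤s z≤n
n<2^n (suc n) = ℕ.≤-trans (s≤s (n<2^n n)) (ℕ.≤-trans (ℕ.+-monoˡ-≤ (2 ^ n) (ℕ.m^n>0 2 n)) (ℕ.≤-reflexive (cong (2 ^ n +_) (sym (ℕ.+-identityʳ (2 ^ n))))))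

-- Abstract, so that comparing two bounds never multiplies out the powers.
abstract
  budget : ℕ → ℕ → ℕ
  budget j a = (2 ^ suc j) ^ a

  budget-def : ∀ j a → budget j a ≡ (2 ^ suc j) ^ a
  budget-def j a = refl

-- The exponent of 2 is `suc j * a` in the upper bound and `j * j` in the lower one; for fixed `a`
-- the latter outgrows every constant multiple of the former. Taking `2 ^ suc j` as the base keeps
-- it at least 2 also for `j = 0`, so that constants can be absorbed.
record Gap (I J : InputType) (a j : ℕ) : Set where
  constructor gap
  field
    {ground} : ℕ
    matroid  : Matroid ground
    few      : Few I matroid (budget j a)
    many     : Many J matroid (2 ^ (j * j))

-- Each of the `1 + (c + c)` terms is at most `ℓ ^ suc d`. The coefficient is then replaced by a
-- power of 2, so that afterwards only exponents have to be compared.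
poly-< : ∀ c d ℓ → 1 ≤ ℓ → ℓ + (c * ℓ ^ d + c) < 2 ^ (1 + (c + c)) * ℓ ^ suc d
poly-< c d ℓ@(suc _) pos = ℕ.≤-<-trans
  (ℕ.+-mono-≤ (ℕ.≤-trans (ℕ.≤-reflexive (sym (ℕ.^-identityʳ ℓ))) (ℕ.^-monoʳ-≤ ℓ (s≤s (z≤n {d}))))
    (ℕ.+-mono-≤ (ℕ.*-monoʳ-≤ c (ℕ.^-monoʳ-≤ ℓ (ℕ.n≤1+n d))) (ℕ.≤-trans (ℕ.≤-reflexive (sym (ℕ.*-identityʳ c))) (ℕ.*-monoʳ-≤ c (ℕ.m^n>0 ℓ (suc d))))))
  (ℕ.≤-<-trans (ℕ.≤-reflexive (eq c (ℓ ^ suc d))) (ℕ.*-monoˡ-< (ℓ ^ suc d) {{ℕ.m^n≢0 ℓ (suc d)}} (n<2^n (1 + (c + c)))))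
  where
  eq : ∀ c x → x + (c * x + c * x) ≡ (1 + (c + c)) * x
  eq = solve-∀

no-reduction : ∀ I J a → (∀ j → Gap I J a j) → ¬ (I ≼ J)
no-reduction I J a family (T , c , d , halts , correct) with family j
  where
  -- With `C = 1 + (c + c)` and `D = a * suc d` the exponent to be beaten is `C + suc j * D`, which
  -- is at most `j * (C + D) + j * D`. The choice of `j` makes this equal to `j * j`.
  j = (1 + (c + c)) + (a * suc d + a * suc d)
... | gap M (w , Dw , short) many with halts w | correct _ M w Dw
... | k , k≤ , h | k′ , u , h′ , out , Du = ℕ.<-irrefl refl (ℕ.≤-<-trans (many u Du) (ℕ.≤-<-trans len
        (ℕ.<-≤-trans (poly-< c d ℓ ℓ-pos) (ℕ.≤-trans (ℕ.≤-reflexive exps) (ℕ.^-monoʳ-≤ 2 big)))))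
  where
  C = 1 + (c + c)
  D = a * suc d
  j = C + (D + D)
  ℓ = budget j a
  ℓ-pos : 1 ≤ ℓ
  ℓ-pos = subst (1 ≤_) (sym (budget-def j a)) (ℕ.m^n>0 (2 ^ suc j) {{ℕ.m^n≢0 2 (suc j)}} a)
  len : length u ≤ ℓ + (c * ℓ ^ d + c)
  len = ℕ.≤-trans (output-length T w k u (subst (λ r → OutputIs r u) (run-unique T w k′ k h′ h) out))
    (ℕ.+-mono-≤ short (ℕ.≤-trans k≤ (ℕ.+-monoˡ-≤ c (ℕ.*-monoʳ-≤ c (ℕ.^-monoˡ-≤ d short)))))
  exps : 2 ^ C * ℓ ^ suc d ≡ 2 ^ (C + suc j * (a * suc d))
  exps = trans (cong (2 ^ C *_) (trans (trans (cong (_^ suc d) (budget-def j a)) (ℕ.^-*-assoc (2 ^ suc j) a (suc d))) (ℕ.^-*-assoc 2 (suc j) (a * suc d)))) (sym (ℕ.^-distribˡ-+-* 2 C (suc j * (a * suc d))))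
  big : C + suc j * D ≤ j * j
  big = ℕ.≤-trans (ℕ.≤-reflexive (e₁ C D j)) (ℕ.≤-trans (ℕ.+-monoˡ-≤ (j * D) (ℕ.≤-trans (ℕ.≤-reflexive (sym (ℕ.*-identityˡ (C + D)))) (ℕ.*-monoˡ-≤ (C + D) {1} {j} (s≤s z≤n)))) (ℕ.≤-reflexive (e₂ C D j)))
    where
    e₁ : ∀ C D j → C + suc j * D ≡ (C + D) + j * D
    e₁ = solve-∀
    e₂ : ∀ C D j → j * (C + D) + j * D ≡ j * (C + (D + D))
    e₂ = solve-∀

-- Counting sets against the length of descriptions

unique-⊆-length : ∀ {A : Set} {xs ys : List A} → Unique xs → (∀ {x} → x ∈ₗ xs → x ∈ₗ ys) → length xs ≤ length ys
unique-⊆-length [] sub = z≤n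
unique-⊆-length {xs = x ∷ xs} {ys} (x∉ ∷ u) sub with ∈ₗ.∈-∃++ (sub (here refl))
... | as , bs , refl = ℕ.≤-trans (s≤s (unique-⊆-length u sub′)) (ℕ.≤-reflexive (trans (cong suc (ListP.length-++ as)) (trans (sym (ℕ.+-suc (length as) (length bs))) (sym (ListP.length-++ as)))))
  where
  sub′ : ∀ {y} → y ∈ₗ xs → y ∈ₗ as ++ bs
  sub′ p with ∈ₗ.∈-++⁻ as (sub (there p))
  ... | inj₁ q           = ∈ₗ.∈-++⁺ˡ q
  ... | inj₂ (here refl) = contradiction refl (All.lookup x∉ p)
  ... | inj₂ (there q)   = ∈ₗ.∈-++⁺ʳ as q

describes-list : ∀ J {n} (M : Matroid n) u → Describes J M u → ∃[ L ] (Enumerates (Target J M) L × length L ≤ length u)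
describes-list J {n} M u D = go J D
  where
  items : ∀ (g : Subset n → Word) → (∀ X → 1 ≤ length (g X)) → ∀ L v → length L ≤ length (v ++ concatMap g L)
  items g pos L v = ℕ.≤-trans (length-blocks g pos L) (ℕ.≤-trans (ℕ.≤-reflexive (ListP.length-map listTok (concatMap g L)))
    (ℕ.≤-trans (ℕ.m≤n+m _ (length v)) (ℕ.≤-reflexive (sym (ListP.length-++ v)))))
  set-pos : ∀ X → 1 ≤ length (encSet {n} X)
  set-pos X = ℕ.≤-trans (s≤s z≤n) (ℕ.≤-reflexive (sym (length-encSet X)))
  ranked-pos : ∀ X → 1 ≤ length (encSet {n} X ++ encℕ (Matroid.rank M X) ++ [ sep ])
  ranked-pos X = ℕ.≤-trans (set-pos X) (ℕ.≤-trans (ℕ.m≤m+n _ _) (ℕ.≤-reflexive (sym (ListP.length-++ (encSet X)))))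
  plain : ∀ {P : Subset n → Set} {w} → ∃[ L ] (Enumerates P L × w ≡ header n ++ encSets L) → ∃[ L ] (Enumerates P L × length L ≤ length w)
  plain (L , en , refl) = L , en , items encSet set-pos L (header n)
  rank-first : ∀ {P : Subset n → Set} {w} → ∃[ L ] (Enumerates P L × w ≡ header n ++ encℕ (r[M] M) ++ [ bar ] ++ encSets L) → ∃[ L ] (Enumerates P L × length L ≤ length w)
  rank-first (L , en , refl) = L , en , ℕ.≤-trans (items encSet set-pos L (encℕ (r[M] M) ++ [ bar ]))
    (ℕ.≤-trans (ℕ.≤-reflexive (cong length (ListP.++-assoc (encℕ (r[M] M)) [ bar ] (encSets L)))) (ℕ.≤-trans (ℕ.m≤n+m _ (length (header n))) (ℕ.≤-reflexive (sym (ListP.length-++ (header n))))))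
  ranked : ∀ {P : Subset n → Set} {w} → ∃[ L ] (Enumerates P L × w ≡ header n ++ encRankedSets (Matroid.rank M) L) → ∃[ L ] (Enumerates P L × length L ≤ length w)
  ranked (L , en , refl) = L , en , items _ ranked-pos L (header n)
  go : ∀ J → Describes J M u → ∃[ L ] (Enumerates (Target J M) L × length L ≤ length u)
  go RANK                  D = ranked D
  go INDEPENDENT-SETS      D = plain D
  go SPANNING-SETS         D = plain D
  go BASES                 D = plain D
  go FLATS                 D = plain D
  go CIRCUITS              D = plain D
  go HYPERPLANES           D = plain D
  go NON-SPANNING-CIRCUITS D = rank-first D
  go DEPENDENT-HYPERPLANES D = rank-first D
  go CYCLIC-FLATS          D = ranked D

Lots : ∀ {n} → (Subset n → Set) → ℕ → Set
Lots P N = ∃[ xs ] (Unique xs × N ≤ length xs × (∀ {X} → X ∈ₗ xs → P X))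

lots-many : ∀ J {n} (M : Matroid n) {P N} → Lots P N → (∀ {X} → P X → Target J M X) → Many J M N
lots-many J M (xs , u , N≤ , p) t w D with describes-list J M w D
... | L , en , le = ℕ.≤-trans N≤ (ℕ.≤-trans (unique-⊆-length u (λ q → Equivalence.from (proj₂ en _) (t (p q)))) le)

lots-map : ∀ {n m} (P : Subset n → Set) (Q : Subset m → Set) {N} (f : Subset n → Subset m) →
  (∀ {X Y} → f X ≡ f Y → X ≡ Y) → (∀ X → P X → Q (f X)) → Lots P N → Lots Q N
lots-map P Q f inj pq (xs , u , N≤ , p) = map f xs , Unq.map⁺ inj u , ℕ.≤-trans N≤ (ℕ.≤-reflexive (sym (ListP.length-map f xs)))
  , λ q → let X , r , eq = ∈ₗ.∈-map⁻ f q in subst Q (sym eq) (pq X (p r))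

vecs : ∀ {A : Set} → List A → ∀ k → List (Vec A k)
vecs as zero    = [ [] ]
vecs as (suc k) = cartesianProductWith _∷_ as (vecs as k)

vecs-unique : ∀ {A : Set} {as : List A} → Unique as → ∀ k → Unique (vecs as k)
vecs-unique u zero    = [] ∷ []
vecs-unique u (suc k) = Unq.cartesianProductWith⁺ _∷_ (λ { refl → refl , refl }) u (vecs-unique u k)

length-product : ∀ {A B C : Set} (f : A → B → C) as bs → length (cartesianProductWith f as bs) ≡ length as * length bs
length-product f []       bs = refl
length-product f (a ∷ as) bs = trans (ListP.length-++ (map (f a) bs)) (cong₂ _+_ (ListP.length-map (f a) bs) (length-product f as bs))

length-vecs : ∀ {A : Set} (as : List A) k → length (vecs as k) ≡ length as ^ k
length-vecs as zero    = refl
length-vecs as (suc k) = trans (length-product _∷_ as (vecs as k)) (cong (length as *_) (length-vecs as k))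

bools : List Bool
bools = true ∷ false ∷ []

bools-unique : Unique bools
bools-unique = ((λ ()) ∷ []) ∷ [] ∷ []

∈-vecs : ∀ {k} (v : Vec Bool k) → v ∈ₗ vecs bools k
∈-vecs []          = here refl
∈-vecs (true ∷ v)  = ∈ₗ.∈-cartesianProductWith⁺ _∷_ {bools} (here refl) (∈-vecs v)
∈-vecs (false ∷ v) = ∈ₗ.∈-cartesianProductWith⁺ _∷_ {bools} (there (here refl)) (∈-vecs v)

lots-vecs : ∀ {A : Set} {as : List A} → Unique as → ∀ k {n} {P : Subset n → Set} (f : Vec A k → Subset n) →
  (∀ {v v′} → f v ≡ f v′ → v ≡ v′) → (∀ v → P (f v)) → ∀ {N} → N ≤ length as ^ k → Lots P N
lots-vecs {as = as} ua k {P = P} f inj t le = map f (vecs as k) , Unq.map⁺ inj (vecs-unique ua k)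
  , ℕ.≤-trans le (ℕ.≤-reflexive (sym (trans (ListP.length-map f (vecs as k)) (length-vecs as k))))
  , λ p → let v , _ , eq = ∈ₗ.∈-map⁻ f p in subst P (sym eq) (t v)

lots-subsets : ∀ k {n} {P : Subset n → Set} (f : Subset k → Subset n) → (∀ {v v′} → f v ≡ f v′ → v ≡ v′) → (∀ v → P (f v)) → Lots P (2 ^ k)
lots-subsets k f inj t = lots-vecs bools-unique k f inj t ℕ.≤-refl

target? : ∀ J {n} (M : Matroid n) X → Dec (Target J M X)
target? J M = go J
  where
  open Theory M
  go : ∀ J X → Dec (Target J M X)
  go RANK                  X = yes tt
  go INDEPENDENT-SETS      X = ind? X
  go SPANNING-SETS         X = spanning? X
  go BASES                 X = ind? X ×-dec spanning? X
  go FLATS                 X = flat? X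
  go CIRCUITS              X = circuit? X
  go HYPERPLANES           X = hyperplane? X
  go NON-SPANNING-CIRCUITS X = circuit? X ×-dec (¬? (spanning? X))
  go DEPENDENT-HYPERPLANES X = hyperplane? X ×-dec (¬? (ind? X))
  go CYCLIC-FLATS          X = cyclic? X

-- A list that merely contains all sets of the kind suffices: filtering and removing duplicates
-- turns it into an exact enumeration. An item takes at most `2 * suc n` symbols, and so do the
-- header and the rank together, which explains `suc (length C)`.
few-cover : ∀ I {n} (M : Matroid n) → I ≢ RANK → (C : List (Subset n)) → (∀ X → Target I M X → X ∈ₗ C) →
  ∀ {ℓ} → 2 * suc n * suc (length C) ≤ ℓ → Few I M ℓ
few-cover I {n} M I≢RANK C covers {ℓ} le = _ , describe I M L I≢RANK (unq , λ X → mk⇔ (λ p → proj₂ (∈ₗ.∈-filter⁻ T? {xs = D} p))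
    (λ t → ∈ₗ.∈-filter⁺ T? (∈ₗ.∈-deduplicate⁺ _≟S_ (covers X t)) t)) , ℕ.≤-trans short le
  where
  T? = target? I M
  D = deduplicate _≟S_ C
  L = filter T? D
  unq : Unique L
  unq = Unq.filter⁺ T? (UnqDec.deduplicate-! _≟S_ C)
  rank≤n : ∀ X → Matroid.rank M X ≤ n
  rank≤n X = ℕ.≤-trans (Matroid.R1 M X) (S.∣p∣≤n X)
  unary≤ : ∀ X s → length (encℕ (Matroid.rank M X) ++ [ s ]) ≤ suc n
  unary≤ X s = ℕ.≤-trans (ℕ.≤-reflexive (trans (ListP.length-++ (encℕ (Matroid.rank M X))) (trans (ℕ.+-comm _ 1) (cong suc (ListP.length-replicate (Matroid.rank M X)))))) (s≤s (rank≤n X))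
  opt : ∀ (c : Bool) (w : Word) {m} → length w ≤ m → length (if c then w else []) ≤ m
  opt true  w le = le
  opt false w le = z≤n
  item≤ : ∀ X → length (itemWord I M X) ≤ suc n + suc n
  item≤ X = ℕ.≤-trans (ℕ.≤-reflexive (ListP.length-++ (encSet X))) (ℕ.+-mono-≤ (ℕ.≤-reflexive (length-encSet X)) (opt (isCyclic I) _ (unary≤ X sep)))
  head≤ : length (header n) ≤ suc n
  head≤ = ℕ.≤-reflexive (trans (ListP.length-++ (encℕ n)) (trans (ℕ.+-comm _ 1) (cong suc (ListP.length-replicate n))))
  short : length (header n ++ rankWord I M ++ concatMap (itemWord I M) L) ≤ 2 * suc n * suc (length C)
  short = begin
    length (header n ++ rankWord I M ++ concatMap (itemWord I M) L)
      ≡⟨ trans (ListP.length-++ (header n)) (cong (length (header n) +_) (ListP.length-++ (rankWord I M))) ⟩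
    length (header n) + (length (rankWord I M) + length (concatMap (itemWord I M) L))
      ≤⟨ ℕ.+-mono-≤ head≤ (ℕ.+-mono-≤ (opt (hasRank I) _ (unary≤ ⊤ bar)) (length-concatMap (itemWord I M) (suc n + suc n) L item≤)) ⟩
    suc n + (suc n + length L * (suc n + suc n))
      ≤⟨ ℕ.+-monoʳ-≤ (suc n) (ℕ.+-monoʳ-≤ (suc n) (ℕ.*-monoˡ-≤ (suc n + suc n) (ℕ.≤-trans (ListP.length-filter T? D) (ListP.length-deduplicate _≟S_ C)))) ⟩
    suc n + (suc n + length C * (suc n + suc n))
      ≡⟨ eq (suc n) (length C) ⟩
    2 * suc n * suc (length C) ∎
    where
    open ℕ.≤-Reasoning
    eq : ∀ m c → m + (m + c * (m + m)) ≡ 2 * m * suc c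
    eq = solve-∀

-- Constructions of matroids

card-∪∩ : ∀ {n} (X Y : Subset n) → ∣ X ∪ Y ∣ + ∣ X ∩ Y ∣ ≡ ∣ X ∣ + ∣ Y ∣
card-∪∩ []          []          = refl
card-∪∩ (true ∷ X)  (true ∷ Y)  = cong suc (trans (ℕ.+-suc _ _) (trans (cong suc (card-∪∩ X Y)) (sym (ℕ.+-suc _ _))))
card-∪∩ (true ∷ X)  (false ∷ Y) = cong suc (card-∪∩ X Y)
card-∪∩ (false ∷ X) (true ∷ Y)  = trans (cong suc (card-∪∩ X Y)) (sym (ℕ.+-suc _ _))
card-∪∩ (false ∷ X) (false ∷ Y) = card-∪∩ X Y

∁-∪ : ∀ {n} (X Y : Subset n) → ∁ (X ∪ Y) ≡ ∁ X ∩ ∁ Y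
∁-∪ []          []      = refl
∁-∪ (true ∷ X)  (_ ∷ Y) = cong (false ∷_) (∁-∪ X Y)
∁-∪ (false ∷ X) (_ ∷ Y) = cong (_ ∷_) (∁-∪ X Y)

∁-∩ : ∀ {n} (X Y : Subset n) → ∁ (X ∩ Y) ≡ ∁ X ∪ ∁ Y
∁-∩ []          []      = refl
∁-∩ (true ∷ X)  (_ ∷ Y) = cong (_ ∷_) (∁-∩ X Y)
∁-∩ (false ∷ X) (_ ∷ Y) = cong (true ∷_) (∁-∩ X Y)

∁-∁ : ∀ {n} (X : Subset n) → ∁ (∁ X) ≡ X
∁-∁ []          = refl
∁-∁ (true ∷ X)  = cong (true ∷_) (∁-∁ X)
∁-∁ (false ∷ X) = cong (false ∷_) (∁-∁ X)

card-⊆ : ∀ {n} {X Y : Subset n} → X ⊆ Y → ∣ Y ∣ ≡ ∣ X ∣ + ∣ Y ∖ X ∣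
card-⊆ {X = X} {Y} X⊆Y = trans (card-split X Y) (cong (λ Z → ∣ Z ∣ + ∣ Y ∖ X ∣) (S.⊆-antisym (S.p∩q⊆q Y X) (λ p → S.x∈p∩q⁺ (X⊆Y p , p))))

card-⊕-≤ : ∀ {n} (X : Subset n) e → ∣ X ⊕ e ∣ ≤ suc ∣ X ∣
card-⊕-≤ X e with e S.∈? X
... | yes p = ℕ.≤-trans (ℕ.≤-reflexive (cong ∣_∣ (⊕-∈ p))) (ℕ.n≤1+n _)
... | no ¬p = ℕ.≤-reflexive (card-⊕ ¬p)

card-zero : ∀ {n} (X : Subset n) → ∣ X ∣ ≡ 0 → X ≡ ⊥
card-zero X eq = S.⊆-antisym (λ p → contradiction (trans (card-⊖ p) eq) λ ()) S.⊥⊆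

free : ∀ n → Matroid n
free n = record
  { rank = ∣_∣ ; R1 = λ _ → ℕ.≤-refl ; R2 = λ _ _ → S.p⊆q⇒∣p∣≤∣q∣ ; R3 = λ X Y → ℕ.≤-reflexive (card-∪∩ X Y) }

null : ∀ n → Matroid n
null n = record { rank = λ _ → 0 ; R1 = λ _ → z≤n ; R2 = λ _ _ _ → z≤n ; R3 = λ _ _ → z≤n }

truncate : ∀ {n} → ℕ → Matroid n → Matroid n
truncate k M = record
  { rank = λ X → k ⊓ rank X
  ; R1 = λ X → ℕ.≤-trans (ℕ.m⊓n≤n k _) (R1 X)
  ; R2 = λ X Y s → ℕ.⊓-monoʳ-≤ k (R2 X Y s)
  ; R3 = λ X Y → cut (rank (X ∪ Y)) (rank (X ∩ Y)) (rank X) (rank Y) (R3 X Y)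
      (R2 (X ∩ Y) X (S.p∩q⊆p X Y)) (R2 (X ∩ Y) Y (S.p∩q⊆q X Y)) }
  where
  open Matroid M
  -- If one of `s` and `t` reaches `k`, its truncation `k` dominates the term of `p`, and `q` is
  -- compared with the other one. Otherwise the right-hand side is not truncated at all.
  cut : ∀ p q s t → p + q ≤ s + t → q ≤ s → q ≤ t → k ⊓ p + k ⊓ q ≤ k ⊓ s + k ⊓ t
  cut p q s t le qs qt with k ℕ.≤? s | k ℕ.≤? t
  ... | yes k≤s | _ = ℕ.+-mono-≤ (ℕ.≤-trans (ℕ.m⊓n≤m k p) (ℕ.≤-reflexive (sym (ℕ.m≤n⇒m⊓n≡m k≤s)))) (ℕ.⊓-monoʳ-≤ k qt)
  ... | no _ | yes k≤t = ℕ.≤-trans (ℕ.+-mono-≤ (ℕ.≤-trans (ℕ.m⊓n≤m k p) (ℕ.≤-reflexive (sym (ℕ.m≤n⇒m⊓n≡m k≤t)))) (ℕ.⊓-monoʳ-≤ k qs))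
                          (ℕ.≤-reflexive (ℕ.+-comm (k ⊓ t) (k ⊓ s)))
  ... | no k≰s | no k≰t = ℕ.≤-trans (ℕ.+-mono-≤ (ℕ.m⊓n≤n k p) (ℕ.m⊓n≤n k q)) (ℕ.≤-trans le
      (ℕ.≤-reflexive (sym (cong₂ _+_ (ℕ.m≥n⇒m⊓n≡n (ℕ.<⇒≤ (ℕ.≰⇒> k≰s))) (ℕ.m≥n⇒m⊓n≡n (ℕ.<⇒≤ (ℕ.≰⇒> k≰t)))))))

subsetOf : ∀ {n} {P : Fin n → Set} → (∀ i → Dec (P i)) → Subset n
subsetOf P? = Vec.tabulate (does ∘ P?)

∈-subsetOf⁺ : ∀ {n} {P : Fin n → Set} (P? : ∀ i → Dec (P i)) {i} → P i → i ∈ subsetOf P?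
∈-subsetOf⁺ P? {i} p = bit⇒∈ (trans (VecP.lookup∘tabulate _ i) (Dec.dec-true (P? i) p))

∈-subsetOf⁻ : ∀ {n} {P : Fin n → Set} (P? : ∀ i → Dec (P i)) {i} → i ∈ subsetOf P? → P i
∈-subsetOf⁻ P? {i} p = Dec.decidable-stable (P? i) λ ¬p →
  contradiction (trans (sym (VecP.[]=⇒lookup p)) (trans (VecP.lookup∘tabulate _ i) (Dec.dec-false (P? i) ¬p))) λ ()

module Pullback {n k : ℕ} (φ : Fin n → Fin k) where

  private
    hit? : ∀ X c → Dec (∃[ i ] (i ∈ X × φ i ≡ c))
    hit? X c = FinP.any? (λ i → (i S.∈? X) ×-dec (φ i Fin.≟ c))

  hits : Subset n → Subset k
  hits X = subsetOf (hit? X)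

  ∈-hits⁺ : ∀ {X i} → i ∈ X → φ i ∈ hits X
  ∈-hits⁺ {X} {i} p = ∈-subsetOf⁺ (hit? X) (i , p , refl)

  ∈-hits⁻ : ∀ {X c} → c ∈ hits X → ∃[ i ] (i ∈ X × φ i ≡ c)
  ∈-hits⁻ {X} = ∈-subsetOf⁻ (hit? X)

  hits-mono : ∀ {X Y} → X ⊆ Y → hits X ⊆ hits Y
  hits-mono X⊆Y p with ∈-hits⁻ p
  ... | i , q , refl = ∈-hits⁺ (X⊆Y q)

  hits-⊕ : ∀ X e → hits (X ⊕ e) ≡ hits X ⊕ φ e
  hits-⊕ X e = S.⊆-antisym to (⊕-⊆ (hits-mono (⊆-⊕ X e)) (∈-hits⁺ (∈-⊕ X e)))
    where
    to : hits (X ⊕ e) ⊆ hits X ⊕ φ e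
    to p with ∈-hits⁻ p
    ... | i , q , refl with ∈-⊕⁻ X e q
    ...   | inj₁ r    = ⊆-⊕ _ _ (∈-hits⁺ r)
    ...   | inj₂ refl = ∈-⊕ _ _

  card-hits : ∀ X → ∣ hits X ∣ ≤ ∣ X ∣
  card-hits X = go ∣ X ∣ X refl
    where
    go : ∀ m X → ∣ X ∣ ≡ m → ∣ hits X ∣ ≤ m
    go zero X eq = ℕ.≤-trans (S.p⊆q⇒∣p∣≤∣q∣ {q = ⊥} (λ p → let i , q , _ = ∈-hits⁻ {X} p in contradiction (subst (i ∈_) (card-zero X eq) q) S.∉⊥)) (ℕ.≤-reflexive (S.∣⊥∣≡0 k))
    go (suc m) X eq with S.nonempty? X
    ... | no ¬e = contradiction (trans (sym eq) (trans (cong ∣_∣ (S.⊆-antisym {j = ⊥} (λ p → contradiction (_ , p) ¬e) S.⊥⊆)) (S.∣⊥∣≡0 n))) λ ()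
    ... | yes (e , p) = ℕ.≤-trans (ℕ.≤-reflexive (cong ∣_∣ (trans (cong hits (sym (⊖-⊕ p))) (hits-⊕ (X ⊖ e) e))))
            (ℕ.≤-trans (card-⊕-≤ (hits (X ⊖ e)) (φ e)) (s≤s (go m (X ⊖ e) (ℕ.suc-injective (trans (card-⊖ p) eq)))))

  -- All elements of a fibre of `φ` become copies of one element. The image of an intersection may
  -- be smaller than the intersection of the images, which is the harmless direction for
  -- submodularity.
  pullback : Matroid k → Matroid n
  pullback N = record
    { rank = λ X → rank (hits X)
    ; R1 = λ X → ℕ.≤-trans (R1 (hits X)) (card-hits X)
    ; R2 = λ X Y s → R2 _ _ (hits-mono s)
    ; R3 = λ X Y → ℕ.≤-trans (ℕ.+-mono-≤ (R2 _ _ (union X Y)) (R2 _ _ (λ p → S.x∈p∩q⁺ (hits-mono (S.p∩q⊆p X Y) p , hits-mono (S.p∩q⊆q X Y) p))))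
                             (R3 (hits X) (hits Y)) }
    where
    open Matroid N
    union : ∀ X Y → hits (X ∪ Y) ⊆ hits X ∪ hits Y
    union X Y p with ∈-hits⁻ p
    ... | i , q , refl = S.x∈p∪q⁺ (Sum.map ∈-hits⁺ ∈-hits⁺ (S.x∈p∪q⁻ X Y q))

weigh : ℕ → Bool → ℕ
weigh c true  = c
weigh c false = 0

-- The direct sum with a one-element matroid of rank c.
adjoin : ∀ {n} c → c ≤ 1 → Matroid n → Matroid (suc n)
adjoin c c≤1 M = record
  { rank = λ { (b ∷ X) → weigh c b + rank X }
  ; R1 = λ { (true ∷ X) → ℕ.+-mono-≤ c≤1 (R1 X) ; (false ∷ X) → R1 X }
  ; R2 = λ { (b ∷ X) (b′ ∷ Y) s → ℕ.+-mono-≤ (mono b b′ (λ { refl → head-∈ (s here) })) (R2 X Y (λ p → S.drop-there (s (there p)))) }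
  ; R3 = λ { (b ∷ X) (b′ ∷ Y) → begin
      (weigh c (b ∨ b′) + rank (X ∪ Y)) + (weigh c (b ∧ b′) + rank (X ∩ Y)) ≡⟨ mix (weigh c (b ∨ b′)) _ _ _ ⟩
      (weigh c (b ∨ b′) + weigh c (b ∧ b′)) + (rank (X ∪ Y) + rank (X ∩ Y)) ≤⟨ ℕ.+-mono-≤ (ℕ.≤-reflexive (modular b b′)) (R3 X Y) ⟩
      (weigh c b + weigh c b′) + (rank X + rank Y)                          ≡⟨ mix (weigh c b) _ _ _ ⟩
      (weigh c b + rank X) + (weigh c b′ + rank Y)                          ∎ } }
  where
  open Matroid M
  open ℕ.≤-Reasoning
  mix : ∀ x y z w → (x + y) + (z + w) ≡ (x + z) + (y + w)
  mix = solve-∀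
  head-∈ : ∀ {m b} {Y : Subset m} → zero ∈ b ∷ Y → b ≡ true
  head-∈ here = refl
  mono : ∀ b b′ → (b ≡ true → b′ ≡ true) → weigh c b ≤ weigh c b′
  mono true  b′ f rewrite f refl = ℕ.≤-refl
  mono false b′ f = z≤n
  modular : ∀ b b′ → weigh c (b ∨ b′) + weigh c (b ∧ b′) ≡ weigh c b + weigh c b′
  modular true  true  = refl
  modular true  false = refl
  modular false true  = ℕ.+-identityʳ c
  modular false false = refl

coloop loop⁺ : ∀ {n} → Matroid n → Matroid (suc n)
coloop = adjoin 1 ℕ.≤-refl
loop⁺  = adjoin 0 z≤n

module Adjoin {n : ℕ} (M : Matroid n) where
  open Matroid M
  open Theory M

  module C = Theory (coloop M)
  module L = Theory (loop⁺ M)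

  ∷-⊕-zero : ∀ b (X : Subset n) → (b ∷ X) ⊕ zero ≡ true ∷ X
  ∷-⊕-zero true  X = cong (true ∷_) (S.∪-identityʳ X)
  ∷-⊕-zero false X = cong (true ∷_) (S.∪-identityʳ X)

  ∷-⊖-zero : ∀ b (X : Subset n) → (b ∷ X) ⊖ zero ≡ false ∷ X
  ∷-⊖-zero true  X = cong (false ∷_) (∖-⊥ X)
  ∷-⊖-zero false X = cong (false ∷_) (∖-⊥ X)

  flat⁻ : ∀ c c≤1 b {X} → Flat (adjoin c c≤1 M) (b ∷ X) → Flat M X
  flat⁻ c _ true  {X} f e e∉ = ℕ.+-cancelˡ-< c _ _ (f (suc e) (e∉ ∘ S.drop-there))
  flat⁻ c _ false {X} f e e∉ = f (suc e) (e∉ ∘ S.drop-there)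

  flat-true : ∀ c c≤1 {X} → Flat M X → Flat (adjoin c c≤1 M) (true ∷ X)
  flat-true c _ f zero    e∉ = contradiction here e∉
  flat-true c _ f (suc e) e∉ = ℕ.+-monoʳ-< c (f e (e∉ ∘ there))

  circuit⁺ : ∀ c c≤1 {C} → Circuit M C → Circuit (adjoin c c≤1 M) (false ∷ C)
  circuit⁺ c c≤1 cC = Theory.circuit-intro (adjoin c c≤1 M) (proj₁ cC) λ { (suc e) (there p) → circuit-⊖ cC p }

  coloop-circuit : ∀ {C} → Circuit M C → NonSpanningCircuit (coloop M) (false ∷ C)
  coloop-circuit {C} cC = circuit⁺ 1 ℕ.≤-refl cC , λ eq → ℕ.<⇒≱ (s≤s (R2 C ⊤ S.⊆⊤)) (ℕ.≤-reflexive (sym eq))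

  coloop-basis : ∀ {X} → Basis M X → Basis (coloop M) (true ∷ X)
  coloop-basis (i , s) = cong suc i , cong suc s

  coloop-hyperplane : ∀ {X} → Hyperplane M X → Hyperplane (coloop M) (true ∷ X)
  coloop-hyperplane (f , eq) = flat-true 1 ℕ.≤-refl f , cong suc eq

  coloop-hyperplane⁻ : ∀ b {X} → Hyperplane (coloop M) (b ∷ X) → (b ≡ true × Hyperplane M X) ⊎ b ∷ X ≡ false ∷ ⊤
  coloop-hyperplane⁻ true  (f , eq) = inj₁ (refl , flat⁻ 1 ℕ.≤-refl true f , ℕ.suc-injective eq)
  coloop-hyperplane⁻ false {X} (f , eq) = inj₂ (cong (false ∷_) (S.⊆-antisym S.⊆⊤
    (λ _ → flat-closed (flat⁻ 1 ℕ.≤-refl false f) _ (ℕ.≤-trans (R2 _ ⊤ S.⊆⊤) (ℕ.≤-reflexive (sym (ℕ.suc-injective eq)))))))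

  coloop-cyclic : ∀ {X} → CyclicFlat M X → CyclicFlat (coloop M) (false ∷ X)
  coloop-cyclic {X} c with Equivalence.to (cyclic⇔ X) c
  ... | f , r = Equivalence.from (C.cyclic⇔ (false ∷ X)) (flat , λ { (suc e) (there p) → r e p })
    where
    flat : Flat (coloop M) (false ∷ X)
    flat zero    e∉ = ℕ.≤-reflexive (sym (cong (Matroid.rank (coloop M)) (∷-⊕-zero false X)))
    flat (suc e) e∉ = f e (e∉ ∘ there)

  coloop-cyclic⁻ : ∀ b {X} → CyclicFlat (coloop M) (b ∷ X) → b ≡ false × CyclicFlat M X
  coloop-cyclic⁻ b {X} c with Equivalence.to (C.cyclic⇔ (b ∷ X)) c
  coloop-cyclic⁻ true  {X} c | f , r = contradiction (trans (sym (r zero here)) (cong (Matroid.rank (coloop M)) (∷-⊖-zero true X))) (ℕ.1+n≢n)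
  coloop-cyclic⁻ false {X} c | f , r = refl , Equivalence.from (cyclic⇔ X) (flat⁻ 1 ℕ.≤-refl false f , λ e p → r (suc e) (there p))

  loop-circuit : ∀ {C} → NonSpanningCircuit M C → NonSpanningCircuit (loop⁺ M) (false ∷ C)
  loop-circuit (cC , ns) = circuit⁺ 0 z≤n cC , ns

  loop-basis : ∀ {X} → Basis M X → Basis (loop⁺ M) (false ∷ X)
  loop-basis b = b

  loop-hyperplane : ∀ {X} → Hyperplane M X → DependentHyperplane (loop⁺ M) (true ∷ X)
  loop-hyperplane {X} (f , eq) = (flat-true 0 z≤n f , eq) , λ i → ℕ.<⇒≱ (s≤s (R1 X)) (ℕ.≤-reflexive (sym i))

  loop-cyclic⁻ : ∀ b {X} → CyclicFlat (loop⁺ M) (b ∷ X) → b ≡ true × CyclicFlat M X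
  loop-cyclic⁻ b {X} c with Equivalence.to (L.cyclic⇔ (b ∷ X)) c
  loop-cyclic⁻ false {X} c | f , r = contradiction (f zero (λ ())) (ℕ.<-irrefl (sym (cong (Matroid.rank (loop⁺ M)) (∷-⊕-zero false X))))
  loop-cyclic⁻ true  {X} c | f , r = refl , Equivalence.from (cyclic⇔ X) (flat⁻ 0 z≤n true f , λ e p → r (suc e) (there p))

module Dual {n : ℕ} (M : Matroid n) where
  open Matroid M
  open Theory M

  rank* : Subset n → ℕ
  rank* X = (∣ X ∣ + rank (∁ X)) ∸ rank ⊤

  rank-∪-≤ : ∀ X Y → rank (X ∪ Y) ≤ rank X + ∣ Y ∣
  rank-∪-≤ X Y = ℕ.≤-trans (ℕ.m≤m+n _ _) (ℕ.≤-trans (R3 X Y) (ℕ.+-monoʳ-≤ (rank X) (R1 Y)))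

  -- The truncated subtraction loses nothing, since the rank of the whole set is at most
  -- `∣ X ∣ + rank (∁ X)`. Later arguments add `rank ⊤` on both sides and use this form.
  rank*-eq : ∀ X → rank* X + rank ⊤ ≡ ∣ X ∣ + rank (∁ X)
  rank*-eq X = ℕ.m∸n+n≡m (ℕ.≤-trans (R2 ⊤ (∁ X ∪ X) (λ {i} _ → split i)) (ℕ.≤-trans (rank-∪-≤ (∁ X) X) (ℕ.≤-reflexive (ℕ.+-comm (rank (∁ X)) ∣ X ∣))))
    where
    split : ∀ i → i ∈ ∁ X ∪ X
    split i with i S.∈? X
    ... | yes p = S.x∈p∪q⁺ (inj₂ p)
    ... | no ¬p = S.x∈p∪q⁺ (inj₁ (S.x∉p⇒x∈∁p ¬p))

  private
    cancel-≤ : ∀ {a b} → a + rank ⊤ ≤ b + rank ⊤ → a ≤ b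
    cancel-≤ = ℕ.+-cancelʳ-≤ (rank ⊤) _ _

  dual : Matroid n
  dual = record
    { rank = rank*
    ; R1 = λ X → cancel-≤ (ℕ.≤-trans (ℕ.≤-reflexive (rank*-eq X)) (ℕ.+-monoʳ-≤ ∣ X ∣ (R2 _ _ S.⊆⊤)))
    ; R2 = λ X Y s → cancel-≤ (mono X Y s)
    ; R3 = λ X Y → cancel-≤ (cancel-≤ (submodular X Y)) }
    where
    open ℕ.≤-Reasoning
    mono : ∀ X Y → X ⊆ Y → rank* X + rank ⊤ ≤ rank* Y + rank ⊤
    mono X Y s = begin
      rank* X + rank ⊤                        ≡⟨ rank*-eq X ⟩
      ∣ X ∣ + rank (∁ X)                      ≤⟨ ℕ.+-monoʳ-≤ ∣ X ∣ (ℕ.≤-trans (R2 _ _ cover) (rank-∪-≤ (∁ Y) (Y ∖ X))) ⟩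
      ∣ X ∣ + (rank (∁ Y) + ∣ Y ∖ X ∣)        ≡⟨ shuffle (∣ X ∣) (rank (∁ Y)) (∣ Y ∖ X ∣) ⟩
      (∣ X ∣ + ∣ Y ∖ X ∣) + rank (∁ Y)        ≡⟨ cong (_+ rank (∁ Y)) (sym (card-⊆ s)) ⟩
      ∣ Y ∣ + rank (∁ Y)                      ≡⟨ sym (rank*-eq Y) ⟩
      rank* Y + rank ⊤                        ∎
      where
      shuffle : ∀ a b c → a + (b + c) ≡ (a + c) + b
      shuffle = solve-∀
      cover : ∁ X ⊆ ∁ Y ∪ (Y ∖ X)
      cover {i} p with i S.∈? Y
      ... | yes q = S.x∈p∪q⁺ (inj₂ (∈-∖⁺ q (S.x∈∁p⇒x∉p p)))
      ... | no ¬q = S.x∈p∪q⁺ (inj₁ (S.x∉p⇒x∈∁p ¬q))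
    submodular : ∀ X Y → rank* (X ∪ Y) + rank* (X ∩ Y) + rank ⊤ + rank ⊤ ≤ rank* X + rank* Y + rank ⊤ + rank ⊤
    submodular X Y = begin
      rank* (X ∪ Y) + rank* (X ∩ Y) + rank ⊤ + rank ⊤                         ≡⟨ pair (rank* (X ∪ Y)) (rank* (X ∩ Y)) (rank ⊤) ⟩
      (rank* (X ∪ Y) + rank ⊤) + (rank* (X ∩ Y) + rank ⊤)                     ≡⟨ cong₂ _+_ (rank*-eq (X ∪ Y)) (rank*-eq (X ∩ Y)) ⟩
      (∣ X ∪ Y ∣ + rank (∁ (X ∪ Y))) + (∣ X ∩ Y ∣ + rank (∁ (X ∩ Y)))         ≡⟨ cong₂ (λ A B → (∣ X ∪ Y ∣ + rank A) + (∣ X ∩ Y ∣ + rank B)) (∁-∪ X Y) (∁-∩ X Y) ⟩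
      (∣ X ∪ Y ∣ + rank (∁ X ∩ ∁ Y)) + (∣ X ∩ Y ∣ + rank (∁ X ∪ ∁ Y))         ≡⟨ mix (∣ X ∪ Y ∣) _ (∣ X ∩ Y ∣) _ ⟩
      (∣ X ∪ Y ∣ + ∣ X ∩ Y ∣) + (rank (∁ X ∪ ∁ Y) + rank (∁ X ∩ ∁ Y))         ≤⟨ ℕ.+-mono-≤ (ℕ.≤-reflexive (card-∪∩ X Y)) (R3 (∁ X) (∁ Y)) ⟩
      (∣ X ∣ + ∣ Y ∣) + (rank (∁ X) + rank (∁ Y))                             ≡⟨ mix′ (∣ X ∣) (∣ Y ∣) _ _ ⟩
      (∣ X ∣ + rank (∁ X)) + (∣ Y ∣ + rank (∁ Y))                             ≡⟨ sym (cong₂ _+_ (rank*-eq X) (rank*-eq Y)) ⟩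
      (rank* X + rank ⊤) + (rank* Y + rank ⊤)                                 ≡⟨ sym (pair (rank* X) (rank* Y) (rank ⊤)) ⟩
      rank* X + rank* Y + rank ⊤ + rank ⊤                                     ∎
      where
      pair : ∀ a b r → a + b + r + r ≡ (a + r) + (b + r)
      pair = solve-∀
      mix : ∀ a b c d → (a + b) + (c + d) ≡ (a + c) + (d + b)
      mix = solve-∀
      mix′ : ∀ a b c d → (a + b) + (c + d) ≡ (a + c) + (b + d)
      mix′ = solve-∀

  private module D = Theory dual

  eq-∁ : ∀ X → rank* (∁ X) + rank ⊤ ≡ ∣ ∁ X ∣ + rank X
  eq-∁ X = trans (rank*-eq (∁ X)) (cong (λ Y → ∣ ∁ X ∣ + rank Y) (∁-∁ X))

  ∁-⊖ : ∀ (X : Subset n) e → e ∈ X → ∁ (X ⊖ e) ≡ ∁ X ⊕ e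
  ∁-⊖ X e p = S.⊆-antisym to (⊕-⊆ (λ q → S.x∉p⇒x∈∁p (S.x∈∁p⇒x∉p q ∘ ⊖-⊆ X e)) (S.x∉p⇒x∈∁p (∉-⊖ X e)))
    where
    to : ∁ (X ⊖ e) ⊆ ∁ X ⊕ e
    to {i} q with i Fin.≟ e
    ... | yes refl = ∈-⊕ _ e
    ... | no i≢e   = ⊆-⊕ _ e (S.x∉p⇒x∈∁p (λ r → S.x∈∁p⇒x∉p q (∈-⊖⁺ r i≢e)))

  ∁-⊕ : ∀ (X : Subset n) e → e ∉ X → ∁ (X ⊕ e) ≡ ∁ X ⊖ e
  ∁-⊕ X e e∉ = trans (cong (λ Y → ∁ (Y ⊕ e)) (sym (∁-∁ X)))
    (trans (cong ∁ (sym (∁-⊖ (∁ X) e (S.x∉p⇒x∈∁p e∉)))) (∁-∁ (∁ X ⊖ e)))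

  ∈∁⇒ : ∀ {X : Subset n} {e} → e ∉ ∁ X → e ∈ X
  ∈∁⇒ {X} {e} q = Dec.decidable-stable (e S.∈? X) (q ∘ S.x∉p⇒x∈∁p)

  dual-⊕ : ∀ {X e} → e ∈ X → rank (X ⊖ e) ≡ rank X → rank* (∁ X ⊕ e) ≡ suc (rank* (∁ X))
  dual-⊕ {X} {e} p eq = ℕ.+-cancelʳ-≡ (rank ⊤) _ _ (trans (cong (λ Y → rank* Y + rank ⊤) (sym (∁-⊖ X e p))) (trans (eq-∁ (X ⊖ e))
    (trans (cong₂ _+_ (trans (cong ∣_∣ (∁-⊖ X e p)) (card-⊕ (λ q → S.x∈∁p⇒x∉p q p))) eq) (cong suc (sym (eq-∁ X))))))

  dual-flat : ∀ {X} → (∀ e → e ∈ X → rank (X ⊖ e) ≡ rank X) → Flat dual (∁ X)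
  dual-flat {X} r e e∉ = ℕ.≤-reflexive (sym (dual-⊕ (∈∁⇒ e∉) (r e (∈∁⇒ e∉))))

  rank*-⊤ : rank* ⊤ + rank ⊤ ≡ n
  rank*-⊤ = trans (rank*-eq ⊤) (trans (cong₂ _+_ (S.∣⊤∣≡n n) rank∁⊤) (ℕ.+-identityʳ n))
    where
    rank∁⊤ : rank (∁ ⊤) ≡ 0
    rank∁⊤ = ℕ.n≤0⇒n≡0 (ℕ.≤-trans (R1 (∁ ⊤)) (ℕ.≤-trans (S.p⊆q⇒∣p∣≤∣q∣ {p = ∁ ⊤} {q = ⊥ {n}} (λ p → contradiction S.∈⊤ (S.x∈∁p⇒x∉p p))) (ℕ.≤-reflexive (S.∣⊥∣≡0 n))))

  card-∁ : ∀ (X : Subset n) → ∣ ∁ X ∣ + ∣ X ∣ ≡ n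
  card-∁ X = trans (cong (_+ ∣ X ∣) (S.∣∁p∣≡n∸∣p∣ X)) (ℕ.m∸n+n≡m (S.∣p∣≤n X))

  dual-basis : ∀ {B} → Basis M B → Basis dual (∁ B)
  dual-basis {B} (i , s) = ind , ℕ.+-cancelʳ-≡ (rank ⊤) _ _ (trans (cong (_+ rank ⊤) ind) (trans (cong (∣ ∁ B ∣ +_) (trans (sym s) i)) (trans (card-∁ B) (sym rank*-⊤))))
    where
    ind : rank* (∁ B) ≡ ∣ ∁ B ∣
    ind = ℕ.+-cancelʳ-≡ (rank ⊤) _ _ (trans (eq-∁ B) (cong (∣ ∁ B ∣ +_) s))

  -- Complements of circuits are hyperplanes of the dual, and independence of the complement in the
  -- dual would mean that `C` is spanning.
  dual-hyperplane : ∀ {C} → NonSpanningCircuit M C → DependentHyperplane dual (∁ C)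
  dual-hyperplane {C} (cC , ns) = (dual-flat (λ e p → in-circuit⇒rank cC id p) , hyp) ,
      λ ind → ns (ℕ.+-cancelˡ-≡ ∣ ∁ C ∣ _ _ (trans (sym (eq-∁ C)) (cong (_+ rank ⊤) ind)))
    where
    card-C : suc (rank C) ≡ ∣ C ∣
    card-C with ¬⊆⇒∃ C ⊥ (λ s → proj₁ cC (ind-⊆ (λ {i} → s i) ind-⊥))
    ... | e , p , _ = trans (cong suc (trans (sym (in-circuit⇒rank cC id p)) (circuit-⊖ cC p))) (card-⊖ p)
    hyp : suc (rank* (∁ C)) ≡ rank* ⊤
    hyp = ℕ.+-cancelʳ-≡ (rank ⊤) _ _ (trans (cong suc (eq-∁ C)) (trans (sym (ℕ.+-suc _ _)) (trans (cong (∣ ∁ C ∣ +_) card-C) (trans (card-∁ C) (sym rank*-⊤)))))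

  -- Complementation interchanges the two halves of `cyclic⇔`: absence of coloops turns into
  -- flatness, and flatness into absence of coloops.
  dual-cyclic : ∀ {X} → CyclicFlat M X → CyclicFlat dual (∁ X)
  dual-cyclic {X} c with Equivalence.to (cyclic⇔ X) c
  ... | f , r = Equivalence.from (D.cyclic⇔ (∁ X)) (dual-flat r , back)
    where
    back : ∀ e → e ∈ ∁ X → rank* (∁ X ⊖ e) ≡ rank* (∁ X)
    back e p = ℕ.+-cancelʳ-≡ (rank ⊤) _ _ (trans (cong (λ Y → rank* Y + rank ⊤) (sym (∁-⊕ X e e∉))) (trans (eq-∁ (X ⊕ e))
      (trans (cong₂ _+_ (cong ∣_∣ (∁-⊕ X e e∉)) (ℕ.≤-antisym (rank-⊕ X e) (f e e∉))) (trans (ℕ.+-suc _ _) (trans (cong (_+ rank X) (card-⊖ p)) (sym (eq-∁ X)))))))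
      where
      e∉ : e ∉ X
      e∉ = S.x∈∁p⇒x∉p p

  -- Bounds the number of circuits of the dual by the number of hyperplanes, which is small for the
  -- partition matroids.
  dual-circuit⁻ : ∀ {C} → Circuit dual C → Hyperplane M (∁ C)
  dual-circuit⁻ {C} cC = flat , hyp
    where
    less : rank (∁ C) < rank ⊤
    less = ℕ.≤∧≢⇒< (R2 _ _ S.⊆⊤) λ eq → proj₁ cC (ℕ.+-cancelʳ-≡ (rank ⊤) _ _ (trans (rank*-eq C) (cong (∣ C ∣ +_) eq)))
    full : ∀ e → e ∈ C → rank (∁ C ⊕ e) ≡ rank ⊤
    full e p = ℕ.+-cancelˡ-≡ ∣ C ⊖ e ∣ _ _ (trans (cong (λ Y → ∣ C ⊖ e ∣ + rank Y) (sym (∁-⊖ C e p))) (trans (sym (rank*-eq (C ⊖ e))) (cong (_+ rank ⊤) (D.circuit-⊖ cC p))))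
    flat : Flat M (∁ C)
    flat e e∉ = ℕ.≤-trans less (ℕ.≤-reflexive (sym (full e (∈∁⇒ e∉))))
    hyp : suc (rank (∁ C)) ≡ rank ⊤
    hyp with ¬⊆⇒∃ C ⊥ (λ s → proj₁ cC (D.ind-⊆ (λ {i} → s i) D.ind-⊥))
    ... | e , p , _ = ℕ.≤-antisym less (ℕ.≤-trans (ℕ.≤-reflexive (sym (full e p))) (rank-⊕ (∁ C) e))

-- Uniform and truncated partition matroids

module Uniform (k : ℕ) where

  ground : ℕ
  ground = 2 + k * 2

  U : Matroid ground
  U = truncate (suc k) (free ground)

  open Matroid U
  open Theory U

  private
    k≤ground : suc k ≤ ∣ ⊤ {ground} ∣
    k≤ground = ℕ.≤-trans (s≤s (ℕ.m≤n⇒m≤1+n (ℕ.≤-trans (ℕ.≤-reflexive (sym (ℕ.*-identityʳ k))) (ℕ.*-monoʳ-≤ k (s≤s z≤n))))) (ℕ.≤-reflexive (sym (S.∣⊤∣≡n ground)))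

  small : ∀ X → ∣ X ∣ ≤ suc k → rank X ≡ ∣ X ∣
  small X = ℕ.m≥n⇒m⊓n≡n {suc k} {∣ X ∣}

  big : ∀ X → suc k ≤ ∣ X ∣ → rank X ≡ suc k
  big X = ℕ.m≤n⇒m⊓n≡m {suc k} {∣ X ∣}

  rank-⊤ : rank ⊤ ≡ suc k
  rank-⊤ = big ⊤ k≤ground

  basis : ∀ X → ∣ X ∣ ≡ suc k → Basis U X
  basis X eq = small X (ℕ.≤-reflexive eq) , trans (big X (ℕ.≤-reflexive (sym eq))) (sym rank-⊤)

  hyperplane : ∀ X → ∣ X ∣ ≡ k → Hyperplane U X
  hyperplane X eq = flat , trans (cong suc rank-X) (sym rank-⊤)
    where
    rank-X : rank X ≡ k
    rank-X = trans (small X (ℕ.m≤n⇒m≤1+n (ℕ.≤-reflexive eq))) eq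
    flat : Flat U X
    flat e e∉ = ℕ.≤-reflexive (trans (cong suc rank-X) (sym (big (X ⊕ e) (ℕ.≤-reflexive (sym (trans (card-⊕ e∉) (cong suc eq)))))))

  circuit : ∀ X → ∣ X ∣ ≡ 2 + k → Circuit U X
  circuit X eq = circuit-intro (λ i → ℕ.<⇒≢ (s≤s (ℕ.m⊓n≤m (suc k) ∣ X ∣)) (trans i eq))
    λ e p → small (X ⊖ e) (ℕ.≤-reflexive (ℕ.suc-injective (trans (card-⊖ p) eq)))

  no-nonspanning-circuit : ∀ X → ¬ NonSpanningCircuit U X
  no-nonspanning-circuit X ((d , _) , ns) with ∣ X ∣ ℕ.≤? suc k
  ... | yes le = d (small X le)
  ... | no ¬le = ns (trans (big X (ℕ.<⇒≤ (ℕ.≰⇒> ¬le))) (sym rank-⊤))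

  no-dependent-hyperplane : ∀ X → ¬ DependentHyperplane U X
  no-dependent-hyperplane X ((_ , eq) , d) with ∣ X ∣ ℕ.≤? suc k
  ... | yes le = d (small X le)
  ... | no ¬le = ℕ.1+n≢n (trans eq (trans rank-⊤ (sym (big X (ℕ.<⇒≤ (ℕ.≰⇒> ¬le))))))

  cyclic⇒ : ∀ X → CyclicFlat U X → X ≡ ⊥ ⊎ X ≡ ⊤
  cyclic⇒ X c with Equivalence.to (cyclic⇔ X) c | ∣ X ∣ ℕ.≤? k
  ... | f , r | yes le = inj₁ (S.⊆-antisym (λ {e} p → contradiction (r e p) (ℕ.<⇒≢ (ind⇒rank-⊖ (small X (ℕ.m≤n⇒m≤1+n le)) p))) S.⊥⊆)
  ... | f , r | no ¬le = inj₂ (S.⊆-antisym S.⊆⊤ (λ {e} _ → flat-closed f e (ℕ.≤-trans (ℕ.m⊓n≤m (suc k) ∣ X ⊕ e ∣) (ℕ.≤-reflexive (sym (big X (ℕ.≰⇒> ¬le)))))))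

-- One element from each of `k` pairs gives `2 ^ k` sets of the same size `k`. The two further
-- elements of the ground set raise this size to `k + 1` for bases and to `k + 2` for circuits;
-- without them the sets are hyperplanes.
pairs : ∀ {k} → Subset k → Subset (k * 2)
pairs []      = []
pairs (b ∷ v) = b ∷ not b ∷ pairs v

card-pairs : ∀ {k} (v : Subset k) → ∣ pairs v ∣ ≡ k
card-pairs []          = refl
card-pairs (true ∷ v)  = cong suc (card-pairs v)
card-pairs (false ∷ v) = cong suc (card-pairs v)

pairs-injective : ∀ {k} {v v′ : Subset k} → pairs v ≡ pairs v′ → v ≡ v′
pairs-injective {v = []}    {[]}      eq = refl
pairs-injective {v = b ∷ v} {b′ ∷ v′} eq = cong₂ _∷_ (VecP.∷-injectiveˡ eq) (pairs-injective (VecP.∷-injectiveʳ (VecP.∷-injectiveʳ eq)))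

-- 2 + k parallel classes of m elements each; any 1 + k elements from different classes form a basis.
module Partition (k m : ℕ) (x₀ : Fin m) where

  K : ℕ
  K = 2 + k

  φ : Fin (K * m) → Fin K
  φ = Fin.quotient m

  ρ : Fin (K * m) → Fin m
  ρ = Fin.remainder {K} m

  elt : Fin K → Fin m → Fin (K * m)
  elt = Fin.combine

  φ-elt : ∀ c x → φ (elt c x) ≡ c
  φ-elt c x = cong proj₁ (FinP.remQuot-combine c x)

  ρ-elt : ∀ c x → ρ (elt c x) ≡ x
  ρ-elt c x = cong proj₂ (FinP.remQuot-combine c x)

  elt-φ-ρ : ∀ i → elt (φ i) (ρ i) ≡ i
  elt-φ-ρ i = FinP.combine-remQuot {K} m i

  open Pullback φ

  P : Matroid (K * m)
  P = truncate (suc k) (pullback (free K))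

  open Matroid P
  open Theory P

  pre : Subset K → Subset (K * m)
  pre Y = subsetOf (λ i → φ i S.∈? Y)

  ∈-pre⁺ : ∀ {Y i} → φ i ∈ Y → i ∈ pre Y
  ∈-pre⁺ {Y} = ∈-subsetOf⁺ (λ i → φ i S.∈? Y)

  ∈-pre⁻ : ∀ {Y i} → i ∈ pre Y → φ i ∈ Y
  ∈-pre⁻ {Y} = ∈-subsetOf⁻ (λ i → φ i S.∈? Y)

  elt-∈-pre : ∀ {Y c x} → c ∈ Y → elt c x ∈ pre Y
  elt-∈-pre {Y} {c} {x} p = ∈-pre⁺ (subst (_∈ Y) (sym (φ-elt c x)) p)

  hits-elt : ∀ {X c x} → elt c x ∈ X → c ∈ hits X
  hits-elt {X} {c} {x} p = subst (_∈ hits X) (φ-elt c x) (∈-hits⁺ p)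

  hits-pre : ∀ Y → hits (pre Y) ≡ Y
  hits-pre Y = S.⊆-antisym (λ p → let i , q , eq = ∈-hits⁻ p in subst (_∈ Y) eq (∈-pre⁻ q)) (λ p → hits-elt (elt-∈-pre {x = x₀} p))

  rank-hits : ∀ X {Y} → hits X ≡ Y → rank X ≡ suc k ⊓ ∣ Y ∣
  rank-hits X eq = cong (λ Y → suc k ⊓ ∣ Y ∣) eq

  rank-⊤ : rank ⊤ ≡ suc k
  rank-⊤ = trans (rank-hits ⊤ {⊤} (S.⊆-antisym S.⊆⊤ (λ {c} _ → hits-elt {x = x₀} S.∈⊤))) (trans (cong (suc k ⊓_) (S.∣⊤∣≡n K)) (ℕ.m≤n⇒m⊓n≡m (ℕ.n≤1+n (suc k))))

  rank-pre : ∀ Y → ∣ Y ∣ ≤ suc k → rank (pre Y) ≡ ∣ Y ∣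
  rank-pre Y le = trans (rank-hits (pre Y) (hits-pre Y)) (ℕ.m≥n⇒m⊓n≡n le)

  -- Every class has two different elements, so deleting one of them leaves its class represented
  -- and there is no coloop. With at most `k` classes the truncation is not yet felt, so a further
  -- class still raises the rank.
  cyclic : ∀ (x₁ : Fin m) → x₁ ≢ x₀ → ∀ Y → ∣ Y ∣ ≤ k → CyclicFlat P (pre Y)
  cyclic x₁ x₁≢x₀ Y le = Equivalence.from (cyclic⇔ (pre Y)) (flat , no-coloop)
    where
    flat : Flat P (pre Y)
    flat e e∉ = ℕ.≤-reflexive (trans (cong suc (rank-pre Y (ℕ.m≤n⇒m≤1+n le))) (sym (trans (rank-hits (pre Y ⊕ e) (trans (hits-⊕ (pre Y) e) (cong (_⊕ φ e) (hits-pre Y))))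
      (trans (ℕ.m≥n⇒m⊓n≡n (ℕ.≤-trans (ℕ.≤-reflexive card) (s≤s le))) card))))
      where
      card : ∣ Y ⊕ φ e ∣ ≡ suc ∣ Y ∣
      card = card-⊕ (e∉ ∘ ∈-pre⁺)
    other : ∀ x → ∃[ y ] y ≢ x
    other x with x Fin.≟ x₀
    ... | yes refl = x₁ , x₁≢x₀
    ... | no x≢x₀  = x₀ , x≢x₀ ∘ sym
    no-coloop : ∀ e → e ∈ pre Y → rank (pre Y ⊖ e) ≡ rank (pre Y)
    no-coloop e p = rank-hits (pre Y ⊖ e) (S.⊆-antisym (hits-mono (⊖-⊆ (pre Y) e)) back)
      where
      back : hits (pre Y) ⊆ hits (pre Y ⊖ e)
      back {c} q with other (ρ e)
      ... | y , y≢ = hits-elt {x = y} (∈-⊖⁺ (elt-∈-pre (subst (c ∈_) (hits-pre Y) q)) (λ eq → y≢ (trans (sym (ρ-elt c y)) (cong ρ eq))))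

  flat⇒pre : ∀ X → Flat P X → ∃[ Y ] X ≡ pre Y
  flat⇒pre X f with ∣ hits X ∣ ℕ.≤? k
  ... | yes le = hits X , S.⊆-antisym (λ p → ∈-pre⁺ (∈-hits⁺ p))
        (λ {i} p → flat-closed f i (ℕ.≤-reflexive (rank-hits (X ⊕ i) (trans (hits-⊕ X i) (⊕-∈ (∈-pre⁻ p))))))
  ... | no ¬le = ⊤ , S.⊆-antisym (λ p → ∈-pre⁺ S.∈⊤)
        (λ {i} p → flat-closed f i (ℕ.≤-trans (ℕ.m⊓n≤m (suc k) _) (ℕ.≤-reflexive (sym (ℕ.m≤n⇒m⊓n≡m (ℕ.≰⇒> ¬le))))))

  -- A hyperplane is a union of `k` among the `2 + k` classes. Naming the two missing classes shows
  -- that the number of hyperplanes is at most quadratic in the number of classes, however large the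
  -- classes are.
  hyperplane⇒pre : ∀ X → Hyperplane P X → ∃[ c ] ∃[ c′ ] X ≡ pre (∁ (⁅ c ⁆ ⊕ c′))
  hyperplane⇒pre X (f , eq) with flat⇒pre X f
  ... | Y , refl with ∣ Y ∣ ℕ.≤? suc k
  ...   | no ¬le = contradiction (trans (sym (cong suc (trans (rank-hits (pre Y) (hits-pre Y)) (ℕ.m≤n⇒m⊓n≡m (ℕ.<⇒≤ (ℕ.≰⇒> ¬le)))))) (trans eq rank-⊤)) ℕ.1+n≢n
  ...   | yes le = two (∁ Y) refl card
    where
    card-Y : ∣ Y ∣ ≡ k
    card-Y = trans (sym (rank-pre Y le)) (ℕ.suc-injective (trans eq rank-⊤))
    card : ∣ ∁ Y ∣ ≡ 2
    card = trans (S.∣∁p∣≡n∸∣p∣ Y) (trans (cong (K ∸_) card-Y) (ℕ.m+n∸n≡m 2 k))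
    two : ∀ Z → ∁ Y ≡ Z → ∣ Z ∣ ≡ 2 → ∃[ c ] ∃[ c′ ] pre Y ≡ pre (∁ (⁅ c ⁆ ⊕ c′))
    two Z eqZ cZ with S.nonempty? Z
    ... | no ¬e = contradiction (trans (sym cZ) (trans (cong ∣_∣ (S.⊆-antisym {j = ⊥} (λ p → contradiction (_ , p) ¬e) S.⊥⊆)) (S.∣⊥∣≡0 K))) λ ()
    ... | yes (c , c∈) with S.nonempty? (Z ⊖ c)
    ...   | no ¬e = contradiction (trans (sym cZ) (trans (sym (card-⊖ c∈)) (cong suc (trans (cong ∣_∣ (S.⊆-antisym {j = ⊥} (λ p → contradiction (_ , p) ¬e) S.⊥⊆)) (S.∣⊥∣≡0 K))))) λ ()
    ...   | yes (c′ , c′∈) = c , c′ , cong pre (trans (sym (∁-∁ Y)) (cong ∁ (trans eqZ (sym pair))))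
      where
      empty : Z ⊖ c ⊖ c′ ≡ ⊥
      empty = card-zero _ (ℕ.suc-injective (ℕ.suc-injective (trans (cong suc (card-⊖ c′∈)) (trans (card-⊖ c∈) cZ))))
      pair : ⁅ c ⁆ ⊕ c′ ≡ Z
      pair = S.⊆-antisym (⊕-⊆ (λ p → subst (_∈ Z) (sym (S.x∈⁅y⁆⇒x≡y c p)) c∈) (⊖-⊆ Z c c′∈)) back
        where
        back : Z ⊆ ⁅ c ⁆ ⊕ c′
        back {i} p with i Fin.≟ c | i Fin.≟ c′
        ... | yes refl | _        = ⊆-⊕ _ c′ (S.x∈⁅x⁆ c)
        ... | no _     | yes refl = ∈-⊕ _ c′
        ... | no i≢c   | no i≢c′  = contradiction (subst (i ∈_) empty (∈-⊖⁺ (∈-⊖⁺ p i≢c) i≢c′)) S.∉⊥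

  transversal : Vec (Fin m) K → Subset (K * m)
  transversal g = subsetOf (λ i → ρ i Fin.≟ lookup g (φ i))

  ∈-transversal⁻ : ∀ {g i} → i ∈ transversal g → ρ i ≡ lookup g (φ i)
  ∈-transversal⁻ {g} = ∈-subsetOf⁻ (λ i → ρ i Fin.≟ lookup g (φ i))

  elt-∈-transversal : ∀ g c → elt c (lookup g c) ∈ transversal g
  elt-∈-transversal g c = ∈-subsetOf⁺ (λ i → ρ i Fin.≟ lookup g (φ i)) (trans (ρ-elt c _) (cong (lookup g) (sym (φ-elt c _))))

  φ-injective : ∀ {g i j} → i ∈ transversal g → j ∈ transversal g → φ i ≡ φ j → i ≡ j
  φ-injective {g} {i} {j} p q eq = trans (sym (elt-φ-ρ i)) (trans (cong₂ elt eq (trans (∈-transversal⁻ {g} p) (trans (cong (lookup g) eq) (sym (∈-transversal⁻ {g} q))))) (elt-φ-ρ j))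

  hits-transversal : ∀ g → hits (transversal g) ≡ ⊤
  hits-transversal g = S.⊆-antisym S.⊆⊤ (λ {c} _ → hits-elt (elt-∈-transversal g c))

  hits-⊖ : ∀ {g X e} → X ⊆ transversal g → e ∈ X → hits (X ⊖ e) ≡ hits X ⊖ φ e
  hits-⊖ {g} {X} {e} X⊆ p = S.⊆-antisym to from
    where
    to : hits (X ⊖ e) ⊆ hits X ⊖ φ e
    to q with ∈-hits⁻ q
    ... | i , r , refl = ∈-⊖⁺ (∈-hits⁺ (⊖-⊆ X e r)) (λ eq → proj₂ (∈-⊖⁻ X e r) (φ-injective {g} (X⊆ (⊖-⊆ X e r)) (X⊆ p) eq))
    from : hits X ⊖ φ e ⊆ hits (X ⊖ e)
    from q with ∈-hits⁻ (⊖-⊆ (hits X) (φ e) q)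
    ... | i , r , refl = ∈-hits⁺ (∈-⊖⁺ r (λ { refl → proj₂ (∈-⊖⁻ (hits X) (φ e) q) refl }))

  card-hits-⊖ : ∀ {g X e} → X ⊆ transversal g → e ∈ X → suc ∣ hits (X ⊖ e) ∣ ≡ ∣ hits X ∣
  card-hits-⊖ {g} {X} {e} X⊆ p = trans (cong (suc ∘ ∣_∣) (hits-⊖ {g} X⊆ p)) (card-⊖ (∈-hits⁺ p))

  card-transversal-⊖ : ∀ g {e} → e ∈ transversal g → ∣ hits (transversal g ⊖ e) ∣ ≡ suc k
  card-transversal-⊖ g p = ℕ.suc-injective (trans (card-hits-⊖ {g} id p) (trans (cong ∣_∣ (hits-transversal g)) (S.∣⊤∣≡n K)))

  transversal-⊖-basis : ∀ g {e} → e ∈ transversal g → Basis P (transversal g ⊖ e)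
  transversal-⊖-basis g {e} p = rank-⊖⇒ind _ smaller , trans full (sym rank-⊤)
    where
    full : rank (transversal g ⊖ e) ≡ suc k
    full = trans (cong (suc k ⊓_) (card-transversal-⊖ g p)) (ℕ.⊓-idem (suc k))
    smaller : ∀ f → f ∈ transversal g ⊖ e → rank (transversal g ⊖ e ⊖ f) < rank (transversal g ⊖ e)
    smaller f q = ℕ.≤-trans (s≤s (ℕ.m⊓n≤n (suc k) _)) (ℕ.≤-reflexive (trans (trans (card-hits-⊖ {g} (⊖-⊆ _ e) q) (card-transversal-⊖ g p)) (sym full)))

  transversal-circuit : ∀ g → Circuit P (transversal g)
  transversal-circuit g = circuit-intro (λ i → ℕ.<⇒≱ (ind⇒rank-⊖ i (elt-∈-transversal g zero))
      (ℕ.≤-trans (ℕ.m⊓n≤m (suc k) _) (ℕ.≤-reflexive (sym (trans (cong (suc k ⊓_) (card-transversal-⊖ g (elt-∈-transversal g zero))) (ℕ.⊓-idem (suc k)))))))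
    (λ e p → proj₁ (transversal-⊖-basis g p))

  -- With the choice in class 0 frozen, deleting `corner` from the transversal loses no information.
  -- Both the circuits and the bases obtained in this way are then indexed by all `m ^ suc k`
  -- vectors.
  fixed : Vec (Fin m) (suc k) → Vec (Fin m) K
  fixed g = x₀ ∷ g

  corner : Fin (K * m)
  corner = elt zero x₀

  partial : Vec (Fin m) (suc k) → Subset (K * m)
  partial g = transversal (fixed g) ⊖ corner

  partial-basis : ∀ g → Basis P (partial g)
  partial-basis g = transversal-⊖-basis (fixed g) (elt-∈-transversal (fixed g) zero)

  agree : ∀ {g g′} → (∀ c → elt (suc c) (lookup g c) ∈ transversal (fixed g′)) → g ≡ g′
  agree {g} {g′} f = lookup-ext λ c → trans (sym (ρ-elt (suc c) _)) (trans (∈-transversal⁻ {fixed g′} (f c)) (cong (lookup (fixed g′)) (φ-elt (suc c) (lookup g c))))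
    where
    lookup-ext : ∀ {A : Set} {n} {xs ys : Vec A n} → (∀ i → lookup xs i ≡ lookup ys i) → xs ≡ ys
    lookup-ext {xs = []}     {[]}     f = refl
    lookup-ext {xs = x ∷ xs} {y ∷ ys} f = cong₂ _∷_ (f zero) (lookup-ext (f ∘ suc))

  transversal-injective : ∀ {g g′} → transversal (fixed g) ≡ transversal (fixed g′) → g ≡ g′
  transversal-injective {g} {g′} eq = agree λ c → subst (_ ∈_) eq (elt-∈-transversal (fixed g) (suc c))

  partial-injective : ∀ {g g′} → partial g ≡ partial g′ → g ≡ g′
  partial-injective {g} {g′} eq = agree λ c → ⊖-⊆ _ corner (subst (_ ∈_) eq (∈-⊖⁺ (elt-∈-transversal (fixed g) (suc c))
    (λ e → contradiction (trans (sym (φ-elt (suc c) _)) (trans (cong φ e) (φ-elt zero x₀))) λ ())))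

  -- The transversals are spanning circuits of `P`. The coloop makes them non-spanning, at the price
  -- of one more hyperplane and at most twice as many flats.
  M : Matroid (suc (K * m))
  M = coloop P

  open Adjoin P

  flat-cover : List (Subset (suc (K * m)))
  flat-cover = cartesianProductWith (λ b Y → b ∷ pre Y) bools (vecs bools K)

  flat-covers : ∀ X → Flat M X → X ∈ₗ flat-cover
  flat-covers (b ∷ X) f with flat⇒pre X (flat⁻ 1 ℕ.≤-refl b f)
  ... | Y , refl = ∈ₗ.∈-cartesianProductWith⁺ (λ b Y → b ∷ pre Y) (bool∈ b) (∈-vecs Y)
    where
    bool∈ : ∀ b → b ∈ₗ bools
    bool∈ true  = here refl
    bool∈ false = there (here refl)

  hyperplane-cover : List (Subset (suc (K * m)))
  hyperplane-cover = (false ∷ ⊤) ∷ cartesianProductWith (λ c c′ → true ∷ pre (∁ (⁅ c ⁆ ⊕ c′))) (allFin K) (allFin K)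

  hyperplane-covers : ∀ X → Hyperplane M X → X ∈ₗ hyperplane-cover
  hyperplane-covers (b ∷ X) h with coloop-hyperplane⁻ b h
  ... | inj₂ eq = here eq
  ... | inj₁ (refl , h′) with hyperplane⇒pre X h′
  ...   | c , c′ , refl = there (∈ₗ.∈-cartesianProductWith⁺ (λ c c′ → true ∷ pre (∁ (⁅ c ⁆ ⊕ c′))) (∈ₗ.∈-allFin c) (∈ₗ.∈-allFin c′))

  lots-bases : ∀ {N} → N ≤ m ^ suc k → Lots (Basis M) N
  lots-bases le = lots-vecs (Unq.allFin⁺ m) (suc k) (λ g → true ∷ partial g) (partial-injective ∘ VecP.∷-injectiveʳ)
    (λ g → coloop-basis (partial-basis g)) (ℕ.≤-trans le (ℕ.≤-reflexive (cong (_^ suc k) (sym (ListP.length-tabulate {n = m} id)))))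

  lots-circuits : ∀ {N} → N ≤ m ^ suc k → Lots (NonSpanningCircuit M) N
  lots-circuits le = lots-vecs (Unq.allFin⁺ m) (suc k) (λ g → false ∷ transversal (fixed g)) (transversal-injective ∘ VecP.∷-injectiveʳ)
    (λ g → coloop-circuit (transversal-circuit (fixed g))) (ℕ.≤-trans le (ℕ.≤-reflexive (cong (_^ suc k) (sym (ListP.length-tabulate {n = m} id)))))

  lots-cyclic : (x₁ : Fin m) → x₁ ≢ x₀ → Lots (CyclicFlat M) (2 ^ k)
  lots-cyclic x₁ x₁≢x₀ = lots-subsets k (λ v → false ∷ pre (false ∷ false ∷ v))
    -- The first two classes are left out of every set, which ensures that at most `k` classes are
    -- used. The set of classes is recovered by `hits`.
    (λ eq → VecP.∷-injectiveʳ (VecP.∷-injectiveʳ (trans (sym (hits-pre _)) (trans (cong hits (VecP.∷-injectiveʳ eq)) (hits-pre _)))))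
    (λ v → coloop-cyclic (cyclic x₁ x₁≢x₀ (false ∷ false ∷ v) (S.∣p∣≤n v)))

-- Exponents of the length bounds, and the families of matroids

module _ {j : ℕ} where

  private
    p = 2 ^ suc j

    2≤p : 2 ≤ p
    2≤p = ℕ.≤-trans (ℕ.≤-reflexive (sym (ℕ.*-identityʳ 2))) (ℕ.*-monoʳ-≤ 2 (ℕ.m^n>0 2 j))

    instance
      p≢0 : NonZero p
      p≢0 = ℕ.m^n≢0 2 (suc j)

    unfold : ∀ {x} a → x ≤ budget j a → x ≤ p ^ a
    unfold a = subst (_ ≤_) (budget-def j a)

    fold : ∀ {x} a → x ≤ p ^ a → x ≤ budget j a
    fold a = subst (_ ≤_) (sym (budget-def j a))

  bound-* : ∀ {x y} a b → x ≤ budget j a → y ≤ budget j b → x * y ≤ budget j (a + b)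
  bound-* a b le le′ = fold (a + b) (ℕ.≤-trans (ℕ.*-mono-≤ (unfold a le) (unfold b le′)) (ℕ.≤-reflexive (sym (ℕ.^-distribˡ-+-* p a b))))

  bound-+ : ∀ {x y} a b → x ≤ budget j a → y ≤ budget j b → x + y ≤ budget j (suc (a + b))
  bound-+ {x} {y} a b le le′ = fold (suc (a + b)) (ℕ.≤-trans
    (ℕ.+-mono-≤ (ℕ.≤-trans (unfold a le) (ℕ.^-monoʳ-≤ p (ℕ.m≤m+n a b))) (ℕ.≤-trans (unfold b le′) (ℕ.^-monoʳ-≤ p (ℕ.m≤n+m b a))))
    (ℕ.≤-trans (ℕ.≤-reflexive (cong (p ^ (a + b) +_) (sym (ℕ.+-identityʳ _)))) (ℕ.*-monoˡ-≤ (p ^ (a + b)) 2≤p)))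

  bound-const : ∀ c → c ≤ budget j c
  bound-const c = fold c (ℕ.≤-trans (ℕ.<⇒≤ (n<2^n c)) (ℕ.^-monoˡ-≤ c 2≤p))

  bound-2^ : 2 ^ j ≤ budget j 1
  bound-2^ = fold 1 (ℕ.≤-trans (ℕ.^-monoʳ-≤ 2 (ℕ.n≤1+n j)) (ℕ.≤-reflexive (sym (ℕ.^-identityʳ p))))

  bound-j : j ≤ budget j 1
  bound-j = ℕ.≤-trans (ℕ.<⇒≤ (n<2^n j)) bound-2^

  bound-j² : j * j ≤ budget j 2
  bound-j² = bound-* 1 1 bound-j bound-j

  -- Exponents are tracked mechanically and not optimised. The values 8, 11, 15, 19 and 25 of the
  -- families below all arise as `2 + a + b` from the size of the ground set and the length of the
  -- cover.
  bound-word : ∀ {n m} a b → suc n ≤ budget j a → suc m ≤ budget j b → 2 * suc n * suc m ≤ budget j (2 + a + b)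
  bound-word a b le le′ = bound-* (2 + a) b (bound-* 2 a (bound-const 2) le) le′

free-few : ∀ j I → I ≢ RANK → (∀ X → Target I (free (j * j)) X → X ≡ ⊤) → Few I (free (j * j)) (budget j 8)
free-few j I I≢RANK full = few-cover I (free (j * j)) I≢RANK [ ⊤ ] (λ X t → here (full X t)) (bound-word 4 2 (bound-+ 1 2 (bound-const 1) bound-j²) (bound-const 2))

free-many : ∀ j J → (∀ X → Target J (free (j * j)) X) → Many J (free (j * j)) (2 ^ (j * j))
free-many j J all = lots-many J (free (j * j)) (lots-subsets (j * j) {P = λ _ → 𝟏} id id (λ _ → tt)) (λ {X} _ → all X)

free-flat : ∀ {n} X → Flat (free n) X
free-flat X e e∉ = ℕ.≤-reflexive (sym (card-⊕ e∉))

free-spanning : ∀ {n} X → Spanning (free n) X → X ≡ ⊤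
free-spanning {n} X eq = S.∣p∣≡n⇒p≡⊤ (trans eq (S.∣⊤∣≡n n))

null-few : ∀ j I → I ≢ RANK → (∀ X → Target I (null (j * j)) X → X ≡ ⊥) → Few I (null (j * j)) (budget j 8)
null-few j I I≢RANK empty = few-cover I (null (j * j)) I≢RANK [ ⊥ ] (λ X t → here (empty X t)) (bound-word 4 2 (bound-+ 1 2 (bound-const 1) bound-j²) (bound-const 2))

null-many : ∀ j J → (∀ X → Target J (null (j * j)) X) → Many J (null (j * j)) (2 ^ (j * j))
null-many j J all = lots-many J (null (j * j)) (lots-subsets (j * j) {P = λ _ → 𝟏} id id (λ _ → tt)) (λ {X} _ → all X)

null-independent : ∀ {n} X → Independent (null n) X → X ≡ ⊥
null-independent X i = card-zero X (sym i)

module UniformFamily (j : ℕ) where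
  open Uniform (j * j)

  private
    bound-2j² : j * j * 2 ≤ budget j 4
    bound-2j² = bound-* 2 2 bound-j² (bound-const 2)

  lots-bases : Lots (Basis U) (2 ^ (j * j))
  lots-bases = lots-subsets (j * j) (λ v → true ∷ false ∷ pairs v) (pairs-injective ∘ VecP.∷-injectiveʳ ∘ VecP.∷-injectiveʳ) (λ v → basis (true ∷ false ∷ pairs v) (cong suc (card-pairs v)))

  lots-hyperplanes : Lots (Hyperplane U) (2 ^ (j * j))
  lots-hyperplanes = lots-subsets (j * j) (λ v → false ∷ false ∷ pairs v) (pairs-injective ∘ VecP.∷-injectiveʳ ∘ VecP.∷-injectiveʳ) (λ v → hyperplane (false ∷ false ∷ pairs v) (card-pairs v))

  lots-circuits : Lots (Circuit U) (2 ^ (j * j))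
  lots-circuits = lots-subsets (j * j) (λ v → true ∷ true ∷ pairs v) (pairs-injective ∘ VecP.∷-injectiveʳ ∘ VecP.∷-injectiveʳ) (λ v → circuit (true ∷ true ∷ pairs v) (cong (2 +_) (card-pairs v)))

  few-none : ∀ I → I ≢ RANK → (∀ X → ¬ Target I U X) → Few I U (budget j 11)
  few-none I I≢RANK none = few-cover I U I≢RANK [] (λ X t → contradiction t (none X)) (bound-word 8 1 (bound-+ 3 4 (bound-const 3) bound-2j²) (bound-const 1))

  -- The coloop makes the circuits of `U` non-spanning and the loop makes the hyperplanes dependent,
  -- so both of these lists become long as well. The cyclic flats remain the two of `U`, each with
  -- the loop added.
  U⁺ : Matroid (2 + ground)
  U⁺ = loop⁺ (coloop U)

  module A = Adjoin U
  module B = Adjoin (coloop U)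

  few-cyclic : Few CYCLIC-FLATS U⁺ (budget j 15)
  few-cyclic = few-cover CYCLIC-FLATS U⁺ (λ ()) ((true ∷ false ∷ ⊥) ∷ (true ∷ false ∷ ⊤) ∷ []) covers (bound-word 10 3 (bound-+ 5 4 (bound-const 5) bound-2j²) (bound-const 3))
    where
    covers : ∀ X → CyclicFlat U⁺ X → X ∈ₗ (true ∷ false ∷ ⊥) ∷ (true ∷ false ∷ ⊤) ∷ []
    covers (b ∷ b′ ∷ X) c with B.loop-cyclic⁻ b c
    ... | refl , c′ with A.coloop-cyclic⁻ b′ c′
    ... | refl , c″ with cyclic⇒ X c″
    ... | inj₁ refl = here refl
    ... | inj₂ refl = there (here refl)

  many-all : ∀ J → J ≢ CYCLIC-FLATS → Many J U⁺ (2 ^ (j * j))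
  many-all J ≢cyc = go J ≢cyc
    where
    bs : Lots (Basis U⁺) (2 ^ (j * j))
    bs = lots-map (Basis U) (Basis U⁺) (λ X → false ∷ true ∷ X) (VecP.∷-injectiveʳ ∘ VecP.∷-injectiveʳ) (λ X b → B.loop-basis {true ∷ X} (A.coloop-basis {X} b)) lots-bases
    cs : Lots (NonSpanningCircuit U⁺) (2 ^ (j * j))
    cs = lots-map (Circuit U) (NonSpanningCircuit U⁺) (λ X → false ∷ false ∷ X) (VecP.∷-injectiveʳ ∘ VecP.∷-injectiveʳ) (λ X c → B.loop-circuit {false ∷ X} (A.coloop-circuit {X} c)) lots-circuits
    hs : Lots (DependentHyperplane U⁺) (2 ^ (j * j))
    hs = lots-map (Hyperplane U) (DependentHyperplane U⁺) (λ X → true ∷ true ∷ X) (VecP.∷-injectiveʳ ∘ VecP.∷-injectiveʳ) (λ X h → B.loop-hyperplane {true ∷ X} (A.coloop-hyperplane {X} h)) lots-hyperplanes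
    go : ∀ J → J ≢ CYCLIC-FLATS → Many J U⁺ (2 ^ (j * j))
    go RANK                  _ = lots-many RANK U⁺ bs (λ _ → tt)
    go INDEPENDENT-SETS      _ = lots-many INDEPENDENT-SETS U⁺ bs proj₁
    go SPANNING-SETS         _ = lots-many SPANNING-SETS U⁺ bs proj₂
    go BASES                 _ = lots-many BASES U⁺ bs id
    go FLATS                 _ = lots-many FLATS U⁺ hs (proj₁ ∘ proj₁)
    go CIRCUITS              _ = lots-many CIRCUITS U⁺ cs proj₁
    go HYPERPLANES           _ = lots-many HYPERPLANES U⁺ hs proj₁
    go NON-SPANNING-CIRCUITS _ = lots-many NON-SPANNING-CIRCUITS U⁺ cs id
    go DEPENDENT-HYPERPLANES _ = lots-many DEPENDENT-HYPERPLANES U⁺ hs id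
    go CYCLIC-FLATS         ne = contradiction refl ne

-- Two elements per class already give exponentially many bases, circuits and cyclic flats when
-- there are `2 + j * j` classes, while the hyperplanes stay polynomial in number. Duality exchanges
-- the roles of hyperplanes and circuits.
module PairsFamily (j : ℕ) where
  open Partition (j * j) 2 zero
  open Dual M

  private
    ground≤ : suc (suc (K * 2)) ≤ budget j 10
    ground≤ = bound-+ 2 7 (bound-const 2) (bound-* 5 2 (bound-+ 2 2 (bound-const 2) bound-j²) (bound-const 2))

    cover≤ : suc (length hyperplane-cover) ≤ budget j 13
    cover≤ = ℕ.≤-trans (ℕ.≤-reflexive (cong (2 +_) (trans (length-product _ (allFin K) (allFin K)) (cong₂ _*_ (ListP.length-tabulate {n = K} id) (ListP.length-tabulate {n = K} id)))))
      (bound-+ 2 10 (bound-const 2) (bound-* 5 5 bound-K bound-K))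
      where
      bound-K : K ≤ budget j 5
      bound-K = bound-+ 2 2 (bound-const 2) bound-j²

    half : 2 ^ (j * j) ≤ 2 ^ suc (j * j)
    half = ℕ.^-monoʳ-≤ 2 (ℕ.n≤1+n (j * j))

    bs : Lots (Basis M) (2 ^ (j * j))
    bs = lots-bases half
    cs : Lots (NonSpanningCircuit M) (2 ^ (j * j))
    cs = lots-circuits half
    ys : Lots (CyclicFlat M) (2 ^ (j * j))
    ys = lots-cyclic (suc zero) (λ ())

    ∁-injective : ∀ {n} {X Y : Subset n} → ∁ X ≡ ∁ Y → X ≡ Y
    ∁-injective {X = X} {Y} eq = trans (sym (∁-∁ X)) (trans (cong ∁ eq) (∁-∁ Y))

  pairs-matroid dual-matroid : Matroid (suc (K * 2))
  pairs-matroid = M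
  dual-matroid  = dual

  few-hyperplanes : ∀ I → I ≢ RANK → (∀ X → Target I M X → Hyperplane M X) → Few I M (budget j 25)
  few-hyperplanes I I≢RANK hyp = few-cover I M I≢RANK hyperplane-cover (λ X t → hyperplane-covers X (hyp X t)) (bound-word 10 13 ground≤ cover≤)

  few-circuits : ∀ I → I ≢ RANK → (∀ X → Target I dual X → Circuit dual X) → Few I dual (budget j 25)
  few-circuits I I≢RANK circ = few-cover I dual I≢RANK (map ∁ hyperplane-cover)
    (λ X t → subst (_∈ₗ map ∁ hyperplane-cover) (∁-∁ X) (∈ₗ.∈-map⁺ ∁ (hyperplane-covers (∁ X) (dual-circuit⁻ (circ X t)))))
    (bound-word 10 13 ground≤ (ℕ.≤-trans (ℕ.≤-reflexive (cong suc (ListP.length-map ∁ hyperplane-cover))) cover≤))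

  many-pairs : ∀ J → J ≢ HYPERPLANES → J ≢ DEPENDENT-HYPERPLANES → Many J M (2 ^ (j * j))
  many-pairs RANK                  _ _ = lots-many RANK M bs (λ _ → tt)
  many-pairs INDEPENDENT-SETS      _ _ = lots-many INDEPENDENT-SETS M bs proj₁
  many-pairs SPANNING-SETS         _ _ = lots-many SPANNING-SETS M bs proj₂
  many-pairs BASES                 _ _ = lots-many BASES M bs id
  many-pairs FLATS                 _ _ = lots-many FLATS M ys proj₁
  many-pairs CIRCUITS              _ _ = lots-many CIRCUITS M cs proj₁
  many-pairs HYPERPLANES          ne _ = contradiction refl ne
  many-pairs NON-SPANNING-CIRCUITS _ _ = lots-many NON-SPANNING-CIRCUITS M cs id
  many-pairs DEPENDENT-HYPERPLANES _ ne = contradiction refl ne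
  many-pairs CYCLIC-FLATS          _ _ = lots-many CYCLIC-FLATS M ys id

  many-dual : ∀ J → J ≢ CIRCUITS → J ≢ NON-SPANNING-CIRCUITS → Many J dual (2 ^ (j * j))
  many-dual J ≢c ≢n = go J ≢c ≢n
    where
    bs* : Lots (Basis dual) (2 ^ (j * j))
    bs* = lots-map (Basis M) (Basis dual) ∁ ∁-injective (λ B → dual-basis {B}) bs
    hs* : Lots (DependentHyperplane dual) (2 ^ (j * j))
    hs* = lots-map (NonSpanningCircuit M) (DependentHyperplane dual) ∁ ∁-injective (λ C → dual-hyperplane {C}) cs
    go : ∀ J → J ≢ CIRCUITS → J ≢ NON-SPANNING-CIRCUITS → Many J dual (2 ^ (j * j))
    go RANK                  _ _ = lots-many RANK dual bs* (λ _ → tt)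
    go INDEPENDENT-SETS      _ _ = lots-many INDEPENDENT-SETS dual bs* proj₁
    go SPANNING-SETS         _ _ = lots-many SPANNING-SETS dual bs* proj₂
    go BASES                 _ _ = lots-many BASES dual bs* id
    go FLATS                 _ _ = lots-many FLATS dual hs* (proj₁ ∘ proj₁)
    go CIRCUITS             ne _ = contradiction refl ne
    go HYPERPLANES           _ _ = lots-many HYPERPLANES dual hs* proj₁
    go NON-SPANNING-CIRCUITS _ ne = contradiction refl ne
    go DEPENDENT-HYPERPLANES _ _ = lots-many DEPENDENT-HYPERPLANES dual hs* id
    go CYCLIC-FLATS          _ _ = lots-many CYCLIC-FLATS dual (lots-map (CyclicFlat M) (CyclicFlat dual) ∁ ∁-injective (λ X → dual-cyclic {X}) ys) id

-- The `2 + j` classes give at most `2 ^ (3 + j)` flats on `1 + (2 + j) * 2 ^ j` elements. There are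
-- nevertheless at least `(2 ^ j) ^ suc j` bases and as many non-spanning circuits, because the
-- classes themselves are large.
module ClassesFamily (j : ℕ) where
  open Partition j (2 ^ j) (fromℕ< (ℕ.m^n>0 2 j)) public

  few-flats : Few FLATS M (budget j 19)
  few-flats = few-cover FLATS M (λ ()) flat-cover flat-covers (bound-word 8 9 ground≤ cover≤)
    where
    ground≤ : suc (suc (K * 2 ^ j)) ≤ budget j 8
    ground≤ = bound-+ 2 5 (bound-const 2) (bound-* 4 1 (bound-+ 2 1 (bound-const 2) bound-j) bound-2^)
    cover≤ : suc (length flat-cover) ≤ budget j 9
    cover≤ = ℕ.≤-trans (ℕ.≤-reflexive (cong suc (trans (length-product (λ b Y → b ∷ pre Y) bools (vecs bools K)) (cong (2 *_) (length-vecs bools K)))))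
      (bound-+ 1 7 (bound-const 1) (bound-* 2 5 (bound-const 2) (bound-* 2 3 (bound-const 2) (bound-* 2 1 (bound-const 2) bound-2^))))

  private
    enough : 2 ^ (j * j) ≤ (2 ^ j) ^ suc j
    enough = ℕ.≤-trans (ℕ.^-monoʳ-≤ 2 (ℕ.*-monoʳ-≤ j (ℕ.n≤1+n j))) (ℕ.≤-reflexive (sym (ℕ.^-*-assoc 2 j (suc j))))

  many-basis : ∀ J → (∀ X → Basis M X → Target J M X) → Many J M (2 ^ (j * j))
  many-basis J t = lots-many J M (lots-bases enough) (λ {X} → t X)

  many-circuit : ∀ J → (∀ X → NonSpanningCircuit M X → Target J M X) → Many J M (2 ^ (j * j))
  many-circuit J t = lots-many J M (lots-circuits enough) (λ {X} → t X)

-- Separations, and the decision for every pair of types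

free-gap : ∀ I J → I ≢ RANK → (∀ n X → Target I (free n) X → X ≡ ⊤) → (∀ n X → Target J (free n) X) → ¬ (I ≼ J)
free-gap I J I≢RANK few many = no-reduction I J 8 λ j → gap (free (j * j)) (free-few j I I≢RANK (few (j * j))) (free-many j J (many (j * j)))

null-gap : ∀ I J → I ≢ RANK → (∀ n X → Target I (null n) X → X ≡ ⊥) → (∀ n X → Target J (null n) X) → ¬ (I ≼ J)
null-gap I J I≢RANK few many = no-reduction I J 8 λ j → gap (null (j * j)) (null-few j I I≢RANK (few (j * j))) (null-many j J (many (j * j)))

flats-bases-gap : ∀ J → (∀ {n} (M : Matroid n) X → Basis M X → Target J M X) → ¬ (FLATS ≼ J)
flats-bases-gap J t = no-reduction FLATS J 19 λ j → let open ClassesFamily j in gap M few-flats (many-basis J (t M))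

flats-circuits-gap : ∀ J → (∀ {n} (M : Matroid n) X → NonSpanningCircuit M X → Target J M X) → ¬ (FLATS ≼ J)
flats-circuits-gap J t = no-reduction FLATS J 19 λ j → let open ClassesFamily j in gap M few-flats (many-circuit J (t M))

circuits-gap : ∀ I J → I ≢ RANK → (∀ {n} (M : Matroid n) X → Target I M X → Circuit M X) → J ≢ CIRCUITS → J ≢ NON-SPANNING-CIRCUITS → ¬ (I ≼ J)
circuits-gap I J I≢RANK t ≢c ≢n = no-reduction I J 25 λ j → let open PairsFamily j in gap dual-matroid (few-circuits I I≢RANK (t dual-matroid)) (many-dual J ≢c ≢n)

hyperplanes-gap : ∀ I J → I ≢ RANK → (∀ {n} (M : Matroid n) X → Target I M X → Hyperplane M X) → J ≢ HYPERPLANES → J ≢ DEPENDENT-HYPERPLANES → ¬ (I ≼ J)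
hyperplanes-gap I J I≢RANK t ≢h ≢d = no-reduction I J 25 λ j → let open PairsFamily j in gap pairs-matroid (few-hyperplanes I I≢RANK (t pairs-matroid)) (many-pairs J ≢h ≢d)

cyclic-gap : ∀ J → J ≢ CYCLIC-FLATS → ¬ (CYCLIC-FLATS ≼ J)
cyclic-gap J ≢c = no-reduction CYCLIC-FLATS J 15 λ j → let open UniformFamily j in gap U⁺ few-cyclic (many-all J ≢c)

nonspanning-gap : ¬ (NON-SPANNING-CIRCUITS ≼ CIRCUITS)
nonspanning-gap = no-reduction NON-SPANNING-CIRCUITS CIRCUITS 11 λ j → let open UniformFamily j in
  gap (Uniform.U (j * j)) (few-none NON-SPANNING-CIRCUITS (λ ()) (Uniform.no-nonspanning-circuit (j * j))) (lots-many CIRCUITS (Uniform.U (j * j)) lots-circuits id)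

dependent-gap : ¬ (DEPENDENT-HYPERPLANES ≼ HYPERPLANES)
dependent-gap = no-reduction DEPENDENT-HYPERPLANES HYPERPLANES 11 λ j → let open UniformFamily j in
  gap (Uniform.U (j * j)) (few-none DEPENDENT-HYPERPLANES (λ ()) (Uniform.no-dependent-hyperplane (j * j))) (lots-many HYPERPLANES (Uniform.U (j * j)) lots-hyperplanes id)

-- A path or a refutation for every pair is all that the forward direction of the theorem needs: a
-- reduction contradicts the refutation, so only the path is left.
Classified : InputType → InputType → Set
Classified I J = (I ≡ J ⊎ Path I J) ⊎ ¬ (I ≼ J)

via : ∀ {I J K} → Arc I J → J ≡ K ⊎ Path J K → I ≡ K ⊎ Path I K
via a (inj₁ refl) = inj₂ Plus.[ a ]
via a (inj₂ p)    = inj₂ (a Plus.∷ p)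

bases⇝ : ∀ J → J ≢ RANK → J ≢ INDEPENDENT-SETS → J ≢ SPANNING-SETS → J ≢ FLATS → BASES ≡ J ⊎ Path BASES J
bases⇝ RANK                  a b c d = contradiction refl a
bases⇝ INDEPENDENT-SETS      a b c d = contradiction refl b
bases⇝ SPANNING-SETS         a b c d = contradiction refl c
bases⇝ BASES                 a b c d = inj₁ refl
bases⇝ FLATS                 a b c d = contradiction refl d
bases⇝ CIRCUITS              a b c d = via bases→circ (inj₁ refl)
bases⇝ HYPERPLANES           a b c d = via bases→hyp (inj₁ refl)
bases⇝ NON-SPANNING-CIRCUITS a b c d = via bases→circ (via circ→nsc (inj₁ refl))
bases⇝ DEPENDENT-HYPERPLANES a b c d = via bases→hyp (via hyp→dh (inj₁ refl))
bases⇝ CYCLIC-FLATS          a b c d = via bases→cyc (inj₁ refl)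

independent⇝ : ∀ J → J ≢ RANK → J ≢ SPANNING-SETS → INDEPENDENT-SETS ≡ J ⊎ Path INDEPENDENT-SETS J
independent⇝ RANK             a b = contradiction refl a
independent⇝ SPANNING-SETS    a b = contradiction refl b
independent⇝ INDEPENDENT-SETS a b = inj₁ refl
independent⇝ FLATS            a b = via ind→flats (inj₁ refl)
independent⇝ BASES            a b = via ind→bases (bases⇝ BASES a (λ ()) b (λ ()))
independent⇝ CIRCUITS         a b = via ind→bases (bases⇝ CIRCUITS a (λ ()) b (λ ()))
independent⇝ HYPERPLANES      a b = via ind→bases (bases⇝ HYPERPLANES a (λ ()) b (λ ()))
independent⇝ NON-SPANNING-CIRCUITS a b = via ind→bases (bases⇝ NON-SPANNING-CIRCUITS a (λ ()) b (λ ()))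
independent⇝ DEPENDENT-HYPERPLANES a b = via ind→bases (bases⇝ DEPENDENT-HYPERPLANES a (λ ()) b (λ ()))
independent⇝ CYCLIC-FLATS     a b = via ind→bases (bases⇝ CYCLIC-FLATS a (λ ()) b (λ ()))

_≟I_ : ∀ (I J : InputType) → Dec (I ≡ J)
I ≟I J = Dec.map′ (λ eq → trans (sym (decode∘code I)) (trans (cong decode eq) (decode∘code J))) (cong code) (code I ℕ.≟ code J)
  where
  code : InputType → ℕ
  code RANK                  = 0
  code INDEPENDENT-SETS      = 1
  code SPANNING-SETS         = 2
  code BASES                 = 3
  code FLATS                 = 4
  code CIRCUITS              = 5
  code HYPERPLANES           = 6
  code NON-SPANNING-CIRCUITS = 7
  code DEPENDENT-HYPERPLANES = 8
  code CYCLIC-FLATS          = 9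
  decode : ℕ → InputType
  decode 0 = RANK
  decode 1 = INDEPENDENT-SETS
  decode 2 = SPANNING-SETS
  decode 3 = BASES
  decode 4 = FLATS
  decode 5 = CIRCUITS
  decode 6 = HYPERPLANES
  decode 7 = NON-SPANNING-CIRCUITS
  decode 8 = DEPENDENT-HYPERPLANES
  decode _ = CYCLIC-FLATS
  decode∘code : ∀ I → decode (code I) ≡ I
  decode∘code RANK                  = refl
  decode∘code INDEPENDENT-SETS      = refl
  decode∘code SPANNING-SETS         = refl
  decode∘code BASES                 = refl
  decode∘code FLATS                 = refl
  decode∘code CIRCUITS              = refl
  decode∘code HYPERPLANES           = refl
  decode∘code NON-SPANNING-CIRCUITS = refl
  decode∘code DEPENDENT-HYPERPLANES = refl
  decode∘code CYCLIC-FLATS          = refl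

classify : ∀ I J → Classified I J
classify RANK J with J ≟I RANK | J ≟I SPANNING-SETS
... | yes refl | _        = inj₁ (inj₁ refl)
... | no _     | yes refl = inj₁ (via rank→span (inj₁ refl))
... | no a     | no b     = inj₁ (via rank→ind (independent⇝ J a b))
classify INDEPENDENT-SETS J with J ≟I RANK | J ≟I SPANNING-SETS
... | yes refl | _        = inj₂ (null-gap INDEPENDENT-SETS RANK (λ ()) (λ n → null-independent) (λ _ _ → tt))
... | no _     | yes refl = inj₂ (null-gap INDEPENDENT-SETS SPANNING-SETS (λ ()) (λ n → null-independent) (λ _ _ → refl))
... | no a     | no b     = inj₁ (independent⇝ J a b)
classify SPANNING-SETS J with J ≟I RANK | J ≟I INDEPENDENT-SETS | J ≟I FLATS | J ≟I SPANNING-SETS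
... | yes refl | _        | _        | _        = inj₂ (free-gap SPANNING-SETS RANK (λ ()) (λ n → free-spanning) (λ _ _ → tt))
... | no _     | yes refl | _        | _        = inj₂ (free-gap SPANNING-SETS INDEPENDENT-SETS (λ ()) (λ n → free-spanning) (λ _ _ → refl))
... | no _     | no _     | yes refl | _        = inj₂ (free-gap SPANNING-SETS FLATS (λ ()) (λ n → free-spanning) (λ _ → free-flat))
... | no _     | no _     | no _     | yes refl = inj₁ (inj₁ refl)
... | no a     | no b     | no d     | no c     = inj₁ (via span→bases (bases⇝ J a b c d))
classify BASES J with J ≟I RANK | J ≟I INDEPENDENT-SETS | J ≟I FLATS | J ≟I SPANNING-SETS
... | yes refl | _        | _        | _        = inj₂ (free-gap BASES RANK (λ ()) (λ n X b → free-spanning X (proj₂ b)) (λ _ _ → tt))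
... | no _     | yes refl | _        | _        = inj₂ (free-gap BASES INDEPENDENT-SETS (λ ()) (λ n X b → free-spanning X (proj₂ b)) (λ _ _ → refl))
... | no _     | no _     | yes refl | _        = inj₂ (free-gap BASES FLATS (λ ()) (λ n X b → free-spanning X (proj₂ b)) (λ _ → free-flat))
... | no _     | no _     | no _     | yes refl = inj₂ (null-gap BASES SPANNING-SETS (λ ()) (λ n X b → null-independent X (proj₁ b)) (λ _ _ → refl))
... | no a     | no b     | no d     | no c     = inj₁ (bases⇝ J a b c d)
classify FLATS RANK                  = inj₂ (flats-bases-gap RANK (λ _ _ _ → tt))
classify FLATS INDEPENDENT-SETS      = inj₂ (flats-bases-gap INDEPENDENT-SETS (λ _ _ → proj₁))
classify FLATS SPANNING-SETS         = inj₂ (flats-bases-gap SPANNING-SETS (λ _ _ → proj₂))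
classify FLATS BASES                 = inj₂ (flats-bases-gap BASES (λ _ _ → id))
classify FLATS FLATS                 = inj₁ (inj₁ refl)
classify FLATS CIRCUITS              = inj₂ (flats-circuits-gap CIRCUITS (λ _ _ → proj₁))
classify FLATS HYPERPLANES           = inj₁ (via flats→hyp (inj₁ refl))
classify FLATS NON-SPANNING-CIRCUITS = inj₂ (flats-circuits-gap NON-SPANNING-CIRCUITS (λ _ _ → id))
classify FLATS DEPENDENT-HYPERPLANES = inj₁ (via flats→hyp (via hyp→dh (inj₁ refl)))
classify FLATS CYCLIC-FLATS          = inj₁ (via flats→cyc (inj₁ refl))
classify CIRCUITS J with J ≟I CIRCUITS | J ≟I NON-SPANNING-CIRCUITS
... | yes refl | _        = inj₁ (inj₁ refl)
... | no _     | yes refl = inj₁ (via circ→nsc (inj₁ refl))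
... | no a     | no b     = inj₂ (circuits-gap CIRCUITS J (λ ()) (λ _ _ → id) a b)
classify NON-SPANNING-CIRCUITS J with J ≟I CIRCUITS | J ≟I NON-SPANNING-CIRCUITS
... | yes refl | _        = inj₂ nonspanning-gap
... | no _     | yes refl = inj₁ (inj₁ refl)
... | no a     | no b     = inj₂ (circuits-gap NON-SPANNING-CIRCUITS J (λ ()) (λ _ _ → proj₁) a b)
classify HYPERPLANES J with J ≟I HYPERPLANES | J ≟I DEPENDENT-HYPERPLANES
... | yes refl | _        = inj₁ (inj₁ refl)
... | no _     | yes refl = inj₁ (via hyp→dh (inj₁ refl))
... | no a     | no b     = inj₂ (hyperplanes-gap HYPERPLANES J (λ ()) (λ _ _ → id) a b)
classify DEPENDENT-HYPERPLANES J with J ≟I HYPERPLANES | J ≟I DEPENDENT-HYPERPLANES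
... | yes refl | _        = inj₂ dependent-gap
... | no _     | yes refl = inj₁ (inj₁ refl)
... | no a     | no b     = inj₂ (hyperplanes-gap DEPENDENT-HYPERPLANES J (λ ()) (λ _ _ → proj₁) a b)
classify CYCLIC-FLATS J with J ≟I CYCLIC-FLATS
... | yes refl = inj₁ (inj₁ refl)
... | no a     = inj₂ (cyclic-gap J a)

theorem1 : ∀ (I₁ I₂ : InputType) → (I₁ ≼ I₂) ⇔ (I₁ ≡ I₂ ⊎ Path I₁ I₂)
theorem1 I₁ I₂ = mk⇔ (λ r → Sum.fromInj₁ (λ ¬r → contradiction r ¬r) (classify I₁ I₂)) path⇒≼
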